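{- Let $\ell\ge 1$ and $n\ge 6\ell+11$ be integers. Then every $n$-vertex tree is $\ell$-reconstructible.
   Context: For an $n$-vertex graph $G$ and an integer $\ell$ with $0\le \ell<n$, the $(n-\ell)$-deck of $G$ is the multiset of the (unlabeled) induced subgraphs of $G$ on $n-\ell$ vertices (obtained by deleting $\ell$ vertices); its members are called cards. An $n$-vertex graph is $\ell$-reconstructible if it is determined by its $(n-\ell)$-deck, i.e., every graph with the same $(n-\ell)$-deck is isomorphic to it. -}

module Defs where

open import Data.Nat using (ℕ; zero; suc; _∸_)
open import Data.Fin using (Fin; _<_; zero; suc)
open import Data.Bool using (Bool; true; false)
open import Data.Vec using (Vec; []; _∷_; lookup; toList)
open import Data.Product using (Σ; _×_; proj₁; ∃)
open import Data.List.Relation.Unary.Unique.Propositional using (Unique)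
open import Function.Bundles using (_↔_; Inverse)
open import Relation.Binary.PropositionalEquality using (_≡_)

record Graph (n : ℕ) : Set where
  field
    adj    : Fin n → Fin n → Bool
    sym    : ∀ u v → adj u v ≡ adj v u
    irrefl : ∀ v → adj v v ≡ false
open Graph public

Adj : ∀ {n} → Graph n → Fin n → Fin n → Set
Adj G u v = adj G u v ≡ true

_≅_ : ∀ {n} → Graph n → Graph n → Set
_≅_ {n} G H = Σ (Fin n ↔ Fin n) λ σ →
  ∀ u v → adj G u v ≡ adj H (Inverse.to σ u) (Inverse.to σ v)

data Walk {n} (G : Graph n) : Fin n → Fin n → Set where
  here : ∀ {v} → Walk G v v
  step : ∀ {u w v} → Adj G u w → Walk G w v → Walk G u v

Connected : ∀ {n} → Graph n → Set
Connected G = ∀ u v → Walk G u v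

HasCycle : ∀ {n} → Graph n → Set
HasCycle {n} G = ∃ λ (m : ℕ) → Σ (Vec (Fin n) (suc (suc (suc m)))) λ vs →
  Unique (toList vs) ×
  (∀ (i : Fin (suc (suc m))) → Adj G (lookup vs (Data.Fin.inject₁ i)) (lookup vs (suc i))) ×
  Adj G (lookup vs (Data.Fin.fromℕ (suc (suc m)))) (lookup vs zero)

Acyclic : ∀ {n} → Graph n → Set
Acyclic G = HasCycle G → Data.Empty.⊥
  where import Data.Empty

IsTree : ∀ {n} → Graph n → Set
IsTree G = Connected G × Acyclic G

-- k-element subsets of Fin n, represented canonically as strictly
-- increasing vectors of length k.
data Increasing {n : ℕ} : ∀ {k} → Vec (Fin n) k → Set where
  []  : Increasing []
  [_] : ∀ x → Increasing (x ∷ [])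
  _∷_ : ∀ {k x y} {xs : Vec (Fin n) k} → x < y → Increasing (y ∷ xs) → Increasing (x ∷ y ∷ xs)

KSubset : ℕ → ℕ → Set
KSubset n k = Σ (Vec (Fin n) k) Increasing

induce : ∀ {n k} → Graph n → Vec (Fin n) k → Graph k
induce G vs = record
  { adj    = λ i j → adj G (lookup vs i) (lookup vs j)
  ; sym    = λ i j → sym G (lookup vs i) (lookup vs j)
  ; irrefl = λ i → irrefl G (lookup vs i)
  }

card : ∀ {n k} → Graph n → KSubset n k → Graph k
card G S = induce G (proj₁ S)

-- G and H have the same (n-ℓ)-deck: a bijection between the (n-ℓ)-subsets
-- (indexing the cards as a multiset) matching isomorphic cards.
SameDeck : ∀ {n} → ℕ → Graph n → Graph n → Set
SameDeck {n} ℓ G H = Σ (KSubset n (n ∸ ℓ) ↔ KSubset n (n ∸ ℓ)) λ φ →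
  ∀ S → card G S ≅ card H (Inverse.to φ S)

Reconstructible : ∀ {n} → ℕ → Graph n → Set
Reconstructible {n} ℓ G = ∀ (H : Graph n) → SameDeck ℓ G H → G ≅ H

-- Write N = n − ℓ.  By Kelly's counting argument the deck determines, for every weight on tuples of
-- vertices that depends only on the induced pattern and vanishes on tuples with more than N distinct
-- entries, the sum of this weight.  For connected tuples that have at most N vertices together with
-- their outer neighbours, also the degrees of the entries may enter the weight (by falling factorial
-- moments of the number of outer neighbours).
--
-- The graph H has n − 1 edges.  If it were disconnected it would contain a cycle, too long to fit into
-- a card; the long path in it bounds all vertex boundaries, so a small component of H would be visible
-- in the tree T.  Hence H is a tree.
--
-- If T has many inner vertices, the branches with at most n/2 vertices ("limbs") are counted, degrees
-- included.  Rooting both trees next to a largest limb, all other branches are no larger, and a greedy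
-- matching, largest branch first, is an isomorphism.  If T has few inner vertices, the same is tried on
-- the subtree T° of inner vertices labelled by their degrees; an isomorphism there extends to the leaves.
--
-- If both attempts fail, for T and for H, then at most N − 2ℓ − 8 vertices have two inner neighbours.
-- Then both trees are rooted at the centre of a longest path, and occurrences of a branch at a vertex of
-- given depth are counted together with a longest path and the path to the root; except for the vertices
-- beside a longest descending path of the branch ("loose" ones) and six others, all vertices involved have
-- two inner neighbours.  Descending from the root, either all unmatched branches fit into a card and are
-- matched greedily, or exactly one branch per tree has ℓ or more loose vertices; then its siblings are
-- matched by counting them together with a part of that branch, and one continues inside it.

module Submission where

open import Defs renaming (sym to adj-sym; here to stop; step to hop)
open import Data.Nat
open import Data.Nat.Properties renaming (≤-reflexive to ≡⇒≤)
open import Data.Nat.ListAction using (sum)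
open import Data.Nat.Tactic.RingSolver using (solve-∀)
open import Data.Bool using (Bool; true; false; T; _∧_; _∨_; if_then_else_)
open import Data.Bool.Properties using () renaming (_≟_ to _≟ᵇ_)
open import Data.Empty using (⊥; ⊥-elim)
open import Data.Fin using (Fin; zero; suc; _↑ˡ_; _↑ʳ_; fromℕ; inject₁; punchOut) renaming (_<_ to _<ᶠ_)
import Data.Fin.Properties as Finₚ
open import Data.Fin.Properties using () renaming (_≟_ to _≟ᶠ_)
open import Data.List using (List; []; _∷_)
open import Data.Maybe using (Maybe; just; nothing)
open import Data.Product using (_×_; _,_; proj₁; proj₂; Σ; ∃)
open import Data.Sum using (_⊎_; inj₁; inj₂; map₁)
open import Data.Unit using (⊤; tt)
open import Data.Vec using (Vec; []; _∷_; lookup; _++_; map; splitAt; last; head; tail; tabulate)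
open import Data.Vec.Membership.DecPropositional using () renaming (_∈?_ to dec∈)
open import Data.Vec.Membership.Propositional using (_∈_; _∉_)
open import Data.Vec.Membership.Propositional.Properties using (∈-lookup; ∈-++⁺ˡ; ∈-++⁺ʳ)
open import Data.Vec.N-ary using (N-ary; _$ⁿ_)
open import Data.Vec.Properties using (lookup-map; lookup-++ˡ; lookup-++ʳ; lookup∘tabulate; map-∘; ∷-injective; ≡-dec)
open import Data.Vec.Relation.Unary.All as All using (All; []; _∷_)
open import Data.Vec.Relation.Unary.AllPairs using ([]; _∷_; allPairs?)
open import Data.Vec.Relation.Unary.Any using (here; there; index)
open import Data.Vec.Relation.Unary.Any.Properties using (lookup-index)
open import Data.Vec.Relation.Unary.Unique.Propositional using (Unique)
open import Data.Vec.Relation.Unary.Unique.Propositional.Properties using (lookup-injective) renaming (tabulate⁺ to unique-tabulate)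
open import Function using (_∘_)
open import Function.Bundles using (_↔_; Inverse; mk↔ₛ′)
open import Relation.Binary using (DecidableEquality)
open import Relation.Binary.Definitions using (tri<; tri≈; tri>)
open import Relation.Binary.PropositionalEquality
open import Relation.Nullary using (¬_; Dec; yes; no; ¬?)
open import Relation.Nullary.Decidable using (_×-dec_; _⊎-dec_; map′)

-- The main obstacle is that a card does not show where a pattern sits in the tree. Limbs overcome
-- it by degrees, which certify that a single edge leaves the pattern; the last method counts a
-- longest path along with the branch, and the middle of this path is the root. The constants come
-- from one budget. In a counted configuration every vertex with a descendant two levels below it
-- has two inner neighbours. What is left over are the two lowest vertices of each leg, two at the
-- lower end of each branch and at most ℓ loose ones per branch: 4 + 2(2 + ℓ) for two branches, so
-- `inner²` + 8 + 2ℓ must be at most N. If both limb counts fail, then 2 `inner` ≤ n + 2ℓ and 2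
-- `inner²` ≤ `inner` + 2ℓ, hence 4 `inner²` ≤ n + 6ℓ. The budget then follows from 3n ≥ 18ℓ + 32,
-- which for integers means n ≥ 6ℓ + 11. Sums are compared by injections in both directions, and an
-- isomorphism is a pair of injective tuples with the same pattern, turned into a map only at the
-- end.

-- A verified search for linear arithmetic over the natural numbers

module Linear where

  infixl 7 _:+_
  infixl 8 _:*_
  infix 6 _:≤_ _:<_ _:≡_
  infix 3 _⊢_

  data Lin (n : ℕ) : Set where
    var  : Fin n → Lin n
    con  : ℕ → Lin n
    _:+_ : Lin n → Lin n → Lin n
    _:*_ : ℕ → Lin n → Lin n

  data Con (n : ℕ) : Set where
    _:≤_ _:<_ _:≡_ : Lin n → Lin n → Con n

  data Seq (n : ℕ) : Set where
    _⊢_ : List (Con n) → Con n → Seq n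

  ⟦_⟧ : ∀ {n} → Lin n → Vec ℕ n → ℕ
  ⟦ var i ⟧  ρ = lookup ρ i
  ⟦ con k ⟧  ρ = k
  ⟦ a :+ b ⟧ ρ = ⟦ a ⟧ ρ + ⟦ b ⟧ ρ
  ⟦ k :* a ⟧ ρ = k * ⟦ a ⟧ ρ

  ⟦_⟧ᶜ : ∀ {n} → Con n → Vec ℕ n → Set
  ⟦ a :≤ b ⟧ᶜ ρ = ⟦ a ⟧ ρ ≤ ⟦ b ⟧ ρ
  ⟦ a :< b ⟧ᶜ ρ = ⟦ a ⟧ ρ < ⟦ b ⟧ ρ
  ⟦ a :≡ b ⟧ᶜ ρ = ⟦ a ⟧ ρ ≡ ⟦ b ⟧ ρ

  ⟦_⟧ᴴ : ∀ {n} → List (Con n) → Vec ℕ n → Set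
  ⟦ [] ⟧ᴴ     ρ = ⊤
  ⟦ c ∷ cs ⟧ᴴ ρ = ⟦ c ⟧ᶜ ρ × ⟦ cs ⟧ᴴ ρ

  -- Coefficient vectors; the constant term is the entry of an extra variable with value 1.
  dot : ∀ {n} → Vec ℕ n → Vec ℕ n → ℕ
  dot []       []       = 0
  dot (a ∷ as) (x ∷ ρ) = a * x + dot as ρ

  val : ∀ {n} → Vec ℕ (suc n) → Vec ℕ n → ℕ
  val as ρ = dot as (1 ∷ ρ)

  zeros : ∀ n → Vec ℕ n
  zeros zero    = []
  zeros (suc n) = 0 ∷ zeros n

  unit : ∀ {n} → Fin n → Vec ℕ n
  unit {suc n} zero    = 1 ∷ zeros n
  unit {suc n} (suc i) = 0 ∷ unit i

  _⊞_ : ∀ {n} → Vec ℕ n → Vec ℕ n → Vec ℕ n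
  []       ⊞ []       = []
  (a ∷ as) ⊞ (b ∷ bs) = (a + b) ∷ (as ⊞ bs)

  scale : ∀ {n} → ℕ → Vec ℕ n → Vec ℕ n
  scale k []       = []
  scale k (a ∷ as) = (k * a) ∷ scale k as

  norm : ∀ {n} → Lin n → Vec ℕ (suc n)
  norm (var i)  = 0 ∷ unit i
  norm (con k)  = k ∷ zeros _
  norm (a :+ b) = norm a ⊞ norm b
  norm (k :* a) = scale k (norm a)

  dot-zeros : ∀ {n} (ρ : Vec ℕ n) → dot (zeros n) ρ ≡ 0
  dot-zeros []      = refl
  dot-zeros (x ∷ ρ) = dot-zeros ρ

  dot-unit : ∀ {n} (i : Fin n) ρ → dot (unit i) ρ ≡ lookup ρ i
  dot-unit zero    (x ∷ ρ) = trans (cong₂ _+_ (+-identityʳ x) (dot-zeros ρ)) (+-identityʳ x)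
  dot-unit (suc i) (x ∷ ρ) = dot-unit i ρ

  dot-⊞ : ∀ {n} (as bs ρ : Vec ℕ n) → dot (as ⊞ bs) ρ ≡ dot as ρ + dot bs ρ
  dot-⊞ []       []       []      = refl
  dot-⊞ (a ∷ as) (b ∷ bs) (x ∷ ρ) rewrite dot-⊞ as bs ρ = lemma a b x (dot as ρ) (dot bs ρ)
    where
    lemma : ∀ a b x u v → (a + b) * x + (u + v) ≡ a * x + u + (b * x + v)
    lemma = solve-∀

  dot-scale : ∀ {n} k (as ρ : Vec ℕ n) → dot (scale k as) ρ ≡ k * dot as ρ
  dot-scale k []       []      = sym (*-zeroʳ k)
  dot-scale k (a ∷ as) (x ∷ ρ) rewrite dot-scale k as ρ = lemma k a x (dot as ρ)
    where
    lemma : ∀ k a x u → k * a * x + k * u ≡ k * (a * x + u)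
    lemma = solve-∀

  norm-sound : ∀ {n} (e : Lin n) ρ → val (norm e) ρ ≡ ⟦ e ⟧ ρ
  norm-sound (var i)  ρ = dot-unit i ρ
  norm-sound (con k)  ρ = trans (cong (k * 1 +_) (dot-zeros ρ)) (trans (+-identityʳ _) (*-identityʳ k))
  norm-sound (a :+ b) ρ = trans (dot-⊞ (norm a) (norm b) (1 ∷ ρ)) (cong₂ _+_ (norm-sound a ρ) (norm-sound b ρ))
  norm-sound (k :* a) ρ = trans (dot-scale k (norm a) (1 ∷ ρ)) (cong (k *_) (norm-sound a ρ))

  T-∨ : ∀ {a b} → T (a ∨ b) → T a ⊎ T b
  T-∨ {true}  t = inj₁ t
  T-∨ {false} t = inj₂ t

  T-∧ : ∀ {a b} → T (a ∧ b) → T a × T b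
  T-∧ {true} t = tt , t

  -- A pair (l , r) stands for the inequality l ≤ r.
  Ineq : ℕ → Set
  Ineq n = Vec ℕ (suc n) × Vec ℕ (suc n)

  ineqs : ∀ {n} → List (Con n) → List (Ineq n)
  ineqs []            = []
  ineqs (a :≤ b ∷ cs) = (norm a , norm b) ∷ ineqs cs
  ineqs (a :< b ∷ cs) = (norm (con 1 :+ a) , norm b) ∷ ineqs cs
  ineqs (a :≡ b ∷ cs) = (norm a , norm b) ∷ (norm b , norm a) ∷ ineqs cs

  Holds : ∀ {n} → Vec ℕ n → List (Ineq n) → Set
  Holds ρ []             = ⊤
  Holds ρ ((a , b) ∷ is) = val a ρ ≤ val b ρ × Holds ρ is

  sound≤ : ∀ {n} (ρ : Vec ℕ n) a b → ⟦ a ⟧ ρ ≤ ⟦ b ⟧ ρ → val (norm a) ρ ≤ val (norm b) ρ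
  sound≤ ρ a b = subst₂ _≤_ (sym (norm-sound a ρ)) (sym (norm-sound b ρ))

  ineqs-sound : ∀ {n} (ρ : Vec ℕ n) cs → ⟦ cs ⟧ᴴ ρ → Holds ρ (ineqs cs)
  ineqs-sound ρ []            h       = tt
  ineqs-sound ρ (a :≤ b ∷ cs) (p , h) = sound≤ ρ a b p , ineqs-sound ρ cs h
  ineqs-sound ρ (a :< b ∷ cs) (p , h) = sound≤ ρ (con 1 :+ a) b p , ineqs-sound ρ cs h
  ineqs-sound ρ (a :≡ b ∷ cs) (p , h) =
    sound≤ ρ a b (≡⇒≤ p) , sound≤ ρ b a (≡⇒≤ (sym p)) , ineqs-sound ρ cs h

  -- The tail is inspected first, so the constant term, which has index zero, is repaired last.
  deficit : ∀ {n} → Vec ℕ n → Vec ℕ n → Maybe (Fin n)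
  deficit []       []       = nothing
  deficit (a ∷ as) (b ∷ bs) with deficit as bs
  ... | just i  = just (suc i)
  ... | nothing = if a ≤ᵇ b then nothing else just zero

  deficit-sound : ∀ {n} (as bs ρ : Vec ℕ n) → deficit as bs ≡ nothing → dot as ρ ≤ dot bs ρ
  deficit-sound []       []       []      e = z≤n
  deficit-sound (a ∷ as) (b ∷ bs) (x ∷ ρ) e with deficit as bs in eq
  deficit-sound (a ∷ as) (b ∷ bs) (x ∷ ρ) () | just i
  ... | nothing with a ≤ᵇ b in q
  ...   | true = +-mono-≤ (*-monoˡ-≤ x (≤ᵇ⇒≤ a b (subst T (sym q) tt))) (deficit-sound as bs ρ eq)
  deficit-sound (a ∷ as) (b ∷ bs) (x ∷ ρ) () | nothing | false

  -- To prove l ≤ r, repeatedly add to the two sides a hypothesis whose left side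
  -- lowers the deficit of r at some variable.
  search : ∀ {n} → ℕ → List (Ineq n) → Vec ℕ (suc n) → Vec ℕ (suc n) → Bool
  tries  : ∀ {n} → ℕ → Fin (suc n) → List (Ineq n) → List (Ineq n) → Vec ℕ (suc n) → Vec ℕ (suc n) → Bool
  search f hs l r with deficit l r
  ... | nothing = true
  search zero    hs l r | just i = false
  search (suc f) hs l r | just i = tries f i hs hs l r
  tries f i hs []             l r = false
  tries f i hs ((a , b) ∷ is) l r =
    ((suc (lookup b i) ≤ᵇ lookup a i) ∧ search f hs (l ⊞ b) (r ⊞ a)) ∨ tries f i hs is l r

  search-sound : ∀ {n} f (ρ : Vec ℕ n) hs → Holds ρ hs → ∀ l r → T (search f hs l r) → val l ρ ≤ val r ρ
  tries-sound  : ∀ {n} f i (ρ : Vec ℕ n) hs → Holds ρ hs → ∀ is → Holds ρ is → ∀ l r →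
                 T (tries f i hs is l r) → val l ρ ≤ val r ρ
  search-sound f ρ hs h l r t with deficit l r in eq
  ... | nothing = deficit-sound l r (1 ∷ ρ) eq
  search-sound (suc f) ρ hs h l r t | just i = tries-sound f i ρ hs h hs h l r t
  tries-sound f i ρ hs h ((a , b) ∷ is) (p , g) l r t
    with T-∨ {(suc (lookup b i) ≤ᵇ lookup a i) ∧ search f hs (l ⊞ b) (r ⊞ a)} t
  ... | inj₂ u = tries-sound f i ρ hs h is g l r u
  -- From l + b ≤ r + a and a ≤ b follows l + b ≤ r + b, and b cancels.
  ... | inj₁ u = +-cancelʳ-≤ (val b ρ) _ _ (≤-trans (subst₂ _≤_ (dot-⊞ l b (1 ∷ ρ)) (dot-⊞ r a (1 ∷ ρ))
        (search-sound f ρ hs h (l ⊞ b) (r ⊞ a) (proj₂ (T-∧ {suc (lookup b i) ≤ᵇ lookup a i} u)))) (+-monoʳ-≤ (val r ρ) p))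

  -- The largest number of hypotheses, counted with multiplicity, in one certificate.
  fuel : ℕ
  fuel = 16

  decide : ∀ {n} → Seq n → Bool
  decide (hs ⊢ (a :≤ b)) = search fuel (ineqs hs) (norm a) (norm b)
  decide (hs ⊢ (a :< b)) = search fuel (ineqs hs) (norm (con 1 :+ a)) (norm b)
  decide (hs ⊢ (a :≡ b)) = search fuel (ineqs hs) (norm a) (norm b) ∧ search fuel (ineqs hs) (norm b) (norm a)

  Valid : ∀ {n} → Vec ℕ n → Seq n → Set
  Valid ρ (hs ⊢ c) = ⟦ hs ⟧ᴴ ρ → ⟦ c ⟧ᶜ ρ

  prove≤ : ∀ {n} (ρ : Vec ℕ n) hs → ⟦ hs ⟧ᴴ ρ → ∀ a b → T (search fuel (ineqs hs) (norm a) (norm b)) → ⟦ a ⟧ ρ ≤ ⟦ b ⟧ ρ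
  prove≤ ρ hs h a b t = subst₂ _≤_ (norm-sound a ρ) (norm-sound b ρ)
    (search-sound fuel ρ (ineqs hs) (ineqs-sound ρ hs h) (norm a) (norm b) t)

  decide-sound : ∀ {n} (ρ : Vec ℕ n) s → T (decide s) → Valid ρ s
  decide-sound ρ (hs ⊢ (a :≤ b)) t h = prove≤ ρ hs h a b t
  decide-sound ρ (hs ⊢ (a :< b)) t h = prove≤ ρ hs h (con 1 :+ a) b t
  decide-sound ρ (hs ⊢ (a :≡ b)) t h = ≤-antisym (prove≤ ρ hs h a b (proj₁ (T-∧ t)))
    (prove≤ ρ hs h b a (proj₂ (T-∧ {search fuel (ineqs hs) (norm a) (norm b)} t)))

  vars : ∀ n → Vec (Lin n) n
  vars n = tabulate var

  lia : ∀ {n} (ρ : Vec ℕ n) (f : N-ary n (Lin n) (Seq n)) {_ : T (decide (f $ⁿ vars n))} →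
        Valid ρ (f $ⁿ vars n)
  lia {n} ρ f {t} = decide-sound ρ (f $ⁿ vars n) t

  lia⊥ : ∀ {a} {A : Set a} {n} (ρ : Vec ℕ n) (f : N-ary n (Lin n) (List (Con n)))
         {_ : T (decide ((f $ⁿ vars n) ⊢ (con 1 :≤ con 0)))} → ⟦ f $ⁿ vars n ⟧ᴴ ρ → A
  lia⊥ ρ f {t} h = ⊥-elim (1+n≰n (decide-sound ρ ((f $ⁿ vars _) ⊢ (con 1 :≤ con 0)) t h))

open Linear using (lia; lia⊥; con; _:+_; _:*_; _:≤_; _:<_; _:≡_; _⊢_)

private variable
  n n' k m : ℕ

-- Finite sums

Tuple : ℕ → ℕ → Set
Tuple n k = Vec (Fin n) k

private variable
  I₁ I₂ P₁ P₂ : Set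

χ : Dec P₁ → ℕ
χ (yes _) = 1
χ (no _)  = 0

χ-yes : (d : Dec P₁) → P₁ → χ d ≡ 1
χ-yes (yes _) p = refl
χ-yes (no ¬p) p = ⊥-elim (¬p p)

χ-no : (d : Dec P₁) → ¬ P₁ → χ d ≡ 0
χ-no (yes p) ¬p = ⊥-elim (¬p p)
χ-no (no _)  ¬p = refl

χ≤1 : (d : Dec P₁) → χ d ≤ 1
χ≤1 (yes _) = ≤-refl
χ≤1 (no _)  = z≤n

χ≢0 : (d : Dec P₁) → χ d ≢ 0 → P₁
χ≢0 (yes p) _ = p
χ≢0 (no _)  h = ⊥-elim (h refl)

χ-cong : (d : Dec P₁) (e : Dec P₂) → (P₁ → P₂) → (P₂ → P₁) → χ d ≡ χ e
χ-cong (yes p) e f g = sym (χ-yes e (f p))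
χ-cong (no ¬p) e f g = sym (χ-no e (¬p ∘ g))

χ-mono : (d : Dec P₁) (e : Dec P₂) → (P₁ → P₂) → χ d ≤ χ e
χ-mono (yes p) e f = ≡⇒≤ (sym (χ-yes e (f p)))
χ-mono (no _)  e f = z≤n

χ-× : (d : Dec P₁) (e : Dec P₂) → χ (d ×-dec e) ≡ χ d * χ e
χ-× (yes _) (yes _) = refl
χ-× (yes _) (no _)  = refl
χ-× (no _)  e       = refl

χ-compl : (d : Dec P₁) (f : Dec (¬ P₁)) → χ d + χ f ≡ 1
χ-compl (yes p) (yes f) = ⊥-elim (f p)
χ-compl (yes p) (no _)  = refl
χ-compl (no _)  (yes _) = refl
χ-compl (no ¬p) (no f)  = ⊥-elim (f ¬p)

χ-gate : (d : Dec P₁) {a b : ℕ} → (P₁ → a ≡ b) → χ d * a ≡ χ d * b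
χ-gate (yes p) h = cong (_+ 0) (h p)
χ-gate (no _)  h = refl

*≢0ˡ : ∀ a {b} → a * b ≢ 0 → a ≢ 0
*≢0ˡ a h refl = h refl

*≢0ʳ : ∀ a {b} → a * b ≢ 0 → b ≢ 0
*≢0ʳ a h refl = h (*-zeroʳ a)

≥1⇒≢0 : ∀ {a} → 1 ≤ a → a ≢ 0
≥1⇒≢0 (s≤s _) ()

record Additive {I₁ : Set} (L : (I₁ → ℕ) → ℕ) : Set where
  field
    resp≗  : ∀ {f g} → (∀ a → f a ≡ g a) → L f ≡ L g
    plus  : ∀ f g → L (λ a → f a + g a) ≡ L f + L g
    nil   : L (λ _ → 0) ≡ 0
open Additive

-- Fubini is demanded against every additive functional and not only against other sums. Adding the
-- values at the two points of `Bool` then gives additivity, the empty type gives the sum of zeros,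
-- and scaling the value at the point of `⊤` gives linearity.
record Summ (I₁ : Set) : Set₁ where
  field
    S    : (I₁ → ℕ) → ℕ
    S-cong : ∀ {f g} → (∀ a → f a ≡ g a) → S f ≡ S g
    swap : ∀ {I₂ : Set} {L : (I₂ → ℕ) → ℕ} → Additive L → (f : I₁ → I₂ → ℕ) →
           S (λ a → L (f a)) ≡ L (λ b → S (λ a → f a b))
    deq  : DecidableEquality I₁
    δ    : ∀ a w → S (λ b → χ (deq a b) * w b) ≡ w a
    pos  : ∀ w → S w ≢ 0 → ∃ λ a → w a ≢ 0

  S-+ : ∀ f g → S (λ a → f a + g a) ≡ S f + S g
  S-+ f g = swap {Bool} {λ h → h true + h false}
    (record { resp≗ = λ e → cong₂ _+_ (e true) (e false)
            ; plus = λ f g → lemma (f true) (g true) (f false) (g false)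
            ; nil = refl })
    (λ { a true → f a ; a false → g a })
    where
    lemma : ∀ a b c d → a + b + (c + d) ≡ a + c + (b + d)
    lemma = solve-∀

  S-0 : S (λ _ → 0) ≡ 0
  S-0 = swap {⊥} {λ _ → 0} (record { resp≗ = λ _ → refl ; plus = λ _ _ → refl ; nil = refl }) λ _ ()

  S-add : Additive S
  S-add = record { resp≗ = S-cong ; plus = S-+ ; nil = S-0 }

  S-* : ∀ c f → S (λ a → c * f a) ≡ c * S f
  S-* c f = swap {⊤} {λ h → c * h tt}
    (record { resp≗ = λ e → cong (c *_) (e tt) ; plus = λ f g → *-distribˡ-+ c _ _ ; nil = *-zeroʳ c })
    (λ a _ → f a)

  S-*ʳ : ∀ f c → S (λ a → f a * c) ≡ S f * c
  S-*ʳ f c = trans (S-cong (λ a → *-comm (f a) c)) (trans (S-* c f) (*-comm c _))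

  S-mono : ∀ {f g} → (∀ a → f a ≤ g a) → S f ≤ S g
  S-mono {f} {g} h = ≤-trans (m≤m+n (S f) _) (≡⇒≤
    (trans (sym (S-+ f (λ a → g a ∸ f a))) (S-cong (λ a → m+[n∸m]≡n (h a)))))

  S-zero : ∀ {f} → (∀ a → f a ≡ 0) → S f ≡ 0
  S-zero h = trans (S-cong h) S-0

  S-single : ∀ a w → (∀ b → b ≢ a → w b ≡ 0) → S w ≡ w a
  S-single a w h = trans (S-cong step) (δ a w)
    where
    step : ∀ b → w b ≡ χ (deq a b) * w b
    step b with deq a b
    ... | yes _ = sym (+-identityʳ _)
    ... | no a≢b = h b (a≢b ∘ sym)

  S-≥ : ∀ a w → w a ≤ S w
  S-≥ a w = ≤-trans (≡⇒≤ (sym (δ a w)))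
    (S-mono (λ b → ≤-trans (*-monoˡ-≤ (w b) (χ≤1 (deq a b))) (≡⇒≤ (+-identityʳ _))))

  S-atMost1 : ∀ u → (∀ a → u a ≤ 1) → (∀ a b → u a ≢ 0 → u b ≢ 0 → a ≡ b) → S u ≤ 1
  S-atMost1 u h one with S u ≟ 0
  ... | yes z = ≤-trans (≡⇒≤ z) z≤n
  ... | no nz = let (a , ua) = pos u nz in
    ≤-trans (≡⇒≤ (S-single a u (λ b b≢a → others b b≢a ua))) (h a)
    where
    others : ∀ {a} b → b ≢ a → u a ≢ 0 → u b ≡ 0
    others b b≢a ua with u b ≟ 0
    ... | yes z = z
    ... | no nzb = ⊥-elim (b≢a (one b _ nzb ua))

open Summ public

S-swap : (SA : Summ I₁) (SB : Summ I₂) (f : I₁ → I₂ → ℕ) →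
         S SA (λ a → S SB (f a)) ≡ S SB (λ b → S SA (λ a → f a b))
S-swap SA SB f = swap SA (S-add SB) f

-- Each weight `w a` is spread over the b with β a = b. After exchanging the sums, injectivity on
-- the support leaves at most one a for every b. This replaces all arguments by bijection: two
-- injections give equality of the sums.
S-inj-≤ : (SA : Summ I₁) (SB : Summ I₂) (w : I₁ → ℕ) (w' : I₂ → ℕ) (β : I₁ → I₂) →
  (∀ a a' → w a ≢ 0 → w a' ≢ 0 → β a ≡ β a' → a ≡ a') → (∀ a → w a ≢ 0 → w a ≤ w' (β a)) →
  S SA w ≤ S SB w'
S-inj-≤ SA SB w w' β inj le = begin
    S SA w ≤⟨ S-mono SA step ⟩
    S SA (λ a → s a * w' (β a))
      ≡⟨ S-cong SA (λ a → sym (trans (δ SB (β a) (λ b → s a * w' b)) refl)) ⟩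
    S SA (λ a → S SB (λ b → χ (deq SB (β a) b) * (s a * w' b)))
      ≡⟨ S-swap SA SB _ ⟩
    S SB (λ b → S SA (λ a → χ (deq SB (β a) b) * (s a * w' b)))
      ≡⟨ S-cong SB (λ b → trans (S-cong SA (λ a → sym (*-assoc (χ (deq SB (β a) b)) (s a) (w' b)))) (S-*ʳ SA _ (w' b))) ⟩
    S SB (λ b → S SA (λ a → χ (deq SB (β a) b) * s a) * w' b)
      ≤⟨ S-mono SB (λ b → *-monoˡ-≤ (w' b) (S-atMost1 SA _
           (λ a → *-mono-≤ (χ≤1 (deq SB (β a) b)) (χ≤1 (¬? (w a ≟ 0)))) (one b))) ⟩
    S SB (λ b → 1 * w' b) ≡⟨ S-cong SB (λ b → +-identityʳ _) ⟩
    S SB w' ∎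
  where
  open ≤-Reasoning
  s : _ → ℕ
  s a = χ (¬? (w a ≟ 0))
  step : ∀ a → w a ≤ s a * w' (β a)
  step a with w a ≟ 0
  ... | yes z = ≡⇒≤ z
  ... | no nz = ≤-trans (le a nz) (≡⇒≤ (sym (+-identityʳ _)))
  one : ∀ b a a' → χ (deq SB (β a) b) * s a ≢ 0 → χ (deq SB (β a') b) * s a' ≢ 0 → a ≡ a'
  one b a a' h h' = inj a a' (χ≢0 (¬? (w a ≟ 0)) (*≢0ʳ (χ (deq SB (β a) b)) h)) (χ≢0 (¬? (w a' ≟ 0)) (*≢0ʳ (χ (deq SB (β a') b)) h'))
    (trans (χ≢0 (deq SB (β a) b) (*≢0ˡ _ h)) (sym (χ≢0 (deq SB (β a') b) (*≢0ˡ _ h'))))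

opaque
  ∑ : (Fin n → ℕ) → ℕ
  ∑ {zero}  f = 0
  ∑ {suc n} f = f zero + ∑ (f ∘ suc)

  ∑-nil : (f : Fin 0 → ℕ) → ∑ f ≡ 0
  ∑-nil f = refl

  ∑-cons : (f : Fin (suc n) → ℕ) → ∑ f ≡ f zero + ∑ (f ∘ suc)
  ∑-cons f = refl

  ∑-cong : {f g : Fin n → ℕ} → (∀ i → f i ≡ g i) → ∑ f ≡ ∑ g
  ∑-cong {zero}  h = refl
  ∑-cong {suc n} h = cong₂ _+_ (h zero) (∑-cong (h ∘ suc))

  ∑-swap : {L : (I₂ → ℕ) → ℕ} → Additive L → (f : Fin n → I₂ → ℕ) →
           ∑ (λ a → L (f a)) ≡ L (λ b → ∑ (λ a → f a b))
  ∑-swap {n = zero}  ad f = sym (nil ad)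
  ∑-swap {n = suc n} {L} ad f = trans (cong (L (f zero) +_) (∑-swap ad (f ∘ suc))) (sym (plus ad (f zero) _))

  ∑-zero : ∀ n → ∑ {n} (λ _ → 0) ≡ 0
  ∑-zero zero = refl
  ∑-zero (suc n) = ∑-zero n

  ∑-δ : ∀ (a : Fin n) (w : Fin n → ℕ) → ∑ (λ b → χ (a ≟ᶠ b) * w b) ≡ w a
  ∑-δ {suc n} zero w = trans (cong₂ _+_ (+-identityʳ (w zero)) (trans (∑-cong {n} {g = λ _ → 0} (λ i → refl)) (∑-zero n))) (+-identityʳ _)
  ∑-δ {suc n} (suc a) w = trans (∑-cong step) (∑-δ a (w ∘ suc))
    where
    step : ∀ i → χ (suc a ≟ᶠ suc i) * w (suc i) ≡ χ (a ≟ᶠ i) * w (suc i)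
    step i = cong (_* w (suc i)) (χ-cong (suc a ≟ᶠ suc i) (a ≟ᶠ i) Finₚ.suc-injective (cong suc))

  ∑-pos : (w : Fin n → ℕ) → ∑ w ≢ 0 → ∃ λ a → w a ≢ 0
  ∑-pos {zero}  w h = ⊥-elim (h refl)
  ∑-pos {suc n} w h with w zero ≟ 0
  ... | no nz = zero , nz
  ... | yes z = let (a , p) = ∑-pos (w ∘ suc) (λ e → h (cong₂ _+_ z e)) in suc a , p

  ∑-const : ∀ n c → ∑ {n} (λ _ → c) ≡ n * c
  ∑-const zero c = refl
  ∑-const (suc n) c = cong (c +_) (∑-const n c)

fin : ∀ n → Summ (Fin n)
fin n = record { S = ∑ ; S-cong = ∑-cong ; swap = ∑-swap ; deq = _≟ᶠ_ ; δ = ∑-δ ; pos = ∑-pos }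

-- The head is the innermost variable, so counting the ways to prepend an entry to a fixed tuple is
-- a single inner sum.
∑ᵛ : ∀ k → (Tuple n k → ℕ) → ℕ
∑ᵛ zero    F = F []
∑ᵛ (suc k) F = ∑ᵛ k (λ xs → ∑ (λ x → F (x ∷ xs)))

∑ᵛ-cong : ∀ k {f g : Tuple n k → ℕ} → (∀ i → f i ≡ g i) → ∑ᵛ k f ≡ ∑ᵛ k g
∑ᵛ-cong zero    h = h []
∑ᵛ-cong (suc k) h = ∑ᵛ-cong k (λ xs → ∑-cong (λ x → h (x ∷ xs)))

∑ᵛ-swap : ∀ k {L : (I₂ → ℕ) → ℕ} → Additive L → (f : Tuple n k → I₂ → ℕ) →
          ∑ᵛ k (λ a → L (f a)) ≡ L (λ b → ∑ᵛ k (λ a → f a b))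
∑ᵛ-swap zero    ad f = resp≗ ad (λ _ → refl)
∑ᵛ-swap (suc k) ad f = trans (∑ᵛ-cong k (λ xs → ∑-swap ad (λ x → f (x ∷ xs)))) (∑ᵛ-swap k ad _)

_≟ᵛ_ : DecidableEquality (Tuple n k)
_≟ᵛ_ = ≡-dec _≟ᶠ_

∑ᵛ-δ : ∀ {n} k (a : Tuple n k) (w : Tuple n k → ℕ) → ∑ᵛ k (λ b → χ (a ≟ᵛ b) * w b) ≡ w a
∑ᵛ-δ zero [] w = +-identityʳ _
∑ᵛ-δ {n} (suc k) (x ∷ xs) w = trans (∑ᵛ-cong k step) (∑ᵛ-δ k xs (λ ys → w (x ∷ ys)))
  where
  split : ∀ ys y → χ ((x ∷ xs) ≟ᵛ (y ∷ ys)) * w (y ∷ ys) ≡ χ (x ≟ᶠ y) * (χ (xs ≟ᵛ ys) * w (y ∷ ys))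
  split ys y = trans (cong (_* w (y ∷ ys)) (trans (χ-cong ((x ∷ xs) ≟ᵛ (y ∷ ys)) ((x ≟ᶠ y) ×-dec (xs ≟ᵛ ys))
    ∷-injective (λ { (refl , refl) → refl })) (χ-× (x ≟ᶠ y) (xs ≟ᵛ ys)))) (*-assoc (χ (x ≟ᶠ y)) (χ (xs ≟ᵛ ys)) _)
  step : ∀ ys → ∑ (λ y → χ ((x ∷ xs) ≟ᵛ (y ∷ ys)) * w (y ∷ ys)) ≡ χ (xs ≟ᵛ ys) * w (x ∷ ys)
  step ys = trans (∑-cong (split ys)) (∑-δ x (λ y → χ (xs ≟ᵛ ys) * w (y ∷ ys)))

∑ᵛ-pos : ∀ k (w : Tuple n k → ℕ) → ∑ᵛ k w ≢ 0 → ∃ λ a → w a ≢ 0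
∑ᵛ-pos zero    w h = [] , h
∑ᵛ-pos (suc k) w h = let (xs , p) = ∑ᵛ-pos k _ h ; (x , q) = ∑-pos _ p in (x ∷ xs) , q

vec : ∀ n k → Summ (Tuple n k)
vec n k = record { S = ∑ᵛ k ; S-cong = ∑ᵛ-cong k ; swap = ∑ᵛ-swap k ; deq = _≟ᵛ_ ; δ = ∑ᵛ-δ k ; pos = ∑ᵛ-pos k }

∑ᵛ-++ : ∀ m k (F : Tuple n (m + k) → ℕ) → ∑ᵛ (m + k) F ≡ ∑ᵛ k (λ ys → ∑ᵛ m (λ xs → F (xs ++ ys)))
∑ᵛ-++ zero    k F = refl
∑ᵛ-++ {n} (suc m) k F = ∑ᵛ-++ m k (λ zs → ∑ (λ x → F (x ∷ zs)))

opaque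
  _∈?_ : (x : Fin n) (xs : Tuple n k) → Dec (x ∈ xs)
  x ∈? xs = dec∈ _≟ᶠ_ x xs

  unique? : (xs : Tuple n k) → Dec (Unique xs)
  unique? = allPairs? (λ x y → ¬? (x ≟ᶠ y))

∉⇒All : {x : I₁} {xs : Vec I₁ k} → x ∉ xs → All (x ≢_) xs
∉⇒All {xs = []}     h = []
∉⇒All {xs = y ∷ xs} h = (λ e → h (here e)) ∷ ∉⇒All (h ∘ there)

All⇒∉ : {x : I₁} {xs : Vec I₁ k} → All (x ≢_) xs → x ∉ xs
All⇒∉ (p ∷ ps) (here e)  = p e
All⇒∉ (p ∷ ps) (there m) = All⇒∉ ps m

∈⇒lookup : {x : I₁} {xs : Vec I₁ k} → x ∈ xs → ∃ λ i → lookup xs i ≡ x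
∈⇒lookup m = index m , sym (lookup-index m)

χ∈-unique : (xs : Tuple n k) → Unique xs → ∀ x → χ (x ∈? xs) ≡ ∑ (λ i → χ (lookup xs i ≟ᶠ x))
χ∈-unique [] u x = trans (χ-no (x ∈? []) (λ ())) (sym (∑-nil _))
χ∈-unique (y ∷ xs) (p ∷ u) x = trans (go (y ≟ᶠ x) (x ∈? xs) (χ∈-unique xs u x)) (sym (∑-cons _))
  where
  rest = ∑ (λ i → χ (lookup xs i ≟ᶠ x))
  go : (d : Dec (y ≡ x)) (e : Dec (x ∈ xs)) → χ e ≡ rest → χ (x ∈? (y ∷ xs)) ≡ χ d + rest
  go (yes refl) (yes m) q = ⊥-elim (All⇒∉ p m)
  go (yes refl) (no ¬m) q = trans (χ-yes (x ∈? (x ∷ xs)) (here refl)) (cong suc q)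
  go (no ¬e) (yes m) q = trans (χ-yes (x ∈? (y ∷ xs)) (there m)) q
  go (no ¬e) (no ¬m) q =
    trans (χ-no (x ∈? (y ∷ xs)) (λ { (here e) → ¬e (sym e) ; (there m) → ¬m m })) q

∑-∈ : (xs : Tuple n k) → Unique xs → ∀ (f : Fin n → ℕ) → ∑ (λ x → χ (x ∈? xs) * f x) ≡ ∑ (λ i → f (lookup xs i))
∑-∈ {n} {k} xs u f = trans (∑-cong (λ x → trans (cong (_* f x) (χ∈-unique xs u x)) (sym (S-*ʳ (fin k) _ (f x)))))
  (trans (S-swap (fin n) (fin k) _) (∑-cong (λ i → ∑-δ (lookup xs i) f)))

∑-one : ∀ n → ∑ {n} (λ _ → 1) ≡ n
∑-one n = trans (∑-const n 1) (*-identityʳ n)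

count-∈ : (xs : Tuple n k) → Unique xs → ∑ (λ x → χ (x ∈? xs)) ≡ k
count-∈ {n} {k} xs u = trans (∑-cong (λ x → sym (*-identityʳ _))) (trans (∑-∈ xs u (λ _ → 1)) (∑-one k))

∉? : (x : Fin n) (xs : Tuple n k) → Dec (x ∉ xs)
∉? x xs = ¬? (x ∈? xs)

count-∉ : (xs : Tuple n k) → Unique xs → ∑ (λ x → χ (∉? x xs)) ≡ n ∸ k
count-∉ {n} {k} xs u = sym (trans (cong (_∸ k) total) (m+n∸m≡n k _))
  where
  total : n ≡ k + ∑ (λ x → χ (∉? x xs))
  total = trans (sym (∑-one n)) (trans (∑-cong (λ x → sym (χ-compl (x ∈? xs) (∉? x xs))))
    (trans (S-+ (fin n) _ _) (cong (_+ ∑ (λ x → χ (∉? x xs))) (count-∈ xs u))))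

unique-≤ : (xs : Tuple n k) → Unique xs → k ≤ n
unique-≤ {n} {k} xs u = ≤-trans (≡⇒≤ (sym (count-∈ xs u)))
  (≤-trans (S-mono (fin n) (λ x → χ≤1 (x ∈? xs))) (≡⇒≤ (∑-one n)))

∈-++⁻ : ∀ {n m k} (xs : Tuple n m) {ys : Tuple n k} {x} → x ∈ (xs ++ ys) → x ∈ xs ⊎ x ∈ ys
∈-++⁻ []       m        = inj₂ m
∈-++⁻ (y ∷ xs) (here e) = inj₁ (here e)
∈-++⁻ (y ∷ xs) (there m) with ∈-++⁻ xs m
... | inj₁ p = inj₁ (there p)
... | inj₂ p = inj₂ p

-- Sums determined by the deck

unique-lookup : {A : Set} {xs : Vec A k} → (∀ i j → lookup xs i ≡ lookup xs j → i ≡ j) → Unique xs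
unique-lookup {xs = []}     h = []
unique-lookup {xs = x ∷ xs} h =
  ∉⇒All (λ x∈ → case (h zero (suc (proj₁ (∈⇒lookup x∈))) (sym (proj₂ (∈⇒lookup x∈)))))
  ∷ unique-lookup (λ i j e → Finₚ.suc-injective (h (suc i) (suc j) e))
  where
  case : ∀ {i : Fin k} → ¬ (zero ≡ suc i)
  case ()

inc-cons : ∀ {x : Fin n} {S : Tuple n k} → All (x <ᶠ_) S → Increasing S → Increasing (x ∷ S)
inc-cons []      []        = [ _ ]
inc-cons (p ∷ _) [ y ]     = p ∷ [ y ]
inc-cons (p ∷ _) (q ∷ inc) = p ∷ (q ∷ inc)

inc-tail : ∀ {x : Fin n} {S : Tuple n k} → Increasing (x ∷ S) → Increasing S
inc-tail [ _ ]     = []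
inc-tail (_ ∷ inc) = inc

inc-head : ∀ {x : Fin n} {S : Tuple n k} → Increasing (x ∷ S) → All (x <ᶠ_) S
inc-head [ _ ]     = []
inc-head (p ∷ inc) = p ∷ All.map (Finₚ.<-trans p) (inc-head inc)

inc-unique : ∀ {S : Tuple n k} → Increasing S → Unique S
inc-unique {S = []}    inc = []
inc-unique {S = x ∷ S} inc = All.map (λ { p refl → Finₚ.<-irrefl refl p }) (inc-head inc) ∷ inc-unique (inc-tail inc)

inc-irr : ∀ {S : Tuple n k} (p q : Increasing S) → p ≡ q
inc-irr []      []       = refl
inc-irr [ x ]   [ .x ]   = refl
inc-irr (p ∷ i) (q ∷ j) = cong₂ _∷_ (<-irrelevant p q) (inc-irr i j)

inc-least : ∀ {x y : Fin n} {S : Tuple n k} → x <ᶠ y → x ∈ (y ∷ S) → ¬ Increasing (y ∷ S)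
inc-least x<y (here refl) j = Finₚ.<-irrefl refl x<y
inc-least x<y (there m)   j = Finₚ.<-asym x<y (All.lookup (inc-head j) m)

inc-sub-tail : ∀ {x : Fin n} {S S' : Tuple n k} → (∀ {z} → z ∈ (x ∷ S) → z ∈ (x ∷ S')) → Increasing (x ∷ S) →
               ∀ {z} → z ∈ S → z ∈ S'
inc-sub-tail f i m with f (there m)
... | here refl = ⊥-elim (Finₚ.<-irrefl refl (All.lookup (inc-head i) m))
... | there m'  = m'

inc-≡ : ∀ {S S' : Tuple n k} → Increasing S → Increasing S' →
        (∀ {x} → x ∈ S → x ∈ S') → (∀ {x} → x ∈ S' → x ∈ S) → S ≡ S'
inc-≡ {S = []}    {[]}     i j f g = refl
inc-≡ {S = x ∷ S} {y ∷ S'} i j f g with Finₚ.<-cmp x y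
... | tri< x<y _ _ = ⊥-elim (inc-least x<y (f (here refl)) j)
... | tri> _ _ y<x = ⊥-elim (inc-least y<x (g (here refl)) i)
... | tri≈ _ refl _ = cong (x ∷_) (inc-≡ (inc-tail i) (inc-tail j) (inc-sub-tail f i) (inc-sub-tail g j))

-- The last component, that common strict lower bounds persist, is what keeps the result increasing
-- in the recursion.
insert : (x : Fin n) (S : Tuple n k) → Increasing S → x ∉ S →
  Σ (Tuple n (suc k)) λ S' → Increasing S' × x ∈ S' × (∀ {y} → y ∈ S → y ∈ S') ×
  (∀ {z} → z <ᶠ x → All (z <ᶠ_) S → All (z <ᶠ_) S')
insert x [] inc x∉ = x ∷ [] , [ x ] , here refl , (λ ()) , λ p _ → p ∷ []
insert x (y ∷ S) inc x∉ with Finₚ.<-cmp x y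
... | tri< x<y _ _ = x ∷ y ∷ S , x<y ∷ inc , here refl , there , λ p q → p ∷ q
... | tri≈ _ refl _ = ⊥-elim (x∉ (here refl))
... | tri> _ _ y<x with insert x S (inc-tail inc) (x∉ ∘ there)
... | S' , inc' , x∈ , sub , low = y ∷ S' , inc-cons (low y<x (inc-head inc)) inc' , there x∈ ,
      (λ { (here e) → here e ; (there m) → there (sub m) }) , λ { p (q ∷ qs) → q ∷ low p qs }

-- The lengths agree, so an entry of S outside f would give S more than k distinct entries.
unique-⊆-⊇ : ∀ {f S : Tuple n k} → Unique f → Unique S → (∀ {x} → x ∈ f → x ∈ S) → ∀ {x} → x ∈ S → x ∈ f
unique-⊆-⊇ {n} {k} {f} {S} u v sub {x} x∈ with x ∈? f
... | yes m = m
... | no ¬m = ⊥-elim (1+n≰n (subst₂ _≤_ (cong suc (count-∈ f u)) (count-∈ S v) lt))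
  where
  pt : ∀ y → χ (x ≟ᶠ y) + χ (y ∈? f) ≤ χ (y ∈? S)
  pt y with x ≟ᶠ y | y ∈? f
  ... | yes refl | yes m = ⊥-elim (¬m m)
  ... | yes refl | no _  = ≡⇒≤ (sym (χ-yes (x ∈? S) x∈))
  ... | no _ | yes m = ≡⇒≤ (sym (χ-yes (y ∈? S) (sub m)))
  ... | no _ | no _  = z≤n
  one : ∑ (λ y → χ (x ≟ᶠ y)) ≡ 1
  one = trans (∑-cong (λ y → sym (*-identityʳ _))) (∑-δ x (λ _ → 1))
  lt : 1 + ∑ (λ y → χ (y ∈? f)) ≤ ∑ (λ y → χ (y ∈? S))
  lt = subst (λ z → z + ∑ (λ y → χ (y ∈? f)) ≤ ∑ (λ y → χ (y ∈? S))) one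
         (≤-trans (≡⇒≤ (sym (S-+ (fin n) _ _))) (S-mono (fin n) pt))

sortᵛ : (f : Tuple n k) → Unique f → Σ (Tuple n k) λ S → Increasing S × (∀ {x} → x ∈ f → x ∈ S)
sortᵛ []      u       = [] , [] , λ ()
sortᵛ (x ∷ f) (p ∷ u) =
  let (S , inc , sub) = sortᵛ f u
      (S' , inc' , x∈ , sub' , _) = insert x S inc (All⇒∉ p ∘ unique-⊆-⊇ u (inc-unique inc) sub)
  in S' , inc' , λ { (here refl) → x∈ ; (there m) → sub' (sub m) }

inj-hits : (f : Fin k → Fin k) → (∀ i j → f i ≡ f j → i ≡ j) → ∀ j → ∃ λ i → f i ≡ j
inj-hits {suc k} f inj j with Finₚ.any? (λ i → f i ≟ᶠ j)
... | yes p = p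
... | no ¬p = ⊥-elim (1+n≰n (Finₚ.injective⇒≤ {f = λ i → punchOut {i = j} (λ e → ¬p (i , sym e))}
                (λ {x} {y} e → inj x y (Finₚ.punchOut-injective (λ e → ¬p (x , sym e)) (λ e → ¬p (y , sym e)) e))))

-- Labels serve the tree of inner vertices, where they record degrees in the whole tree; `plain`
-- covers all other uses.
record LGraph (n : ℕ) : Set where
  constructor _⟨_⟩
  field
    graph : Graph n
    lab   : Fin n → ℕ
open LGraph public

plain : Graph n → LGraph n
plain G = G ⟨ (λ _ → 0) ⟩

record Same (G : LGraph n) (xs : Tuple n k) (H : LGraph m) (ys : Tuple m k) : Set where
  constructor _&_
  field
    same-adj : ∀ i j → adj (graph G) (lookup xs i) (lookup xs j) ≡ adj (graph H) (lookup ys i) (lookup ys j)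
    same-lab : ∀ i → lab G (lookup xs i) ≡ lab H (lookup ys i)
open Same public

χu : (xs : Tuple n k) → ℕ
χu xs = χ (unique? xs)

χu-∷ : (x : Fin n) (xs : Tuple n k) → χu (x ∷ xs) ≡ χ (∉? x xs) * χu xs
χu-∷ x xs = trans (χ-cong (unique? (x ∷ xs)) (∉? x xs ×-dec unique? xs)
  (λ { (p ∷ u) → All⇒∉ p , u }) (λ (p , u) → ∉⇒All p ∷ u)) (χ-× (∉? x xs) (unique? xs))

-- Kelly's lemma in the form used throughout. A weight that depends on the induced pattern only is
-- given as two functions, one per graph, that agree on tuples of the same pattern; no type of
-- patterns has to be chosen.
AgreeAt : LGraph n → LGraph m → ℕ → Set
AgreeAt {n} {m} G H k = (F : Tuple n k → ℕ) (F' : Tuple m k → ℕ) →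
  (∀ xs ys → Unique xs → Unique ys → Same G xs H ys → F xs ≡ F' ys) →
  ∑ᵛ k (λ xs → χu xs * F xs) ≡ ∑ᵛ k (λ ys → χu ys * F' ys)

module _ {n N : ℕ} (T H : Graph n) (φ : KSubset n N ↔ KSubset n N) (iso : ∀ S → card T S ≅ card H (Inverse.to φ S)) where

  private
    srt : (f : Tuple n N) (u : Unique f) → KSubset n N
    srt f u = let (S , inc , _) = sortᵛ f u in S , inc
    pos-in : (f : Tuple n N) (u : Unique f) → ∀ i → ∃ λ j → lookup (proj₁ (srt f u)) j ≡ lookup f i
    pos-in f u i = ∈⇒lookup (proj₂ (proj₂ (sortᵛ f u)) (∈-lookup i f))
    π : (f : Tuple n N) (u : Unique f) → Fin N → Fin N
    π f u i = proj₁ (pos-in f u i)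
    π-inj : ∀ f u i j → π f u i ≡ π f u j → i ≡ j
    π-inj f u i j e = lookup-injective u i j (trans (sym (proj₂ (pos-in f u i)))
      (trans (cong (lookup (proj₁ (srt f u))) e) (proj₂ (pos-in f u j))))
    σ : KSubset n N → Fin N → Fin N
    σ S = Inverse.to (proj₁ (iso S))
    σ-inj : ∀ S i j → σ S i ≡ σ S j → i ≡ j
    σ-inj S i j e = trans (sym (Inverse.strictlyInverseʳ (proj₁ (iso S)) i))
      (trans (cong (Inverse.from (proj₁ (iso S))) e) (Inverse.strictlyInverseʳ (proj₁ (iso S)) j))
    img : (f : Tuple n N) (u : Unique f) → Tuple n N
    img f u = tabulate (λ i → lookup (proj₁ (Inverse.to φ (srt f u))) (σ (srt f u) (π f u i)))
    img-lookup : ∀ f u i → lookup (img f u) i ≡ lookup (proj₁ (Inverse.to φ (srt f u))) (σ (srt f u) (π f u i))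
    img-lookup f u i = lookup∘tabulate _ i
    -- Tuples with a repeated entry have weight zero, so the value there is a placeholder.
    β : Tuple n N → Tuple n N
    β f with unique? f
    ... | yes u = img f u
    ... | no _  = f
    img-unique : ∀ f u → Unique (img f u)
    img-unique f u = unique-tabulate (λ {i} {j} e → π-inj f u i j (σ-inj (srt f u) _ _
      (lookup-injective (inc-unique (proj₂ (Inverse.to φ (srt f u)))) _ _ e)))
    img-same : ∀ f u → Same (plain T) f (plain H) (img f u)
    img-same f u = (λ i j → trans (cong₂ (adj T) (sym (proj₂ (pos-in f u i))) (sym (proj₂ (pos-in f u j))))
      (trans (proj₂ (iso (srt f u)) (π f u i) (π f u j))
             (cong₂ (adj H) (sym (img-lookup f u i)) (sym (img-lookup f u j))))) & λ _ → refl
    img-∈ : ∀ f u {x} → x ∈ proj₁ (Inverse.to φ (srt f u)) → x ∈ img f u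
    img-∈ f u {x} m =
      let (j , e) = ∈⇒lookup m
          (a , ea) = inj-hits (σ (srt f u)) (σ-inj (srt f u)) j
          (b , eb) = inj-hits (π f u) (π-inj f u) a
      in subst (_∈ img f u) (trans (img-lookup f u b) (trans (cong (λ z → lookup (proj₁ (Inverse.to φ (srt f u))) (σ (srt f u) z)) eb)
           (trans (cong (lookup (proj₁ (Inverse.to φ (srt f u)))) ea) e))) (∈-lookup b (img f u))
    ∈-img : ∀ f u {x} → x ∈ img f u → x ∈ proj₁ (Inverse.to φ (srt f u))
    ∈-img f u m = let (i , e) = ∈⇒lookup m in
      subst (_∈ proj₁ (Inverse.to φ (srt f u))) (trans (sym (img-lookup f u i)) e) (∈-lookup (σ (srt f u) (π f u i)) (proj₁ (Inverse.to φ (srt f u))))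
    φ-inj : ∀ S S' → Inverse.to φ S ≡ Inverse.to φ S' → S ≡ S'
    φ-inj S S' e = trans (sym (Inverse.strictlyInverseʳ φ S)) (trans (cong (Inverse.from φ) e) (Inverse.strictlyInverseʳ φ S'))
    ks-≡ : {S S' : KSubset n N} → proj₁ S ≡ proj₁ S' → S ≡ S'
    ks-≡ {A , i} {B , j} refl = cong (A ,_) (inc-irr i j)
    vec-≡ : ∀ {k} {xs ys : Tuple n k} → (∀ i → lookup xs i ≡ lookup ys i) → xs ≡ ys
    vec-≡ {xs = []} {[]} h = refl
    vec-≡ {xs = x ∷ xs} {y ∷ ys} h = cong₂ _∷_ (h zero) (vec-≡ (h ∘ suc))
    img-inj : ∀ f u g v → img f u ≡ img g v → f ≡ g
    img-inj f u g v e = vec-≡ step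
      where
      -- The image of f lists the card assigned to the card of f, so equal images have the same
      -- assigned card, and φ is injective.
      same-set : srt f u ≡ srt g v
      same-set = φ-inj _ _ (ks-≡ (inc-≡ (proj₂ (Inverse.to φ (srt f u))) (proj₂ (Inverse.to φ (srt g v)))
        (λ m → ∈-img g v (subst (_ ∈_) e (img-∈ f u m))) (λ m → ∈-img f u (subst (_ ∈_) (sym e) (img-∈ g v m)))))
      go : ∀ S S' a b → S ≡ S' → lookup (proj₁ (Inverse.to φ S)) (σ S a) ≡ lookup (proj₁ (Inverse.to φ S')) (σ S' b) →
           lookup (proj₁ S) a ≡ lookup (proj₁ S') b
      go A B a b refl e = cong (lookup (proj₁ A)) (σ-inj A a b (lookup-injective (inc-unique (proj₂ (Inverse.to φ A))) _ _ e))
      step : ∀ i → lookup f i ≡ lookup g i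
      step i = trans (sym (proj₂ (pos-in f u i))) (trans (go _ _ _ _ same-set
        (trans (sym (img-lookup f u i)) (trans (cong (λ z → lookup z i) e) (img-lookup g v i)))) (proj₂ (pos-in g v i)))

  -- An injective N-tuple lists a card: sort it, pass to the assigned card of H, and read off the
  -- image of the listing under the isomorphism of the two cards. This map preserves patterns and is
  -- injective. The opposite inequality comes from the inverse of φ.
  deck-≤ : (F F' : Tuple n N → ℕ) →
    (∀ xs ys → Unique xs → Unique ys → Same (plain T) xs (plain H) ys → F xs ≡ F' ys) →
    ∑ᵛ N (λ xs → χu xs * F xs) ≤ ∑ᵛ N (λ ys → χu ys * F' ys)
  deck-≤ F F' r = S-inj-≤ (vec n N) (vec n N) _ _ β inj le
    where
    supp : ∀ f → χu f * F f ≢ 0 → Unique f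
    supp f h = χ≢0 (unique? f) (*≢0ˡ (χu f) h)
    inj : ∀ f g → χu f * F f ≢ 0 → χu g * F g ≢ 0 → β f ≡ β g → f ≡ g
    inj f g hf hg e with unique? f | unique? g
    ... | yes u | yes v = img-inj f u g v e
    ... | no ¬u | _ = ⊥-elim (hf refl)
    ... | yes _ | no ¬v = ⊥-elim (hg refl)
    le : ∀ f → χu f * F f ≢ 0 → χu f * F f ≤ χu (β f) * F' (β f)
    le f h with unique? f
    ... | no _ = ⊥-elim (h refl)
    ... | yes u = ≡⇒≤ (cong₂ _*_ {1} {χu (img f u)} {F f} {F' (img f u)} (sym (χ-yes (unique? (img f u)) (img-unique f u)))
                    (r f (img f u) u (img-unique f u) (img-same f u)))

same-flip : {G : LGraph n} {H : LGraph m} {xs : Tuple n k} {ys : Tuple m k} → Same G xs H ys → Same H ys G xs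
same-flip (a & l) = (λ i j → sym (a i j)) & λ i → sym (l i)

deck-agree : ∀ {n ℓ} (T H : Graph n) → SameDeck ℓ T H → AgreeAt (plain T) (plain H) (n ∸ ℓ)
deck-agree {n} {ℓ} T H (φ , iso) F F' r = ≤-antisym (deck-≤ T H φ iso F F' r)
  (deck-≤ H T φ⁻ iso⁻ F' F (λ xs ys u v s → sym (r ys xs v u (same-flip s))))
  where
  N = n ∸ ℓ
  φ⁻ : KSubset n N ↔ KSubset n N
  φ⁻ = mk↔ₛ′ (Inverse.from φ) (Inverse.to φ) (Inverse.strictlyInverseʳ φ) (Inverse.strictlyInverseˡ φ)
  flip≅ : ∀ {k} {A B : Graph k} → A ≅ B → B ≅ A
  flip≅ {A = A} {B} (s , p) = mk↔ₛ′ (Inverse.from s) (Inverse.to s) (Inverse.strictlyInverseʳ s) (Inverse.strictlyInverseˡ s) ,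
    λ u v → trans (cong₂ (adj B) (sym (Inverse.strictlyInverseˡ s u)) (sym (Inverse.strictlyInverseˡ s v)))
              (sym (p (Inverse.from s u) (Inverse.from s v)))
  iso⁻ : ∀ S → card H S ≅ card T (Inverse.from φ S)
  iso⁻ S = flip≅ {A = card T (Inverse.from φ S)} {card H S} (subst (λ Z → card T (Inverse.from φ S) ≅ card H Z) (Inverse.strictlyInverseˡ φ S) (iso (Inverse.from φ S)))

-- Every injective k-tuple extends in exactly n - k ways to an injective (k + 1)-tuple, and this
-- positive factor cancels.
agree-down : ∀ {k} (G H : LGraph n) → k < n → AgreeAt G H (suc k) → AgreeAt G H k
agree-down {n} {k} G H k<n ag F F' r = *-cancelʳ-≡ _ _ (n ∸ k) {{>-nonZero (m<n⇒0<n∸m k<n)}}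
  (trans (sym (expand F)) (trans (ag (λ { (x ∷ xs) → F xs }) (λ { (x ∷ xs) → F' xs }) resp') (expand F')))
  where
  resp' : ∀ xs ys → Unique xs → Unique ys → Same G xs H ys → _
  resp' (x ∷ xs) (y ∷ ys) (_ ∷ u) (_ ∷ v) (a & l) = r xs ys u v ((λ i j → a (suc i) (suc j)) & λ i → l (suc i))
  expand : (F : Tuple n k → ℕ) → ∑ᵛ k (λ xs → ∑ (λ x → χu (x ∷ xs) * F xs)) ≡ ∑ᵛ k (λ xs → χu xs * F xs) * (n ∸ k)
  expand F = trans (S-cong (vec n k) step) (S-*ʳ (vec n k) _ (n ∸ k))
    where
    step : ∀ xs → ∑ (λ x → χu (x ∷ xs) * F xs) ≡ χu xs * F xs * (n ∸ k)
    step xs = trans (S-cong (fin n) (λ x → trans (cong (_* F xs) (χu-∷ x xs)) (*-assoc (χ (∉? x xs)) (χu xs) (F xs))))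
      (trans (S-*ʳ (fin n) _ (χu xs * F xs)) (trans (*-comm _ (χu xs * F xs)) (inner (unique? xs))))
      where
      inner : (d : Dec (Unique xs)) → χ d * F xs * ∑ (λ x → χ (∉? x xs)) ≡ χ d * F xs * (n ∸ k)
      inner (yes u) = cong ((F xs + 0 * F xs) *_) (count-∉ xs u)
      inner (no _) = refl

Agree : LGraph n → LGraph m → ℕ → Set
Agree G H N = ∀ k → k ≤ N → AgreeAt G H k

agree-below : ∀ {N} (G H : LGraph n) → N ≤ n → AgreeAt G H N → Agree G H N
agree-below {n} {N} G H N≤n ag k k≤N = go (N ∸ k) k (m+[n∸m]≡n k≤N)
  where
  go : ∀ d k → k + d ≡ N → AgreeAt G H k
  go zero    k e = subst (AgreeAt G H) (trans (sym e) (+-identityʳ k)) ag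
  go (suc d) k e = agree-down G H
    (lia (k ∷ d ∷ N ∷ n ∷ []) (λ k d N n → k :+ (con 1 :+ d) :≡ N ∷ N :≤ n ∷ [] ⊢ k :< n) (e , N≤n , tt))
    (go d (suc k) (trans (sym (+-suc k d)) e))

-- From injective tuples to arbitrary lists of tuples

Zip : Tuple n k → Tuple m k → Fin n → Fin m → Set
Zip xs ys x y = ∃ λ i → lookup xs i ≡ x × lookup ys i ≡ y

-- Equality is respected along with adjacency because vertices of different tuples may coincide.
Corr : Graph n → Graph m → (Fin n → Fin m → Set) → Set
Corr G H R = ∀ {x y x' y'} → R x y → R x' y' → adj G x x' ≡ adj H y y' × (x ≡ x' → y ≡ y') × (y ≡ y' → x ≡ x')

_∪_ : (R R' : Fin n → Fin m → Set) → Fin n → Fin m → Set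
(R ∪ R') x y = R x y ⊎ R' x y

private
  -- Induction on the number of unrestricted entries. The next entry is either new, and joins the
  -- injective tuple, or repeats one of its k entries. The weight vanishes on more than N distinct
  -- vertices, so the injective tuple never has to outgrow a card.
  gen : ∀ {n m N : ℕ} (G : Graph n) (H : Graph m) → Agree (plain G) (plain H) N → ∀ i k → k ≤ N →
    (F : Tuple n k → Tuple n i → ℕ) (F' : Tuple m k → Tuple m i → ℕ) →
    (∀ xs ts ys us → Unique xs → Unique ys → Corr G H (Zip xs ys ∪ Zip ts us) → F xs ts ≡ F' ys us) →
    (∀ xs ts (g : Tuple n (suc N)) → Unique g → (∀ {v} → v ∈ g → v ∈ xs ⊎ v ∈ ts) → F xs ts ≡ 0) →
    (∀ xs ts (g : Tuple m (suc N)) → Unique g → (∀ {v} → v ∈ g → v ∈ xs ⊎ v ∈ ts) → F' xs ts ≡ 0) →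
    ∑ᵛ k (λ xs → χu xs * ∑ᵛ i (F xs)) ≡ ∑ᵛ k (λ ys → χu ys * ∑ᵛ i (F' ys))
  gen G H ag zero k k≤ F F' r z z' = ag k k≤ (λ xs → F xs []) (λ ys → F' ys [])
    (λ xs ys u v (a & _) → r xs [] ys [] u v
      (λ { (inj₁ (i , refl , refl)) (inj₁ (j , refl , refl)) →
             a i j , (λ e → cong (lookup ys) (lookup-injective u i j e)) , (λ e → cong (lookup xs) (lookup-injective v i j e))
         ; (inj₂ (() , _)) _ ; _ (inj₂ (() , _)) }))
  gen {n} {m} {N} G H ag (suc i) k k≤ F F' r z z' =
    trans (peel F) (trans (cong₂ _+_ fresh old) (sym (peel F')))
    where
    peel : ∀ {n} (F : Tuple n k → Tuple n (suc i) → ℕ) →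
      ∑ᵛ k (λ xs → χu xs * ∑ᵛ (suc i) (F xs)) ≡
      ∑ᵛ (suc k) (λ zs → χu zs * ∑ᵛ i (λ ts → F (Data.Vec.tail zs) (Data.Vec.head zs ∷ ts))) +
      ∑ (λ (a : Fin k) → ∑ᵛ k (λ xs → χu xs * ∑ᵛ i (λ ts → F xs (lookup xs a ∷ ts))))
    peel {n} F = trans (S-cong (vec n k) step) (trans (S-+ (vec n k) _ _)
        (cong₂ _+_ (S-cong (vec n k) (λ xs → S-cong (fin n) (λ w → cong (_* Φ xs w) (sym (trans (χu-∷ w xs) (*-comm (χ (∉? w xs)) (χu xs)))))))
                   (S-swap (vec n k) (fin k) _)))
      where
      Φ : Tuple n k → Fin n → ℕ
      Φ xs w = ∑ᵛ i (λ ts → F xs (w ∷ ts))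
      step : ∀ xs → χu xs * ∑ᵛ (suc i) (F xs) ≡
                    ∑ (λ w → χu xs * χ (∉? w xs) * Φ xs w) + ∑ (λ (a : Fin k) → χu xs * Φ xs (lookup xs a))
      step xs = trans (cong (χu xs *_) (trans (S-swap (vec n i) (fin n) (λ ts w → F xs (w ∷ ts)))
          (trans (S-cong (fin n) (λ w → trans (sym (*-identityˡ (Φ xs w)))
                 (trans (cong (_* Φ xs w) (sym (trans (+-comm (χ (∉? w xs)) _) (χ-compl (w ∈? xs) (∉? w xs)))))
                        (*-distribʳ-+ (Φ xs w) (χ (∉? w xs)) (χ (w ∈? xs))))))
                 (S-+ (fin n) _ _))))
        (trans (*-distribˡ-+ (χu xs) _ _) (cong₂ _+_
          (trans (sym (S-* (fin n) (χu xs) _)) (S-cong (fin n) (λ w → sym (*-assoc (χu xs) (χ (∉? w xs)) (Φ xs w)))))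
          (trans (χ-gate (unique? xs) (λ u → ∑-∈ xs u (Φ xs))) (sym (S-* (fin k) (χu xs) _)))))
    fresh : ∑ᵛ (suc k) (λ zs → χu zs * ∑ᵛ i (λ ts → F (Data.Vec.tail zs) (Data.Vec.head zs ∷ ts))) ≡
            ∑ᵛ (suc k) (λ zs → χu zs * ∑ᵛ i (λ ts → F' (Data.Vec.tail zs) (Data.Vec.head zs ∷ ts)))
    fresh with suc k ≤? N
    ... | yes sk≤ = gen G H ag i (suc k) sk≤ (λ zs ts → F (Data.Vec.tail zs) (Data.Vec.head zs ∷ ts)) (λ zs ts → F' (Data.Vec.tail zs) (Data.Vec.head zs ∷ ts))
        (λ { (x ∷ xs) ts (y ∷ ys) us (_ ∷ u) (_ ∷ v) c → r xs (x ∷ ts) ys (y ∷ us) u v (λ p q → c (mv p) (mv q)) })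
        (λ { (x ∷ xs) ts g ug h → z xs (x ∷ ts) g ug (mvz h) }) (λ { (x ∷ xs) ts g ug h → z' xs (x ∷ ts) g ug (mvz h) })
      where
      mv : ∀ {x y} {xs : Tuple n k} {ys : Tuple m k} {ts us} {a b} →
           (Zip xs ys ∪ Zip (x ∷ ts) (y ∷ us)) a b → (Zip (x ∷ xs) (y ∷ ys) ∪ Zip {k = i} ts us) a b
      mv (inj₁ (j , e))     = inj₁ (suc j , e)
      mv (inj₂ (zero , e))  = inj₁ (zero , e)
      mv (inj₂ (suc j , e)) = inj₂ (j , e)
      mvz : ∀ {n K} {x} {xs : Tuple n k} {ts : Tuple n i} {g : Tuple n K} → (∀ {v} → v ∈ g → v ∈ (x ∷ xs) ⊎ v ∈ ts) →
            ∀ {v} → v ∈ g → v ∈ xs ⊎ v ∈ (x ∷ ts)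
      mvz h m with h m
      ... | inj₁ (here e)  = inj₂ (here e)
      ... | inj₁ (there p) = inj₁ p
      ... | inj₂ p         = inj₂ (there p)
    ... | no sk≰ with ≤-antisym k≤ (s≤s⁻¹ (≰⇒> sk≰))
    -- Here k = N, and one more distinct vertex makes N + 1, where the weight is zero.
    ...   | refl = trans (vanish F z) (sym (vanish F' z'))
      where
      vanish : ∀ {n} (F : Tuple n k → Tuple n (suc i) → ℕ) →
        (∀ xs ts (g : Tuple n (suc k)) → Unique g → (∀ {v} → v ∈ g → v ∈ xs ⊎ v ∈ ts) → F xs ts ≡ 0) →
        ∑ᵛ (suc k) (λ zs → χu zs * ∑ᵛ i (λ ts → F (Data.Vec.tail zs) (Data.Vec.head zs ∷ ts))) ≡ 0
      vanish {n} F z = S-zero (vec n (suc k)) {λ zs → χu zs * ∑ᵛ i (λ ts → F (Data.Vec.tail zs) (Data.Vec.head zs ∷ ts))} λ { (x ∷ xs) → trans (χ-gate (unique? (x ∷ xs)) (λ u →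
          S-zero (vec n i) (λ ts → z xs (x ∷ ts) (x ∷ xs) u (λ { (here e) → inj₂ (here e) ; (there p) → inj₁ p })))) (*-zeroʳ (χu (x ∷ xs))) }
    old : ∑ (λ (a : Fin k) → ∑ᵛ k (λ xs → χu xs * ∑ᵛ i (λ ts → F xs (lookup xs a ∷ ts)))) ≡
          ∑ (λ (a : Fin k) → ∑ᵛ k (λ xs → χu xs * ∑ᵛ i (λ ts → F' xs (lookup xs a ∷ ts))))
    old = S-cong (fin k) λ a → gen G H ag i k k≤ (λ xs ts → F xs (lookup xs a ∷ ts)) (λ xs ts → F' xs (lookup xs a ∷ ts))
        (λ xs ts ys us u v c → r xs _ ys _ u v (λ p q → c (mv a {xs} {ys} p) (mv a {xs} {ys} q)))
        (λ xs ts g ug h → z xs _ g ug (inj h)) (λ xs ts g ug h → z' xs _ g ug (inj h))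
      where
      mv : ∀ a {xs : Tuple n k} {ys : Tuple m k} {ts us} {x y} →
           (Zip xs ys ∪ Zip (lookup xs a ∷ ts) (lookup ys a ∷ us)) x y → (Zip xs ys ∪ Zip {k = i} ts us) x y
      mv a (inj₁ p) = inj₁ p
      mv a (inj₂ (zero , e)) = inj₁ (a , e)
      mv a (inj₂ (suc j , e)) = inj₂ (j , e)
      inj : ∀ {n K} {x} {xs : Tuple n k} {ts : Tuple n i} {g : Tuple n K} → (∀ {v} → v ∈ g → v ∈ xs ⊎ v ∈ ts) →
            ∀ {v} → v ∈ g → v ∈ xs ⊎ v ∈ (x ∷ ts)
      inj h m with h m
      ... | inj₁ p = inj₁ p
      ... | inj₂ p = inj₂ (there p)

Tup : ℕ → List ℕ → Set
Tup n []       = ⊤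
Tup n (k ∷ ks) = Tuple n k × Tup n ks

∑ᵗ : ∀ {n} ks → (Tup n ks → ℕ) → ℕ
∑ᵗ []       F = F tt
∑ᵗ (k ∷ ks) F = ∑ᵗ ks (λ t → ∑ᵛ k (λ v → F (v , t)))

infix 4 _∈ᵗ_
_∈ᵗ_ : ∀ {n ks} → Fin n → Tup n ks → Set
_∈ᵗ_ {ks = []}     x t       = ⊥
_∈ᵗ_ {ks = k ∷ ks} x (v , t) = x ∈ v ⊎ x ∈ᵗ t

Zipᵗ : ∀ {n m} ks → Tup n ks → Tup m ks → Fin n → Fin m → Set
Zipᵗ []       t       s       x y = ⊥
Zipᵗ (k ∷ ks) (v , t) (w , s) x y = Zip v w x y ⊎ Zipᵗ ks t s x y

splitAt-++ : ∀ {A : Set} k {m} (xs : Vec A k) (ys : Vec A m) → splitAt k (xs ++ ys) ≡ (xs , ys , refl)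
splitAt-++ zero [] ys = refl
splitAt-++ (suc k) (x ∷ xs) ys rewrite splitAt-++ k xs ys = refl

private
  unflat : ∀ {n} ks → Tuple n (sum ks) → Tup n ks
  unflat []       v = tt
  unflat (k ∷ ks) v = let (a , b , _) = splitAt k v in a , unflat ks b

  ∑ᵗ-flat : ∀ {n} ks (F : Tup n ks → ℕ) → ∑ᵗ ks F ≡ ∑ᵛ (sum ks) (F ∘ unflat ks)
  ∑ᵗ-flat []       F = refl
  ∑ᵗ-flat {n} (k ∷ ks) F = trans (∑ᵗ-flat ks _) (sym (trans (∑ᵛ-++ k (sum ks) _)
    (S-cong (vec n (sum ks)) (λ ys → S-cong (vec n k) (λ xs → cong (λ z → F (proj₁ z , unflat ks (proj₁ (proj₂ z)))) (splitAt-++ k xs ys))))))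

  ∈-unflat : ∀ {n} ks (v : Tuple n (sum ks)) {x} → x ∈ v → x ∈ᵗ unflat ks v
  ∈-unflat [] [] ()
  ∈-unflat (k ∷ ks) v m with splitAt k v
  ... | a , b , refl with ∈-++⁻ a m
  ... | inj₁ p = inj₁ p
  ... | inj₂ p = inj₂ (∈-unflat ks b p)

  zip-unflat : ∀ {n m} ks (v : Tuple n (sum ks)) (w : Tuple m (sum ks)) {x y} → Zipᵗ ks (unflat ks v) (unflat ks w) x y → Zip v w x y
  zip-unflat (k ∷ ks) v w p with splitAt k v | splitAt k w
  zip-unflat (k ∷ ks) .(a ++ b) .(c ++ d) (inj₁ (i , refl , refl)) | a , b , refl | c , d , refl =
    (i ↑ˡ sum ks) , lookup-++ˡ a b i , lookup-++ˡ c d i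
  zip-unflat (k ∷ ks) .(a ++ b) .(c ++ d) (inj₂ p) | a , b , refl | c , d , refl with zip-unflat ks b d p
  ... | i , refl , refl = (k ↑ʳ i) , lookup-++ʳ a b i , lookup-++ʳ c d i

transfer : ∀ {n m N : ℕ} (G : Graph n) (H : Graph m) → Agree (plain G) (plain H) N → ∀ ks →
  (F : Tup n ks → ℕ) (F' : Tup m ks → ℕ) →
  (∀ t s → Corr G H (Zipᵗ ks t s) → F t ≡ F' s) →
  (∀ t (g : Tuple n (suc N)) → Unique g → (∀ {v} → v ∈ g → v ∈ᵗ t) → F t ≡ 0) →
  (∀ t (g : Tuple m (suc N)) → Unique g → (∀ {v} → v ∈ g → v ∈ᵗ t) → F' t ≡ 0) →
  ∑ᵗ ks F ≡ ∑ᵗ ks F'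
transfer {n} {m} G H ag ks F F' r z z' = trans (∑ᵗ-flat ks F) (trans (trans (sym (drop-χ _)) (trans
  (gen G H ag (sum ks) 0 z≤n (λ _ v → F (unflat ks v)) (λ _ v → F' (unflat ks v))
    (λ { [] ts [] us _ _ c → r _ _ (λ p q → c (inj₂ (zip-unflat ks ts us p)) (inj₂ (zip-unflat ks ts us q))) })
    (λ { [] ts g u h → z _ g u (λ m → ∈-unflat ks ts (out (h m))) }) (λ { [] ts g u h → z' _ g u (λ m → ∈-unflat ks ts (out (h m))) }))
  (drop-χ _))) (sym (∑ᵗ-flat ks F')))
  where
  out : ∀ {n K} {x : Fin n} {v : Tuple n K} → x ∈ [] ⊎ x ∈ v → x ∈ v
  out (inj₂ p) = p
  drop-χ : ∀ {n} X → χu {n} [] * X ≡ X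
  drop-χ X = trans (cong (_* X) (χ-yes (unique? []) [])) (+-identityʳ X)

-- Connected tuples and degrees

opaque
  adj? : (G : Graph n) (u v : Fin n) → Dec (Adj G u v)
  adj? G u v = adj G u v ≟ᵇ true

deg : Graph n → Fin n → ℕ
deg G v = ∑ (λ x → χ (adj? G v x))

-- New vertices are put in front: the last entry is the starting vertex, and every nonempty suffix
-- is again connected.
data Grow (G : Graph n) : ∀ {k} → Tuple n k → Set where
  one : ∀ x → Grow G (x ∷ [])
  add : ∀ {k x} {xs : Tuple n k} → x ∉ xs → ∀ i → Adj G x (lookup xs i) → Grow G xs → Grow G (x ∷ xs)

grow-unique : {G : Graph n} {xs : Tuple n k} → Grow G xs → Unique xs
grow-unique (one x)          = ∉⇒All (λ ()) ∷ []
grow-unique (add x∉ i a g) = ∉⇒All x∉ ∷ grow-unique g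

grow-tail : {G : Graph n} {x : Fin n} {xs : Tuple n k} → Grow G (x ∷ xs) → 1 ≤ k → Grow G xs
grow-tail (add _ _ _ g) _ = g

grow-nonempty : {G : Graph n} {xs : Tuple n k} → Grow G xs → 1 ≤ k
grow-nonempty (one x)       = s≤s z≤n
grow-nonempty (add _ _ _ _) = s≤s z≤n

opaque
  grow? : (G : Graph n) (xs : Tuple n k) → Dec (Grow G xs)
  grow? G []           = no λ ()
  grow? G (x ∷ [])     = yes (one x)
  grow? G (x ∷ y ∷ xs) = map′ (λ { (a , (i , e) , g) → add a i e g }) (λ { (add a i e g) → a , (i , e) , g })
    (∉? x (y ∷ xs) ×-dec (Finₚ.any? (λ i → adj? G x (lookup (y ∷ xs) i)) ×-dec grow? G (y ∷ xs)))

same-tail : {G : LGraph n} {H : LGraph m} {x : Fin n} {y : Fin m} {xs : Tuple n k} {ys : Tuple m k} →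
            Same G (x ∷ xs) H (y ∷ ys) → Same G xs H ys
same-tail (a & l) = (λ i j → a (suc i) (suc j)) & (λ i → l (suc i))

grow-same : {G : LGraph n} {H : LGraph m} {xs : Tuple n k} {ys : Tuple m k} →
            Same G xs H ys → Unique ys → Grow (graph G) xs → Grow (graph H) ys
grow-same {ys = y ∷ []} s u (one x) = one y
grow-same {xs = x ∷ xs} {y ∷ ys} s (p ∷ u) (add x∉ i a g) =
  add (All⇒∉ p) i (trans (sym (same-adj s zero (suc i))) a) (grow-same (same-tail s) u g)

χg : Graph n → Tuple n k → ℕ
χg G xs = χ (grow? G xs)

-- Agreement for connected tuples only. This is all that is established for the tree of inner
-- vertices, and all that counting limbs requires.
GAgree : LGraph n → LGraph m → ℕ → Set
GAgree {n} {m} G H M = ∀ k → k ≤ M → (F : Tuple n k → ℕ) (F' : Tuple m k → ℕ) →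
  (∀ xs ys → Grow (graph G) xs → Grow (graph H) ys → Same G xs H ys → F xs ≡ F' ys) →
  ∑ᵛ k (λ xs → χg (graph G) xs * F xs) ≡ ∑ᵛ k (λ ys → χg (graph H) ys * F' ys)

agree-grow : ∀ {M} (G : LGraph n) (H : LGraph m) → Agree G H M → GAgree G H M
agree-grow {n} {m} G H ag k k≤ F F' r = trans (sym (intro G F)) (trans
  (ag k k≤ (λ xs → χg (graph G) xs * F xs) (λ ys → χg (graph H) ys * F' ys) same) (intro H F'))
  where
  intro : ∀ {n} (G : LGraph n) (F : Tuple n k → ℕ) →
          ∑ᵛ k (λ xs → χu xs * (χg (graph G) xs * F xs)) ≡ ∑ᵛ k (λ xs → χg (graph G) xs * F xs)
  intro {n} G F = S-cong (vec n k) step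
    where
    step : ∀ xs → χu xs * (χg (graph G) xs * F xs) ≡ χg (graph G) xs * F xs
    step xs with grow? (graph G) xs
    ... | yes g = trans (cong (_* (F xs + 0)) (χ-yes (unique? xs) (grow-unique g))) (+-identityʳ _)
    ... | no _ = *-zeroʳ (χu xs)
  same : ∀ xs ys → Unique xs → Unique ys → Same G xs H ys → χg (graph G) xs * F xs ≡ χg (graph H) ys * F' ys
  same xs ys u v s with grow? (graph G) xs | grow? (graph H) ys
  ... | yes g | yes h = cong (_+ 0) (r xs ys g h s)
  ... | yes g | no ¬h = ⊥-elim (¬h (grow-same s v g))
  ... | no ¬g | yes h = ⊥-elim (¬g (grow-same (same-flip s) u h))
  ... | no _ | no _ = refl

-- Falling factorial moments

sumTo : ℕ → (ℕ → ℕ) → ℕ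
sumTo zero    h = h 0
sumTo (suc r) h = h (suc r) + sumTo r h

sumTo-cong : ∀ r {f g : ℕ → ℕ} → (∀ i → i ≤ r → f i ≡ g i) → sumTo r f ≡ sumTo r g
sumTo-cong zero    h = h 0 z≤n
sumTo-cong (suc r) h = cong₂ _+_ (h _ ≤-refl) (sumTo-cong r (λ i i≤ → h i (m≤n⇒m≤1+n i≤)))

sumTo-zero : ∀ r {f : ℕ → ℕ} → (∀ i → i ≤ r → f i ≡ 0) → sumTo r f ≡ 0
sumTo-zero zero h = h 0 z≤n
sumTo-zero (suc r) h = cong₂ _+_ (h _ ≤-refl) (sumTo-zero r (λ i i≤ → h i (m≤n⇒m≤1+n i≤)))

sumTo-swap : ∀ {A : Set} (SA : Summ A) r (f : A → ℕ → ℕ) → S SA (λ a → sumTo r (f a)) ≡ sumTo r (λ i → S SA (λ a → f a i))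
sumTo-swap SA zero    f = refl
sumTo-swap SA (suc r) f = trans (S-+ SA _ _) (cong (S SA (λ a → f a (suc r)) +_) (sumTo-swap SA r f))

sumTo-pick : ∀ r (h : ℕ → ℕ) b → b ≤ r → sumTo r (λ j → χ (b ≟ j) * h j) ≡ h b
sumTo-pick zero h .0 z≤n = +-identityʳ _
sumTo-pick (suc r) h b b≤ with b ≟ suc r
... | yes refl = trans (cong₂ _+_ (+-identityʳ (h (suc r))) (sumTo-zero r (λ i i≤ → cong (_* h i) (χ-no (suc r ≟ i) (λ { refl → 1+n≰n i≤ }))))) (+-identityʳ _)
... | no ne = sumTo-pick r h b (s≤s⁻¹ (≤∧≢⇒< b≤ ne))

fall : ℕ → ℕ → ℕ
fall j zero    = 1
fall j (suc i) = fall j i * (j ∸ i)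

fall-0 : ∀ j i → j < i → fall j i ≡ 0
fall-0 j (suc i) (s≤s j≤i) = trans (cong (fall j i *_) (m≤n⇒m∸n≡0 j≤i)) (*-zeroʳ (fall j i))

fall-pos : ∀ j i → i ≤ j → fall j i ≢ 0
fall-pos j zero    le ()
fall-pos j (suc i) le e with m*n≡0⇒m≡0∨n≡0 (fall j i) e
... | inj₁ z = fall-pos j i (<⇒≤ le) z
... | inj₂ z = ≥1⇒≢0 (m<n⇒0<n∸m le) z

-- The system is triangular: `fall j R` vanishes for j < R, so the moment of order R determines
-- `A R`; subtract its share and descend.
moments : ∀ R (A A' : ℕ → ℕ) →
  (∀ i → i ≤ R → sumTo R (λ j → A j * fall j i) ≡ sumTo R (λ j → A' j * fall j i)) → ∀ j → j ≤ R → A j ≡ A' j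
moments zero A A' h .0 z≤n = *-cancelʳ-≡ _ _ 1 (h 0 z≤n)
moments (suc R) A A' h j j≤ = go (j ≟ suc R)
  where
  low : ∀ A → sumTo R (λ j → A j * fall j (suc R)) ≡ 0
  low A = sumTo-zero R (λ i i≤ → trans (cong (A i *_) (fall-0 i (suc R) (s≤s i≤))) (*-zeroʳ (A i)))
  top : A (suc R) ≡ A' (suc R)
  top = *-cancelʳ-≡ _ _ (fall (suc R) (suc R)) {{≢-nonZero (fall-pos (suc R) (suc R) ≤-refl)}}
    (+-cancelʳ-≡ 0 _ _ (subst₂ (λ u v → A (suc R) * fall (suc R) (suc R) + u ≡ A' (suc R) * fall (suc R) (suc R) + v) (low A) (low A') (h (suc R) ≤-refl)))
  go : Dec (j ≡ suc R) → A j ≡ A' j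
  go (yes refl) = top
  go (no ne) = moments R A A' (λ i i≤ → +-cancelˡ-≡ (A (suc R) * fall (suc R) i) _ _
    (trans (h i (m≤n⇒m≤1+n i≤)) (cong (λ z → z * fall (suc R) i + sumTo R (λ j → A' j * fall j i)) (sym top)))) j (s≤s⁻¹ (≤∧≢⇒< j≤ ne))

-- Boundary vertices and the transfer of degrees

module _ (G : Graph n) where

  Bd : Tuple n k → Fin n → Set
  Bd f z = z ∉ f × ∃ λ i → Adj G z (lookup f i)

  opaque
    bd? : (f : Tuple n k) (z : Fin n) → Dec (Bd f z)
    bd? f z = ∉? z f ×-dec Finₚ.any? (λ i → adj? G z (lookup f i))

  bnd : Tuple n k → ℕ
  bnd f = ∑ (λ z → χ (bd? f z))

  data BdSeq (f : Tuple n k) : ∀ {m} → Tuple n m → Set where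
    []  : BdSeq f []
    _∷_ : ∀ {m z} {zs : Tuple n m} → z ∉ zs × Bd f z → BdSeq f zs → BdSeq f (z ∷ zs)

  opaque
    bdseq? : (f : Tuple n k) (zs : Tuple n m) → Dec (BdSeq f zs)
    bdseq? f []       = yes []
    bdseq? f (z ∷ zs) = map′ (λ { (p , q) → p ∷ q }) (λ { (p ∷ q) → p , q }) ((∉? z zs ×-dec bd? f z) ×-dec bdseq? f zs)

  χb : Tuple n k → Tuple n m → ℕ
  χb f zs = χ (bdseq? f zs)

  bdseq-unique : {f : Tuple n k} {zs : Tuple n m} → BdSeq f zs → Unique zs
  bdseq-unique []             = []
  bdseq-unique ((p , _) ∷ q) = ∉⇒All p ∷ bdseq-unique q

  bdseq-Bd : {f : Tuple n k} {zs : Tuple n m} → BdSeq f zs → ∀ {z} → z ∈ zs → Bd f z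
  bdseq-Bd ((_ , b) ∷ q) (here refl) = b
  bdseq-Bd (_ ∷ q)       (there m)   = bdseq-Bd q m

  bd-fresh : (f : Tuple n k) (zs : Tuple n m) → BdSeq f zs →
             ∑ (λ z → χ (∉? z zs ×-dec bd? f z)) + m ≡ bnd f
  bd-fresh {m = m} f zs q = trans (cong (∑ (λ z → χ (∉? z zs ×-dec bd? f z)) +_) (sym (count-∈ zs (bdseq-unique q))))
    (trans (sym (S-+ (fin n) _ _)) (S-cong (fin n) step))
    where
    step : ∀ z → χ (∉? z zs ×-dec bd? f z) + χ (z ∈? zs) ≡ χ (bd? f z)
    step z with z ∈? zs
    ... | yes m = sym (χ-yes (bd? f z) (bdseq-Bd q m))
    ... | no ¬m = trans (+-identityʳ _) (χ-cong (yes ¬m ×-dec bd? f z) (bd? f z) proj₂ (¬m ,_))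

  bdseq-≤ : {f : Tuple n k} {zs : Tuple n m} → BdSeq f zs → m ≤ bnd f
  bdseq-≤ {f = f} {zs} q = subst (_ ≤_) (bd-fresh f zs q) (m≤n+m _ _)

  -- A boundary sequence of length m leaves exactly `bnd f ∸ m` choices for one more entry in front.
  extra : (f : Tuple n k) (m : ℕ) (W : Tuple n m → ℕ) →
    ∑ᵛ (suc m) (λ { (z ∷ zs) → χb f (z ∷ zs) * W zs }) ≡ ∑ᵛ m (λ zs → χb f zs * W zs) * (bnd f ∸ m)
  extra f m W = trans (S-cong (vec n m) step) (S-*ʳ (vec n m) _ (bnd f ∸ m))
    where
    step : ∀ zs → ∑ (λ z → χb f (z ∷ zs) * W zs) ≡ χb f zs * W zs * (bnd f ∸ m)
    step zs = trans (S-cong (fin n) (λ z → trans (cong (_* W zs) (trans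
        (χ-cong (bdseq? f (z ∷ zs)) ((∉? z zs ×-dec bd? f z) ×-dec bdseq? f zs) (λ { (p ∷ q) → p , q }) (λ { (p , q) → p ∷ q }))
        (χ-× (∉? z zs ×-dec bd? f z) (bdseq? f zs)))) (*-assoc (χ (∉? z zs ×-dec bd? f z)) (χb f zs) (W zs))))
      (trans (S-*ʳ (fin n) _ (χb f zs * W zs)) (trans (*-comm _ (χb f zs * W zs)) (inner (bdseq? f zs))))
      where
      inner : (d : Dec (BdSeq f zs)) → χ d * W zs * ∑ (λ z → χ (∉? z zs ×-dec bd? f z)) ≡ χ d * W zs * (bnd f ∸ m)
      inner (yes q) = cong ((W zs + 0) *_) (sym (trans (cong (_∸ m) (sym (bd-fresh f zs q))) (m+n∸n≡m _ m)))
      inner (no _)  = refl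

  grow-ext : {f : Tuple n k} {zs : Tuple n m} → BdSeq f zs → Grow G f → Grow G (zs ++ f)
  grow-ext []                               g = g
  grow-ext {f = f} {z ∷ zs} ((p , z∉f , i , a) ∷ q) g =
    add (λ m → case (∈-++⁻ zs m)) (_ ↑ʳ i) (trans (cong (adj G z) (lookup-++ʳ zs f i)) a) (grow-ext q g)
    where
    case : z ∈ zs ⊎ z ∈ f → ⊥
    case (inj₁ m) = p m
    case (inj₂ m) = z∉f m

  grow-drop : (zs : Tuple n m) {f : Tuple n (suc k)} → Grow G (zs ++ f) → Grow G f
  grow-drop []       g             = g
  grow-drop {m = suc m} {k} (z ∷ zs) g = grow-drop zs (grow-tail g (≤-trans (s≤s z≤n) (m≤n+m (suc k) m)))

  vdeg : Tuple n m → Fin n → ℕ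
  vdeg ys v = ∑ (λ i → χ (adj? G v (lookup ys i)))

  vdeg-∈ : (ys : Tuple n m) → Unique ys → ∀ v → vdeg ys v ≡ ∑ (λ x → χ (x ∈? ys) * χ (adj? G v x))
  vdeg-∈ ys u v = sym (∑-∈ ys u (λ x → χ (adj? G v x)))

  vdeg≤deg : (ys : Tuple n m) → Unique ys → ∀ v → vdeg ys v ≤ deg G v
  vdeg≤deg ys u v = ≤-trans (≡⇒≤ (vdeg-∈ ys u v)) (S-mono (fin n) (λ x →
    ≤-trans (*-monoˡ-≤ (χ (adj? G v x)) (χ≤1 (x ∈? ys))) (≡⇒≤ (+-identityʳ _))))

  vdeg≡deg : (ys : Tuple n m) → Unique ys → ∀ v → (∀ x → Adj G v x → x ∈ ys) → vdeg ys v ≡ deg G v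
  vdeg≡deg ys u v h = trans (vdeg-∈ ys u v) (S-cong (fin n) step)
    where
    step : ∀ x → χ (x ∈? ys) * χ (adj? G v x) ≡ χ (adj? G v x)
    step x with adj? G v x
    ... | yes a = trans (*-identityʳ _) (χ-yes (x ∈? ys) (h x a))
    ... | no _  = *-zeroʳ (χ (x ∈? ys))

module _ {n n' M : ℕ} (G : LGraph n) (H : LGraph n') (ag : GAgree G H M) (k s : ℕ)
  (Ψ : Tuple n (suc k) → Vec ℕ (suc k) → ℕ) (Ψ' : Tuple n' (suc k) → Vec ℕ (suc k) → ℕ)
  (resp : ∀ f f' → Grow (graph G) f → Grow (graph H) f' → Same G f H f' → ∀ d → Ψ f d ≡ Ψ' f' d)
  (supp : ∀ f d → Ψ f d ≢ 0 → ∀ i → s ≤ lookup d i) (supp' : ∀ f d → Ψ' f d ≢ 0 → ∀ i → s ≤ lookup d i)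
  (close : ∀ (f : Tuple n (suc k)) → Grow (graph G) f → (∀ i → s ≤ deg (graph G) (lookup f i)) → suc k + bnd (graph G) f ≤ M)
  (close' : ∀ (f : Tuple n' (suc k)) → Grow (graph H) f → (∀ i → s ≤ deg (graph H) (lookup f i)) → suc k + bnd (graph H) f ≤ M)
  where

  private
    module Side {n : ℕ} (G : Graph n) (Ψ : Tuple n (suc k) → Vec ℕ (suc k) → ℕ)
      (supp : ∀ f d → Ψ f d ≢ 0 → ∀ i → s ≤ lookup d i)
      (close : ∀ (f : Tuple n (suc k)) → Grow G f → (∀ i → s ≤ deg G (lookup f i)) → suc k + bnd G f ≤ M) where

      W : ∀ {m} → Tuple n (suc k) → Tuple n m → ℕ
      W f zs = Ψ f (map (vdeg G (zs ++ f)) f)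

      -- Boundary sequences supply the missing neighbours: if f has exactly m boundary vertices,
      -- then `zs ++ f` shows the true degrees of f, and `a m f` is m! times the wanted weight.
      a : ℕ → Tuple n (suc k) → ℕ
      a m f = ∑ᵛ m (λ zs → χb G f zs * W f zs)

      -- The i front entries are only counted. They multiply `a m f` by the falling factorial of
      -- order i of the number of boundary vertices beyond m.
      Wᵢ : ∀ i {m} → Tuple n (suc k) → Tuple n (i + m) → ℕ
      Wᵢ zero    f zs       = W f zs
      Wᵢ (suc i) f (z ∷ zs) = Wᵢ i f zs

      aᵢ : ∀ i m f → ∑ᵛ (i + m) (λ zs → χb G f zs * Wᵢ i f zs) ≡ a m f * fall (bnd G f ∸ m) i
      aᵢ zero    m f = sym (*-identityʳ _)
      aᵢ (suc i) m f = trans (S-cong (vec n (i + m)) (λ zs → S-cong (fin n) (λ z → refl)))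
        (trans (extra G f (i + m) (Wᵢ i f)) (trans (cong₂ _*_ (aᵢ i m f)
          (trans (cong (bnd G f ∸_) (+-comm i m)) (sym (∸-+-assoc (bnd G f) m i)))) (*-assoc (a m f) _ _)))

      U : ∀ i m → ℕ
      U i m = ∑ᵛ (suc k) (λ f → χg G f * ∑ᵛ (i + m) (λ zs → χb G f zs * Wᵢ i f zs))

      Uᶠ : ∀ i m → Tuple n (i + m + suc k) → ℕ
      Uᶠ i m v = let (zs , f , _) = splitAt (i + m) v in χb G f zs * Wᵢ i f zs

      U-flat : ∀ i m → U i m ≡ ∑ᵛ (i + m + suc k) (λ v → χg G v * Uᶠ i m v)
      U-flat i m = sym (trans (∑ᵛ-++ (i + m) (suc k) _) (S-cong (vec n (suc k)) (λ f →
          trans (S-cong (vec n (i + m)) (step f)) (S-* (vec n (i + m)) (χg G f) _))))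
        where
        step : ∀ f zs → χg G (zs ++ f) * Uᶠ i m (zs ++ f) ≡ χg G f * (χb G f zs * Wᵢ i f zs)
        step f zs rewrite splitAt-++ (i + m) zs f with bdseq? G f zs
        ... | yes q = cong (_* (Wᵢ i f zs + 0)) (χ-cong (grow? G (zs ++ f)) (grow? G f) (grow-drop G zs) (grow-ext G q))
        ... | no _  = trans (*-zeroʳ (χg G (zs ++ f))) (sym (*-zeroʳ (χg G f)))

      -- The contributions to `a m` sorted by the number j of boundary vertices beyond m; only j = 0
      -- is wanted.
      A : ℕ → ℕ → ℕ
      A m j = ∑ᵛ (suc k) (λ f → χ (bnd G f ∸ m ≟ j) * (χg G f * a m f))

      -- Visible degrees are at most the true ones, so a nonzero weight forces true degrees of at
      -- least s, and `close` applies.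
      a-supp : ∀ m f → χg G f * a m f ≢ 0 → suc k + bnd G f ≤ M
      a-supp m f h with grow? G f
      ... | no _ = ⊥-elim (h refl)
      ... | yes g with ∑ᵛ-pos m _ (λ e → h (trans (+-identityʳ _) e))
      ... | zs , p = close f g (λ i → ≤-trans (supp f _ (*≢0ʳ (χb G f zs) p) i)
          (≤-trans (≡⇒≤ (lookup-map i _ f)) (vdeg≤deg G (zs ++ f) (grow-unique (grow-ext G (χ≢0 (bdseq? G f zs) (*≢0ˡ _ p)) g)) _)))

      U-moment : ∀ i m R → suc k + m + R ≡ M → U i m ≡ sumTo R (λ j → A m j * fall j i)
      U-moment i m R e = trans (S-cong (vec n (suc k)) step) (trans (sumTo-swap (vec n (suc k)) R (λ f j → χ (bnd G f ∸ m ≟ j) * (χg G f * a m f) * fall j i))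
          (sumTo-cong R (λ j _ → S-*ʳ (vec n (suc k)) (λ f → χ (bnd G f ∸ m ≟ j) * (χg G f * a m f)) (fall j i))))
        where
        step : ∀ f → χg G f * ∑ᵛ (i + m) (λ zs → χb G f zs * Wᵢ i f zs) ≡
                     sumTo R (λ j → χ (bnd G f ∸ m ≟ j) * (χg G f * a m f) * fall j i)
        step f = trans (cong (χg G f *_) (aᵢ i m f)) (trans (sym (*-assoc (χg G f) (a m f) _)) (fin' (χg G f * a m f ≟ 0)))
          where
          b = bnd G f ∸ m
          fin' : Dec (χg G f * a m f ≡ 0) → χg G f * a m f * fall b i ≡ sumTo R (λ j → χ (b ≟ j) * (χg G f * a m f) * fall j i)
          fin' (yes z) = trans (cong (_* fall b i) z) (sym (sumTo-zero R (λ j _ → cong (_* fall j i) (trans (cong (χ (b ≟ j) *_) z) (*-zeroʳ (χ (b ≟ j)))))))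
          fin' (no nz) = trans (sym (sumTo-pick R (λ j → χg G f * a m f * fall j i) b b≤))
              (sumTo-cong R (λ j _ → sym (*-assoc (χ (b ≟ j)) _ _)))
            where
            b≤ : b ≤ R
            b≤ = m≤n+o⇒m∸n≤o (bnd G f) m (lia (bnd G f ∷ m ∷ R ∷ k ∷ M ∷ [])
              (λ b m R k M → con 1 :+ k :+ b :≤ M ∷ con 1 :+ k :+ m :+ R :≡ M ∷ [] ⊢ b :≤ m :+ R) (a-supp m f nz , e , tt))

      Z : ℕ → ℕ
      Z m = ∑ᵛ (suc k) (λ f → χ (bnd G f ≟ m) * (χg G f * Ψ f (map (deg G) f)))

      full : ∀ (f : Tuple n (suc k)) m (zs : Tuple n m) → Grow G f → bnd G f ≡ m → BdSeq G f zs → map (vdeg G (zs ++ f)) f ≡ map (deg G) f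
      full f m zs g e q = map-cong-∈ f (λ v v∈ → vdeg≡deg G (zs ++ f) (grow-unique (grow-ext G q g)) v (all-in v v∈))
        where
        map-cong-∈ : ∀ {k} (f : Tuple n k) {p q : Fin n → ℕ} → (∀ v → v ∈ f → p v ≡ q v) → map p f ≡ map q f
        map-cong-∈ []      h = refl
        map-cong-∈ (x ∷ f) h = cong₂ _∷_ (h x (here refl)) (map-cong-∈ f (λ v m → h v (there m)))
        none : ∑ (λ z → χ (∉? z zs ×-dec bd? G f z)) ≡ 0
        none = +-cancelʳ-≡ m _ 0 (trans (bd-fresh G f zs q) e)
        all-in : ∀ v → v ∈ f → ∀ x → Adj G v x → x ∈ (zs ++ f)
        all-in v v∈ x ad with x ∈? f | x ∈? zs
        ... | yes m | _ = ∈-++⁺ʳ zs m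
        ... | no _ | yes m = ∈-++⁺ˡ m
        ... | no ¬f | no ¬z = ⊥-elim (1+n≰n (≤-trans (≡⇒≤ (sym (χ-yes (∉? x zs ×-dec bd? G f x)
              (¬z , ¬f , proj₁ (∈⇒lookup v∈) , trans (adj-sym G x _) (trans (cong (λ z → adj G z x) (proj₂ (∈⇒lookup v∈))) ad)))))
              (≤-trans (S-≥ (fin n) x (λ z → χ (∉? z zs ×-dec bd? G f z))) (≡⇒≤ none))))

      -- A boundary with fewer than m vertices also has `bnd f ∸ m` = 0, but then no sequence of
      -- length m exists. In the remaining case every sequence is an ordering of the whole boundary.
      A-Z : ∀ m → A m 0 ≡ Z m * fall m m
      A-Z m = trans (S-cong (vec n (suc k)) step) (S-*ʳ (vec n (suc k)) (λ f → χ (bnd G f ≟ m) * (χg G f * Ψ f (map (deg G) f))) (fall m m))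
        where
        step : ∀ f → χ (bnd G f ∸ m ≟ 0) * (χg G f * a m f) ≡ χ (bnd G f ≟ m) * (χg G f * Ψ f (map (deg G) f)) * fall m m
        step f with grow? G f
        ... | no _ = trans (*-zeroʳ (χ (bnd G f ∸ m ≟ 0))) (sym (trans (cong (_* fall m m) (*-zeroʳ (χ (bnd G f ≟ m)))) refl))
        ... | yes g with bnd G f ≟ m
        ...   | yes refl = trans (cong (_* (a m f + 0)) (χ-yes (m ∸ m ≟ 0) (n∸n≡0 m)))
            (trans (+-identityʳ (a m f + 0)) (trans (+-identityʳ (a m f)) (trans val (cong (_* fall m m) (sym (trans (+-identityʳ (P + 0)) (+-identityʳ P)))))))
          where
          P = Ψ f (map (deg G) f)
          seqs : ∀ i → ∑ᵛ i (λ zs → χb G f zs * 1) ≡ fall (bnd G f) i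
          seqs zero = trans (*-identityʳ _) (χ-yes (bdseq? G f []) [])
          seqs (suc i) = trans (extra G f i (λ _ → 1)) (cong (_* (bnd G f ∸ i)) (seqs i))
          val : a m f ≡ P * fall m m
          val = trans (S-cong (vec n m) (λ zs → trans (χ-gate (bdseq? G f zs) (λ q → cong (Ψ f) (full f m zs g refl q)))
                  (trans (cong (χb G f zs *_) (sym (*-identityʳ P))) (trans (sym (*-assoc (χb G f zs) P 1)) (trans (cong (_* 1) (*-comm (χb G f zs) P)) (*-assoc P (χb G f zs) 1))))))
                (trans (S-* (vec n m) P _) (cong (P *_) (seqs m)))
        ...   | no ne = cong-0 (m ≤? bnd G f)
          where
          cong-0 : Dec (m ≤ bnd G f) → χ (bnd G f ∸ m ≟ 0) * (1 * a m f) ≡ 0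
          cong-0 (yes le) = cong (_* (1 * a m f)) (χ-no (bnd G f ∸ m ≟ 0) (λ e → ne (≤-antisym (m∸n≡0⇒m≤n e) le)))
          cong-0 (no nle) = trans (cong (λ z → χ (bnd G f ∸ m ≟ 0) * (1 * z)) (S-zero (vec n m)
              (λ zs → cong (_* W f zs) (χ-no (bdseq? G f zs) (λ q → nle (bdseq-≤ G q)))))) (*-zeroʳ (χ (bnd G f ∸ m ≟ 0)))

      total : ∀ R → suc k + R ≡ M → ∑ᵛ (suc k) (λ f → χg G f * Ψ f (map (deg G) f)) ≡ sumTo R Z
      total R e = trans (S-cong (vec n (suc k)) step) (sumTo-swap (vec n (suc k)) R (λ f m → χ (bnd G f ≟ m) * (χg G f * Ψ f (map (deg G) f))))
        where
        step : ∀ f → χg G f * Ψ f (map (deg G) f) ≡ sumTo R (λ m → χ (bnd G f ≟ m) * (χg G f * Ψ f (map (deg G) f)))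
        step f with χg G f * Ψ f (map (deg G) f) ≟ 0
        ... | yes z = trans z (sym (sumTo-zero R (λ m _ → trans (cong (χ (bnd G f ≟ m) *_) z) (*-zeroʳ (χ (bnd G f ≟ m))))))
        ... | no nz = sym (sumTo-pick R (λ _ → χg G f * Ψ f (map (deg G) f)) (bnd G f)
              (+-cancelˡ-≤ (suc k) _ _ (≤-trans (close f (χ≢0 (grow? G f) (*≢0ˡ _ nz))
                (λ i → subst (s ≤_) (lookup-map i (deg G) f) (supp f _ (*≢0ʳ (χg G f) nz) i))) (≡⇒≤ (sym e)))))

    module L = Side (graph G) Ψ supp close
    module R = Side (graph H) Ψ' supp' close'

    U≡ : ∀ i m → i + m + suc k ≤ M → L.U i m ≡ R.U i m
    U≡ i m le = trans (L.U-flat i m) (trans (ag _ le (L.Uᶠ i m) (R.Uᶠ i m) same) (sym (R.U-flat i m)))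
      where
      same : ∀ xs ys → Grow (graph G) xs → Grow (graph H) ys → Same G xs H ys → L.Uᶠ i m xs ≡ R.Uᶠ i m ys
      same xs ys g h s with splitAt (i + m) xs | splitAt (i + m) ys
      ... | zs , f , refl | ws , f' , refl =
          cong₂ _*_ (χ-cong (bdseq? (graph G) f zs) (bdseq? (graph H) f' ws) (to zs ws (grow-unique h) same-adj′) (to ws zs (grow-unique g) (λ i j → sym (same-adj′ i j)) ))
            (wsame i zs ws s)
        where
        same-adj′ = same-adj s
        inner : Same G f H f'
        inner = (λ a b → subst₂ _≡_ (cong₂ (adj (graph G)) (lookup-++ʳ zs f a) (lookup-++ʳ zs f b))
                   (cong₂ (adj (graph H)) (lookup-++ʳ ws f' a) (lookup-++ʳ ws f' b)) (same-adj s (_ ↑ʳ a) (_ ↑ʳ b)))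
              & (λ a → subst₂ _≡_ (cong (lab G) (lookup-++ʳ zs f a)) (cong (lab H) (lookup-++ʳ ws f' a)) (same-lab s (_ ↑ʳ a)))
        to : ∀ {n n' j} {G : Graph n} {H : Graph n'} {f : Tuple n (suc k)} {f' : Tuple n' (suc k)}
             (zs : Tuple n j) (ws : Tuple n' j) → Unique (ws ++ f') →
             (∀ a b → adj G (lookup (zs ++ f) a) (lookup (zs ++ f) b) ≡ adj H (lookup (ws ++ f') a) (lookup (ws ++ f') b)) →
             BdSeq G f zs → BdSeq H f' ws
        to [] [] u s [] = []
        to {G = G} {H} {f} {f'} (z ∷ zs) (w ∷ ws) (p ∷ u) s ((_ , _ , i , a) ∷ q) =
          ((λ m → All⇒∉ p (∈-++⁺ˡ m)) , (λ m → All⇒∉ p (∈-++⁺ʳ ws m)) , i ,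
            trans (sym (subst₂ _≡_ (cong (adj G z) (lookup-++ʳ zs f i)) (cong (adj H w) (lookup-++ʳ ws f' i)) (s zero (suc (_ ↑ʳ i))))) a)
          ∷ to zs ws u (λ a b → s (suc a) (suc b)) q
        base : ∀ {m} (zs : Tuple n m) (ws : Tuple n' m) → Same G (zs ++ f) H (ws ++ f') → L.W f zs ≡ R.W f' ws
        base zs ws s = trans (resp f f' (grow-drop (graph G) _ g) (grow-drop (graph H) _ h) inner _)
            (cong (Ψ' f') (vec-map f f' (λ j → S-cong (fin _) (λ i → χ-cong (adj? (graph G) _ _) (adj? (graph H) _ _)
              (λ e → trans (sym (eq i j)) e) (λ e → trans (eq i j) e)))))
          where
          vec-map : ∀ {n n' k} (f : Tuple n k) (f' : Tuple n' k) {p : Fin n → ℕ} {q : Fin n' → ℕ} →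
                    (∀ j → p (lookup f j) ≡ q (lookup f' j)) → map p f ≡ map q f'
          vec-map [] [] h = refl
          vec-map (x ∷ f) (y ∷ f') h = cong₂ _∷_ (h zero) (vec-map f f' (λ j → h (suc j)))
          eq : ∀ i j → adj (graph G) (lookup f j) (lookup (zs ++ f) i) ≡ adj (graph H) (lookup f' j) (lookup (ws ++ f') i)
          eq i j = subst₂ _≡_ (cong (λ z → adj (graph G) z _) (lookup-++ʳ zs f j)) (cong (λ z → adj (graph H) z _) (lookup-++ʳ ws f' j)) (same-adj s (_ ↑ʳ j) i)
        wsame : ∀ i {m} (zs : Tuple n (i + m)) (ws : Tuple n' (i + m)) → Same G (zs ++ f) H (ws ++ f') → L.Wᵢ i f zs ≡ R.Wᵢ i f' ws
        wsame zero    zs       ws       s = base zs ws s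
        wsame (suc i) (z ∷ zs) (w ∷ ws) s = wsame i zs ws (same-tail s)

    -- For fixed m the sums `U i m` run over tuples that fit into M vertices as long as i ≤ D. They
    -- are the moments of `A m`, hence determine its value at 0.
    Z≡ : ∀ m → suc k + m ≤ M → L.Z m ≡ R.Z m
    Z≡ m le = *-cancelʳ-≡ _ _ (fall m m) {{≢-nonZero (fall-pos m m ≤-refl)}} (trans (sym (L.A-Z m)) (trans
      (moments D (L.A m) (R.A m) (λ i i≤ → trans (sym (L.U-moment i m D eD)) (trans (U≡ i m
        (lia (i ∷ m ∷ k ∷ D ∷ M ∷ []) (λ i m k D M → con 1 :+ k :+ m :+ D :≡ M ∷ i :≤ D ∷ [] ⊢ i :+ m :+ (con 1 :+ k) :≤ M) (eD , i≤ , tt)))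
        (R.U-moment i m D eD))) 0 z≤n) (R.A-Z m)))
      where
      D = M ∸ (suc k + m)
      eD : suc k + m + D ≡ M
      eD = m+[n∸m]≡n le

  -- Sum over the possible boundary sizes; by `close` none exceeds M - (k + 1).
  deg-transfer : suc k ≤ M → ∑ᵛ (suc k) (λ f → χg (graph G) f * Ψ f (map (deg (graph G)) f)) ≡
                             ∑ᵛ (suc k) (λ f → χg (graph H) f * Ψ' f (map (deg (graph H)) f))
  deg-transfer le = trans (L.total D eD) (trans (sumTo-cong D (λ m m≤ → Z≡ m
      (≤-trans (+-monoʳ-≤ (suc k) m≤) (≡⇒≤ eD)))) (sym (R.total D eD)))
    where
    D = M ∸ suc k
    eD : suc k + D ≡ M
    eD = m+[n∸m]≡n le

-- Rooted trees

irrefl-adj : (G : Graph n) {u v : Fin n} → Adj G u v → u ≢ v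
irrefl-adj G {u} a refl with trans (sym a) (irrefl G u)
... | ()

flip-adj : (G : Graph n) {u v : Fin n} → Adj G u v → Adj G v u
flip-adj G {u} {v} a = trans (adj-sym G v u) a

base : Bool → ℕ
base e = if e then 1 else 0

-- A rooted structure.  With e = false the root is a vertex of depth 0 that is its own parent;
-- with e = true it is an edge, whose ends have depth 1 and are each other's parents.
record Rooted (G : Graph n) (e : Bool) : Set where
  field
    par     : Fin n → Fin n
    dep     : Fin n → ℕ
    dep≥    : ∀ v → base e ≤ dep v
    up      : ∀ v → base e < dep v → dep v ≡ suc (dep (par v))
    top-dep : ∀ v → dep v ≡ base e → dep (par v) ≡ base e
    top-par : ∀ v → dep v ≡ base e → par (par v) ≡ v
    tops    : ∀ u v → dep u ≡ base e → dep v ≡ base e → u ≡ v ⊎ u ≡ par v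
    kind    : ∀ v → dep v ≡ base e → if e then par v ≢ v else par v ≡ v
    adj→    : ∀ {u v} → Adj G u v → u ≡ par v ⊎ v ≡ par u
    adj←    : ∀ {u} → par u ≢ u → Adj G u (par u)

module Root {n : ℕ} {G : Graph n} {e : Bool} (R : Rooted G e) where
  open Rooted R public

  infix 4 _≼_
  -- The guard stops the ascent at the top, so it neither loops at a root vertex nor crosses a
  -- central edge.
  data _≼_ (y : Fin n) : Fin n → Set where
    ≼-refl : y ≼ y
    ≼-step : ∀ {x} → base e < dep x → y ≼ par x → y ≼ x

  low : ∀ {v} → dep v ≢ base e → base e < dep v
  low {v} ne = ≤∧≢⇒< (dep≥ v) (ne ∘ sym)

  up-par : ∀ {v} → base e < dep v → par v ≢ v
  up-par {v} lt q = 1+n≢n (trans (sym (up v lt)) (cong dep (sym q)))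

  ≼-dep : ∀ {y x} → y ≼ x → dep y ≤ dep x
  ≼-dep ≼-refl = ≤-refl
  ≼-dep {y} {x} (≼-step lt p) = ≤-trans (≼-dep p) (≤-trans (n≤1+n _) (≡⇒≤ (sym (up x lt))))

  ≼-dep-eq : ∀ {y x} → y ≼ x → dep x ≤ dep y → y ≡ x
  ≼-dep-eq ≼-refl _ = refl
  ≼-dep-eq {y} {x} (≼-step lt p) le = ⊥-elim (1+n≰n (≤-trans (≤-trans (≡⇒≤ (sym (up x lt))) le) (≼-dep p)))

  ≼-trans : ∀ {x y z} → x ≼ y → y ≼ z → x ≼ z
  ≼-trans p ≼-refl         = p
  ≼-trans p (≼-step lt q) = ≼-step lt (≼-trans p q)

  ≼-linear : ∀ {y y' x} → y ≼ x → y' ≼ x → dep y ≡ dep y' → y ≡ y'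
  ≼-linear ≼-refl q eq = sym (≼-dep-eq q (≡⇒≤ eq))
  ≼-linear p ≼-refl eq = ≼-dep-eq p (≡⇒≤ (sym eq))
  ≼-linear (≼-step _ p) (≼-step _ q) eq = ≼-linear p q eq

  ≼-up : ∀ {y x} → y ≼ x → x ≢ y → base e < dep x × y ≼ par x
  ≼-up ≼-refl ne = ⊥-elim (ne refl)
  ≼-up (≼-step lt p) _ = lt , p

  private
    dec : ∀ d y x → dep x ≤ d → Dec (y ≼ x)
    dec d y x le with x ≟ᶠ y
    ... | yes refl = yes ≼-refl
    ... | no ne with base e <? dep x
    ...   | no ¬lt = no (λ p → ¬lt (proj₁ (≼-up p ne)))
    dec zero y x le | no ne | yes lt = ⊥-elim (1+n≰n (≤-trans (≤-trans (s≤s z≤n) lt) le))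
    dec (suc d) y x le | no ne | yes lt =
      map′ (≼-step lt) (λ p → proj₂ (≼-up p ne)) (dec d y (par x) (s≤s⁻¹ (≤-trans (≡⇒≤ (sym (up x lt))) le)))

  opaque
    _≼?_ : ∀ y x → Dec (y ≼ x)
    y ≼? x = dec (dep x) y x ≤-refl

  size : Fin n → ℕ
  size y = ∑ (λ x → χ (y ≼? x))

  -- Every edge joins a vertex to its parent, so a subtree can be left only upwards from y. An edge
  -- between two vertices of minimal depth is the central edge, where `top-par` identifies the ends.
  ≼-adj : ∀ {y u v} → y ≼ u → Adj G u v → y ≼ v ⊎ (u ≡ y × v ≡ par y)
  ≼-adj {y} {u} {v} p a with adj→ a
  ... | inj₂ refl with u ≟ᶠ y
  ...   | yes refl = inj₂ (refl , refl)
  ...   | no ne = inj₁ (proj₂ (≼-up p ne))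
  ≼-adj {y} {u} {v} p a | inj₁ refl with base e <? dep v
  ...   | yes lt = inj₁ (≼-step lt p)
  ...   | no ¬lt with par v ≟ᶠ y
  ...     | yes refl = inj₂ (refl , sym (top-par v (≤-antisym (≮⇒≥ ¬lt) (dep≥ v))))
  ...     | no ne = ⊥-elim (<-irrefl (sym (top-dep v (≤-antisym (≮⇒≥ ¬lt) (dep≥ v)))) (proj₁ (≼-up p ne)))

  par-not-below : ∀ {y} → par y ≢ y → ¬ (y ≼ par y)
  par-not-below {y} ne p with base e <? dep y
  ... | yes lt = 1+n≰n (≤-trans (≡⇒≤ (sym (up y lt))) (≼-dep p))
  ... | no ¬lt = ne (sym (≼-dep-eq p (≡⇒≤ (trans (top-dep y d) (sym d)))))
    where d = ≤-antisym (≮⇒≥ ¬lt) (dep≥ y)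

  ancestor : ∀ x d → base e ≤ d → d ≤ dep x → ∃ λ y → y ≼ x × dep y ≡ d
  ancestor x d b≤ le = go (dep x) x refl le
    where
    go : ∀ h x → dep x ≡ h → d ≤ dep x → ∃ λ y → y ≼ x × dep y ≡ d
    go h x eq le with d ≟ dep x
    ... | yes q = x , ≼-refl , sym q
    go zero x eq le | no ne = ⊥-elim (ne (trans (n≤0⇒n≡0 (≤-trans le (≡⇒≤ eq))) (sym eq)))
    go (suc h) x eq le | no ne =
      let lt = ≤-<-trans b≤ (≤∧≢⇒< le ne)
          (y , p , q) = go h (par x) (suc-injective (trans (sym (up x lt)) eq)) (s≤s⁻¹ (≤-trans (≤∧≢⇒< le ne) (≡⇒≤ (up x lt))))
      in y , ≼-step lt p , q

-- Closures, paths and cycles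

module _ (G : Graph n) {Q : Fin n → Set} (Q? : ∀ x → Dec (Q x)) where

  Closed : Tuple n k → Set
  Closed xs = ∀ x → Q x → (∃ λ i → Adj G x (lookup xs i)) → x ∈ xs

  module _ (xs : Tuple n k) where
    Saturation : Set
    Saturation = ∃ λ m → Σ (Tuple n m) λ zs → Grow G (zs ++ xs) × (∀ {x} → x ∈ zs → Q x) × Closed (zs ++ xs)

    private
      go : ∀ d {m} (zs : Tuple n m) → m + k + d ≡ n → Grow G (zs ++ xs) → (∀ {x} → x ∈ zs → Q x) → Saturation
      go d {m} zs e g qs with Finₚ.any? (λ x → (Q? x ×-dec ∉? x (zs ++ xs)) ×-dec Finₚ.any? (λ i → adj? G x (lookup (zs ++ xs) i)))
      ... | no none = m , zs , g , qs , closed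
        where
        closed : Closed (zs ++ xs)
        closed x q a with x ∈? (zs ++ xs)
        ... | yes p = p
        ... | no ¬p = ⊥-elim (none (x , (q , ¬p) , a))
      go zero {m} zs e g qs | yes (x , (q , x∉) , i , a) =
        ⊥-elim (1+n≰n (subst (suc (m + k) ≤_) (trans (sym e) (+-identityʳ (m + k)))
          (unique-≤ (x ∷ (zs ++ xs)) (∉⇒All x∉ ∷ grow-unique g))))
      go (suc d) {m} zs e g qs | yes (x , (q , x∉) , i , a) =
        go d (x ∷ zs) (trans (sym (+-suc (m + k) d)) e) (add x∉ i a g) (λ { (here refl) → q ; (there p) → qs p })

    saturate : Grow G xs → Saturation
    saturate g = go (n ∸ k) [] (m+[n∸m]≡n (unique-≤ xs (grow-unique g))) g (λ ())

data SPath (G : Graph n) : ∀ {k} → Fin n → Fin n → Tuple n k → Set where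
  end  : ∀ x → SPath G x x (x ∷ [])
  link : ∀ {k x y z} {ps : Tuple n k} → Adj G x y → x ∉ ps → SPath G y z ps → SPath G x z (x ∷ ps)

∷ʳ-∉ : ∀ {n k} {x z : Fin n} (ps : Tuple n k) → z ≢ x → x ∈ (ps Data.Vec.∷ʳ z) → x ∈ ps
∷ʳ-∉ []       ne (here e)  = ⊥-elim (ne (sym e))
∷ʳ-∉ (p ∷ ps) ne (here e)  = here e
∷ʳ-∉ (p ∷ ps) ne (there m) = there (∷ʳ-∉ ps ne m)

spath-snoc : {G : Graph n} {x y z : Fin n} {ps : Tuple n k} → SPath G x y ps → Adj G y z → z ∉ ps →
             SPath G x z (ps Data.Vec.∷ʳ z)
spath-snoc {z = z} (end x) a z∉ = link a (λ { (here e) → z∉ (here (sym e)) }) (end z)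
spath-snoc {G = G} {z = z} (link {x = x} {ps = ps} b x∉ p) a z∉ =
  link b (x∉ ∘ ∷ʳ-∉ ps (λ e → z∉ (here e))) (spath-snoc p a (z∉ ∘ there))

∈-snoc : ∀ {n k} (ps : Tuple n k) {x z : Fin n} → x ∈ (ps Data.Vec.∷ʳ z) → x ∈ ps ⊎ x ≡ z
∈-snoc []       (here e)  = inj₂ e
∈-snoc (p ∷ ps) (here e)  = inj₁ (here e)
∈-snoc (p ∷ ps) (there m) with ∈-snoc ps m
... | inj₁ q = inj₁ (there q)
... | inj₂ q = inj₂ q

spath-in : {G : Graph n} {xs : Tuple n k} → Grow G xs → ∀ {a b} → a ∈ xs → b ∈ xs →
           ∃ λ m → Σ (Tuple n m) λ ps → SPath G a b ps × (∀ {x} → x ∈ ps → x ∈ xs)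
spath-in (one x) (here refl) (here refl) = 1 , x ∷ [] , end x , λ { (here e) → here e }
spath-in (add x∉ i ad g) (here refl) (here refl) = 1 , _ ∷ [] , end _ , λ { (here e) → here e }
spath-in (add {x = x} {xs} x∉ i ad g) (here refl) (there b∈) =
  let (m , ps , p , sub) = spath-in g (∈-lookup i xs) b∈
  in suc m , x ∷ ps , link ad (x∉ ∘ sub) p , λ { (here e) → here e ; (there m) → there (sub m) }
spath-in {n} {G = G} (add {x = x} {xs} x∉ i ad g) (there a∈) (here refl) =
  let (m , ps , p , sub) = spath-in g a∈ (∈-lookup i xs)
  in suc m , _ , spath-snoc p (flip-adj G ad) (x∉ ∘ sub) , λ q → case (∈-snoc ps q) sub
  where
  case : ∀ {y : Fin n} {k} {ps : Tuple n k} → y ∈ ps ⊎ y ≡ x → (∀ {z} → z ∈ ps → z ∈ xs) → y ∈ (x ∷ xs)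
  case (inj₁ p) sub = there (sub p)
  case (inj₂ refl) _ = here refl
spath-in (add x∉ i ad g) (there a∈) (there b∈) =
  let (m , ps , p , sub) = spath-in g a∈ b∈ in m , ps , p , there ∘ sub

data Chain (G : Graph n) : ∀ {k} → Tuple n k → Set where
  one : ∀ x → Chain G (x ∷ [])
  _∷_ : ∀ {k x y} {xs : Tuple n k} → Adj G x y → Chain G (y ∷ xs) → Chain G (x ∷ y ∷ xs)

opaque
  chain? : (G : Graph n) (xs : Tuple n k) → Dec (Chain G xs)
  chain? G []           = no λ ()
  chain? G (x ∷ [])     = yes (one x)
  chain? G (x ∷ y ∷ xs) = map′ (λ (a , c) → a ∷ c) (λ { (a ∷ c) → a , c }) (adj? G x y ×-dec chain? G (y ∷ xs))

record Cycle (G : Graph n) {k} (xs : Tuple n (suc k)) : Set where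
  constructor cycle
  field
    chain  : Chain G xs
    unique : Unique xs
    closes : Adj G (last xs) (head xs)

spath-chain : {G : Graph n} {x y : Fin n} {ps : Tuple n (suc k)} → SPath G x y ps →
              Chain G ps × Unique ps × head ps ≡ x × last ps ≡ y
spath-chain (end x) = one x , ∉⇒All (λ ()) ∷ [] , refl , refl
spath-chain {k = zero} (link a x∉ ())
spath-chain {k = suc k} (link {ps = y ∷ ps} a x∉ p) with spath-chain p
... | c , u , refl , l = a ∷ c , ∉⇒All x∉ ∷ u , refl , l

chain-lookup : {G : Graph n} {xs : Tuple n (suc k)} → Chain G xs → ∀ i → Adj G (lookup xs (Data.Fin.inject₁ i)) (lookup xs (suc i))
chain-lookup (one x) ()
chain-lookup (a ∷ c) zero    = a
chain-lookup (a ∷ c) (suc i) = chain-lookup c i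

module _ where
  import Data.List.Relation.Unary.AllPairs as LA
  import Data.List.Relation.Unary.All as LL
  import Data.List.Relation.Unary.Unique.Propositional as LU
  open import Data.Vec.Relation.Unary.All using ([]; _∷_) renaming (All to VAll)

  all-list : ∀ {A : Set} {k} {x : A} {xs : Vec A k} → VAll (x ≢_) xs → LL.All (x ≢_) (Data.Vec.toList xs)
  all-list []       = LL.[]
  all-list (p ∷ ps) = p LL.∷ all-list ps

  unique-list : ∀ {A : Set} {k} {xs : Vec A k} → Unique xs → LU.Unique (Data.Vec.toList xs)
  unique-list []      = LA.[]
  unique-list (p ∷ u) = all-list p LA.∷ unique-list u

last-lookup : ∀ {A : Set} {k} (xs : Vec A (suc k)) → last xs ≡ lookup xs (Data.Fin.fromℕ k)
last-lookup (x ∷ [])     = refl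
last-lookup (x ∷ y ∷ xs) = last-lookup (y ∷ xs)

last-∷ : ∀ {A : Set} {k} (x : A) (xs : Vec A (suc k)) → last (x ∷ xs) ≡ last xs
last-∷ x (y ∷ xs) = refl

cycle→HasCycle : {G : Graph n} {xs : Tuple n (3 + k)} → Cycle G xs → HasCycle G
cycle→HasCycle {k = k} {G} {x ∷ xs} (cycle c u l) =
  k , x ∷ xs , unique-list u , chain-lookup c , subst (λ z → Adj G z x) (last-lookup (x ∷ xs)) l

-- A path between the two neighbours inside the connected tuple closes up through x; as they differ,
-- it has at least two vertices and the cycle at least three.
two-nbrs-cycle : {G : Graph n} {xs : Tuple n k} → Grow G xs → ∀ {x} → x ∉ xs → ∀ {a b} → a ∈ xs → b ∈ xs → a ≢ b →
  Adj G x a → Adj G x b → ∃ λ m → Σ (Tuple n (3 + m)) (Cycle G)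
two-nbrs-cycle {n} {G = G} g {x} x∉ a∈ b∈ a≢b xa xb with spath-in g a∈ b∈
... | zero , [] , () , _
... | suc zero , (p ∷ []) , end _ , _ = ⊥-elim (a≢b refl)
... | suc zero , (p ∷ []) , link _ _ () , _
... | suc (suc m) , ps , p , sub with spath-chain p
... | c , u , hd , ls = m , x ∷ ps , cycle (cons ps hd xa c) (∉⇒All (x∉ ∘ sub) ∷ u)
        (subst (λ z → Adj G z x) (sym (trans (last-∷ x ps) ls)) (flip-adj G xb))
  where
  cons : ∀ {k y} (ps : Tuple n (suc k)) → head ps ≡ y → Adj G x y → Chain G ps → Chain G (x ∷ ps)
  cons (y ∷ ps) refl a c = a ∷ c

-- Each new vertex has exactly one neighbour among the older ones, so the tuple induces a tree,
-- rooted at its last entry.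
data Tight (G : Graph n) : ∀ {k} → Tuple n k → Set where
  one : ∀ x → Tight G (x ∷ [])
  add : ∀ {k x} {xs : Tuple n k} → x ∉ xs → ∀ i → Adj G x (lookup xs i) →
        (∀ {a} → a ∈ xs → Adj G x a → a ≡ lookup xs i) → Tight G xs → Tight G (x ∷ xs)

tight? : (G : Graph n) {xs : Tuple n k} → Grow G xs →
         Tight G xs ⊎ (∃ λ m → Σ (Tuple n (3 + m)) (Cycle G))
tight? G (one x) = inj₁ (one x)
tight? G (add {x = x} {xs} x∉ i a g) with tight? G g
... | inj₂ c = inj₂ c
... | inj₁ t with Finₚ.any? (λ j → adj? G x (lookup xs j) ×-dec ¬? (lookup xs j ≟ᶠ lookup xs i))
...   | yes (j , b , ne) = inj₂ (two-nbrs-cycle g x∉ (∈-lookup j xs) (∈-lookup i xs) ne b a)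
...   | no none = inj₁ (add x∉ i a uniq t)
  where
  uniq : ∀ {b} → b ∈ xs → Adj G x b → b ≡ lookup xs i
  uniq {b} b∈ xb with b ≟ᶠ lookup xs i
  ... | yes q = q
  ... | no ne with ∈⇒lookup b∈
  ...   | j , refl = ⊥-elim (none (j , xb , ne))

last-∈ : ∀ {A : Set} {k} (xs : Vec A (suc k)) → last xs ∈ xs
last-∈ (x ∷ [])     = here refl
last-∈ (x ∷ y ∷ xs) = there (last-∈ (y ∷ xs))

module _ {G : Graph n} where

  tight-par : {xs : Tuple n k} → Tight G xs → Fin n → Fin n
  tight-par (one x) v = v
  tight-par (add {x = x} {xs} _ i _ _ t) v with v ≟ᶠ x
  ... | yes _ = lookup xs i
  ... | no _  = tight-par t v

  tight-dep : {xs : Tuple n k} → Tight G xs → Fin n → ℕ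
  tight-dep (one x) v = 0
  tight-dep (add {x = x} {xs} _ i _ _ t) v with v ≟ᶠ x
  ... | yes _ = suc (tight-dep t (lookup xs i))
  ... | no _  = tight-dep t v

  private
    par-in : {xs : Tuple n k} (t : Tight G xs) → ∀ {v} → v ∈ xs → tight-par t v ∈ xs
    par-in (one x) m = m
    par-in (add {x = x} {xs} _ i _ _ t) {v} m with v ≟ᶠ x
    ... | yes _ = there (∈-lookup i xs)
    par-in (add _ i _ _ t) (here e)  | no ne = ⊥-elim (ne e)
    par-in (add _ i _ _ t) (there m) | no _  = there (par-in t m)

    dep-old : ∀ {k x} {xs : Tuple n k} (x∉ : x ∉ xs) i a (u : ∀ {b} → b ∈ xs → Adj G x b → b ≡ lookup xs i) (t : Tight G xs) →
              ∀ {v} → v ∈ xs → tight-dep (add x∉ i a u t) v ≡ tight-dep t v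
    dep-old {x = x} x∉ i a u t {v} m with v ≟ᶠ x
    ... | yes refl = ⊥-elim (x∉ m)
    ... | no _ = refl

    t-up : {xs : Tuple n k} (t : Tight G xs) → ∀ {v} → v ∈ xs → 0 < tight-dep t v →
           tight-dep t v ≡ suc (tight-dep t (tight-par t v))
    t-up (add {x = x} {xs} x∉ i a u t) {v} m lt with v ≟ᶠ x
    ... | yes refl = cong suc (sym (dep-old x∉ i a u t (∈-lookup i xs)))
    t-up (add x∉ i a u t) {v} (here e) lt | no ne = ⊥-elim (ne e)
    t-up (add x∉ i a u t) {v} (there m) lt | no ne = trans (t-up t m lt) (cong suc (sym (dep-old x∉ i a u t (par-in t m))))

    t-root : {xs : Tuple n (suc k)} (t : Tight G xs) → ∀ {v} → v ∈ xs → tight-dep t v ≡ 0 → v ≡ last xs × tight-par t v ≡ v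
    t-root (one x) (here e) _ = e , refl
    t-root (add {x = x} {xs} x∉ i a u t) {v} m z with v ≟ᶠ x
    t-root (add {x = x} {xs} x∉ i a u t) {v} m () | yes refl
    t-root (add x∉ i a u t) {v} (here e) z | no ne = ⊥-elim (ne e)
    t-root (add {xs = y ∷ xs} x∉ i a u t) {v} (there m) z | no ne = t-root t m z

    t-adj→ : {xs : Tuple n k} (t : Tight G xs) → ∀ {u v} → u ∈ xs → v ∈ xs → Adj G u v → u ≡ tight-par t v ⊎ v ≡ tight-par t u
    t-adj→ (one x) (here refl) (here refl) a = ⊥-elim (irrefl-adj G a refl)
    t-adj→ (add {x = x} {xs} x∉ i a uq t) {u} {v} mu mv uv with u ≟ᶠ x | v ≟ᶠ x
    ... | yes refl | yes refl = ⊥-elim (irrefl-adj G uv refl)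
    t-adj→ (add x∉ i a uq t) mu (here e) uv | yes refl | no ne = ⊥-elim (ne e)
    t-adj→ (add x∉ i a uq t) mu (there mv) uv | yes refl | no ne = inj₂ (uq mv uv)
    t-adj→ (add x∉ i a uq t) (here e) mv uv | no ne | yes refl = ⊥-elim (ne e)
    t-adj→ (add x∉ i a uq t) (there mu) mv uv | no ne | yes refl = inj₁ (uq mu (flip-adj G uv))
    t-adj→ (add x∉ i a uq t) (here e) mv uv | no ne | no _ = ⊥-elim (ne e)
    t-adj→ (add x∉ i a uq t) mu (here e) uv | no _ | no ne = ⊥-elim (ne e)
    t-adj→ (add x∉ i a uq t) (there mu) (there mv) uv | no _ | no _ = t-adj→ t mu mv uv

    t-adj← : {xs : Tuple n k} (t : Tight G xs) → ∀ {u} → u ∈ xs → tight-par t u ≢ u → Adj G u (tight-par t u)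
    t-adj← (one x) m ne = ⊥-elim (ne refl)
    t-adj← (add {x = x} {xs} x∉ i a uq t) {u} m ne with u ≟ᶠ x
    ... | yes refl = a
    t-adj← (add x∉ i a uq t) {u} (here e) ne | no h = ⊥-elim (h e)
    t-adj← (add x∉ i a uq t) {u} (there m) ne | no h = t-adj← t m ne

  tight-rooted : {xs : Tuple n (suc k)} → Tight G xs → (∀ v → v ∈ xs) → Rooted G false
  tight-rooted {xs = xs} t all = record
    { par = tight-par t ; dep = tight-dep t ; dep≥ = λ _ → z≤n ; up = λ v → t-up t (all v)
    ; top-dep = λ v z → trans (cong (tight-dep t) (proj₂ (t-root t (all v) z))) z
    ; top-par = λ v z → trans (cong (tight-par t) (proj₂ (t-root t (all v) z))) (proj₂ (t-root t (all v) z))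
    ; tops = λ u v zu zv → inj₁ (trans (proj₁ (t-root t (all u) zu)) (sym (proj₁ (t-root t (all v) zv))))
    ; kind = λ v z → proj₂ (t-root t (all v) z)
    ; adj→ = λ {u} {v} → t-adj→ t (all u) (all v) ; adj← = λ {u} → t-adj← t (all u) }

  tight-root : {xs : Tuple n (suc k)} (t : Tight G xs) → tight-dep t (last xs) ≡ 0
  tight-root (one x) = refl
  tight-root (add {x = x} {xs = y ∷ xs} x∉ i a u t) = trans (dep-old x∉ i a u t (last-∈ (y ∷ xs))) (tight-root t)

-- Recognising trees

deg-≥ : (G : Graph n) (v : Fin n) (ys : Tuple n k) → Unique ys → (∀ {y} → y ∈ ys → Adj G v y) → k ≤ deg G v
deg-≥ {k = k} G v ys u h = ≤-trans (≡⇒≤ (sym (trans (S-cong (fin k) (λ i → χ-yes (adj? G v (lookup ys i)) (h (∈-lookup i ys)))) (∑-one k))))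
  (vdeg≤deg G ys u v)

module _ (G : Graph n) where

  -- Twice the number of edges spanned, for an injective tuple.
  adjs : Tuple n k → ℕ
  adjs xs = ∑ (λ i → vdeg G xs (lookup xs i))

  χ-flip : ∀ u v → χ (adj? G u v) ≡ χ (adj? G v u)
  χ-flip u v = χ-cong (adj? G u v) (adj? G v u) (flip-adj G) (flip-adj G)

  adjs-∷ : ∀ x (xs : Tuple n k) → adjs (x ∷ xs) ≡ 2 * vdeg G xs x + adjs xs
  adjs-∷ {k} x xs = trans (∑-cons _) (trans (cong₂ _+_ first (trans (∑-cong (λ i → trans (∑-cons _) (cong (_+ vdeg G xs (lookup xs i)) (χ-flip _ _)))) (S-+ (fin k) _ _)))
     (lemma (vdeg G xs x) (adjs xs)))
    where
    first : vdeg G (x ∷ xs) x ≡ vdeg G xs x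
    first = trans (∑-cons _) (cong (_+ vdeg G xs x) (χ-no (adj? G x x) (λ a → irrefl-adj G a refl)))
    lemma : ∀ a b → a + (a + b) ≡ 2 * a + b
    lemma = solve-∀

  vdeg-≥1 : ∀ x (xs : Tuple n k) i → Adj G x (lookup xs i) → 1 ≤ vdeg G xs x
  vdeg-≥1 {k} x xs i a = ≤-trans (≡⇒≤ (sym (χ-yes (adj? G x (lookup xs i)) a))) (S-≥ (fin k) i (λ j → χ (adj? G x (lookup xs j))))

  grow-adjs : {xs : Tuple n k} → Grow G xs → 2 * k ≤ adjs xs + 2
  grow-adjs (one x) = m≤n+m 2 _
  grow-adjs {k = suc k} (add {x = x} {xs} x∉ i a g) = lia (k ∷ adjs (x ∷ xs) ∷ adjs xs ∷ vdeg G xs x ∷ [])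
    (λ k A B v → 2 :* k :≤ B :+ con 2 ∷ con 1 :≤ v ∷ A :≡ 2 :* v :+ B ∷ [] ⊢ 2 :* (con 1 :+ k) :≤ A :+ con 2)
    (grow-adjs g , vdeg-≥1 x xs i a , adjs-∷ x xs , tt)

  -- Every vertex after the starting one brings at least one edge. With no more than k - 1 edges in
  -- all, none can bring a second.
  grow-adjs-tight : {xs : Tuple n k} → Grow G xs → adjs xs + 2 ≤ 2 * k → Tight G xs
  grow-adjs-tight (one x) _ = one x
  grow-adjs-tight {k = suc k} (add {x = x} {xs} x∉ i a g) le = add x∉ i a uniq (grow-adjs-tight g
    (lia (k ∷ adjs (x ∷ xs) ∷ adjs xs ∷ vdeg G xs x ∷ [])
      (λ k A B v → A :+ con 2 :≤ 2 :* (con 1 :+ k) ∷ con 1 :≤ v ∷ A :≡ 2 :* v :+ B ∷ [] ⊢ B :+ con 2 :≤ 2 :* k)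
      (le , vdeg-≥1 x xs i a , adjs-∷ x xs , tt)))
    where
    two : ∀ j → j ≢ i → Adj G x (lookup xs j) → 2 ≤ vdeg G xs x
    two j ne b = ≤-trans (≡⇒≤ eq)
        (≤-trans (≡⇒≤ (sym (S-+ (fin _) _ _))) (S-mono (fin _) pt))
      where
      u v : Fin _ → ℕ
      u l = χ (i ≟ᶠ l) * 1
      v l = χ (j ≟ᶠ l) * 1
      eq : 2 ≡ ∑ u + ∑ v
      eq = cong₂ _+_ (sym (∑-δ i (λ _ → 1))) (sym (∑-δ j (λ _ → 1)))
      pt : ∀ l → χ (i ≟ᶠ l) * 1 + χ (j ≟ᶠ l) * 1 ≤ χ (adj? G x (lookup xs l))
      pt l with i ≟ᶠ l | j ≟ᶠ l
      ... | yes refl | yes refl = ⊥-elim (ne refl)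
      ... | yes refl | no _ = ≡⇒≤ (sym (χ-yes (adj? G x (lookup xs i)) a))
      ... | no _ | yes refl = ≡⇒≤ (sym (χ-yes (adj? G x (lookup xs j)) b))
      ... | no _ | no _ = z≤n
    uniq : ∀ {b} → b ∈ xs → Adj G x b → b ≡ lookup xs i
    uniq {b} b∈ ab with ∈⇒lookup b∈
    ... | j , refl with j ≟ᶠ i
    ...   | yes refl = refl
    ...   | no ne = lia⊥ (k ∷ adjs (x ∷ xs) ∷ adjs xs ∷ vdeg G xs x ∷ [])
      (λ k A B v → A :+ con 2 :≤ 2 :* (con 1 :+ k) ∷ 2 :* k :≤ B :+ con 2 ∷ con 2 :≤ v ∷ A :≡ 2 :* v :+ B ∷ [])
      (le , grow-adjs g , two j ne ab , adjs-∷ x xs , tt)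

  tight-grow : {xs : Tuple n k} → Tight G xs → Grow G xs
  tight-grow (one x) = one x
  tight-grow (add x∉ i a _ t) = add x∉ i a (tight-grow t)

  tight-adjs : {xs : Tuple n k} → Tight G xs → adjs xs + 2 ≡ 2 * k
  tight-adjs (one x) = cong (_+ 2) (trans (adjs-∷ x []) (cong₂ (λ a b → 2 * a + b) (∑-nil _) (∑-nil _)))
  tight-adjs {k = suc k} (add {x = x} {xs} x∉ i a u t) = lia (k ∷ adjs (x ∷ xs) ∷ adjs xs ∷ vdeg G xs x ∷ [])
    (λ k A B v → B :+ con 2 :≡ 2 :* k ∷ v :≡ con 1 ∷ A :≡ 2 :* v :+ B ∷ [] ⊢ A :+ con 2 :≡ 2 :* (con 1 :+ k))
    (tight-adjs t , one-nbr , adjs-∷ x xs , tt)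
    where
    one-nbr : vdeg G xs x ≡ 1
    one-nbr = trans (∑-cong (λ j → χ-cong (adj? G x (lookup xs j)) (i ≟ᶠ j)
        (λ b → lookup-injective (grow-unique (tight-grow t)) i j (sym (u (∈-lookup j xs) b))) (λ { refl → a })))
      (trans (∑-cong (λ j → sym (*-identityʳ _))) (∑-δ i (λ _ → 1)))

  degs : ℕ
  degs = ∑ (deg G)

  degs≡adjs : (xs : Tuple n k) → Unique xs → (∀ v → v ∈ xs) → degs ≡ adjs xs
  degs≡adjs xs u all = trans (∑-cong (λ v → trans (sym (vdeg≡deg G xs u v (λ x _ → all x)))
      (sym (trans (cong (_* vdeg G xs v) (χ-yes (v ∈? xs) (all v))) (+-identityʳ _))))) (∑-∈ xs u (vdeg G xs))

  complete-length : (xs : Tuple n k) → Unique xs → (∀ v → v ∈ xs) → k ≡ n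
  complete-length xs u all = trans (sym (count-∈ xs u)) (trans (∑-cong (λ v → χ-yes (v ∈? xs) (all v))) (∑-one n))

  all? : (xs : Tuple n k) → (∀ v → v ∈ xs) ⊎ ∃ λ v → v ∉ xs
  all? xs with Finₚ.any? (λ v → ∉? v xs)
  ... | yes p = inj₂ p
  ... | no h = inj₁ λ v → dec v (v ∈? xs)
    where
    dec : ∀ v → Dec (v ∈ xs) → v ∈ xs
    dec v (yes m) = m
    dec v (no ¬m) = ⊥-elim (h (v , ¬m))

  ⊤? : (x : Fin n) → Dec ⊤
  ⊤? _ = yes tt

  Sealed : Tuple n k → Set
  Sealed xs = ∀ x → (∃ λ i → Adj G x (lookup xs i)) → x ∈ xs

  component : (xs : Tuple n k) → Grow G xs → ∃ λ m → Σ (Tuple n m) λ zs → Grow G (zs ++ xs) × Sealed (zs ++ xs)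
  component xs g = let (m , zs , g' , _ , c) = saturate G {λ _ → ⊤} ⊤? xs g in m , zs , g' , λ x → c x tt

  sealed-adj : {xs : Tuple n k} → Sealed xs → ∀ {u v} → v ∈ xs → Adj G u v → u ∈ xs
  sealed-adj {xs = xs} c v∈ a with ∈⇒lookup v∈
  ... | i , refl = c _ (i , a)

  walk-in : Connected G → {xs : Tuple n k} → Sealed xs → ∀ {r} → r ∈ xs → ∀ v → v ∈ xs
  walk-in connected {xs} c r∈ v = go (connected v _) r∈
    where
    go : ∀ {u r} → Walk G u r → r ∈ xs → u ∈ xs
    go stop m = m
    go (hop a w) m = sealed-adj c (go w m) a

  grow-disjoint : {xs : Tuple n k} {ys : Tuple n (suc m)} → Sealed xs → Grow G ys → last ys ∉ xs → ∀ {v} → v ∈ ys → v ∉ xs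
  grow-disjoint c (one x) h (here refl) = h
  grow-disjoint {xs = xs} c (add {x = x} {xs = y ∷ ys} x∉ i a g) h = λ { (here refl) x∈ → ih (∈-lookup i (y ∷ ys)) (sealed-adj c x∈ (flip-adj G a)) ; (there m) → ih m }
    where
    ih : ∀ {v} → v ∈ (y ∷ ys) → v ∉ xs
    ih = grow-disjoint c g h

  adjs-++ : (xs : Tuple n k) (ys : Tuple n m) → (∀ {u v} → u ∈ ys → v ∈ xs → ¬ Adj G u v) →
            adjs (ys ++ xs) ≡ adjs ys + adjs xs
  adjs-++ xs []       no-adj = cong (_+ adjs xs) (sym (∑-nil _))
  adjs-++ {k} {suc m} xs (y ∷ ys) no-adj = trans (adjs-∷ y (ys ++ xs)) (trans (cong₂ (λ a b → 2 * a + b) (v++ ys) (adjs-++ xs ys (no-adj ∘ there)))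
      (trans (sym (+-assoc _ (adjs ys) (adjs xs))) (cong (_+ adjs xs) (sym (adjs-∷ y ys)))))
    where
    v++ : ∀ {m} (zs : Tuple n m) → vdeg G (zs ++ xs) y ≡ vdeg G zs y
    v++ [] = trans (S-zero (fin k) (λ i → χ-no (adj? G y (lookup xs i)) (no-adj (here refl) (∈-lookup i xs)))) (sym (∑-nil _))
    v++ (z ∷ zs) = trans (∑-cons _) (trans (cong (χ (adj? G y z) +_) (v++ zs)) (sym (∑-cons _)))

  unique-++ : {xs : Tuple n k} (ys : Tuple n m) → Unique xs → Unique ys → (∀ {v} → v ∈ ys → v ∉ xs) → Unique (ys ++ xs)
  unique-++ []       u v d = u
  unique-++ {xs = xs} (y ∷ ys) u (p ∷ v) d = ∉⇒All (λ m → case (∈-++⁻ ys m)) ∷ unique-++ ys u v (d ∘ there)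
    where
    case : y ∈ ys ⊎ y ∈ xs → ⊥
    case (inj₁ m) = All⇒∉ p m
    case (inj₂ m) = d (here refl) m

  component-of : ∀ r → ∃ λ k → Σ (Tuple n (suc k)) λ ys → Grow G ys × Sealed ys × last ys ≡ r
  component-of r with component (r ∷ []) (one r)
  ... | m , zs , g , c = m , cast zs g c
    where
    cast : ∀ {m} (zs : Tuple n m) → Grow G (zs ++ (r ∷ [])) → Sealed (zs ++ (r ∷ [])) →
           Σ (Tuple n (suc m)) λ ys → Grow G ys × Sealed ys × last ys ≡ r
    cast {m} zs g c = go (+-comm m 1) (zs ++ (r ∷ [])) g c (lst zs)
      where
      lst : ∀ {m} (zs : Tuple n m) → ∃ λ j → Σ (m + 1 ≡ suc j) λ e → last (subst (Tuple n) e (zs ++ (r ∷ []))) ≡ r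
      lst [] = 0 , refl , refl
      lst {suc m} (z ∷ zs) with lst zs
      ... | j , e , q = suc j , cong suc e , trans (cong last (push e (zs ++ (r ∷ [])))) (trans (last-∷ z (subst (Tuple n) e (zs ++ (r ∷ [])))) q)
        where
        push : ∀ {a b} (e : a ≡ b) (v : Tuple n a) → subst (Tuple n) (cong suc e) (z ∷ v) ≡ z ∷ subst (Tuple n) e v
        push refl v = refl
      go : ∀ {a} → a ≡ suc m → (v : Tuple n a) → Grow G v → Sealed v → (∃ λ j → Σ (a ≡ suc j) λ e → last (subst (Tuple n) e v) ≡ r) →
           Σ (Tuple n (suc m)) λ ys → Grow G ys × Sealed ys × last ys ≡ r
      go refl v g c (j , refl , q) = v , g , c , q

  -- In a graph without cycles a union of components spans fewer edges than vertices.
  forest : (¬ ∃ λ m → Σ (Tuple n (3 + m)) (Cycle G)) → ∀ d {k} (xs : Tuple n k) → n ≤ k + d → Unique xs → Sealed xs →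
           ∀ c → adjs xs + c ≤ 2 * k → degs + c ≤ 2 * n
  forest nc d xs e u s c le with all? xs
  ... | inj₁ all = subst₂ (λ a b → a + c ≤ 2 * b) (sym (degs≡adjs xs u all)) (complete-length xs u all) le
  forest nc d {k} xs e u s c le | inj₂ (v , v∉) with component-of v
  ... | j , ys , g , sy , q with tight? G g
  ...   | inj₂ cy = ⊥-elim (nc cy)
  ...   | inj₁ t = next d e
    where
    dis : ∀ {w} → w ∈ ys → w ∉ xs
    dis = grow-disjoint s g (subst (_∉ xs) (sym q) v∉)
    sealed : Sealed (ys ++ xs)
    sealed x (i , a) = case (∈-++⁻ ys (∈-lookup i (ys ++ xs)))
      where
      case : lookup (ys ++ xs) i ∈ ys ⊎ lookup (ys ++ xs) i ∈ xs → x ∈ (ys ++ xs)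
      case (inj₁ m) = ∈-++⁺ˡ (sealed-adj sy m a)
      case (inj₂ m) = ∈-++⁺ʳ ys (sealed-adj s m a)
    uq : Unique (ys ++ xs)
    uq = unique-++ ys u (grow-unique g) dis
    next : ∀ d → n ≤ k + d → degs + c ≤ 2 * n
    next zero e = ⊥-elim (1+n≰n (≤-trans (≤-trans (s≤s (m≤n+m k j)) (unique-≤ (ys ++ xs) uq)) (≤-trans e (≡⇒≤ (+-identityʳ k)))))
    next (suc d) e = forest nc d (ys ++ xs)
      (lia (n ∷ k ∷ d ∷ j ∷ []) (λ n k d j → n :≤ k :+ (con 1 :+ d) ∷ [] ⊢ n :≤ con 1 :+ j :+ k :+ d) (e , tt)) uq sealed c
      (lia (adjs (ys ++ xs) ∷ adjs ys ∷ adjs xs ∷ c ∷ j ∷ k ∷ [])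
        (λ A Y X c j k → A :≡ Y :+ X ∷ X :+ c :≤ 2 :* k ∷ Y :+ con 2 :≡ 2 :* (con 1 :+ j) ∷ [] ⊢ A :+ c :≤ 2 :* (con 1 :+ j :+ k))
        (adjs-++ xs ys (λ u∈ v∈ a → dis u∈ (sealed-adj s v∈ a)) , le , tight-adjs t , tt))

record Spanning (G : Graph n) (r : Fin n) : Set where
  field
    {len}  : ℕ
    verts  : Tuple n (suc len)
    tight  : Tight G verts
    all-in : ∀ v → v ∈ verts
    root≡  : last verts ≡ r

tree-spanning : (G : Graph n) → IsTree G → ∀ r → Spanning G r
tree-spanning G (connected , acyclic) r with component-of G r
... | k , ys , g , c , q with tight? G g
...   | inj₂ (_ , _ , cy) = ⊥-elim (acyclic (cycle→HasCycle cy))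
...   | inj₁ t = record { verts = ys ; tight = t ; all-in = walk-in G connected c (subst (_∈ ys) q (last-∈ ys)) ; root≡ = q }

spanning-degs : (G : Graph n) {r : Fin n} → Spanning G r → degs G + 2 ≡ 2 * n
spanning-degs G sp = trans (cong (_+ 2) (degs≡adjs G verts u all-in))
    (trans (tight-adjs G tight) (cong (2 *_) (complete-length G verts u all-in)))
  where
  open Spanning sp
  u = grow-unique (tight-grow G tight)

-- Every vertex has degree at least 2 except those outside the interior of a long path,
-- so the total excess degree, and with it every vertex boundary, is small.
module _ (G : Graph n) (e : degs G + 2 ≡ 2 * n) where

  interior : ∀ {j} (ps : Tuple n (2 + j)) → Chain G ps → Unique ps →
             Σ (Tuple n j) λ is → Unique is × (∀ {v} → v ∈ is → v ∈ tail ps) × (∀ {v} → v ∈ is → 2 ≤ deg G v)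
  interior {zero}  ps c u = [] , [] , (λ ()) , λ ()
  interior {suc j} (x ∷ y ∷ z ∷ ps) (a ∷ b ∷ c) (p ∷ q ∷ u) =
    let (is , iu , sub , ds) = interior (y ∷ z ∷ ps) (b ∷ c) (q ∷ u)
    in y ∷ is , ∉⇒All (All⇒∉ q ∘ sub) ∷ iu , (λ { (here r) → here r ; (there m) → there (sub m) })
     , λ { (here refl) → deg-≥ G y (x ∷ z ∷ []) (∉⇒All (λ { (here refl) → All⇒∉ p (there (here refl)) }) ∷ (∉⇒All (λ ()) ∷ []))
             (λ { (here refl) → flip-adj G a ; (there (here refl)) → b }) ; (there m) → ds m }

  bnd-adjs : (f : Tuple n k) → Unique f → bnd G f + adjs G f ≤ ∑ (λ i → deg G (lookup f i))
  bnd-adjs {k} f u = ≤-trans (≡⇒≤ (cong (bnd G f +_) (sym (∑-∈ f u (λ v → vdeg G f v)))))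
    (≤-trans (≡⇒≤ (sym (S-+ (fin n) _ _))) (≤-trans (S-mono (fin n) pt) (≡⇒≤ (S-swap (fin n) (fin k) (λ x i → χ (adj? G (lookup f i) x))))))
    where
    pt : ∀ x → χ (bd? G f x) + χ (x ∈? f) * vdeg G f x ≤ ∑ (λ i → χ (adj? G (lookup f i) x))
    pt x with x ∈? f
    ... | yes m = ≡⇒≤ (trans (cong₂ _+_ (χ-no (bd? G f x) (λ b → proj₁ b m)) (+-identityʳ _)) (∑-cong (λ i → χ-flip G x (lookup f i))))
    ... | no ¬m with bd? G f x
    ...   | no _ = z≤n
    ...   | yes (_ , i , a) = ≤-trans (≡⇒≤ (sym (χ-yes (adj? G (lookup f i) x) (flip-adj G a)))) (S-≥ (fin k) i _)

  -- Let X be the total excess of the degrees over 2 and Y their total deficit. The degree sum 2n -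
  -- 2 gives Y = X + 2. A connected f spans at least k - 1 edges, so `bnd f` ≤ X + 2 = Y, and Y ≤
  -- 2(n - j) because the j interior vertices of the path have no deficit.
  bnd-bound : ∀ {j} (ps : Tuple n (2 + j)) → Chain G ps → Unique ps →
              ∀ {k} (f : Tuple n k) → Grow G f → bnd G f + 2 * j ≤ 2 * n
  bnd-bound {j} ps c up {k} f g = lia (bnd G f ∷ adjs G f ∷ ∑ (λ i → deg G (lookup f i)) ∷ k ∷ X ∷ Y ∷ degs G ∷ n ∷ j ∷ [])
      (λ B A D k X Y S n j → B :+ A :≤ D ∷ D :≤ 2 :* k :+ X ∷ 2 :* k :≤ A :+ con 2 ∷ S :+ Y :≡ 2 :* n :+ X ∷ S :+ con 2 :≡ 2 :* n ∷ Y :+ 2 :* j :≤ 2 :* n ∷ [] ⊢ B :+ 2 :* j :≤ 2 :* n)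
      (bnd-adjs f u , fsum , grow-adjs G g , balance , e , short , tt)
    where
    u = grow-unique g
    X = ∑ (λ v → deg G v ∸ 2)
    Y = ∑ (λ v → 2 ∸ deg G v)
    fsum : ∑ (λ i → deg G (lookup f i)) ≤ 2 * k + X
    fsum = ≤-trans (S-mono (fin k) (λ i → m≤n+m∸n (deg G (lookup f i)) 2)) (≤-trans (≡⇒≤ (S-+ (fin k) (λ _ → 2) _))
      (+-mono-≤ (≡⇒≤ (trans (∑-const k 2) (*-comm k 2))) (≤-trans (≡⇒≤ (sym (∑-∈ f u (λ v → deg G v ∸ 2))))
        (S-mono (fin n) (λ v → ≤-trans (*-monoˡ-≤ (deg G v ∸ 2) (χ≤1 (v ∈? f))) (≡⇒≤ (+-identityʳ _)))))))
    balance : degs G + Y ≡ 2 * n + X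
    balance = trans (sym (S-+ (fin n) _ _)) (trans (∑-cong (λ v → m+[n∸m]≡m⊔n (deg G v)))
        (trans (S-+ (fin n) (λ _ → 2) _) (cong (_+ X) (trans (∑-const n 2) (*-comm n 2)))))
      where
      m+[n∸m]≡m⊔n : ∀ d → d + (2 ∸ d) ≡ 2 + (d ∸ 2)
      m+[n∸m]≡m⊔n 0 = refl
      m+[n∸m]≡m⊔n 1 = refl
      m+[n∸m]≡m⊔n (suc (suc d)) = trans (cong (λ z → 2 + d + z) (0∸n≡0 d)) (+-identityʳ _)
    short : Y + 2 * j ≤ 2 * n
    short with interior ps c up
    ... | is , iu , _ , ds = ≤-trans (+-mono-≤ (S-mono (fin n) pt) (≡⇒≤ (trans (cong (2 *_) (sym (count-∈ is iu))) (sym (S-* (fin n) 2 _)))))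
        (≤-trans (≡⇒≤ (sym (S-+ (fin n) _ _))) (≤-trans (S-mono (fin n) (λ v → ≡⇒≤
          (trans (sym (*-distribˡ-+ 2 (χ (∉? v is)) (χ (v ∈? is)))) (cong (2 *_) (trans (+-comm (χ (∉? v is)) _) (χ-compl (v ∈? is) (∉? v is)))))))
          (≡⇒≤ (trans (∑-const n 2) (*-comm n 2)))))
      where
      pt : ∀ v → 2 ∸ deg G v ≤ 2 * χ (∉? v is)
      pt v with v ∈? is
      ... | yes m = ≡⇒≤ (m≤n⇒m∸n≡0 (ds m))
      ... | no _ = m∸n≤m 2 (deg G v)

∑ᵛ-exists : ∀ {n n' k} (F : Tuple n k → ℕ) (F' : Tuple n' k → ℕ) → ∑ᵛ k F ≡ ∑ᵛ k F' → ∀ xs → F xs ≢ 0 → ∃ λ ys → F' ys ≢ 0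
∑ᵛ-exists {n} {n'} {k} F F' e xs h = ∑ᵛ-pos k F' (λ z → h (n≤0⇒n≡0 (≤-trans (S-≥ (vec n k) xs F) (≡⇒≤ (trans e z)))))

χ-pos : {P : Set} (d : Dec P) → P → χ d ≢ 0
χ-pos d p e with trans (sym (χ-yes d p)) e
... | ()

*-pos : ∀ {a b} → a ≢ 0 → b ≢ 0 → a * b ≢ 0
*-pos {a} {b} ha hb e with m*n≡0⇒m≡0∨n≡0 a e
... | inj₁ z = ha z
... | inj₂ z = hb z

chain-same : {G : LGraph n} {H : LGraph m} {xs : Tuple n k} {ys : Tuple m k} → Same G xs H ys → Chain (graph G) xs → Chain (graph H) ys
chain-same {ys = y ∷ []} s (one x) = one y
chain-same {ys = y ∷ y' ∷ ys} s (a ∷ c) = trans (sym (same-adj s zero (suc zero))) a ∷ chain-same (same-tail s) c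

exists-transfer : ∀ {n n' k} (G : LGraph n) (H : LGraph n') → AgreeAt G H k →
  {P : Tuple n k → Set} {P' : Tuple n' k → Set} (P? : ∀ xs → Dec (P xs)) (P'? : ∀ ys → Dec (P' ys)) →
  (∀ xs ys → Same G xs H ys → P xs → P' ys) → (∀ xs ys → Same G xs H ys → P' ys → P xs) →
  (∃ λ xs → Unique xs × P xs) → ∃ λ ys → Unique ys × P' ys
exists-transfer G H ag {P} {P'} P? P'? to from (xs , u , p) =
  let (ys , q) = ∑ᵛ-exists _ _ (ag (λ xs → χ (P? xs)) (λ ys → χ (P'? ys)) (λ xs ys _ _ s → χ-cong (P? xs) (P'? ys) (to xs ys s) (from xs ys s)))
                   xs (*-pos (χ-pos (unique? xs) u) (χ-pos (P? xs) p))
  in ys , χ≢0 (unique? ys) (*≢0ˡ _ q) , χ≢0 (P'? ys) (*≢0ʳ (χu ys) q)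

chain-grow : {G : Graph n} {xs : Tuple n k} → Chain G xs → Unique xs → Grow G xs
chain-grow (one x) u = one x
chain-grow (a ∷ c) (p ∷ u) = add (All⇒∉ p) zero a (chain-grow c u)

tight-tail : {G : Graph n} {x : Fin n} {xs : Tuple n k} → Tight G (x ∷ xs) → 1 ≤ k → Tight G xs
tight-tail (add _ _ _ _ t) _ = t

tight-drop : {G : Graph n} (zs : Tuple n m) {f : Tuple n (suc k)} → Tight G (zs ++ f) → Tight G f
tight-drop []       g             = g
tight-drop {m = suc m} {k} (z ∷ zs) g = tight-drop zs (tight-tail g (≤-trans (s≤s z≤n) (m≤n+m (suc k) m)))

cycle-not-tight : {G : Graph n} {xs : Tuple n (3 + k)} → Cycle G xs → ¬ Tight G xs
cycle-not-tight {G = G} {x ∷ y ∷ z ∷ xs} (cycle (a ∷ c) (p ∷ q ∷ u) l) (add x∉ i _ uq t) =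
  All⇒∉ q (subst (_∈ (z ∷ xs)) (trans (uq (last-∈ (y ∷ z ∷ xs)) (flip-adj G l)) (sym (uq (here refl) a))) (last-∈ (z ∷ xs)))

-- A graph with the deck of a tree is a tree

module Recognise {n : ℕ} (ℓ : ℕ) (6ℓ≤n : 6 * ℓ + 11 ≤ n) (T H : Graph n) (tree : IsTree T)
  (ag : Agree (plain T) (plain H) (n ∸ ℓ)) where

  N = n ∸ ℓ

  N+ℓ : N + ℓ ≡ n
  N+ℓ = m∸n+n≡m (lia (ℓ ∷ n ∷ []) (λ ℓ n → 6 :* ℓ :+ con 11 :≤ n ∷ [] ⊢ ℓ :≤ n) (6ℓ≤n , tt))

  T-degs : degs T + 2 ≡ 2 * n
  T-degs = spanning-degs T (tree-spanning T tree (Data.Fin.fromℕ< {0} (≤-trans (s≤s z≤n) (≤-trans (m≤n+m 11 (6 * ℓ)) 6ℓ≤n))))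

  degs-agree : degs T ≡ degs H
  degs-agree = trans (pairs T) (trans (ag 2 2≤N (λ { (x ∷ y ∷ []) → χ (adj? T y x) }) (λ { (x ∷ y ∷ []) → χ (adj? H y x) })
      λ { (x ∷ y ∷ []) (x' ∷ y' ∷ []) _ _ s → χ-cong (adj? T y x) (adj? H y' x') (trans (sym (same-adj s (suc zero) zero))) (trans (same-adj s (suc zero) zero)) })
      (sym (pairs H)))
    where
    2≤N : 2 ≤ N
    2≤N = lia (N ∷ ℓ ∷ n ∷ []) (λ N ℓ n → N :+ ℓ :≡ n ∷ 6 :* ℓ :+ con 11 :≤ n ∷ [] ⊢ con 2 :≤ N) (N+ℓ , 6ℓ≤n , tt)
    pairs : ∀ G → degs G ≡ ∑ᵛ 2 (λ { (x ∷ y ∷ []) → χu {n} (x ∷ y ∷ []) * χ (adj? G y x) })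
    pairs G = S-cong (fin n) (λ y → S-cong (fin n) (λ x → step y x))
      where
      step : ∀ y x → χ (adj? G y x) ≡ χu (x ∷ y ∷ []) * χ (adj? G y x)
      step y x with adj? G y x
      ... | no _ = sym (*-zeroʳ (χu (x ∷ y ∷ [])))
      ... | yes a = sym (trans (*-identityʳ _) (χ-yes (unique? (x ∷ y ∷ [])) (∉⇒All (λ { (here refl) → irrefl-adj G a refl }) ∷ (∉⇒All (λ ()) ∷ []))))

  H-degs : degs H + 2 ≡ 2 * n
  H-degs = trans (cong (_+ 2) (sym degs-agree)) T-degs

  module Long (c : ℕ) (xs : Tuple n (3 + c)) (cy : Cycle H xs) where

    private
      cyc? : ∀ {c} (G : Graph n) (xs : Tuple n (3 + c)) → Dec (Chain G xs × Adj G (last xs) (head xs))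
      cyc? G xs = chain? G xs ×-dec adj? G (last xs) (head xs)

      move : ∀ {c} {G G' : Graph n} (xs ys : Tuple n (3 + c)) → Same (plain G) xs (plain G') ys →
             Chain G xs × Adj G (last xs) (head xs) → Chain G' ys × Adj G' (last ys) (head ys)
      move {G = G} {G'} xs@(x ∷ _) ys@(y ∷ _) s (c , a) = chain-same s c ,
        subst (λ z → Adj G' z y) (sym (last-lookup ys)) (trans (sym (same-adj s (Data.Fin.fromℕ _) zero)) (subst (λ z → Adj G z x) (last-lookup xs) a))

    long : N < 3 + c
    long with 3 + c ≤? N
    ... | no h = ≰⇒> h
    ... | yes le =
      let (ys , u , ch , a) = exists-transfer (plain H) (plain T) (λ F F' r → sym (ag (3 + c) le F' F (λ ys xs v u s → sym (r xs ys u v (same-flip s)))))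
              (cyc? H) (cyc? T) move (λ xs ys s → move ys xs (same-flip s)) (xs , Cycle.unique cy , Cycle.chain cy , Cycle.closes cy)
      in ⊥-elim (proj₂ tree (cycle→HasCycle (cycle ch u a)))

    chain-take : ∀ {m j} (xs : Tuple n (suc m)) → j ≤ m → Chain H xs → Unique xs →
                 Σ (Tuple n (suc j)) λ ys → Chain H ys × Unique ys × (∀ {v} → v ∈ ys → v ∈ xs) × head ys ≡ head xs
    chain-take {m} {zero} (x ∷ xs) _ c u = x ∷ [] , one x , ∉⇒All (λ ()) ∷ [] , (λ { (here e) → here e }) , refl
    chain-take {suc m} {suc j} (x ∷ y ∷ xs) (s≤s le) (a ∷ c) (p ∷ u) with chain-take (y ∷ xs) le c u
    ... | z ∷ zs , c' , u' , sub , refl = x ∷ y ∷ zs , a ∷ c' , ∉⇒All (All⇒∉ p ∘ sub) ∷ u' , (λ { (here e) → here e ; (there m) → there (sub m) }) , refl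

    -- A path on N = 2 + j vertices has j interior vertices, as `bnd-bound` requires.
    j = N ∸ 2
    2+j : 2 + j ≡ N
    2+j = m+[n∸m]≡n (lia (N ∷ ℓ ∷ n ∷ []) (λ N ℓ n → N :+ ℓ :≡ n ∷ 6 :* ℓ :+ con 11 :≤ n ∷ [] ⊢ con 2 :≤ N) (N+ℓ , 6ℓ≤n , tt))

    path-H : ∃ λ (ps : Tuple n (2 + j)) → Unique ps × Chain H ps
    path-H = let (ps , c , u , _) = chain-take xs (s≤s⁻¹ (≤-trans (≡⇒≤ 2+j) (<⇒≤ long))) (Cycle.chain cy) (Cycle.unique cy) in ps , u , c

    path-T : ∃ λ (ps : Tuple n (2 + j)) → Unique ps × Chain T ps
    path-T = exists-transfer (plain H) (plain T) (λ F F' r → sym (ag (2 + j) (≡⇒≤ 2+j) F' F (λ ys xs v u s → sym (r xs ys u v (same-flip s)))))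
               (chain? H) (chain? T) (λ _ _ s → chain-same s) (λ _ _ s → chain-same (same-flip s)) path-H

    -- The component of the cycle misses a vertex: a connected graph with n - 1 edges would be a
    -- tree. The component of the missed vertex has fewer than ℓ vertices. That no edge leaves it is
    -- a statement about degrees, so it carries over to a tuple of T, against connectedness.
    impossible : ⊥
    impossible with component H xs (chain-grow (Cycle.chain cy) (Cycle.unique cy))
    ... | m , zs , g , s with all? H (zs ++ xs)
    ...   | inj₁ all = cycle-not-tight cy (tight-drop zs (grow-adjs-tight H g (≡⇒≤ (trans (cong (_+ 2) (sym (degs≡adjs H (zs ++ xs) (grow-unique g) all)))
                (trans H-degs (cong (2 *_) (sym (complete-length H (zs ++ xs) (grow-unique g) all))))))))
    ...   | inj₂ (v , v∉) with component-of H v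
    ...     | a , ys , gy , sy , q = no-T (∑ᵛ-exists {n} {n} FH FT (sym eq) ys (*-pos (χ-pos (grow? H ys) gy) (χ-pos (full? H ys (map (deg H) ys)) (sealed-full ys gy sy))))
      where
      -- The degrees d are all accounted for inside f, that is, no edge leaves f.
      Full : ∀ {a} (G : Graph n) (f : Tuple n a) (d : Vec ℕ a) → Set
      Full G f d = ∀ i → lookup d i ≡ vdeg G f (lookup f i)
      full? : ∀ {a} (G : Graph n) (f : Tuple n a) (d : Vec ℕ a) → Dec (Full G f d)
      full? G f d = Finₚ.all? (λ i → lookup d i ≟ vdeg G f (lookup f i))
      FT FH : Tuple n (suc a) → ℕ
      FT f = χg T f * χ (full? T f (map (deg T) f))
      FH f = χg H f * χ (full? H f (map (deg H) f))
      sealed-full : (ys : Tuple n (suc a)) → Grow H ys → Sealed H ys → Full H ys (map (deg H) ys)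
      sealed-full ys g s i = trans (lookup-map i (deg H) ys) (sym (vdeg≡deg H ys (grow-unique g) (lookup ys i) (λ x ad → s x (i , flip-adj H ad))))
      dis : Unique (ys ++ (zs ++ xs))
      dis = unique-++ H ys (grow-unique g) (grow-unique gy) (grow-disjoint H s gy (subst (_∉ (zs ++ xs)) (sym q) v∉))
      a<ℓ : suc a < ℓ
      a<ℓ = lia (a ∷ m ∷ c ∷ n ∷ N ∷ ℓ ∷ []) (λ a m c n N ℓ → con 1 :+ a :+ (m :+ (con 3 :+ c)) :≤ n ∷ N :< con 3 :+ c ∷ N :+ ℓ :≡ n ∷ [] ⊢ con 1 :+ a :< ℓ)
              (unique-≤ _ dis , long , N+ℓ , tt)
      -- Fewer than ℓ vertices, with a boundary of at most 2n - 2(N - 2) = 2ℓ + 4 by the long path.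
      close : (G : Graph n) → degs G + 2 ≡ 2 * n → (∃ λ (ps : Tuple n (2 + j)) → Unique ps × Chain G ps) →
              ∀ (f : Tuple n (suc a)) → Grow G f → suc a + bnd G f ≤ N
      close G e (ps , u , c) f g = lia (a ∷ bnd G f ∷ j ∷ n ∷ N ∷ ℓ ∷ [])
        (λ a b j n N ℓ → con 1 :+ a :< ℓ ∷ b :+ 2 :* j :≤ 2 :* n ∷ con 2 :+ j :≡ N ∷ N :+ ℓ :≡ n ∷ 6 :* ℓ :+ con 11 :≤ n ∷ [] ⊢ con 1 :+ a :+ b :≤ N)
        (a<ℓ , bnd-bound G e ps c u f g , 2+j , N+ℓ , 6ℓ≤n , tt)
      eq : ∑ᵛ (suc a) FT ≡ ∑ᵛ (suc a) FH
      eq = deg-transfer (plain T) (plain H) (agree-grow _ _ ag) a 0 (λ f d → χ (full? T f d)) (λ f d → χ (full? H f d))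
        (λ f f' _ _ s d → χ-cong (full? T f d) (full? H f' d) (λ h i → trans (h i) (vs f f' s i)) (λ h i → trans (h i) (sym (vs f f' s i))))
        (λ _ _ _ _ → z≤n) (λ _ _ _ _ → z≤n) (λ f g _ → close T T-degs path-T f g) (λ f g _ → close H H-degs path-H f g)
        (lia (a ∷ n ∷ N ∷ ℓ ∷ []) (λ a n N ℓ → con 1 :+ a :< ℓ ∷ N :+ ℓ :≡ n ∷ 6 :* ℓ :+ con 11 :≤ n ∷ [] ⊢ con 1 :+ a :≤ N) (a<ℓ , N+ℓ , 6ℓ≤n , tt))
        where
        vs : ∀ f f' → Same (plain T) f (plain H) f' → ∀ i → vdeg T f (lookup f i) ≡ vdeg H f' (lookup f' i)
        vs f f' s i = ∑-cong (λ l → χ-cong (adj? T _ _) (adj? H _ _) (trans (sym (same-adj s i l))) (trans (same-adj s i l)))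
      no-T : (∃ λ f → FT f ≢ 0) → ⊥
      no-T (f , h) = 1+n≰n (≤-trans (≤-trans (s≤s (m≤n+m (suc a) 0)) (≤-trans a<ℓ (lia (ℓ ∷ n ∷ []) (λ ℓ n → 6 :* ℓ :+ con 11 :≤ n ∷ [] ⊢ ℓ :≤ n) (6ℓ≤n , tt))))
          (≡⇒≤ (sym (complete-length T f u (walk-in T (proj₁ tree) sealed (∈-lookup zero f))))))
        where
        gf = χ≢0 (grow? T f) (*≢0ˡ _ h)
        u = grow-unique gf
        fl = χ≢0 (full? T f (map (deg T) f)) (*≢0ʳ (χg T f) h)
        sealed : Sealed T f
        sealed x (i , ad) with x ∈? f
        ... | yes m = m
        ... | no x∉ = ⊥-elim (1+n≰n (≤-trans (s≤s (≡⇒≤ (trans (sym (lookup-map i (deg T) f)) (fl i)))) more))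
          where
          more : suc (vdeg T f (lookup f i)) ≤ deg T (lookup f i)
          more = ≤-trans (≡⇒≤ (sym (trans (∑-cons _) (cong (_+ vdeg T f (lookup f i)) (χ-yes (adj? T (lookup f i) x) (flip-adj T ad))))))
                   (vdeg≤deg T (x ∷ f) (∉⇒All x∉ ∷ u) (lookup f i))

  H-acyclic : ¬ ∃ λ m → Σ (Tuple n (3 + m)) (Cycle H)
  H-acyclic (m , xs , cy) = Long.impossible m xs cy

  -- A forest with two components has a degree sum of at most 2n - 4, while the sum here is 2n - 2.
  H-spanning : ∀ r → Spanning H r
  H-spanning r with component-of H r
  ... | k , ys , g , c , q with tight? H g
  ...   | inj₂ cy = ⊥-elim (H-acyclic cy)
  ...   | inj₁ t with all? H ys
  ...     | inj₁ all = record { verts = ys ; tight = t ; all-in = all ; root≡ = q }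
  ...     | inj₂ (v , v∉) with component-of H v
  ...       | j , zs , gz , sz , qz = lia⊥ (degs H ∷ n ∷ []) (λ D n → D :+ con 4 :≤ 2 :* n ∷ D :+ con 2 :≡ 2 :* n ∷ [])
        (forest H H-acyclic n (zs ++ ys) (m≤n+m n _) (unique-++ H zs (grow-unique g) (grow-unique gz) dis) sealed 4 two , H-degs , tt)
    where
    dis : ∀ {w} → w ∈ zs → w ∉ ys
    dis = grow-disjoint H c gz (subst (_∉ ys) (sym qz) v∉)
    sealed : Sealed H (zs ++ ys)
    sealed x (i , a) = case (∈-++⁻ zs (∈-lookup i (zs ++ ys)))
      where
      case : lookup (zs ++ ys) i ∈ zs ⊎ lookup (zs ++ ys) i ∈ ys → x ∈ (zs ++ ys)
      case (inj₁ m) = ∈-++⁺ˡ (sealed-adj H sz m a)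
      case (inj₂ m) = ∈-++⁺ʳ zs (sealed-adj H c m a)
    tz : Tight H zs
    tz with tight? H gz
    ... | inj₁ t = t
    ... | inj₂ cy = ⊥-elim (H-acyclic cy)
    two : adjs H (zs ++ ys) + 4 ≤ 2 * (suc j + suc k)
    two = lia (adjs H (zs ++ ys) ∷ adjs H zs ∷ adjs H ys ∷ j ∷ k ∷ [])
      (λ A Z Y j k → A :≡ Z :+ Y ∷ Z :+ con 2 :≡ 2 :* (con 1 :+ j) ∷ Y :+ con 2 :≡ 2 :* (con 1 :+ k) ∷ [] ⊢ A :+ con 4 :≤ 2 :* (con 1 :+ j :+ (con 1 :+ k)))
      (adjs-++ H ys zs (λ u∈ v∈ a → dis u∈ (sealed-adj H c v∈ a)) , tight-adjs H tz , tight-adjs H t , tt)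

-- Matching branches

-- The index `r` marks the vertex by which a branch hangs on the rest of the tree.
record Pat (k : ℕ) : Set where
  field
    A : Fin k → Fin k → Bool
    L : Fin k → ℕ
    r : Fin k

Match : LGraph n → Pat k → Tuple n k → Set
Match G P g = (∀ i j → adj (graph G) (lookup g i) (lookup g j) ≡ Pat.A P i j) × (∀ i → lab G (lookup g i) ≡ Pat.L P i)

patOf : (G : LGraph n) → Tuple n k → Fin k → Pat k
patOf G f r = record { A = λ i j → adj (graph G) (lookup f i) (lookup f j) ; L = λ i → lab G (lookup f i) ; r = r }

match-same : {G : LGraph n} {H : LGraph n'} {P : Pat k} {g : Tuple n k} {h : Tuple n' k} →
             Match G P g → Match H P h → Same G g H h
match-same (a , l) (b , m) = (λ i j → trans (a i j) (sym (b i j))) & (λ i → trans (l i) (sym (m i)))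

same-match : {G : LGraph n} {H : LGraph n'} {P : Pat k} {g : Tuple n k} {h : Tuple n' k} →
             Same G g H h → Match G P g → Match H P h
same-match s (a , l) = (λ i j → trans (sym (same-adj s i j)) (a i j)) , (λ i → trans (sym (same-lab s i)) (l i))

opaque
  match? : (G : LGraph n) (P : Pat k) (g : Tuple n k) → Dec (Match G P g)
  match? G P g = Finₚ.all? (λ i → Finₚ.all? (λ j → adj (graph G) (lookup g i) (lookup g j) ≟ᵇ Pat.A P i j))
                 ×-dec Finₚ.all? (λ i → lab G (lookup g i) ≟ Pat.L P i)

subset-full : {Q : Fin n → Set} (Q? : ∀ x → Dec (Q x)) (g : Tuple n k) → Unique g → (∀ {x} → x ∈ g → Q x) →
              ∑ (λ x → χ (Q? x)) ≤ k → ∀ x → Q x → x ∈ g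
subset-full {n} {k} Q? g u sub le x q with x ∈? g
... | yes m = m
... | no x∉ = ⊥-elim (1+n≰n (≤-trans lt le))
  where
  lt : suc k ≤ ∑ (λ y → χ (Q? y))
  lt = subst (_≤ ∑ (λ y → χ (Q? y))) (count-∈ (x ∷ g) (∉⇒All x∉ ∷ u))
    (S-mono (fin n) (λ y → χ-mono (y ∈? (x ∷ g)) (Q? y) (λ { (here refl) → q ; (there m) → sub m })))

-- The first argument is a junk value for x outside the second.
at : Fin n' → Tuple n k → Tuple n' k → Fin n → Fin n'
at d []      []       x = d
at d (y ∷ a) (z ∷ b) x with x ≟ᶠ y
... | yes _ = z
... | no _  = at d a b x

at-lookup : (d : Fin n') (a : Tuple n k) (b : Tuple n' k) → Unique a → ∀ j → at d a b (lookup a j) ≡ lookup b j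
at-lookup d (y ∷ a) (z ∷ b) (p ∷ u) zero with y ≟ᶠ y
... | yes _ = refl
... | no ne = ⊥-elim (ne refl)
at-lookup d (y ∷ a) (z ∷ b) (p ∷ u) (suc j) with lookup a j ≟ᶠ y
... | yes q = ⊥-elim (All⇒∉ p (subst (_∈ a) q (∈-lookup j a)))
... | no _ = at-lookup d a b u j

zip-++ : ∀ {m k} (f : Tuple n m) (g : Tuple n' m) {q : Tuple n k} {q' : Tuple n' k} {x y} →
         Zip (f ++ q) (g ++ q') x y → Zip f g x y ⊎ Zip q q' x y
zip-++ []       []       z = inj₂ z
zip-++ (a ∷ f) (b ∷ g) (zero , e) = inj₁ (zero , e)
zip-++ (a ∷ f) (b ∷ g) (suc i , e) with zip-++ f g (i , e)
... | inj₁ (j , e') = inj₁ (suc j , e')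
... | inj₂ z = inj₂ z

same-zip : {G : LGraph n} {H : LGraph n'} {xs : Tuple n k} {ys : Tuple n' k} →
  (∀ {x y x' y'} → Zip xs ys x y → Zip xs ys x' y' → adj (graph G) x x' ≡ adj (graph H) y y') →
  (∀ {x y} → Zip xs ys x y → lab G x ≡ lab H y) → Same G xs H ys
same-zip a l = (λ i j → a (i , refl , refl) (j , refl , refl)) & (λ i → l (i , refl , refl))

map-lookup-same : {G : LGraph n} {H : LGraph n'} {g : Tuple n k} {t : Fin n → Fin n'} →
  (∀ {x x'} → x ∈ g → x' ∈ g → adj (graph G) x x' ≡ adj (graph H) (t x) (t x')) → (∀ {x} → x ∈ g → lab G x ≡ lab H (t x)) →
  Same G g H (map t g)
map-lookup-same {H = H} {g} {t} a l = (λ i j → trans (a (∈-lookup i g) (∈-lookup j g)) (cong₂ (adj (graph H)) (sym (lookup-map i t g)) (sym (lookup-map j t g))))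
  & (λ i → trans (l (∈-lookup i g)) (cong (lab H) (sym (lookup-map i t g))))

map-unique : {g : Tuple n k} {t : Fin n → Fin n'} → (∀ {x x'} → x ∈ g → x' ∈ g → t x ≡ t x' → x ≡ x') → Unique g → Unique (map t g)
map-unique {g = g} {t} inj u = unique-lookup (λ i j e → lookup-injective u i j (inj (∈-lookup i g) (∈-lookup j g)
  (trans (sym (lookup-map i t g)) (trans e (lookup-map j t g)))))

map-inj : {g h : Tuple n k} {t : Fin n → Fin n'} {S : Fin n → Set} → (∀ {x x'} → S x → S x' → t x ≡ t x' → x ≡ x') →
  (∀ {x} → x ∈ g → S x) → (∀ {x} → x ∈ h → S x) → map t g ≡ map t h → g ≡ h
map-inj {g = []} {[]} inj a b e = refl
map-inj {g = x ∷ g} {y ∷ h} inj a b e =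
  cong₂ _∷_ (inj (a (here refl)) (b (here refl)) (cong head e)) (map-inj inj (a ∘ there) (b ∘ there) (cong tail e))

∈-map⁻ : {g : Tuple n k} {t : Fin n → Fin n'} {z : Fin n'} → z ∈ map t g → ∃ λ x → x ∈ g × t x ≡ z
∈-map⁻ {g = x ∷ g} (here e)  = x , here refl , sym e
∈-map⁻ {g = x ∷ g} (there m) = let (y , p , q) = ∈-map⁻ m in y , there p , q

bool-iff : ∀ {a b : Bool} → (a ≡ true → b ≡ true) → (b ≡ true → a ≡ true) → a ≡ b
bool-iff {true}  {b}     p q = sym (p refl)
bool-iff {false} {true}  p q = q refl
bool-iff {false} {false} p q = refl

module Sub {n : ℕ} (G : LGraph n) {e : Bool} (R : Rooted (graph G) e) where
  private
    Γ = graph G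

  open Root R public

  -- A path inside the tuple can leave the subtree of y only through `par y`.
  grow-stays : {g : Tuple n k} → Grow Γ g → ∀ {y z} → z ∈ g → y ≼ z → par y ∉ g → ∀ {x} → x ∈ g → y ≼ x
  grow-stays {g = g} gr {y} z∈ p p∉ x∈ = let (_ , ps , sp , sub) = spath-in gr z∈ x∈ in along sp sub p
    where
    along : ∀ {m u v} {ps : Tuple n m} → SPath Γ u v ps → (∀ {x} → x ∈ ps → x ∈ g) → y ≼ u → y ≼ v
    along (end x) sub p = p
    along (link {y = w} a _ sp) sub p with ≼-adj p a
    ... | inj₁ q = along sp (sub ∘ there) q
    ... | inj₂ (_ , refl) = ⊥-elim (p∉ (sub (there (head-in sp))))
      where
      head-in : ∀ {m u v} {ps : Tuple n m} → SPath Γ u v ps → u ∈ ps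
      head-in (end x) = here refl
      head-in (link _ _ _) = here refl

  grow-below : {g : Tuple n k} → Grow Γ g → ∀ {y} → y ∈ g → par y ∉ g → ∀ {x} → x ∈ g → y ≼ x
  grow-below gr y∈ = grow-stays gr y∈ ≼-refl

  record Enum (y : Fin n) {k : ℕ} (f : Tuple n k) : Set where
    field
      grown  : Grow Γ f
      below  : ∀ {x} → x ∈ f → y ≼ x
      all-of : ∀ {x} → y ≼ x → x ∈ f
    uniq = grow-unique grown
    root-in : y ∈ f
    root-in = all-of ≼-refl
    len≡ : k ≡ size y
    len≡ = trans (sym (count-∈ f uniq)) (∑-cong (λ x → χ-cong (x ∈? f) (y ≼? x) below all-of))

  enum-from : ∀ y {k} (xs : Tuple n k) → Grow Γ xs → y ∈ xs → (∀ {x} → x ∈ xs → y ≼ x) →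
              ∃ λ m → Σ (Tuple n m) λ zs → Enum y (zs ++ xs)
  enum-from y xs g y∈ b with saturate Γ (y ≼?_) xs g
  ... | m , zs , g' , qs , c = m , zs , record
    { grown = g'
    ; below = λ p → bel (∈-++⁻ zs p)
    ; all-of = every }
    where
    bel : ∀ {x} → x ∈ zs ⊎ x ∈ xs → y ≼ x
    bel (inj₁ p) = qs p
    bel (inj₂ p) = b p
    every : ∀ {x} → y ≼ x → x ∈ (zs ++ xs)
    every ≼-refl = ∈-++⁺ʳ zs y∈
    every {x} (≼-step lt p) with ∈⇒lookup (every p)
    ... | i , q = c x (≼-step lt p) (i , trans (cong (adj Γ x) q) (adj← (up-par lt)))

  enum : ∀ y → ∃ λ k → Σ (Tuple n k) (Enum y)
  enum y = let (m , zs , en) = enum-from y (y ∷ []) (one y) (here refl) (λ { (here refl) → ≼-refl }) in m + 1 , zs ++ (y ∷ []) , en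

  -- Forbidding `par y` confines a connected occurrence at y to the subtree of y, and it does so by
  -- a condition on the vertices of the tuple and one vertex more.
  Occ : Pat k → Fin n → Tuple n k → Set
  Occ P y g = Unique g × Match G P g × lookup g (Pat.r P) ≡ y × par y ∉ g

  opaque
    occ? : (P : Pat k) (y : Fin n) (g : Tuple n k) → Dec (Occ P y g)
    occ? P y g = unique? g ×-dec (match? G P g ×-dec ((lookup g (Pat.r P) ≟ᶠ y) ×-dec ∉? (par y) g))

  occs : Pat k → Fin n → ℕ
  occs {k} P y = ∑ᵛ k (λ g → χ (occ? P y g))

  enum-root : ∀ {y} {f : Tuple n k} → Enum y f → ∃ λ i → lookup f i ≡ y
  enum-root en = ∈⇒lookup (Enum.root-in en)

  enum-pat : ∀ {y} {f : Tuple n k} → Enum y f → Pat k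
  enum-pat {f = f} en = patOf G f (proj₁ (enum-root en))

  occ-self : ∀ {y} {f : Tuple n k} (en : Enum y f) → par y ≢ y → Occ (enum-pat en) y f
  occ-self en ne = Enum.uniq en , ((λ i j → refl) , λ i → refl) , proj₂ (enum-root en) , λ m → par-not-below ne (Enum.below en m)

  -- The degree condition says that exactly one edge leaves g, and that it starts at the marked
  -- vertex.
  Limb : Pat k → Tuple n k → Set
  Limb P g = Unique g × Match G P g × (∀ j → deg Γ (lookup g j) ≡ vdeg Γ g (lookup g j) + χ (j ≟ᶠ Pat.r P))

  record Listing (y : Fin n) {k : ℕ} (f : Tuple n k) : Set where
    field
      uniq   : Unique f
      below  : ∀ {x} → x ∈ f → y ≼ x
      all-of : ∀ {x} → y ≼ x → x ∈ f
    len≡ : k ≡ size y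
    len≡ = trans (sym (count-∈ f uniq)) (∑-cong (λ x → χ-cong (x ∈? f) (y ≼? x) below all-of))

  listing : ∀ {y} {f : Tuple n k} → Enum y f → Listing y f
  listing en = record { uniq = Enum.uniq en ; below = Enum.below en ; all-of = Enum.all-of en }

  deg-below : ∀ {y} {f : Tuple n k} → Listing y f → par y ≢ y → ∀ {x} → y ≼ x →
              deg Γ x ≡ vdeg Γ f x + χ (x ≟ᶠ y)
  deg-below {y = y} {f} en ne {x} p with x ≟ᶠ y
  ... | no x≢y = trans (sym (vdeg≡deg Γ f (Listing.uniq en) x (λ z a → in-f z (≼-adj p a)))) (sym (+-identityʳ _))
    where
    in-f : ∀ z → y ≼ z ⊎ (x ≡ y × z ≡ par y) → z ∈ f
    in-f z (inj₁ q) = Listing.all-of en q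
    in-f z (inj₂ (e , _)) = ⊥-elim (x≢y e)
  ... | yes refl = trans (sym (vdeg≡deg Γ (par y ∷ f) (∉⇒All (λ m → par-not-below ne (Listing.below en m)) ∷ Listing.uniq en) y (λ z a → in-f z (≼-adj p a))))
      (trans (∑-cons _) (trans (cong (_+ vdeg Γ f y) (χ-yes (adj? Γ y (par y)) (adj← ne))) (+-comm 1 _)))
    where
    in-f : ∀ z → y ≼ z ⊎ (y ≡ y × z ≡ par y) → z ∈ (par y ∷ f)
    in-f z (inj₁ q) = there (Listing.all-of en q)
    in-f z (inj₂ (_ , e)) = here e

  LimbIn : Pat k → Fin n → Tuple n k → Set
  LimbIn P y g = Limb P g × (∀ j → y ≼ lookup g j)

  opaque
    limb? : (P : Pat k) (y : Fin n) (g : Tuple n k) → Dec (LimbIn P y g)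
    limb? P y g = (unique? g ×-dec (match? G P g ×-dec Finₚ.all? (λ j → deg Γ (lookup g j) ≟ vdeg Γ g (lookup g j) + χ (j ≟ᶠ Pat.r P))))
                  ×-dec Finₚ.all? (λ j → y ≼? lookup g j)

  limbs : Pat k → Fin n → ℕ
  limbs {k} P y = ∑ᵛ k (λ g → χ (limb? P y g))

  limb-self : ∀ {y} {f : Tuple n k} (en : Enum y f) → par y ≢ y → Limb (enum-pat en) f
  limb-self {y = y} {f} en ne = Enum.uniq en , ((λ i j → refl) , λ i → refl) , λ j →
    trans (deg-below (listing en) ne (Enum.below en (∈-lookup j f))) (cong (vdeg Γ f (lookup f j) +_)
      (χ-cong (lookup f j ≟ᶠ y) (j ≟ᶠ proj₁ (enum-root en))
        (λ q → lookup-injective (Enum.uniq en) j _ (trans q (sym (proj₂ (enum-root en))))) (λ { refl → proj₂ (enum-root en) })))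

module Pair {n n' : ℕ} (G : LGraph n) (H : LGraph n') {e : Bool} (R : Rooted (graph G) e) (R' : Rooted (graph H) e) where
  private
    module S = Sub G R
    module S' = Sub H R'

  -- The tuples may reach beyond the two subtrees, as long as the correspondence restricts to them.
  -- In the descent one pair of tuples, the matched part, thus serves all matched vertices of a
  -- level.
  record Twin (y : Fin n) (y' : Fin n') : Set where
    field
      {len}  : ℕ
      a      : Tuple n len
      b      : Tuple n' len
      ua     : Unique a
      ub     : Unique b
      same   : Same G a H b
      inA    : ∀ {x} → y S.≼ x → x ∈ a
      inB    : ∀ {x} → y' S'.≼ x → x ∈ b
      below→ : ∀ j → y S.≼ lookup a j → y' S'.≼ lookup b j
      below← : ∀ j → y' S'.≼ lookup b j → y S.≼ lookup a j
      i      : Fin len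
      a-i    : lookup a i ≡ y
      b-i    : lookup b i ≡ y'

  module _ {y y'} (tw : Twin y y') where
    open Twin tw

    tr : Fin n → Fin n'
    tr = at y' a b

    private
      place : ∀ {x} → y S.≼ x → ∃ λ j → lookup a j ≡ x × tr x ≡ lookup b j
      place p = let (j , q) = ∈⇒lookup (inA p) in j , q , trans (cong tr (sym q)) (at-lookup y' a b ua j)

    tr-below : ∀ {x} → y S.≼ x → y' S'.≼ tr x
    tr-below p with place p
    ... | j , refl , q = subst (y' S'.≼_) (sym q) (below→ j p)

    tr-inj : ∀ {x x'} → y S.≼ x → y S.≼ x' → tr x ≡ tr x' → x ≡ x'
    tr-inj p p' q with place p | place p'
    ... | j , refl , r | j' , refl , r' = cong (lookup a) (lookup-injective ub j j' (trans (sym r) (trans q r')))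

    tr-adj : ∀ {x x'} → y S.≼ x → y S.≼ x' → adj (graph G) x x' ≡ adj (graph H) (tr x) (tr x')
    tr-adj p p' with place p | place p'
    ... | j , refl , r | j' , refl , r' = trans (same-adj same j j') (cong₂ (adj (graph H)) (sym r) (sym r'))

    tr-lab : ∀ {x} → y S.≼ x → lab G x ≡ lab H (tr x)
    tr-lab p with place p
    ... | j , refl , r = trans (same-lab same j) (cong (lab H) (sym r))

    tr-root : tr y ≡ y'
    tr-root = trans (cong tr (sym a-i)) (trans (at-lookup y' a b ua i) b-i)

    tr-onto : ∀ {z} → y' S'.≼ z → ∃ λ x → y S.≼ x × tr x ≡ z
    tr-onto p with ∈⇒lookup (inB p)
    ... | j , refl = lookup a j , below← j p , at-lookup y' a b ua j

    module _ {k} {P : Pat k} (grows : ∀ {g} → Unique g → Match G P g → Grow (graph G) g) (ne' : S'.par y' ≢ y') where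

      occs-≤ : S.occs P y ≤ S'.occs P y'
      occs-≤ = S-inj-≤ (vec n k) (vec n' k) _ _ (map tr)
        (λ g h wg wh q → map-inj {S = y S.≼_} tr-inj (bel wg) (bel wh) q)
        (λ g w → ≤-trans (χ≤1 _) (≡⇒≤ (sym (χ-yes (S'.occ? P y' (map tr g)) (image w)))))
        where
        bel : ∀ {g} → χ (S.occ? P y g) ≢ 0 → ∀ {x} → x ∈ g → y S.≼ x
        bel {g} w with χ≢0 (S.occ? P y g) w
        ... | u , m , q , p∉ = S.grow-below (grows u m) (subst (_∈ g) q (∈-lookup (Pat.r P) g)) p∉
        image : ∀ {g} → χ (S.occ? P y g) ≢ 0 → S'.Occ P y' (map tr g)
        image {g} w with χ≢0 (S.occ? P y g) w
        ... | u , m , q , p∉ = map-unique (λ p p' → tr-inj (bel w p) (bel w p')) u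
          , same-match {G = G} {H} {P} (map-lookup-same (λ p p' → tr-adj (bel w p) (bel w p')) (λ p → tr-lab (bel w p))) m
          , trans (lookup-map (Pat.r P) tr g) (trans (cong tr q) tr-root)
          , λ z → let (x , x∈ , q') = ∈-map⁻ z in S'.par-not-below ne' (subst (y' S'.≼_) q' (tr-below (bel w x∈)))

    tr-vdeg : ∀ {k} (f : Tuple n k) → (∀ {x} → x ∈ f → y S.≼ x) → ∀ {x} → y S.≼ x →
              vdeg (graph G) f x ≡ vdeg (graph H) (map tr f) (tr x)
    tr-vdeg f bel p = ∑-cong (λ j → χ-cong (adj? (graph G) _ _) (adj? (graph H) _ _) (trans (sym (eq j))) (trans (eq j)))
      where
      eq : ∀ j → adj (graph G) _ (lookup f j) ≡ adj (graph H) (tr _) (lookup (map tr f) j)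
      eq j = trans (tr-adj p (bel (∈-lookup j f))) (cong (adj (graph H) (tr _)) (sym (lookup-map j tr f)))

    tr-listing : ∀ {k} {f : Tuple n k} → S.Listing y f → S'.Listing y' (map tr f)
    tr-listing {f = f} li = record
      { uniq = map-unique (λ p p' → tr-inj (below p) (below p')) uniq
      ; below = λ m → let (x , x∈ , q) = ∈-map⁻ m in subst (y' S'.≼_) q (tr-below (below x∈))
      ; all-of = λ p → let (x , q , r) = tr-onto p ; (j , e) = ∈⇒lookup (all-of q) in
                 subst (_∈ map tr f) (trans (lookup-map j tr f) (trans (cong tr e) r)) (∈-lookup j (map tr f)) }
      where open S.Listing li

    tr-deg : S.par y ≢ y → S'.par y' ≢ y' → ∀ {x} → y S.≼ x → deg (graph G) x ≡ deg (graph H) (tr x)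
    tr-deg ne ne' {x} p =
      let (k , f , en) = S.enum y ; li = S.listing en in
      trans (S.deg-below li ne p) (trans (cong₂ _+_ (tr-vdeg f (S.Listing.below li) p) (χ-cong (x ≟ᶠ y) (tr x ≟ᶠ y')
           (λ { refl → tr-root }) (λ q → tr-inj p S.≼-refl (trans q (sym tr-root)))))
         (sym (S'.deg-below (tr-listing li) ne' (tr-below p))))

    limbs-≤ : ∀ {k} {P : Pat k} → S.par y ≢ y → S'.par y' ≢ y' → S.limbs P y ≤ S'.limbs P y'
    limbs-≤ {k} {P} ne ne' = S-inj-≤ (vec n k) (vec n' k) _ _ (map tr)
        (λ g h wg wh q → map-inj {S = y S.≼_} tr-inj (bel wg) (bel wh) q)
        (λ g w → ≤-trans (χ≤1 _) (≡⇒≤ (sym (χ-yes (S'.limb? P y' (map tr g)) (image w)))))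
      where
      bel : ∀ {g} → χ (S.limb? P y g) ≢ 0 → ∀ {x} → x ∈ g → y S.≼ x
      bel {g} w {x} m = let (j , q) = ∈⇒lookup m in subst (y S.≼_) q (proj₂ (χ≢0 (S.limb? P y g) w) j)
      image : ∀ {g} → χ (S.limb? P y g) ≢ 0 → S'.LimbIn P y' (map tr g)
      image {g} w with χ≢0 (S.limb? P y g) w
      ... | (u , m , d) , _ = (map-unique (λ p p' → tr-inj (bel w p) (bel w p')) u
          , same-match {G = G} {H} {P} (map-lookup-same (λ p p' → tr-adj (bel w p) (bel w p')) (λ p → tr-lab (bel w p))) m
          , λ j → trans (cong (deg (graph H)) (lookup-map j tr g)) (trans (sym (tr-deg ne ne' (bel w (∈-lookup j g))))
              (trans (d j) (cong (_+ χ (j ≟ᶠ Pat.r P)) (trans (tr-vdeg g (bel w) (bel w (∈-lookup j g))) (cong (vdeg (graph H) (map tr g)) (sym (lookup-map j tr g))))))))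
          , λ j → subst (y' S'.≼_) (sym (lookup-map j tr g)) (tr-below (bel w (∈-lookup j g)))

  record Iso (y : Fin n) (y' : Fin n') : Set where
    field
      {len} : ℕ
      f     : Tuple n len
      g     : Tuple n' len
      lf    : S.Listing y f
      lg    : S'.Listing y' g
      same  : Same G f H g
      i     : Fin len
      f-i   : lookup f i ≡ y
      g-i   : lookup g i ≡ y'

  iso-twin : ∀ {y y'} → Iso y y' → Twin y y'
  iso-twin io = record { a = f ; b = g ; ua = S.Listing.uniq lf ; ub = S'.Listing.uniq lg ; same = same
    ; inA = S.Listing.all-of lf ; inB = S'.Listing.all-of lg
    ; below→ = λ j _ → S'.Listing.below lg (∈-lookup j g) ; below← = λ j _ → S.Listing.below lf (∈-lookup j f)
    ; i = i ; a-i = f-i ; b-i = g-i }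
    where open Iso io

  -- The occurrence lies below y' and has as many vertices as the branch of y, so it exhausts a
  -- branch that is no larger.
  occ-iso : ∀ {y y' k} {f : Tuple n k} (en : S.Enum y f) → S'.occs (S.enum-pat en) y' ≢ 0 → S'.size y' ≤ S.size y → Iso y y'
  occ-iso {y} {y'} {k} {f} en h le with ∑ᵛ-pos k _ h
  ... | g , w with χ≢0 (S'.occ? (S.enum-pat en) y' g) w
  ... | u , m , q , p∉ = record
    { f = f ; g = g ; lf = S.listing en
    ; lg = record { uniq = u ; below = bel ; all-of = subset-full (y' S'.≼?_) g u bel (≤-trans le (≡⇒≤ (sym (S.Enum.len≡ en)))) _ }
    ; same = sm ; i = proj₁ (S.enum-root en) ; f-i = proj₂ (S.enum-root en) ; g-i = q }
    where
    sm : Same G f H g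
    sm = match-same {G = G} {H} {S.enum-pat en} ((λ i j → refl) , λ i → refl) m
    bel : ∀ {x} → x ∈ g → y' S'.≼ x
    bel = S'.grow-below (grow-same sm u (S.Enum.grown en)) (subst (_∈ g) q (∈-lookup (proj₁ (S.enum-root en)) g)) p∉

  -- Once the limb fills the branch of y', its marked vertex must be y', the only vertex there with
  -- a neighbour outside.
  limb-iso : ∀ {y y' k} {f : Tuple n k} (en : S.Enum y f) → S'.par y' ≢ y' → S'.limbs (S.enum-pat en) y' ≢ 0 → S'.size y' ≤ S.size y → Iso y y'
  limb-iso {y} {y'} {k} {f} en ne h le with ∑ᵛ-pos k _ h
  ... | g , w with χ≢0 (S'.limb? (S.enum-pat en) y' g) w
  ... | (u , m , d) , b = record
    { f = f ; g = g ; lf = S.listing en ; lg = li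
    ; same = match-same {G = G} {H} {S.enum-pat en} ((λ i j → refl) , λ i → refl) m
    ; i = proj₁ (S.enum-root en) ; f-i = proj₂ (S.enum-root en) ; g-i = root }
    where
    bel : ∀ {x} → x ∈ g → y' S'.≼ x
    bel m = let (j , q) = ∈⇒lookup m in subst (y' S'.≼_) q (b j)
    li : S'.Listing y' g
    li = record { uniq = u ; below = bel ; all-of = subset-full (y' S'.≼?_) g u bel (≤-trans le (≡⇒≤ (sym (S.Enum.len≡ en)))) _ }
    root : lookup g (proj₁ (S.enum-root en)) ≡ y'
    root with ∈⇒lookup (S'.Listing.all-of li S'.≼-refl)
    ... | j , refl = cong (lookup g) (sym (χ≢0 (j ≟ᶠ _) (λ z → 1+n≢0 (trans (sym (χ-yes (lookup g j ≟ᶠ lookup g j) refl))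
          (trans (+-cancelˡ-≡ (vdeg (graph H) g (lookup g j)) _ _ (trans (sym (S'.deg-below li ne S'.≼-refl)) (d j))) z)))))

  module _ {y y'} (io : Iso y y') (ne : S.par y ≢ y) (ne' : S'.par y' ≢ y') (dy : S.dep y ≡ S'.dep y') where
    open Iso io
    private
      uf = S.Listing.uniq lf
      ug = S'.Listing.uniq lg
      idx : ∀ {x} → y S.≼ x → ∃ λ j → lookup f j ≡ x
      idx p = ∈⇒lookup (S.Listing.all-of lf p)

      record Deep (x : Fin n) : Set where
        constructor deep
        field
          dp : ∀ j → lookup f j ≡ x → S'.dep (lookup g j) ≡ S.dep x
          pp : x ≢ y → ∀ j l → lookup f j ≡ x → lookup f l ≡ S.par x → lookup g l ≡ S'.par (lookup g j)
      open Deep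

      go : ∀ {x} → y S.≼ x → Deep x
      go S.≼-refl = deep (λ j q → trans (cong S'.dep (trans (cong (lookup g) (lookup-injective uf j i (trans q (sym f-i)))) g-i)) (sym dy)) (λ h → ⊥-elim (h refl))
      go {x} (S.≼-step lt p) = deep dpx (λ _ → ppx)
        where
        ih = go p
        x≢y : x ≢ y
        x≢y refl = 1+n≰n (≤-trans (≡⇒≤ (sym (S.up x lt))) (S.≼-dep p))
        ppx : ∀ j l → lookup f j ≡ x → lookup f l ≡ S.par x → lookup g l ≡ S'.par (lookup g j)
        ppx j l refl ql with S'.adj→ (trans (sym (same-adj same j l)) (trans (cong (adj (graph G) x) ql) (S.adj← (S.up-par lt))))
        ... | inj₂ q = q
        ... | inj₁ q with S.par x ≟ᶠ y
        ...   | yes py = ⊥-elim (S'.par-not-below ne' (subst (y' S'.≼_) (trans q (cong S'.par (trans (cong (lookup g) (lookup-injective uf l i (trans ql (trans py (sym f-i))))) g-i)))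
                                 (S'.Listing.below lg (∈-lookup j g))))
        ...   | no npy with S.≼-up p npy
        ...     | lt2 , p2 with idx p2
        ...       | l2 , q2 with lookup-injective ug l2 j (trans (pp ih npy l l2 ql q2) (sym q))
        ...         | refl = ⊥-elim (m≢1+n+m (S.dep (S.par (S.par x))) {1} (trans (cong S.dep (sym q2)) (trans (S.up x lt) (cong suc (S.up (S.par x) lt2)))))
        dpx : ∀ j → lookup f j ≡ x → S'.dep (lookup g j) ≡ S.dep x
        dpx j refl with idx p
        ... | l , ql = trans (S'.up (lookup g j) (S'.low nb)) (trans (cong suc (trans (cong S'.dep (sym (ppx j l refl ql))) (dp ih l ql))) (sym (S.up x lt)))
          where
          nb : S'.dep (lookup g j) ≢ base e
          nb z = x≢y (trans (cong (lookup f) (lookup-injective ug j i (trans (sym (S'.≼-dep-eq (S'.Listing.below lg (∈-lookup j g)) (≤-trans (≡⇒≤ z) (S'.dep≥ y')))) (sym g-i)))) f-i)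

    -- By induction away from y, parents correspond to parents. If the image of x were the parent of
    -- the image of `par x`, it would be the image of the grandparent of x, or, when `par x` is y,
    -- lie outside the branch.
    iso-dep : ∀ j → S.dep (lookup f j) ≡ S'.dep (lookup g j)
    iso-dep j = sym (dp (go (S.Listing.below lf (∈-lookup j f))) j refl)

  record State : Set where
    field
      {len} : ℕ
      q     : Tuple n len
      q'    : Tuple n' len
      uq    : Unique q
      uq'   : Unique q'
      same  : Same G q H q'
      deps  : ∀ i → S.dep (lookup q i) ≡ S'.dep (lookup q' i)

  -- Stated over matched pairs, so that both parents may still be unmatched, as with a root that is
  -- added last.
  Aligned : State → Fin n → Fin n' → Set
  Aligned st y y' = ∀ {x x'} → Zip (State.q st) (State.q' st) x x' → (x ≡ S.par y → x' ≡ S'.par y') × (x' ≡ S'.par y' → x ≡ S.par y)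

  module Extend (st : State) {y y'} (io : Iso y y') (ne : S.par y ≢ y) (ne' : S'.par y' ≢ y') (dy : S.dep y ≡ S'.dep y')
    (dis : ∀ {x} → x ∈ State.q st → ¬ (y S.≼ x)) (dis' : ∀ {x} → x ∈ State.q' st → ¬ (y' S'.≼ x)) (al : Aligned st y y') where
    open State st
    open Iso io using (f; g; lf; lg; i; f-i; g-i)

    private
      uf = S.Listing.uniq lf
      ug = S'.Listing.uniq lg

      cross : ∀ {x z x' z'} → Zip f g x x' → Zip q q' z z' → adj (graph G) x z ≡ adj (graph H) x' z'
      cross (a , refl , refl) (b , refl , refl) = bool-iff to from
        where
        to : Adj (graph G) (lookup f a) (lookup q b) → Adj (graph H) (lookup g a) (lookup q' b)
        to ad with S.≼-adj (S.Listing.below lf (∈-lookup a f)) ad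
        ... | inj₁ p = ⊥-elim (dis (∈-lookup b q) p)
        ... | inj₂ (ey , ep) with lookup-injective uf a i (trans ey (sym f-i))
        ...   | refl = subst₂ (Adj (graph H)) (sym g-i) (sym (proj₁ (al (b , refl , refl)) ep)) (S'.adj← ne')
        from : Adj (graph H) (lookup g a) (lookup q' b) → Adj (graph G) (lookup f a) (lookup q b)
        from ad with S'.≼-adj (S'.Listing.below lg (∈-lookup a g)) ad
        ... | inj₁ p = ⊥-elim (dis' (∈-lookup b q') p)
        ... | inj₂ (ey , ep) with lookup-injective ug a i (trans ey (sym g-i))
        ...   | refl = subst₂ (Adj (graph G)) (sym f-i) (sym (proj₂ (al (b , refl , refl)) ep)) (S.adj← ne)

      lookup-deps : ∀ {x x'} → Zip f g x x' ⊎ Zip q q' x x' → S.dep x ≡ S'.dep x'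
      lookup-deps (inj₁ (j , refl , refl)) = iso-dep io ne ne' dy j
      lookup-deps (inj₂ (j , refl , refl)) = deps j

    extended : State
    extended = record
      { q = f ++ q ; q' = g ++ q'
      ; uq = unique-++ (graph G) f uq uf (λ p p' → dis p' (S.Listing.below lf p))
      ; uq' = unique-++ (graph H) g uq' ug (λ p p' → dis' p' (S'.Listing.below lg p))
      ; same = same-zip (λ z z' → adjs≡ (zip-++ f g z) (zip-++ f g z')) (λ z → labs (zip-++ f g z))
      ; deps = λ j → lookup-deps (zip-++ f g (j , refl , refl)) }
      where
      adjs≡ : ∀ {x z x' z'} → Zip f g x x' ⊎ Zip q q' x x' → Zip f g z z' ⊎ Zip q q' z z' → adj (graph G) x z ≡ adj (graph H) x' z'
      adjs≡ (inj₁ (a , refl , refl)) (inj₁ (b , refl , refl)) = same-adj (Iso.same io) a b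
      adjs≡ (inj₂ (a , refl , refl)) (inj₂ (b , refl , refl)) = same-adj same a b
      adjs≡ (inj₁ z) (inj₂ z') = cross z z'
      adjs≡ {x} {z} {x'} {z'} (inj₂ w) (inj₁ w') = trans (adj-sym (graph G) x z) (trans (cross w' w) (adj-sym (graph H) z' x'))
      labs : ∀ {x x'} → Zip f g x x' ⊎ Zip q q' x x' → lab G x ≡ lab H x'
      labs (inj₁ (j , refl , refl)) = same-lab (Iso.same io) j
      labs (inj₂ (j , refl , refl)) = same-lab same j

  -- Only connected occurrences are confined to a branch, so occurrences can be carried between
  -- isomorphic branches only for such patterns.
  Good : Pat k → Set
  Good P = (∀ {g} → Unique g → Match G P g → Grow (graph G) g) × (∀ {h} → Unique h → Match H P h → Grow (graph H) h)

  good : ∀ {y k} {f : Tuple n k} (en : S.Enum y f) → Good (S.enum-pat en)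
  good {f = f} en = (λ u m → grow-same (match-same {G = G} {G} {S.enum-pat en} ((λ i j → refl) , λ i → refl) m) u (S.Enum.grown en))
          , (λ u m → grow-same (match-same {G = G} {H} {S.enum-pat en} ((λ i j → refl) , λ i → refl) m) u (S.Enum.grown en))

  good' : ∀ {y k} {f : Tuple n' k} (en : S'.Enum y f) → Good (S'.enum-pat en)
  good' {f = f} en = (λ u m → grow-same (match-same {G = H} {G} {S'.enum-pat en} ((λ i j → refl) , λ i → refl) m) u (S'.Enum.grown en))
          , (λ u m → grow-same (match-same {G = H} {H} {S'.enum-pat en} ((λ i j → refl) , λ i → refl) m) u (S'.Enum.grown en))

-- Greedy matching of branches

on : (Fin n → Bool) → Fin n → ℕ
on β x = χ (β x ≟ᵇ true)

without : (Fin n → Bool) → Fin n → Fin n → Bool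
without β y x with x ≟ᶠ y
... | yes _ = false
... | no _  = β x

without-on : (β : Fin n → Bool) → ∀ y {x} → without β y x ≡ true → β x ≡ true × x ≢ y
without-on β y {x} p with x ≟ᶠ y
without-on β y {x} () | yes _
... | no ne = p , ne

on-without : (β : Fin n → Bool) → ∀ {y x} → β x ≡ true → x ≢ y → without β y x ≡ true
on-without β {y} {x} p ne with x ≟ᶠ y
... | yes q = ⊥-elim (ne q)
... | no _  = p

on-split : (β : Fin n → Bool) (w : Fin n → ℕ) → ∀ y → β y ≡ true →
           ∑ (λ x → on β x * w x) ≡ w y + ∑ (λ x → on (without β y) x * w x)
on-split {n} β w y b = trans (∑-cong pt) (trans (S-+ (fin n) _ _) (cong (_+ ∑ (λ x → on (without β y) x * w x)) (∑-δ y w)))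
  where
  pt : ∀ x → on β x * w x ≡ χ (y ≟ᶠ x) * w x + on (without β y) x * w x
  pt x with x ≟ᶠ y
  ... | yes refl = trans (trans (cong (_* w x) (χ-yes (β x ≟ᵇ true) b)) (sym (cong (_* w x) (χ-yes (x ≟ᶠ x) refl)))) (sym (+-identityʳ _))
  ... | no ne = sym (cong (_+ on β x * w x) (cong (_* w x) (χ-no (y ≟ᶠ x) (ne ∘ sym))))

on-≥ : (β : Fin n → Bool) (w : Fin n → ℕ) → ∀ {y} → β y ≡ true → w y ≢ 0 → ∑ (λ x → on β x * w x) ≢ 0
on-≥ β w {y} b h z = h (m+n≡0⇒m≡0 (w y) (trans (sym (on-split β w y b)) z))

on-pos : (β : Fin n → Bool) (w : Fin n → ℕ) → ∑ (λ x → on β x * w x) ≢ 0 → ∃ λ x → β x ≡ true × w x ≢ 0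
on-pos β w h = let (x , p) = ∑-pos _ h in x , χ≢0 (β x ≟ᵇ true) (*≢0ˡ _ p) , *≢0ʳ (on β x) p

largest : (β : Fin n → Bool) (sz : Fin n → ℕ) → (∀ x → sz x ≤ n) → (∃ λ y → β y ≡ true) →
          ∃ λ y → β y ≡ true × (∀ z → β z ≡ true → sz z ≤ sz y)
largest {n} β sz bound (y , b) = go n y b (m≤n+m n _)
  where
  go : ∀ d y → β y ≡ true → n ≤ sz y + d → ∃ λ y → β y ≡ true × (∀ z → β z ≡ true → sz z ≤ sz y)
  go d y b e with Finₚ.any? (λ z → (β z ≟ᵇ true) ×-dec (sz y <? sz z))
  ... | no none = y , b , λ z bz → ≮⇒≥ (λ lt → none (z , bz , lt))
  go zero y b e | yes (z , bz , lt) = ⊥-elim (1+n≰n (≤-trans lt (≤-trans (bound z) (≤-trans e (≡⇒≤ (+-identityʳ _))))))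
  go (suc d) y b e | yes (z , bz , lt) = go d z bz
    (lia (sz z ∷ sz y ∷ d ∷ n ∷ []) (λ z y d n → y :< z ∷ n :≤ y :+ (con 1 :+ d) ∷ [] ⊢ n :≤ z :+ d) (lt , e , tt))

-- Only the other end of a central edge is both a sibling of y and the parent of a vertex below y's level.
sibling-par : {G : Graph n} {e : Bool} (R : Rooted G e) → let open Root R in
  ∀ {x y z} → y ≼ x → dep z ≡ dep y → z ≢ y → x ≡ par z → x ≡ y × dep y ≡ base e
sibling-par {e = e} R {x} {y} {z} p dz ne q with base e <? Root.dep R z
... | yes lt = ⊥-elim (1+n≰n (≤-trans (≡⇒≤ (trans (cong (suc ∘ dep) q) (trans (sym (up z lt)) dz))) (≼-dep p)))
  where open Root R
... | no ¬lt = sym (≼-dep-eq p (≡⇒≤ (trans (cong dep q) (trans (top-dep z t) (trans (sym t) dz))))) , trans (sym dz) t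
  where
  open Root R
  t = ≤-antisym (≮⇒≥ ¬lt) (dep≥ z)

other-top : {G : Graph n} {e : Bool} (R : Rooted G e) → ∀ {y z d} → d ≡ Root.dep R y → z ≢ y → Root.dep R z ≡ Root.dep R y → d ≡ base e → y ≡ Root.par R z
other-top R {y} {z} dy ne dz t with Root.tops R y z (trans (sym dy) t) (trans dz (trans (sym dy) t))
... | inj₁ q = ⊥-elim (ne (sym q))
... | inj₂ q = q

module Greedy {n n' : ℕ} (G : LGraph n) (H : LGraph n') {e : Bool} (R : Rooted (graph G) e) (R' : Rooted (graph H) e) where
  open Pair G H R R'
  private
    module S = Sub G R
    module S' = Sub H R'

  record Extension (st : State) (β : Fin n → Bool) (β' : Fin n' → Bool) : Set where
    field
      new  : State
      old  : ∀ {x x'} → Zip (State.q st) (State.q' st) x x' → Zip (State.q new) (State.q' new) x x'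
      in-q  : ∀ {y x} → β y ≡ true → y S.≼ x → x ∈ State.q new
      in-q' : ∀ {y x} → β' y ≡ true → y S'.≼ x → x ∈ State.q' new
      q-in  : ∀ {x} → x ∈ State.q new → x ∈ State.q st ⊎ (∃ λ y → β y ≡ true × y S.≼ x)
      q-in' : ∀ {x} → x ∈ State.q' new → x ∈ State.q' st ⊎ (∃ λ y → β' y ≡ true × y S'.≼ x)

  -- Common to limbs and occurrences. By `w1` a branch contains its own pattern, by `w2` a branch
  -- pattern found in a branch that is no larger gives an isomorphism, and by `w3` isomorphic
  -- branches have equal weights. `F` is the family of patterns for which the total weights are
  -- known to agree.
  module Weighted (W : ∀ {k} → Pat k → Fin n → ℕ) (W' : ∀ {k} → Pat k → Fin n' → ℕ)
    (enum  : ∀ y → ∃ λ k → Σ (Tuple n k) (S.Enum y)) (enum' : ∀ y → ∃ λ k → Σ (Tuple n' k) (S'.Enum y))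
    (w1 : ∀ {y k} {f : Tuple n k} (en : S.Enum y f) → S.par y ≢ y → W (S.enum-pat en) y ≢ 0)
    (w1' : ∀ {y k} {f : Tuple n' k} (en : S'.Enum y f) → S'.par y ≢ y → W' (S'.enum-pat en) y ≢ 0)
    (w2 : ∀ {y y' k} {f : Tuple n k} (en : S.Enum y f) → S'.par y' ≢ y' → W' (S.enum-pat en) y' ≢ 0 → S'.size y' ≤ S.size y → Iso y y')
    (w2' : ∀ {y y' k} {f : Tuple n' k} (en : S'.Enum y' f) → S.par y ≢ y → W (S'.enum-pat en) y ≢ 0 → S.size y ≤ S'.size y' → Iso y y')
    (w3 : ∀ {y y'} → Iso y y' → S.par y ≢ y → S'.par y' ≢ y' → ∀ {k} (P : Pat k) → Good P → W P y ≡ W' P y')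
    (D : ℕ) (F : ∀ {k} → Pat k → Set) where

    record Ready (st : State) (β : Fin n → Bool) (β' : Fin n' → Bool) : Set where
      open State st
      field
        ne    : ∀ {y} → β y ≡ true → S.par y ≢ y
        ne'   : ∀ {y} → β' y ≡ true → S'.par y ≢ y
        depD  : ∀ {y} → β y ≡ true → S.dep y ≡ D
        depD' : ∀ {y} → β' y ≡ true → S'.dep y ≡ D
        apart  : ∀ {y x} → β y ≡ true → x ∈ q → ¬ (y S.≼ x)
        apart' : ∀ {y x} → β' y ≡ true → x ∈ q' → ¬ (y S'.≼ x)
        al    : ∀ {y y'} → β y ≡ true → β' y' ≡ true → Aligned st y y'
        fam   : ∀ {y} → β y ≡ true → F (S.enum-pat (proj₂ (proj₂ (enum y))))
        fam'  : ∀ {y} → β' y ≡ true → F (S'.enum-pat (proj₂ (proj₂ (enum' y))))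
        sums  : ∀ {k} (P : Pat k) → Good P → F P → ∑ (λ x → on β x * W P x) ≡ ∑ (λ x → on β' x * W' P x)

    private
      zip-right : ∀ {m k} (f : Tuple n m) (g : Tuple n' m) {q : Tuple n k} {q' : Tuple n' k} {x y} →
                  Zip q q' x y → Zip (f ++ q) (g ++ q') x y
      zip-right []      []      z = z
      zip-right (a ∷ f) (b ∷ g) z = let (i , e) = zip-right f g z in suc i , e

      module Step (st : State) (β : Fin n → Bool) (β' : Fin n' → Bool) (rd : Ready st β β')
        {y y'} (by : β y ≡ true) (by' : β' y' ≡ true) (io : Iso y y') where
        open Ready rd
        dy = trans (depD by) (sym (depD' by'))
        module E = Extend st io (ne by) (ne' by') dy (apart by) (apart' by') (al by by')
        open Iso io

        st+ = E.extended
        β- = without β y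
        β'- = without β' y'

        sep : ∀ {z x} → β- z ≡ true → y S.≼ x → ¬ (z S.≼ x)
        sep bz p q = let (b , h) = without-on β y bz in h (S.≼-linear q p (trans (depD b) (sym (depD by))))

        sep' : ∀ {z x} → β'- z ≡ true → y' S'.≼ x → ¬ (z S'.≼ x)
        sep' bz p q = let (b , h) = without-on β' y' bz in h (S'.≼-linear q p (trans (depD' b) (sym (depD' by'))))

        al+ : ∀ {z z'} → β- z ≡ true → β'- z' ≡ true → Aligned st+ z z'
        al+ {z} {z'} bz bz' zp with zip-++ f g zp
        ... | inj₂ w = al (proj₁ (without-on β y bz)) (proj₁ (without-on β' y' bz')) w
        ... | inj₁ (j , refl , refl) =
            (λ q → let (jy , p) = sibling-par R (S.Listing.below lf (∈-lookup j f)) (level bz) (proj₂ (without-on β y bz)) q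
                   in trans (trans (cong (lookup g) (lookup-injective (S.Listing.uniq lf) j i (trans jy (sym f-i)))) g-i) (other-top R' dy (proj₂ (without-on β' y' bz')) (level' bz') p))
          , (λ q → let (jy , p) = sibling-par R' (S'.Listing.below lg (∈-lookup j g)) (level' bz') (proj₂ (without-on β' y' bz')) q
                   in trans (trans (cong (lookup f) (lookup-injective (S'.Listing.uniq lg) j i (trans jy (sym g-i)))) f-i) (other-top R (sym dy) (proj₂ (without-on β y bz)) (level bz) p))
          where
          level : ∀ {z} → β- z ≡ true → S.dep z ≡ S.dep y
          level b = trans (depD (proj₁ (without-on β y b))) (sym (depD by))
          level' : ∀ {z} → β'- z ≡ true → S'.dep z ≡ S'.dep y'
          level' b = trans (depD' (proj₁ (without-on β' y' b))) (sym (depD' by'))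

        ready+ : Ready st+ β- β'-
        ready+ = record
          { ne = ne ∘ proj₁ ∘ without-on β y ; ne' = ne' ∘ proj₁ ∘ without-on β' y'
          ; depD = depD ∘ proj₁ ∘ without-on β y ; depD' = depD' ∘ proj₁ ∘ without-on β' y'
          ; apart = λ bz m → ap bz (∈-++⁻ f m) ; apart' = λ bz m → ap' bz (∈-++⁻ g m)
          ; al = al+
          ; fam = λ b → fam (proj₁ (without-on β y b)) ; fam' = λ b → fam' (proj₁ (without-on β' y' b))
          -- The matched branches contribute equally by `w3` and are cancelled from both totals.
          ; sums = λ P gd fp → +-cancelˡ-≡ (W P y) _ _ (trans (sym (on-split β (W P) y by)) (trans (sums P gd fp)
              (trans (on-split β' (W' P) y' by') (cong (_+ ∑ (λ x → on β'- x * W' P x)) (sym (w3 io (ne by) (ne' by') P gd)))))) }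
          where
          ap : ∀ {z x} → β- z ≡ true → x ∈ f ⊎ x ∈ State.q st → ¬ (z S.≼ x)
          ap bz (inj₁ m) = sep bz (S.Listing.below lf m)
          ap bz (inj₂ m) = apart (proj₁ (without-on β y bz)) m
          ap' : ∀ {z x} → β'- z ≡ true → x ∈ g ⊎ x ∈ State.q' st → ¬ (z S'.≼ x)
          ap' bz (inj₁ m) = sep' bz (S'.Listing.below lg m)
          ap' bz (inj₂ m) = apart' (proj₁ (without-on β' y' bz)) m

        extend : Extension st+ β- β'- → Extension st β β'
        extend ex = record
          { new = new
          ; old = λ z → old (zip-right f g z)
          ; in-q = λ {z} bz p → case-in bz p (z ≟ᶠ y)
          ; in-q' = λ {z} bz p → case-in' bz p (z ≟ᶠ y')
          ; q-in = λ m → out (q-in m) ; q-in' = λ m → out' (q-in' m) }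
          where
          open Extension ex
          fromzip : ∀ {x} → x ∈ (f ++ State.q st) → x ∈ State.q new
          fromzip m = let (j , e) = ∈⇒lookup m ; (l , e' , _) = old (j , refl , refl) in subst (_∈ State.q new) (trans e' e) (∈-lookup l (State.q new))
          fromzip' : ∀ {x} → x ∈ (g ++ State.q' st) → x ∈ State.q' new
          fromzip' m = let (j , e) = ∈⇒lookup m ; (l , _ , e') = old (j , refl , refl) in subst (_∈ State.q' new) (trans e' e) (∈-lookup l (State.q' new))
          case-in : ∀ {z x} → β z ≡ true → z S.≼ x → Dec (z ≡ y) → x ∈ State.q new
          case-in bz p (yes refl) = fromzip (∈-++⁺ˡ (S.Listing.all-of lf p))
          case-in bz p (no h) = in-q (on-without β bz h) p
          case-in' : ∀ {z x} → β' z ≡ true → z S'.≼ x → Dec (z ≡ y') → x ∈ State.q' new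
          case-in' bz p (yes refl) = fromzip' (∈-++⁺ˡ (S'.Listing.all-of lg p))
          case-in' bz p (no h) = in-q' (on-without β' bz h) p
          out : ∀ {x} → x ∈ (f ++ State.q st) ⊎ (∃ λ z → β- z ≡ true × z S.≼ x) → x ∈ State.q st ⊎ (∃ λ z → β z ≡ true × z S.≼ x)
          out (inj₂ (z , b , p)) = inj₂ (z , proj₁ (without-on β y b) , p)
          out (inj₁ m) with ∈-++⁻ f m
          ... | inj₁ p = inj₂ (y , by , S.Listing.below lf p)
          ... | inj₂ p = inj₁ p
          out' : ∀ {x} → x ∈ (g ++ State.q' st) ⊎ (∃ λ z → β'- z ≡ true × z S'.≼ x) → x ∈ State.q' st ⊎ (∃ λ z → β' z ≡ true × z S'.≼ x)
          out' (inj₂ (z , b , p)) = inj₂ (z , proj₁ (without-on β' y' b) , p)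
          out' (inj₁ m) with ∈-++⁻ g m
          ... | inj₁ p = inj₂ (y' , by' , S'.Listing.below lg p)
          ... | inj₂ p = inj₁ p

      card-on : (Fin n → Bool) → ℕ
      card-on β = ∑ (λ x → on β x)

      card-without : ∀ β {y} → β y ≡ true → card-on β ≡ suc (card-on (without β y))
      card-without β {y} b = trans (∑-cong (λ x → sym (*-identityʳ _))) (trans (on-split β (λ _ → 1) y b) (cong suc (∑-cong (λ x → *-identityʳ _))))

      size≤ : ∀ x → S.size x ≤ n
      size≤ x = ≤-trans (S-mono (fin n) (λ z → χ≤1 (x S.≼? z))) (≡⇒≤ (∑-one n))
      size≤' : ∀ x → S'.size x ≤ n'
      size≤' x = ≤-trans (S-mono (fin n') (λ z → χ≤1 (x S'.≼? z))) (≡⇒≤ (∑-one n'))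

      go : ∀ d st β β' → card-on β ≤ d → Ready st β β' → Extension st β β'
      -- Take the largest unmatched branch of both sides together. Its pattern has a positive total
      -- on its own side, hence on the other, where it occurs in an unmatched branch that is no
      -- larger.
      partner : ∀ st β β' → Ready st β β' → (∃ λ y → β y ≡ true) ⊎ (∃ λ y → β' y ≡ true) →
                ∃ λ y → ∃ λ y' → β y ≡ true × β' y' ≡ true × Iso y y'
      go d st β β' le rd with Finₚ.any? (λ y → β y ≟ᵇ true) | Finₚ.any? (λ y → β' y ≟ᵇ true)
      ... | no h | no h' = record { new = st ; old = λ z → z ; in-q = λ b _ → ⊥-elim (h (_ , b)) ; in-q' = λ b _ → ⊥-elim (h' (_ , b)) ; q-in = inj₁ ; q-in' = inj₁ }
      ... | yes (y , b) | _ with partner st β β' rd (inj₁ (y , b))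
      ...   | y , y' , by , by' , io with d
      ...     | zero = ⊥-elim (1+n≰n (≤-trans (s≤s z≤n) (≤-trans (≡⇒≤ (sym (card-without β by))) le)))
      ...     | suc d = Step.extend st β β' rd by by' io (go d _ _ _ (s≤s⁻¹ (≤-trans (≡⇒≤ (sym (card-without β by))) le)) (Step.ready+ st β β' rd by by' io))
      go d st β β' le rd | no h | yes (y' , b') with partner st β β' rd (inj₂ (y' , b'))
      ... | y , _ , by , _ = ⊥-elim (h (y , by))

      partner st β β' rd some with Finₚ.any? (λ y → β y ≟ᵇ true) | Finₚ.any? (λ y → β' y ≟ᵇ true)
      ... | no h | no h' = ⊥-elim (neither some)
        where
        neither : _ ⊎ _ → ⊥
        neither (inj₁ p) = h p
        neither (inj₂ p) = h' p
      ... | yes p | no h' = let (y , by) = p ; (k , f , en) = enum y in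
            ⊥-elim (on-≥ β (W (S.enum-pat en)) by (w1 en (ne by)) (trans (sums _ (good en) (fam by))
              (S-zero (fin n') (λ x → cong (_* W' (S.enum-pat en) x) (χ-no (β' x ≟ᵇ true) (λ b → h' (x , b)))))))
        where open Ready rd
      ... | no h | yes p' = let (y , by) = p' ; (k , f , en) = enum' y in
            ⊥-elim (on-≥ β' (W' (S'.enum-pat en)) by (w1' en (ne' by)) (trans (sym (sums _ (good' en) (fam' by)))
              (S-zero (fin n) (λ x → cong (_* W (S'.enum-pat en) x) (χ-no (β x ≟ᵇ true) (λ b → h (x , b)))))))
        where open Ready rd
      ... | yes p | yes p' with largest β S.size size≤ p | largest β' S'.size size≤' p'
      ...   | y , by , my | y' , by' , my' with S'.size y' ≤? S.size y
      ...     | yes le = let (k , f , en) = enum y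
                             (z , bz , wz) = on-pos β' (W' (S.enum-pat en)) (λ q → on-≥ β (W (S.enum-pat en)) by (w1 en (ne by)) (trans (sums _ (good en) (fam by)) q))
                         in y , z , by , bz , w2 en (ne' bz) wz (≤-trans (my' z bz) le)
        where open Ready rd
      ...     | no gt = let (k , f , en) = enum' y'
                            (z , bz , wz) = on-pos β (W (S'.enum-pat en)) (λ q → on-≥ β' (W' (S'.enum-pat en)) by' (w1' en (ne' by')) (trans (sym (sums _ (good' en) (fam' by'))) q))
                        in z , y' , bz , by' , w2' en (ne bz) wz (≤-trans (my z bz) (<⇒≤ (≰⇒> gt)))
        where open Ready rd

    opaque
      greedy : ∀ {st β β'} → Ready st β β' → Extension st β β'
      greedy {st} {β} {β'} rd = go n st β β' (≤-trans (S-mono (fin n) (λ x → χ≤1 (β x ≟ᵇ true))) (≡⇒≤ (∑-one n))) rd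

module _ {G : LGraph n} {H : LGraph n'} {e : Bool} {R : Rooted (graph G) e} {R' : Rooted (graph H) e} where
  private
    module P = Pair G H R R'
    module P' = Pair H G R' R

  twin-flip : ∀ {y y'} → P.Twin y y' → P'.Twin y' y
  twin-flip t = record { a = b ; b = a ; ua = ub ; ub = ua ; same = same-flip same ; inA = inB ; inB = inA
    ; below→ = below← ; below← = below→ ; i = i ; a-i = b-i ; b-i = a-i }
    where open P.Twin t

  iso-flip : ∀ {y y'} → P.Iso y y' → P'.Iso y' y
  iso-flip t = record { f = g ; g = f ; lf = lg ; lg = lf ; same = same-flip same ; i = i ; f-i = g-i ; g-i = f-i }
    where open P.Iso t

module _ (G : LGraph n) (H : LGraph n') {e : Bool} (R : Rooted (graph G) e) (R' : Rooted (graph H) e) where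
  private
    module S = Sub G R
    module S' = Sub H R'
    module P = Pair G H R R'
    module P' = Pair H G R' R

  limbs-≡ : ∀ {y y'} → P.Twin y y' → S.par y ≢ y → S'.par y' ≢ y' → ∀ {k} (Q : Pat k) → S.limbs Q y ≡ S'.limbs Q y'
  limbs-≡ t ne ne' Q = ≤-antisym (P.limbs-≤ t {P = Q} ne ne') (P'.limbs-≤ (twin-flip t) {P = Q} ne' ne)

  occs-≡ : ∀ {y y'} → P.Twin y y' → S.par y ≢ y → S'.par y' ≢ y' → ∀ {k} (Q : Pat k) → P.Good Q → S.occs Q y ≡ S'.occs Q y'
  occs-≡ t ne ne' Q (gr , gr') = ≤-antisym (P.occs-≤ t {P = Q} gr ne') (P'.occs-≤ (twin-flip t) {P = Q} gr' ne)

module LimbGreedy {n n' : ℕ} (G : LGraph n) (H : LGraph n') {e : Bool} (R : Rooted (graph G) e) (R' : Rooted (graph H) e) =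
  Greedy.Weighted G H R R' (Sub.limbs G R) (Sub.limbs H R') (Sub.enum G R) (Sub.enum H R')
    (λ {y} en ne z → χ-pos (Sub.limb? G R _ y _) (Sub.limb-self G R en ne , λ j → Sub.Enum.below en (∈-lookup j _))
       (n≤0⇒n≡0 (≤-trans (S-≥ (vec n _) _ (λ g → χ (Sub.limb? G R _ y g))) (≡⇒≤ z))))
    (λ {y} en ne z → χ-pos (Sub.limb? H R' _ y _) (Sub.limb-self H R' en ne , λ j → Sub.Enum.below en (∈-lookup j _))
       (n≤0⇒n≡0 (≤-trans (S-≥ (vec n' _) _ (λ g → χ (Sub.limb? H R' _ y g))) (≡⇒≤ z))))
    (λ en ne' → Pair.limb-iso G H R R' en ne')
    (λ en ne h le → iso-flip (Pair.limb-iso H G R' R en ne h le))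
    (λ io ne ne' P _ → limbs-≡ G H R R' (Pair.iso-twin G H R R' io) ne ne' P)

module OccGreedy {n n' : ℕ} (G : LGraph n) (H : LGraph n') {e : Bool} (R : Rooted (graph G) e) (R' : Rooted (graph H) e)
  (enum : ∀ y → ∃ λ k → Σ (Tuple n k) (Sub.Enum G R y)) (enum' : ∀ y → ∃ λ k → Σ (Tuple n' k) (Sub.Enum H R' y)) =
  Greedy.Weighted G H R R' (Sub.occs G R) (Sub.occs H R') enum enum'
    (λ {y} en ne z → χ-pos (Sub.occ? G R _ y _) (Sub.occ-self G R en ne)
       (n≤0⇒n≡0 (≤-trans (S-≥ (vec n _) _ (λ g → χ (Sub.occ? G R _ y g))) (≡⇒≤ z))))
    (λ {y} en ne z → χ-pos (Sub.occ? H R' _ y _) (Sub.occ-self H R' en ne)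
       (n≤0⇒n≡0 (≤-trans (S-≥ (vec n' _) _ (λ g → χ (Sub.occ? H R' _ y g))) (≡⇒≤ z))))
    (λ en _ → Pair.occ-iso G H R R' en)
    (λ en _ h le → iso-flip (Pair.occ-iso H G R' R en h le))
    (λ io ne ne' P gd → occs-≡ G H R R' (Pair.iso-twin G H R R' io) ne ne' P gd)

-- Limbs

module _ (G : Graph n) where

  LimbAt : Tuple n k → Fin k → Set
  LimbAt g r = ∀ j → deg G (lookup g j) ≡ vdeg G g (lookup g j) + χ (j ≟ᶠ r)

  opaque
    limbAt? : (g : Tuple n k) (r : Fin k) → Dec (LimbAt g r)
    limbAt? g r = Finₚ.all? (λ j → deg G (lookup g j) ≟ vdeg G g (lookup g j) + χ (j ≟ᶠ r))

  vdeg-∷ : ∀ {u x} (g : Tuple n k) → Adj G u x → vdeg G (x ∷ g) u ≡ suc (vdeg G g u)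
  vdeg-∷ {u = u} {x} g a = trans (∑-cons _) (cong (_+ vdeg G g u) (χ-yes (adj? G u x) a))

  module _ {g : Tuple n k} {r : Fin k} (u : Unique g) (l : LimbAt g r) where

    exits : ∀ {v x} → v ∈ g → x ∉ g → Adj G v x → v ≡ lookup g r
    exits v∈ x∉ a with ∈⇒lookup v∈
    ... | j , refl with j ≟ᶠ r | l j
    ...   | yes refl | _ = refl
    ...   | no _ | d = ⊥-elim (1+n≰n (≤-trans (≡⇒≤ (sym (vdeg-∷ g a)))
                        (≤-trans (vdeg≤deg G (_ ∷ g) (∉⇒All x∉ ∷ u) _) (≡⇒≤ (trans d (+-identityʳ _))))))

    exit-unique : ∀ {v v' x x'} → v ∈ g → x ∉ g → Adj G v x → v' ∈ g → x' ∉ g → Adj G v' x' → x ≡ x'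
    exit-unique {v} {v'} {x} {x'} v∈ x∉ a v'∈ x'∉ a' with x ≟ᶠ x'
    ... | yes e = e
    ... | no ne with exits v∈ x∉ a | exits v'∈ x'∉ a'
    ...   | refl | refl = ⊥-elim (lia⊥ (vdeg G g ρ ∷ vdeg G (x' ∷ g) ρ ∷ vdeg G (x ∷ x' ∷ g) ρ ∷ deg G ρ ∷ χ (r ≟ᶠ r) ∷ [])
              (λ a b c d e → b :≡ con 1 :+ a ∷ c :≡ con 1 :+ b ∷ c :≤ d ∷ d :≡ a :+ e ∷ e :≤ con 1 ∷ [])
              (vdeg-∷ g a' , vdeg-∷ (x' ∷ g) a , vdeg≤deg G (x ∷ x' ∷ g) (∉⇒All (λ { (here e) → ne e ; (there m) → x∉ m }) ∷ ∉⇒All x'∉ ∷ u) ρ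
              , l r , χ≤1 (r ≟ᶠ r) , tt))
      where ρ = lookup g r

    opaque
      exit : ∃ λ w → w ∉ g × Adj G (lookup g r) w
      exit with Finₚ.any? (λ w → ∉? w g ×-dec adj? G (lookup g r) w)
      ... | yes p = p
      ... | no none = ⊥-elim (1+n≢0 (trans (sym (χ-yes (r ≟ᶠ r) refl)) (+-cancelˡ-≡ (vdeg G g (lookup g r)) _ _ (trans (sym (l r))
                        (trans (sym (vdeg≡deg G g u (lookup g r) inside)) (sym (+-identityʳ _)))))))
        where
        inside : ∀ x → Adj G (lookup g r) x → x ∈ g
        inside x a with x ∈? g
        ... | yes m = m
        ... | no x∉ = ⊥-elim (none (x , x∉ , a))

root-at : {G : Graph n} {w : Fin n} → Spanning G w → Σ (Rooted G false) λ R → Rooted.dep R w ≡ 0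
root-at sp = tight-rooted tight all-in , subst (λ w → tight-dep tight w ≡ 0) root≡ (tight-root tight)
  where open Spanning sp

module At {n : ℕ} (G : LGraph n) (R : Rooted (graph G) false) (w : Fin n) (dw : Rooted.dep R w ≡ 0) where
  private
    Γ = graph G

  open Sub G R

  is-root : ∀ {x} → dep x ≡ 0 → x ≡ w
  is-root {x} d with tops x w d dw
  ... | inj₁ q = q
  ... | inj₂ q = trans q (kind w dw)

  deeper : ∀ {x} → x ≢ w → 0 < dep x
  deeper ne = low (λ z → ne (is-root z))

  first-par : ∀ {y} → dep y ≡ 1 → par y ≡ w
  first-par {y} d = is-root (suc-injective (trans (sym (up y (≡⇒≤ (sym d)))) d))

  nbr-of-root : ∀ {x} → Adj Γ x w → dep x ≡ 1 × par x ≡ w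
  nbr-of-root {x} a with adj→ a
  ... | inj₁ q = ⊥-elim (irrefl-adj Γ a (trans q (kind w dw)))
  ... | inj₂ q = trans (up x (deeper (irrefl-adj Γ a))) (cong suc (trans (cong dep (sym q)) dw)) , sym q

  above : ∀ x → x ≢ w → ∃ λ y → dep y ≡ 1 × y ≼ x
  above x ne = let (y , p , d) = ancestor x 1 z≤n (deeper ne) in y , d , p

  root-below : ∀ {y} → y ≼ w → y ≡ w
  root-below p = ≼-dep-eq p (≤-trans (≡⇒≤ dw) z≤n)

  -- The only edge leaving the limb leads to w, which is not below its top, so no descendant of the
  -- top can lie outside.
  limb-listing : {g : Tuple n k} {r : Fin k} → Grow Γ g → LimbAt Γ g r → w ∉ g → Adj Γ (lookup g r) w →
                 Listing (lookup g r) g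
  limb-listing {g = g} {r} gr l w∉ a = record
    { uniq = grow-unique gr
    ; below = grow-below gr (∈-lookup r g) (subst (_∉ g) (sym (proj₂ (nbr-of-root a))) w∉)
    ; all-of = all }
    where
    all : ∀ {x} → lookup g r ≼ x → x ∈ g
    all ≼-refl = ∈-lookup r g
    all {x} (≼-step lt p) with x ∈? g
    ... | yes m = m
    ... | no x∉ with exit-unique Γ (grow-unique gr) l (all p) x∉ (flip-adj Γ (adj← (up-par lt))) (∈-lookup r g) w∉ a
    ...   | refl = ⊥-elim (<-irrefl (sym dw) lt)

  -- Cutting the edge above z leaves two limbs; this is the one with the root, marked at `par z`.
  record Complement (z : Fin n) : Set where
    field
      {len} : ℕ
      g     : Tuple n len
      r     : Fin len
      grown : Grow Γ g
      limb  : LimbAt Γ g r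
      off   : ∀ {x} → x ∈ g → ¬ z ≼ x
      in-g  : ∀ {x} → ¬ z ≼ x → x ∈ g
    total : len + size z ≡ n
    total = trans (cong (_+ size z) (trans (sym (count-∈ g (grow-unique grown)))
        (∑-cong (λ x → χ-cong (x ∈? g) (¬? (z ≼? x)) off in-g))))
      (trans (sym (S-+ (fin n) _ _)) (trans (∑-cong (λ x → trans (+-comm (χ (¬? (z ≼? x))) _) (χ-compl (z ≼? x) (¬? (z ≼? x))))) (∑-one n)))

  private
    complement′ : ∀ z → z ≢ w → Complement z
    complement′ z z≢w with saturate Γ (λ x → ¬? (z ≼? x)) (w ∷ []) (one w)
    ... | m , zs , gr , qs , c = record { g = g ; r = proj₁ pz ; grown = gr ; limb = limb ; off = λ x∈ → off (∈-++⁻ zs x∈) ; in-g = in-g _ ≤-refl }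
      where
      g = zs ++ (w ∷ [])
      off : ∀ {x} → x ∈ zs ⊎ x ∈ (w ∷ []) → ¬ z ≼ x
      off (inj₁ p) = qs p
      off (inj₂ (here refl)) p = z≢w (root-below p)
      in-g : ∀ {x} d → dep x ≤ d → ¬ z ≼ x → x ∈ g
      in-g {x} d le h with x ≟ᶠ w
      ... | yes refl = ∈-++⁺ʳ zs (here refl)
      in-g {x} zero le h | no ne = ⊥-elim (1+n≰n (≤-trans (deeper ne) le))
      in-g {x} (suc d) le h | no ne with ∈⇒lookup (in-g {par x} d (s≤s⁻¹ (≤-trans (≡⇒≤ (sym (up x (deeper ne)))) le)) (λ p → h (≼-step (deeper ne) p)))
      ... | i , q = c x h (i , trans (cong (adj Γ x) q) (adj← (up-par (deeper ne))))
      pz : ∃ λ i → lookup g i ≡ par z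
      pz = ∈⇒lookup (in-g {par z} _ ≤-refl (par-not-below (up-par (deeper z≢w))))
      ug = grow-unique gr
      limb : LimbAt Γ g (proj₁ pz)
      limb j with j ≟ᶠ proj₁ pz
      ... | no ne = trans (sym (vdeg≡deg Γ g ug (lookup g j) inside)) (sym (+-identityʳ _))
        where
        inside : ∀ x → Adj Γ (lookup g j) x → x ∈ g
        inside x a with z ≼? x
        ... | no h = in-g _ ≤-refl h
        ... | yes p with ≼-adj p (flip-adj Γ a)
        ...   | inj₁ q = ⊥-elim (off (∈-++⁻ zs (∈-lookup j g)) q)
        ...   | inj₂ (_ , e) = ⊥-elim (ne (lookup-injective ug j _ (trans e (sym (proj₂ pz)))))
      ... | yes refl = trans (sym (vdeg≡deg Γ (z ∷ g) (∉⇒All (λ z∈ → off (∈-++⁻ zs z∈) ≼-refl) ∷ ug) v inside))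
                             (trans (vdeg-∷ Γ g (trans (cong (λ v → adj Γ v z) (proj₂ pz)) (flip-adj Γ (adj← (up-par (deeper z≢w)))))) (+-comm 1 _))
        where
        v = lookup g j
        inside : ∀ x → Adj Γ v x → x ∈ (z ∷ g)
        inside x a with z ≼? x
        ... | no h = there (in-g _ ≤-refl h)
        ... | yes p with ≼-adj p (flip-adj Γ a)
        ...   | inj₁ q = ⊥-elim (off (∈-++⁻ zs (∈-lookup j g)) q)
        ...   | inj₂ (e , _) = here e

  opaque
    complement : ∀ z → z ≢ w → Complement z
    complement = complement′

  -- A limb through the root leaves only part of one branch uncovered.
  limb-through-root : ∀ {B} → (∀ y → y ≢ w → size y ≤ B) → {g : Tuple n k} {r : Fin k} → Grow Γ g → LimbAt Γ g r →
                      w ∈ g → n ≤ k + B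
  limb-through-root {k} {B} bound {g} {r} gr l w∈ with all? Γ g
  ... | inj₁ all = ≤-trans (≡⇒≤ (sym (complete-length Γ g (grow-unique gr) all))) (m≤m+n k B)
  ... | inj₂ (x , x∉) = ≤-trans (≡⇒≤ (sym (∑-one n))) (≤-trans (S-mono (fin n) pt) (≤-trans (≡⇒≤ (S-+ (fin n) _ _))
          (+-mono-≤ (≡⇒≤ (count-∈ g ug)) (bound z z≢w))))
    where
    ug = grow-unique gr
    -- Climb from x until the parent lies in g. All vertices z reached in this way coincide, since
    -- only one edge leaves g.
    root-of : ∀ {x} d → dep x ≤ d → x ∉ g → ∃ λ z → z ≼ x × z ∉ g × par z ∈ g × Adj Γ (par z) z
    root-of {x} d le x∉ with x ≟ᶠ w
    ... | yes refl = ⊥-elim (x∉ w∈)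
    root-of zero le x∉ | no ne = ⊥-elim (1+n≰n (≤-trans (deeper ne) le))
    root-of {x} (suc d) le x∉ | no ne with par x ∈? g
    ... | yes m = x , ≼-refl , x∉ , m , flip-adj Γ (adj← (up-par (deeper ne)))
    ... | no p∉ = let (z , p , q) = root-of {par x} d (s≤s⁻¹ (≤-trans (≡⇒≤ (sym (up x (deeper ne)))) le)) p∉ in z , ≼-step (deeper ne) p , q
    zz = root-of (dep x) ≤-refl x∉
    z = proj₁ zz
    z≢w : z ≢ w
    z≢w e = proj₁ (proj₂ (proj₂ zz)) (subst (_∈ g) (sym e) w∈)
    pt : ∀ v → 1 ≤ χ (v ∈? g) + χ (z ≼? v)
    pt v with v ∈? g
    ... | yes _ = s≤s z≤n
    ... | no v∉ with root-of (dep v) ≤-refl v∉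
    ...   | z' , p , z'∉ , p'∈ , a with exit-unique Γ ug l p'∈ z'∉ a (proj₁ (proj₂ (proj₂ (proj₂ zz)))) (proj₁ (proj₂ (proj₂ zz))) (proj₂ (proj₂ (proj₂ (proj₂ zz))))
    ...     | refl = ≡⇒≤ (sym (χ-yes (z ≼? v) p))

  branch : Fin n → Bool
  branch y = dep y ≡ᵇ 1

  branch→ : ∀ {y} → branch y ≡ true → dep y ≡ 1
  branch→ {y} e = ≡ᵇ⇒≡ (dep y) 1 (subst T (sym e) tt)

  branch← : ∀ {y} → dep y ≡ 1 → branch y ≡ true
  branch← {y} e = cong (_≡ᵇ 1) e

  -- A connected tuple that avoids the root lies below exactly one vertex of depth 1.
  limb-total : (P : Pat k) → (∀ {g} → Unique g → Match G P g → Grow Γ g) →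
    (∀ {g : Tuple n k} → Grow Γ g → LimbAt Γ g (Pat.r P) → w ∉ g) →
    ∑ᵛ k (λ g → χg Γ g * (χ (match? G P g) * χ (limbAt? Γ g (Pat.r P)))) ≡ ∑ (λ y → on branch y * limbs P y)
  limb-total {k} P grows avoid = trans (S-cong (vec n k) step) (trans (S-swap (vec n k) (fin n) _) (∑-cong (λ y → S-* (vec n k) (on branch y) (λ g → χ (limb? P y g)))))
    where
    wt : Fin n → Tuple n k → ℕ
    wt y g = χ (branch y ≟ᵇ true) * χ (limb? P y g)
    step : ∀ g → χg Γ g * (χ (match? G P g) * χ (limbAt? Γ g (Pat.r P))) ≡ ∑ (λ y → wt y g)
    step g with grow? Γ g ×-dec (match? G P g ×-dec limbAt? Γ g (Pat.r P))
    ... | no h = trans zero-l (sym (S-zero (fin n) zero-r))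
      where
      zero-l : χg Γ g * (χ (match? G P g) * χ (limbAt? Γ g (Pat.r P))) ≡ 0
      zero-l = trans (sym (trans (χ-× (grow? Γ g) _) (cong (χg Γ g *_) (χ-× (match? G P g) (limbAt? Γ g (Pat.r P))))))
                     (χ-no (grow? Γ g ×-dec (match? G P g ×-dec limbAt? Γ g (Pat.r P))) h)
      zero-r : ∀ y → wt y g ≡ 0
      zero-r y = trans (cong (χ (branch y ≟ᵇ true) *_) (χ-no (limb? P y g) (λ { ((u , m , l) , _) → h (grows u m , m , l) }))) (*-zeroʳ (χ (branch y ≟ᵇ true)))
    ... | yes (gr , m , l) = trans (cong₂ _*_ (χ-yes (grow? Γ g) gr) (cong₂ _*_ (χ-yes (match? G P g) m) (χ-yes (limbAt? Γ g (Pat.r P)) l)))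
            (sym (trans (S-single (fin n) y (λ y → wt y g) others) (cong₂ _*_ (χ-yes (branch y ≟ᵇ true) (branch← dy)) (χ-yes (limb? P y g) lin))))
      where
      ρ = lookup g (Pat.r P)
      w∉ = avoid gr l
      top = above ρ (λ e → w∉ (subst (_∈ g) e (∈-lookup (Pat.r P) g)))
      y = proj₁ top
      dy = proj₁ (proj₂ top)
      lin : LimbIn P y g
      lin = (grow-unique gr , m , l) , λ j → grow-stays gr (∈-lookup (Pat.r P) g) (proj₂ (proj₂ top)) (subst (_∉ g) (sym (first-par dy)) w∉) (∈-lookup j g)
      others : ∀ z → z ≢ y → wt z g ≡ 0
      others z ne with branch z ≟ᵇ true
      ... | no _ = refl
      ... | yes b = trans (+-identityʳ _) (χ-no (limb? P z g) (λ (_ , bel) → ne (≼-linear (bel (Pat.r P)) (proj₂ lin (Pat.r P)) (trans (branch→ b) (sym dy)))))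

record Isom (G : LGraph n) (H : LGraph n') : Set where
  field
    {len} : ℕ
    q     : Tuple n len
    q'    : Tuple n' len
    uq    : Unique q
    uq'   : Unique q'
    same  : Same G q H q'
    all   : ∀ x → x ∈ q
    all'  : ∀ x → x ∈ q'

grow-exists : ∀ {M} (G : LGraph n) (H : LGraph n') → GAgree G H M → k ≤ M →
  {P : Tuple n k → Set} {P' : Tuple n' k → Set} (P? : ∀ xs → Dec (P xs)) (P'? : ∀ ys → Dec (P' ys)) →
  (∀ xs ys → Same G xs H ys → P xs → P' ys) → (∀ xs ys → Same G xs H ys → P' ys → P xs) →
  (∃ λ xs → Grow (graph G) xs × P xs) → ∃ λ ys → Grow (graph H) ys × P' ys
grow-exists G H ag k≤ P? P'? to from (xs , g , p) =
  let (ys , q) = ∑ᵛ-exists _ _ (ag _ k≤ (λ xs → χ (P? xs)) (λ ys → χ (P'? ys)) (λ xs ys _ _ s → χ-cong (P? xs) (P'? ys) (to xs ys s) (from xs ys s)))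
                   xs (*-pos (χ-pos (grow? (graph G) xs) g) (χ-pos (P? xs) p))
  in ys , χ≢0 (grow? (graph H) ys) (*≢0ˡ _ q) , χ≢0 (P'? ys) (*≢0ʳ (χg (graph H) ys) q)

gagree-flip : ∀ {M} (G : LGraph n) (H : LGraph n') → GAgree G H M → GAgree H G M
gagree-flip G H ag k k≤ F F' r = sym (ag k k≤ F' F (λ xs ys gx gy s → sym (r ys xs gy gx (same-flip s))))

vdeg-same : {G : LGraph n} {H : LGraph n'} {f : Tuple n k} {f' : Tuple n' k} → Same G f H f' →
            ∀ j → vdeg (graph G) f (lookup f j) ≡ vdeg (graph H) f' (lookup f' j)
vdeg-same {G = G} {H} {f} {f'} s j = ∑-cong (λ i → χ-cong (adj? (graph G) (lookup f j) (lookup f i)) (adj? (graph H) (lookup f' j) (lookup f' i))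
  (trans (sym (same-adj s j i))) (trans (same-adj s j i)))

opaque
  degs-at? : (G : Graph n) (f : Tuple n k) (r : Fin k) (d : Vec ℕ k) → Dec (∀ j → lookup d j ≡ vdeg G f (lookup f j) + χ (j ≟ᶠ r))
  degs-at? G f r d = Finₚ.all? (λ j → lookup d j ≟ vdeg G f (lookup f j) + χ (j ≟ᶠ r))

bdseq-of : (G : Graph n) (f : Tuple n k) → ∀ m → m ≤ bnd G f → ∃ λ zs → BdSeq G f {m} zs
bdseq-of G f zero    _  = [] , []
bdseq-of {n} G f (suc m) le with bdseq-of G f m (≤-trans (n≤1+n m) le)
... | zs , s with ∑-pos (λ z → χ (∉? z zs ×-dec bd? G f z)) (λ e → 1+n≰n (≤-trans le (≡⇒≤ (trans (sym (bd-fresh G f zs s)) (cong (_+ m) e)))))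
...   | z , p = z ∷ zs , (χ≢0 (∉? z zs ×-dec bd? G f z) p ∷ s)

-- The inequality is strict so that a violation can be cut down to exactly M vertices and seen in
-- the other graph.
Narrow : Graph n → ℕ → Set
Narrow {n} G M = ∀ {k} (f : Tuple n k) → Grow G f → 2 * k ≤ n → k + bnd G f < M

-- A lower bound m for the boundary, written as a pattern on m + k vertices.
Fringed : Graph n → ∀ m k → Tuple n (m + k) → Set
Fringed G m k xs = ∀ (i : Fin m) → ∃ λ (j : Fin k) → Adj G (lookup xs (i ↑ˡ k)) (lookup xs (m ↑ʳ j))

opaque
  fringed? : (G : Graph n) → ∀ m k xs → Dec (Fringed G m k xs)
  fringed? G m k xs = Finₚ.all? (λ i → Finₚ.any? (λ j → adj? G (lookup xs (i ↑ˡ k)) (lookup xs (m ↑ʳ j))))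

fringed-bnd : (G : Graph n) → ∀ {m k} (zs : Tuple n m) (f : Tuple n k) → Unique (zs ++ f) → Fringed G m k (zs ++ f) → m ≤ bnd G f
fringed-bnd {n} G zs f uq fr = let (u , d) = apart zs uq in
    ≤-trans (≡⇒≤ (sym (count-∈ zs u))) (S-mono (fin n) (λ z → χ-mono (z ∈? zs) (bd? G f z) (λ z∈ → d z∈ , nb z∈)))
  where
  apart : ∀ {m k} (zs : Tuple n m) {f : Tuple n k} → Unique (zs ++ f) → Unique zs × (∀ {z} → z ∈ zs → z ∉ f)
  apart []       u       = [] , λ ()
  apart (z ∷ zs) (p ∷ u) = let (u' , d) = apart zs u in
    (∉⇒All (λ m → All⇒∉ p (∈-++⁺ˡ m)) ∷ u') , λ { (here refl) m → All⇒∉ p (∈-++⁺ʳ zs m) ; (there m) → d m }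
  nb : ∀ {z} → z ∈ zs → ∃ λ j → Adj G z (lookup f j)
  nb z∈ with ∈⇒lookup z∈
  ... | i , refl = let (j , a) = fr i in j , subst₂ (Adj G) (lookup-++ˡ zs f i) (lookup-++ʳ zs f j) a

bnd-fringed : (G : Graph n) (f : Tuple n k) → Grow G f → ∀ m → m ≤ bnd G f → ∃ λ xs → Grow G xs × Fringed G m k xs
bnd-fringed G f g m le = let (zs , s) = bdseq-of G f m le in zs ++ f , grow-ext G s g , λ i →
  let (_ , j , a) = bdseq-Bd G s (∈-lookup i zs) in j , subst₂ (Adj G) (sym (lookup-++ˡ zs f i)) (sym (lookup-++ʳ zs f j)) a

fringed-core : (G : Graph n) → ∀ m k → 1 ≤ k → (∃ λ xs → Grow G xs × Fringed G m k xs) → ∃ λ (f : Tuple n k) → Grow G f × m ≤ bnd G f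
fringed-core G m (suc k) _ (xs , g , fr) with splitAt m xs
... | zs , f , refl = f , grow-drop G zs g , fringed-bnd G zs f (grow-unique g) fr

-- A grown tuple with too many boundary vertices would, together with M minus k of them, be visible in the other graph.
narrow-transfer-at : ∀ {M} (G H : LGraph n) → GAgree G H M → ∀ k → k ≤ M → (∀ (f : Tuple n k) → Grow (graph G) f → k + bnd (graph G) f < M) →
  ∀ (f : Tuple n k) → Grow (graph H) f → k + bnd (graph H) f < M
narrow-transfer-at {M = M} G H ag k k≤M nw f g with k + bnd (graph H) f <? M
... | yes p = p
... | no h =
  let e = m∸n+n≡m k≤M
      (f' , gf , big) = fringed-core (graph G) (M ∸ k) k (grow-nonempty g) (grow-exists H G (gagree-flip G H ag) (≡⇒≤ e)
        (fringed? (graph H) (M ∸ k) k) (fringed? (graph G) (M ∸ k) k)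
        (λ xs ys s p i → let (j , a) = p i in j , trans (sym (same-adj s _ _)) a)
        (λ xs ys s p i → let (j , a) = p i in j , trans (same-adj s _ _) a)
        (bnd-fringed (graph H) f g (M ∸ k)
          (lia ((M ∸ k) ∷ k ∷ M ∷ bnd (graph H) f ∷ []) (λ m k M b → m :+ k :≡ M ∷ M :≤ k :+ b ∷ [] ⊢ m :≤ b) (e , ≮⇒≥ h , tt))))
  in ⊥-elim (1+n≰n (≤-trans (nw f' gf) (≤-trans (≡⇒≤ (sym e)) (≤-trans (≡⇒≤ (+-comm (M ∸ k) k)) (+-monoʳ-≤ k big)))))

narrow-transfer : ∀ {M} (G H : LGraph n) → GAgree G H M → (∀ k → 2 * k ≤ n → k ≤ M) → Narrow (graph G) M → Narrow (graph H) M
narrow-transfer G H ag half nw {k} f g le = narrow-transfer-at G H ag k (half k le) (λ f g → nw f g le) f g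

HasLimb : Graph n → ℕ → Set
HasLimb {n} G k = Σ (Tuple n k) λ g → Σ (Fin k) λ r → Grow G g × LimbAt G g r

module _ {n M : ℕ} (G H : LGraph n) (ag : GAgree G H M) (half : ∀ k → 2 * k ≤ n → k ≤ M)
  (nw : Narrow (graph G) M) (nw' : Narrow (graph H) M) where

  limb-sums : ∀ {k} (P : Pat k) → 2 * k ≤ n →
    ∑ᵛ k (λ g → χg (graph G) g * (χ (match? G P g) * χ (limbAt? (graph G) g (Pat.r P)))) ≡
    ∑ᵛ k (λ g → χg (graph H) g * (χ (match? H P g) * χ (limbAt? (graph H) g (Pat.r P))))
  limb-sums {zero}  P _  = ⊥-elim (Finₚ.¬Fin0 (Pat.r P))
  limb-sums {suc k} P le = trans (unmaps G) (trans step (sym (unmaps H)))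
    where
    Ψ : LGraph n → Tuple n (suc k) → Vec ℕ (suc k) → ℕ
    Ψ G f d = χ (match? G P f) * χ (degs-at? (graph G) f (Pat.r P) d)
    unmap : ∀ G f → χ (match? G P f) * χ (limbAt? (graph G) f (Pat.r P)) ≡ Ψ G f (map (deg (graph G)) f)
    unmap G f = cong (χ (match? G P f) *_) (χ-cong (limbAt? (graph G) f (Pat.r P)) (degs-at? (graph G) f (Pat.r P) (map (deg (graph G)) f))
      (λ l j → trans (lookup-map j (deg (graph G)) f) (l j)) (λ l j → trans (sym (lookup-map j (deg (graph G)) f)) (l j)))
    unmaps : ∀ G → ∑ᵛ (suc k) (λ g → χg (graph G) g * (χ (match? G P g) * χ (limbAt? (graph G) g (Pat.r P)))) ≡
                   ∑ᵛ (suc k) (λ f → χg (graph G) f * Ψ G f (map (deg (graph G)) f))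
    unmaps G = ∑ᵛ-cong (suc k) {λ g → χg (graph G) g * (χ (match? G P g) * χ (limbAt? (graph G) g (Pat.r P)))} {λ f → χg (graph G) f * Ψ G f (map (deg (graph G)) f)}
      (λ f → cong (χg (graph G) f *_) (unmap G f))
    Ψ-same : ∀ f f' → Grow (graph G) f → Grow (graph H) f' → Same G f H f' → ∀ d → Ψ G f d ≡ Ψ H f' d
    Ψ-same f f' _ _ s d = cong₂ _*_ (χ-cong (match? G P f) (match? H P f') (same-match {G = G} {H} {P} s) (same-match {G = H} {G} {P} (same-flip s)))
      (χ-cong (degs-at? (graph G) f (Pat.r P) d) (degs-at? (graph H) f' (Pat.r P) d) (λ l j → trans (l j) (cong (_+ χ (j ≟ᶠ Pat.r P)) (vd j))) (λ l j → trans (l j) (cong (_+ χ (j ≟ᶠ Pat.r P)) (sym (vd j)))))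
      where vd = vdeg-same s
    step : ∑ᵛ (suc k) (λ f → χg (graph G) f * Ψ G f (map (deg (graph G)) f)) ≡ ∑ᵛ (suc k) (λ f → χg (graph H) f * Ψ H f (map (deg (graph H)) f))
    step = deg-transfer G H ag k 0 (Ψ G) (Ψ H) Ψ-same (λ _ _ _ _ → z≤n) (λ _ _ _ _ → z≤n)
      (λ f g _ → <⇒≤ (nw f g le)) (λ f g _ → <⇒≤ (nw' f g le)) (half (suc k) le)

  opaque
    limb-match : ∀ {k} (g : Tuple n k) r → 2 * k ≤ n → Grow (graph G) g → LimbAt (graph G) g r →
      Σ (Tuple n k) λ g' → Grow (graph H) g' × Same G g H g' × LimbAt (graph H) g' r
    limb-match g r le gr l =
      let P = patOf G g r
          (g' , p) = ∑ᵛ-exists _ _ (limb-sums P le) g (*-pos (χ-pos (grow? (graph G) g) gr) (*-pos (χ-pos (match? G P g) ((λ _ _ → refl) , λ _ → refl)) (χ-pos (limbAt? (graph G) g r) l)))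
          q = *≢0ʳ (χg (graph H) g') p
      in g' , χ≢0 (grow? (graph H) g') (*≢0ˡ _ p)
         , match-same {G = G} {H} {P} ((λ _ _ → refl) , λ _ → refl) (χ≢0 (match? H P g') (*≢0ˡ _ q))
         , χ≢0 (limbAt? (graph H) g' r) (*≢0ʳ (χ (match? H P g')) q)

greatest : ∀ (f : ℕ → ℕ) K {k} → k ≤ K → f k ≢ 0 → ∃ λ j → f j ≢ 0 × (∀ i → i ≤ K → f i ≢ 0 → i ≤ j)
greatest f zero    z≤n h = 0 , h , λ i i≤ _ → i≤
greatest f (suc K) {k} le h with f (suc K) ≟ 0
... | no nz = suc K , nz , λ i i≤ _ → i≤
... | yes z with greatest f K (s≤s⁻¹ (≤∧≢⇒< le (λ { refl → h z }))) h
...   | j , p , q = j , p , λ i i≤ fi → q i (s≤s⁻¹ (≤∧≢⇒< i≤ (λ { refl → fi z }))) fi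

module _ {n : ℕ} (G : LGraph n) (sp : ∀ r → Spanning (graph G) r) where

  LimbBound : ℕ → Set
  LimbBound K = ∀ {k} → HasLimb (graph G) k → 2 * k ≤ n → k ≤ K

  module _ {w : Fin n} (R : Rooted (graph G) false) (dw : Rooted.dep R w ≡ 0) where
    open Sub G R
    open At G R w dw

    below-limb : ∀ {y} → y ≢ w → HasLimb (graph G) (size y)
    below-limb {y} ne with enum y
    ... | k , f , en = subst (HasLimb (graph G)) (Enum.len≡ en) (f , _ , Enum.grown en , proj₂ (proj₂ (limb-self en (up-par (deeper ne)))))

    -- A subtree with at most n/2 vertices is a limb and hence bounded. A larger subtree of z either
    -- lies in that of y, or its complement is a limb with fewer than n/2 vertices that contains the
    -- root and the whole subtree of y, which is one vertex too many.
    size-bound : ∀ {K y} → LimbBound K → 2 * K ≤ n → dep y ≡ 1 → size y ≡ K → ∀ z → z ≢ w → size z ≤ K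
    size-bound {K} {y} lb le dy sy z ne with 2 * size z ≤? n
    ... | yes p = lb (below-limb ne) p
    ... | no h with y ≼? z
    ...   | yes y≼z = ≤-trans (S-mono (fin n) (λ x → χ-mono (z ≼? x) (y ≼? x) (≼-trans y≼z))) (≡⇒≤ sy)
    ...   | no y⋠z = ⊥-elim (1+n≰n (≤-trans more (lb (C.g , C.r , C.grown , C.limb)
              (lia (C.len ∷ size z ∷ n ∷ []) (λ l s n → l :+ s :≡ n ∷ n :< 2 :* s ∷ [] ⊢ 2 :* l :≤ n) (C.total , ≰⇒> h , tt)))))
      where
      module C = Complement (complement z ne)
      off : ∀ {x} → y ≼ x → ¬ z ≼ x
      off p q = let (v , dv , r) = above z ne in y⋠z (subst (_≼ z) (≼-linear (≼-trans r q) p (trans dv (sym dy))) r)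
      more : suc K ≤ C.len
      more with enum y
      ... | k , f , en = subst (λ K → suc K ≤ C.len) (trans (Enum.len≡ en) sy) (≤-trans (≡⇒≤ (sym (count-∈ (w ∷ f) (∉⇒All w∉ ∷ Enum.uniq en))))
            (≤-trans (S-mono (fin n) (λ x → χ-mono (x ∈? (w ∷ f)) (x ∈? C.g) λ { (here refl) → C.in-g (λ p → ne (root-below p)) ; (there m) → C.in-g (off (Enum.below en m)) }))
              (≡⇒≤ (count-∈ C.g (grow-unique C.grown)))))
        where
        w∉ : w ∉ f
        w∉ m = <-irrefl (sym dw) (≤-trans (≡⇒≤ (sym dy)) (≼-dep (Enum.below en m)))

  -- A branch and its complement are both limbs, and one of them has at most n/2 vertices.
  some-limb : ∀ {w x : Fin n} → x ≢ w → ∃ λ k → 2 * k ≤ n × HasLimb (graph G) k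
  some-limb {w} {x} x≢w with root-at (sp w)
  ... | R , dw = go (2 * size y ≤? n)
    where
    open Sub G R
    open At G R w dw
    y = proj₁ (above x x≢w)
    y≢w : y ≢ w
    y≢w e = 1+n≢0 (trans (sym (proj₁ (proj₂ (above x x≢w)))) (trans (cong dep e) dw))
    go : Dec (2 * size y ≤ n) → ∃ λ k → 2 * k ≤ n × HasLimb (graph G) k
    go (yes p) = size y , p , below-limb R dw y≢w
    go (no h) = C.len , lia (C.len ∷ size y ∷ n ∷ []) (λ l s n → l :+ s :≡ n ∷ n :< 2 :* s ∷ [] ⊢ 2 :* l :≤ n) (C.total , ≰⇒> h , tt) , C.g , C.r , C.grown , C.limb
      where module C = Complement (complement y y≢w)

  opaque
    largest-limb : ∀ {w x : Fin n} → x ≢ w → ∃ λ K → 2 * K ≤ n × HasLimb (graph G) K × LimbBound K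
    largest-limb x≢w =
      let (k , le , h) = some-limb x≢w
          (K , p , mx) = greatest f n (half≤ k le) (f-pos le h)
          (g , q) = ∑ᵛ-pos K _ (*≢0ʳ (χ (2 * K ≤? n)) p)
          (r , t) = ∑-pos _ (*≢0ʳ (χg (graph G) g) q)
      in K , χ≢0 (2 * K ≤? n) (*≢0ˡ _ p) , (g , r , χ≢0 (grow? (graph G) g) (*≢0ˡ _ q) , χ≢0 (limbAt? (graph G) g r) t)
         , λ {k} h le → mx k (half≤ k le) (f-pos le h)
      where
      half≤ : ∀ k → 2 * k ≤ n → k ≤ n
      half≤ k le = lia (k ∷ n ∷ []) (λ k n → 2 :* k :≤ n ∷ [] ⊢ k :≤ n) (le , tt)
      f : ℕ → ℕ
      f k = χ (2 * k ≤? n) * ∑ᵛ k (λ g → χg (graph G) g * ∑ (λ r → χ (limbAt? (graph G) g r)))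
      f-pos : ∀ {k} → 2 * k ≤ n → HasLimb (graph G) k → f k ≢ 0
      f-pos {k} le (g , r , gr , l) = *-pos (χ-pos (2 * k ≤? n) le) (λ z →
        *-pos (χ-pos (grow? (graph G) g) gr) (λ z' → χ-pos (limbAt? (graph G) g r) l (n≤0⇒n≡0 (≤-trans (S-≥ (fin k) r (λ r → χ (limbAt? (graph G) g r))) (≡⇒≤ z'))))
          (n≤0⇒n≡0 (≤-trans (S-≥ (vec n k) g (λ g → χg (graph G) g * ∑ (λ r → χ (limbAt? (graph G) g r)))) (≡⇒≤ z))))

∑-all : (xs : Tuple n k) → Unique xs → (∀ x → x ∈ xs) → ∀ (f : Fin n → ℕ) → ∑ f ≡ ∑ (λ i → f (lookup xs i))
∑-all xs u all f = trans (∑-cong (λ x → sym (trans (cong (_* f x) (χ-yes (x ∈? xs) (all x))) (+-identityʳ _)))) (∑-∈ xs u f)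

module Branches {n : ℕ} (G : LGraph n) (sp : ∀ r → Spanning (graph G) r) {w : Fin n} (R : Rooted (graph G) false) (dw : Rooted.dep R w ≡ 0)
  {K : ℕ} (2K≤n : 2 * K ≤ n) (lb : LimbBound G sp K) {g : Tuple n K} {r : Fin K} (gr : Grow (graph G) g)
  (l : LimbAt (graph G) g r) (w∉ : w ∉ g) (a : Adj (graph G) (lookup g r) w) where
  open Sub G R
  open At G R w dw

  ρ = lookup g r
  lf = limb-listing gr l w∉ a
  dρ = proj₁ (nbr-of-root a)
  open Listing lf using () renaming (below to g-below; all-of to g-all)

  ne : ∀ {y} → dep y ≡ 1 → par y ≢ y
  ne d = up-par (≡⇒≤ (sym d))

  β = without branch ρ

  dep1 : ∀ {y} → β y ≡ true → dep y ≡ 1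
  dep1 b = branch→ (proj₁ (without-on branch ρ b))

  bound = size-bound G sp R dw lb 2K≤n dρ (sym (Listing.len≡ lf))

  off-g : ∀ {y x} → β y ≡ true → x ∈ g → ¬ y ≼ x
  off-g b m p = proj₂ (without-on branch ρ b) (≼-linear p (g-below m) (trans (dep1 b) (sym dρ)))

  ≢w : ∀ {y} → dep y ≡ 1 → y ≢ w
  ≢w d e = 1+n≢0 (trans (sym d) (trans (cong dep e) dw))

  -- The branch, the limb g and the root are disjoint. The strict inequality excludes limbs through
  -- the root in `limbs-split`.
  fam : ∀ {y} → β y ≡ true → proj₁ (enum y) ≤ K × proj₁ (enum y) + K < n
  fam {y} b = let (k , f , en) = enum y in ≤-trans (≡⇒≤ (Enum.len≡ en)) (bound y (≢w (dep1 b))) ,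
    unique-≤ (w ∷ (f ++ g)) (∉⇒All (λ m → w-out (∈-++⁻ f m)) ∷ unique-++ (graph G) f (grow-unique gr) (Enum.uniq en) (λ m m' → off-g b m' (Enum.below en m)))
    where
    w-out : w ∈ proj₁ (proj₂ (enum y)) ⊎ w ∈ g → ⊥
    w-out (inj₁ m) = ≢w (dep1 b) (root-below (Enum.below (proj₂ (proj₂ (enum y))) m))
    w-out (inj₂ m) = w∉ m

  limbs-split : ∀ {k} (P : Pat k) → (∀ {g} → Unique g → Match G P g → Grow (graph G) g) → k + K < n →
    ∑ᵛ k (λ g → χg (graph G) g * (χ (match? G P g) * χ (limbAt? (graph G) g (Pat.r P)))) ≡ limbs P ρ + ∑ (λ x → on β x * limbs P x)
  limbs-split P gd lt = trans (limb-total P gd (λ gr l m → <⇒≱ lt (limb-through-root bound gr l m))) (on-split branch (limbs P) ρ (branch← dρ))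

  module After {k} (q : Tuple n k) (old : ∀ {x} → x ∈ g → x ∈ q) (in-q : ∀ {y x} → β y ≡ true → y ≼ x → x ∈ q)
    (q-in : ∀ {x} → x ∈ q → x ∈ g ⊎ ∃ λ y → β y ≡ true × y ≼ x) where

    w∉q : w ∉ q
    w∉q m with q-in m
    ... | inj₁ p = w∉ p
    ... | inj₂ (y , b , p) = ≢w (dep1 b) (root-below p)

    all : ∀ x → x ∈ (w ∷ q)
    all x with x ≟ᶠ w
    ... | yes e = here e
    ... | no h with above x h
    ...   | y , d , p with y ≟ᶠ ρ
    ...     | yes refl = there (old (g-all p))
    ...     | no yρ = there (in-q (on-without branch (branch← d) yρ) p)

∈-++[] : ∀ (g : Tuple n k) {x} → x ∈ (g ++ []) → x ∈ g
∈-++[] g m with ∈-++⁻ g m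
... | inj₁ p = p

module Main {n M : ℕ} (G H : LGraph n) (ag : GAgree G H M) (half : ∀ k → 2 * k ≤ n → k ≤ M)
  (sp : ∀ r → Spanning (graph G) r) (sp' : ∀ r → Spanning (graph H) r)
  (nw : Narrow (graph G) M) (nw' : Narrow (graph H) M)
  {w w' : Fin n} (R : Rooted (graph G) false) (dw : Rooted.dep R w ≡ 0) (R' : Rooted (graph H) false) (dw' : Rooted.dep R' w' ≡ 0)
  {K : ℕ} (2K≤n : 2 * K ≤ n) (lb : LimbBound G sp K) (lb' : LimbBound H sp' K)
  {g g' : Tuple n K} {r : Fin K} (gr : Grow (graph G) g) (gr' : Grow (graph H) g') (sm : Same G g H g')
  (l : LimbAt (graph G) g r) (l' : LimbAt (graph H) g' r) (w∉ : w ∉ g) (w∉' : w' ∉ g')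
  (a : Adj (graph G) (lookup g r) w) (a' : Adj (graph H) (lookup g' r) w') where

  private
    module S = Sub G R
    module S' = Sub H R'
    module A = At G R w dw
    module A' = At H R' w' dw'
    module B = Branches G sp R dw 2K≤n lb gr l w∉ a
    module B' = Branches H sp' R' dw' 2K≤n lb' gr' l' w∉' a'
  open Pair G H R R'

  private
    io : Iso B.ρ B'.ρ
    io = record { f = g ; g = g' ; lf = B.lf ; lg = B'.lf ; same = sm ; i = r ; f-i = refl ; g-i = refl }

    st₀ : State
    st₀ = record { q = [] ; q' = [] ; uq = [] ; uq' = [] ; same = (λ ()) & (λ ()) ; deps = λ () }

    al₀ : Aligned st₀ B.ρ B'.ρ
    al₀ (() , _)

    module E = Extend st₀ io (B.ne B.dρ) (B'.ne B'.dρ) (trans B.dρ (sym B'.dρ)) (λ ()) (λ ()) al₀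

    F : ∀ {k} → Pat k → Set
    F {k} _ = k ≤ K × k + K < n

    module LG = LimbGreedy G H R R' 1 F

    sums : ∀ {k} (P : Pat k) → Good P → F P → ∑ (λ x → on B.β x * S.limbs P x) ≡ ∑ (λ x → on B'.β x * S'.limbs P x)
    sums {k} P (gd , gd') (k≤K , lt) = +-cancelˡ-≡ (S.limbs P B.ρ) _ _ (trans (sym (B.limbs-split P gd lt))
      (trans (limb-sums G H ag half nw nw' P (≤-trans (*-monoʳ-≤ 2 k≤K) 2K≤n))
      (trans (B'.limbs-split P gd' lt)
        (cong (_+ ∑ (λ x → on B'.β x * S'.limbs P x)) (sym (limbs-≡ G H R R' (iso-twin io) (B.ne B.dρ) (B'.ne B'.dρ) P))))))

    ready : LG.Ready E.extended B.β B'.β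
    ready = record
      { ne = λ b → B.ne (B.dep1 b) ; ne' = λ b → B'.ne (B'.dep1 b) ; depD = B.dep1 ; depD' = B'.dep1
      ; apart = λ b m → B.off-g b (∈-++[] g m) ; apart' = λ b m → B'.off-g b (∈-++[] g' m)
      ; al = λ { b b' (i , refl , refl) →
          (λ e → ⊥-elim (w∉ (subst (_∈ g) (trans e (A.first-par (B.dep1 b))) (∈-++[] g (∈-lookup i (g ++ []))))))
        , (λ e → ⊥-elim (w∉' (subst (_∈ g') (trans e (A'.first-par (B'.dep1 b'))) (∈-++[] g' (∈-lookup i (g' ++ [])))))) }
      ; fam = B.fam ; fam' = B'.fam ; sums = sums }

    opaque
      ext : Greedy.Extension G H R R' E.extended B.β B'.β
      ext = LG.greedy ready

    module X = Greedy.Extension ext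
    module N = State X.new

    in-new : ∀ {x} → x ∈ g → x ∈ N.q
    in-new m with ∈⇒lookup (∈-++⁺ˡ {ys = []} m)
    ... | i , e with X.old (i , refl , refl)
    ...   | j , q , _ = subst (_∈ N.q) (trans q e) (∈-lookup j N.q)
    in-new' : ∀ {x} → x ∈ g' → x ∈ N.q'
    in-new' m with ∈⇒lookup (∈-++⁺ˡ {ys = []} m)
    ... | i , e with X.old (i , refl , refl)
    ...   | j , _ , q = subst (_∈ N.q') (trans q e) (∈-lookup j N.q')

    module C = B.After N.q in-new X.in-q (λ m → map₁ (∈-++[] g) (X.q-in m))
    module C' = B'.After N.q' in-new' X.in-q' (λ m → map₁ (∈-++[] g') (X.q-in' m))
    open C using (all)
    open C' using () renaming (all to all')

    uw : Unique (w ∷ N.q)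
    uw = ∉⇒All C.w∉q ∷ N.uq
    uw' : Unique (w' ∷ N.q')
    uw' = ∉⇒All C'.w∉q ∷ N.uq'

    -- The root is the one vertex left over, so its label is the one left over too.
    root-lab : lab G w ≡ lab H w'
    root-lab = sym (χ≢0 (lab H w' ≟ c) (λ z → 1+n≢0 (trans (sym (χ-yes (lab G w ≟ c) refl)) (trans (+-cancelʳ-≡ (∑ (λ i → χ (lab G (lookup N.q i) ≟ c))) _ _ labs) z))))
      where
      c = lab G w
      count : ∀ (G : LGraph n) → ∑ᵛ 1 (λ v → χg (graph G) v * χ (lab G (head v) ≟ c)) ≡ ∑ (λ x → χ (lab G x ≟ c))
      count G = ∑-cong (λ x → trans (cong (_* χ (lab G x ≟ c)) (χ-yes (grow? (graph G) (x ∷ [])) (one x))) (+-identityʳ _))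
      split : ∀ (G : LGraph n) {k} {w : Fin n} {q : Tuple n k} → Unique (w ∷ q) → (∀ x → x ∈ (w ∷ q)) →
              ∑ (λ x → χ (lab G x ≟ c)) ≡ χ (lab G w ≟ c) + ∑ (λ i → χ (lab G (lookup q i) ≟ c))
      split G u all = trans (∑-all _ u all _) (∑-cons _)
      1≤M : 1 ≤ M
      1≤M = half 1 (≤-trans (s≤s (s≤s z≤n)) (≤-trans (*-monoʳ-≤ 2 (grow-nonempty gr)) 2K≤n))
      labs : χ (lab G w ≟ c) + ∑ (λ i → χ (lab G (lookup N.q i) ≟ c)) ≡ χ (lab H w' ≟ c) + ∑ (λ i → χ (lab G (lookup N.q i) ≟ c))
      labs = trans (sym (split G uw all)) (trans (sym (count G)) (trans
        (ag 1 1≤M (λ v → χ (lab G (head v) ≟ c)) (λ v → χ (lab H (head v) ≟ c)) (λ { (x ∷ []) (y ∷ []) _ _ s → cong (λ z → χ (z ≟ c)) (same-lab s zero) }))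
        (trans (count H) (trans (split H uw' all') (cong (χ (lab H w' ≟ c) +_) (∑-cong (λ i → cong (λ z → χ (z ≟ c)) (sym (same-lab N.same i)))))))))

    -- The neighbours of the root are the vertices of depth 1, and matched vertices have equal
    -- depths.
    root-adj : ∀ i → adj (graph G) w (lookup N.q i) ≡ adj (graph H) w' (lookup N.q' i)
    root-adj i = bool-iff to from
      where
      x = lookup N.q i
      x' = lookup N.q' i
      to : Adj (graph G) w x → Adj (graph H) w' x'
      to ad = flip-adj (graph H) (subst (Adj (graph H) x') (A'.first-par d) (S'.adj← (B'.ne d)))
        where d = trans (sym (N.deps i)) (proj₁ (A.nbr-of-root (flip-adj (graph G) ad)))
      from : Adj (graph H) w' x' → Adj (graph G) w x
      from ad = flip-adj (graph G) (subst (Adj (graph G) x) (A.first-par d) (S.adj← (B.ne d)))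
        where d = trans (N.deps i) (proj₁ (A'.nbr-of-root (flip-adj (graph H) ad)))

    whole : Same G (w ∷ N.q) H (w' ∷ N.q')
    whole = edges & labels
      where
      edges : ∀ i j → adj (graph G) (lookup (w ∷ N.q) i) (lookup (w ∷ N.q) j) ≡ adj (graph H) (lookup (w' ∷ N.q') i) (lookup (w' ∷ N.q') j)
      edges zero zero = trans (irrefl (graph G) w) (sym (irrefl (graph H) w'))
      edges zero (suc j) = root-adj j
      edges (suc i) zero = trans (adj-sym (graph G) _ _) (trans (root-adj i) (adj-sym (graph H) _ _))
      edges (suc i) (suc j) = same-adj N.same i j
      labels : ∀ i → lab G (lookup (w ∷ N.q) i) ≡ lab H (lookup (w' ∷ N.q') i)
      labels zero = root-lab
      labels (suc i) = same-lab N.same i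

  isom : Isom G H
  isom = record { q = w ∷ N.q ; q' = w' ∷ N.q' ; uq = uw ; uq' = uw' ; same = whole ; all = all ; all' = all' }

narrow-isom : ∀ {n M} (G H : LGraph n) → GAgree G H M → (∀ k → 2 * k ≤ n → k ≤ M) →
  (∀ r → Spanning (graph G) r) → (∀ r → Spanning (graph H) r) → Narrow (graph G) M → ∀ {x y : Fin n} → x ≢ y → Isom G H
narrow-isom {n} {M} G H ag half sp sp' nw x≢y =
  let nw' = narrow-transfer G H ag half nw
      ag' = gagree-flip G H ag
      (K , 2K≤n , (g , r , gr , l) , lb) = largest-limb G sp x≢y
      (g' , gr' , sm , l') = limb-match G H ag half nw nw' g r 2K≤n gr l
      (w , w∉ , a) = exit (graph G) (grow-unique gr) l
      (w' , w∉' , a') = exit (graph H) (grow-unique gr') l'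
      (R , dw) = root-at (sp w)
      (R' , dw') = root-at (sp' w')
      lb' : LimbBound H sp' K
      lb' = λ { (h , s , gh , lh) le → let (h' , gh' , _ , lh') = limb-match H G ag' half nw' nw h s le gh lh in lb (h' , s , gh' , lh') le }
  in Main.isom G H ag half sp sp' nw nw' R dw R' dw' 2K≤n lb lb' gr gr' sm l l' w∉ w∉' a a'

-- Inner vertices

does→ : {P : Set} (d : Dec P) → Dec.does d ≡ true → P
does→ (yes p) _ = p

does← : {P : Set} (d : Dec P) → P → Dec.does d ≡ true
does← (yes _) _ = refl
does← (no h)  p = ⊥-elim (h p)

leaves : Graph n → ℕ
leaves G = ∑ (λ v → χ (deg G v ≤? 1))

inner : Graph n → ℕ
inner G = ∑ (λ v → χ (2 ≤? deg G v))

record Elements {n : ℕ} (Q : Fin n → Set) (m : ℕ) : Set where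
  field
    us     : Tuple n m
    unique : Unique us
    sound  : ∀ {x} → x ∈ us → Q x
    full   : ∀ {x} → Q x → x ∈ us

opaque
  elements : {Q : Fin n → Set} (Q? : ∀ x → Dec (Q x)) → Elements Q (∑ (λ x → χ (Q? x)))
  elements {n} {Q} Q? = let (m , el) = go n [] (m≤n+m n 0) [] λ () in subst (Elements Q) (count el) el
    where
    count : ∀ {m} → Elements Q m → m ≡ ∑ (λ x → χ (Q? x))
    count el = trans (sym (count-∈ (Elements.us el) (Elements.unique el)))
      (∑-cong (λ x → χ-cong (x ∈? Elements.us el) (Q? x) (Elements.sound el) (Elements.full el)))
    go : ∀ d {k} (us : Tuple n k) → n ≤ k + d → Unique us → (∀ {x} → x ∈ us → Q x) → ∃ (Elements Q)
    go d us e u s with Finₚ.any? (λ x → Q? x ×-dec ∉? x us)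
    ... | no none = _ , record { us = us ; unique = u ; sound = s ; full = λ {x} q → dec x q (x ∈? us) }
      where
      dec : ∀ x → Q x → Dec (x ∈ us) → x ∈ us
      dec x q (yes m) = m
      dec x q (no h) = ⊥-elim (none (x , q , h))
    go zero {k} us e u s | yes (x , q , x∉) = ⊥-elim (1+n≰n (≤-trans (unique-≤ (x ∷ us) (∉⇒All x∉ ∷ u)) (≤-trans e (≡⇒≤ (+-identityʳ k)))))
    go (suc d) {k} us e u s | yes (x , q , x∉) = go d (x ∷ us) (≤-trans e (≡⇒≤ (+-suc k d))) (∉⇒All x∉ ∷ u) λ { (here refl) → q ; (there m) → s m }

-- Rooted at one of its own vertices, a connected tuple is closed under parents, so its boundary
-- vertices head the branches that hang from it.
module Core (G : LGraph n) (sp : ∀ r → Spanning (graph G) r) {k} {f : Tuple n k} (gr : Grow (graph G) f) {r} (r∈ : r ∈ f) where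
  private
    Γ = graph G

  R = proj₁ (root-at (sp r))
  dr = proj₂ (root-at (sp r))
  open Sub G R public
  open At G R r dr public

  par-closed : ∀ {x} → x ∈ f → par x ∈ f
  par-closed {x} x∈ with x ≟ᶠ r
  ... | yes refl = subst (_∈ f) (sym (kind r dr)) r∈
  ... | no ne with par x ∈? f
  ...   | yes m = m
  ...   | no h = ⊥-elim (ne (root-below (grow-below gr x∈ h r∈)))

  up-closed : ∀ {y x} → y ≼ x → x ∈ f → y ∈ f
  up-closed ≼-refl m = m
  up-closed (≼-step _ p) m = up-closed p (par-closed m)

  bd-par : ∀ {z} → Bd Γ f z → par z ∈ f
  bd-par (z∉ , i , a) with adj→ a
  ... | inj₂ e = subst (_∈ f) e (∈-lookup i f)
  ... | inj₁ e = ⊥-elim (z∉ (subst (_∈ f) (sym e) (par-closed (∈-lookup i f))))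

  ∉≢r : ∀ {z} → z ∉ f → z ≢ r
  ∉≢r z∉ refl = z∉ r∈

  -- Among the descendants of z one with the smallest subtree has no child.
  leaf-below : ∀ z → z ≢ r → ∃ λ x → z ≼ x × deg Γ x ≤ 1
  leaf-below z z≢r with largest (λ x → Dec.does (z ≼? x)) (λ x → n ∸ size x) (λ x → m∸n≤m n (size x)) (z , does← (z ≼? z) ≼-refl)
  ... | x , b , mx = x , z≼x , S-atMost1 (fin n) _ (λ v → χ≤1 (adj? Γ x v)) (λ u v p q → trans (only p) (sym (only q)))
    where
    z≼x = does→ (z ≼? x) b
    only : ∀ {v} → χ (adj? Γ x v) ≢ 0 → v ≡ par x
    only {v} h with adj→ (χ≢0 (adj? Γ x v) h)
    ... | inj₂ e = e
    ... | inj₁ refl = ⊥-elim (lia⊥ (size v ∷ size (par v) ∷ n ∷ (n ∸ size v) ∷ (n ∸ size (par v)) ∷ [])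
          (λ s t n a b → s :< t ∷ t :≤ n ∷ a :≤ b ∷ a :+ s :≡ n ∷ b :+ t :≡ n ∷ [])
          (smaller , size≤ (par v) , mx v (does← (z ≼? v) (≼-step lt z≼x)) , m∸n+n≡m (size≤ v) , m∸n+n≡m (size≤ (par v)) , tt))
      where
      size≤ : ∀ x → size x ≤ n
      size≤ x = ≤-trans (S-mono (fin n) (λ y → χ≤1 (x ≼? y))) (≡⇒≤ (∑-one n))
      v≢r : v ≢ r
      v≢r refl = irrefl-adj Γ (χ≢0 (adj? Γ (par v) v) h) (kind r dr)
      lt = deeper v≢r
      smaller : size v < size (par v)
      smaller = ≤-trans (≡⇒≤ (cong (_+ size v) (sym (trans (∑-cong (λ x → sym (*-identityʳ _))) (∑-δ (par v) (λ _ → 1))))))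
        (≤-trans (≡⇒≤ (sym (S-+ (fin n) _ _))) (S-mono (fin n) pt))
        where
        pt : ∀ x → χ (par v ≟ᶠ x) + χ (v ≼? x) ≤ χ (par v ≼? x)
        pt x with par v ≟ᶠ x
        ... | no _ = χ-mono (v ≼? x) (par v ≼? x) (≼-trans (≼-step lt ≼-refl))
        ... | yes refl = ≡⇒≤ (trans (cong suc (χ-no (v ≼? par v) (par-not-below (up-par lt)))) (sym (χ-yes (par v ≼? par v) ≼-refl)))

  leaf-of : Fin n → Fin n
  leaf-of z with z ≟ᶠ r
  ... | yes _ = z
  ... | no h = proj₁ (leaf-below z h)

  leaf-of-spec : ∀ {z} → z ∉ f → z ≼ leaf-of z × deg Γ (leaf-of z) ≤ 1
  leaf-of-spec {z} z∉ with z ≟ᶠ r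
  ... | yes e = ⊥-elim (∉≢r z∉ e)
  ... | no h = proj₂ (leaf-below z h)

  -- Boundary vertices head disjoint subtrees, each with a leaf of its own.
  bnd≤leaves : bnd Γ f ≤ leaves Γ
  bnd≤leaves = S-inj-≤ (fin n) (fin n) _ _ leaf-of inj (λ z w → ≤-trans (χ≤1 (bd? Γ f z))
      (≡⇒≤ (sym (χ-yes (deg Γ (leaf-of z) ≤? 1) (proj₂ (leaf-of-spec (proj₁ (bd w))))))))
    where
    bd : ∀ {z} → χ (bd? Γ f z) ≢ 0 → Bd Γ f z
    bd {z} = χ≢0 (bd? Γ f z)
    meet : ∀ {z z' x} → Bd Γ f z → Bd Γ f z' → z ≼ x → z' ≼ x → dep z ≤ dep z' → z ≡ z'
    meet {z} {z'} {x} (z∉ , _) b' p p' le with z' ≟ᶠ z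
    ... | yes e = sym e
    ... | no ne with ancestor z' (dep z) z≤n le
    ...   | y , q , dy with ≼-linear (≼-trans q p') p dy
    ...     | refl = ⊥-elim (z∉ (up-closed (proj₂ (≼-up q ne)) (bd-par b')))
    inj : ∀ z z' → χ (bd? Γ f z) ≢ 0 → χ (bd? Γ f z') ≢ 0 → leaf-of z ≡ leaf-of z' → z ≡ z'
    inj z z' w w' e with ≤-total (dep z) (dep z')
    ... | inj₁ le = meet (bd w) (bd w') (proj₁ (leaf-of-spec (proj₁ (bd w)))) (subst (z' ≼_) (sym e) (proj₁ (leaf-of-spec (proj₁ (bd w'))))) le
    ... | inj₂ le = sym (meet (bd w') (bd w) (proj₁ (leaf-of-spec (proj₁ (bd w')))) (subst (z ≼_) e (proj₁ (leaf-of-spec (proj₁ (bd w))))) le)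

  nbr-other : ∀ {y} p → 2 ≤ deg Γ y → ∃ λ v → Adj Γ y v × v ≢ p
  nbr-other {y} p le with Finₚ.any? (λ v → adj? Γ y v ×-dec ¬? (v ≟ᶠ p))
  ... | yes q = q
  ... | no none = ⊥-elim (1+n≰n (≤-trans le (S-atMost1 (fin n) _ (λ v → χ≤1 (adj? Γ y v)) (λ u v p q → trans (only p) (sym (only q))))))
    where
    only : ∀ {v} → χ (adj? Γ y v) ≢ 0 → v ≡ p
    only {v} h with v ≟ᶠ p
    ... | yes e = e
    ... | no ne = ⊥-elim (none (v , χ≢0 (adj? Γ y v) h , ne))

  child : ∀ {y} → 2 ≤ deg Γ y → ∃ λ v → v ≢ r × par v ≡ y
  child {y} le with nbr-other (par y) le
  ... | v , a , ne with adj→ a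
  ...   | inj₂ e = ⊥-elim (ne e)
  ...   | inj₁ e = v , (λ { refl → irrefl-adj Γ a (trans e (kind r dr)) }) , sym e

  child-of : Fin n → Fin n
  child-of y with 2 ≤? deg Γ y
  ... | yes le = proj₁ (child le)
  ... | no _ = y

  child-of-spec : ∀ {y} → 2 ≤ deg Γ y → child-of y ≢ r × par (child-of y) ≡ y
  child-of-spec {y} le with 2 ≤? deg Γ y
  ... | yes le' = proj₂ (child le')
  ... | no h = ⊥-elim (h le)

  -- The inner vertices outside f have children that are neither in f nor next to it.
  neighbourhood-small : (∀ {x} → x ∈ f → 2 ≤ deg Γ x) → bnd Γ f + inner Γ ≤ n
  neighbourhood-small fat = begin
      bnd Γ f + inner Γ
        ≡⟨ cong (bnd Γ f +_) (trans (∑-cong split) (S-+ (fin n) _ _)) ⟩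
      bnd Γ f + (∑ (λ v → χ (v ∈? f)) + ∑ (λ v → χ (2 ≤? deg Γ v ×-dec ∉? v f)))
        ≤⟨ +-monoʳ-≤ (bnd Γ f) (+-monoʳ-≤ (∑ (λ v → χ (v ∈? f))) (S-inj-≤ (fin n) (fin n) _ _ child-of
             (λ y y' w w' e → trans (sym (proj₂ (child-of-spec (proj₁ (st w))))) (trans (cong par e) (proj₂ (child-of-spec (proj₁ (st w'))))))
             (λ y w → ≤-trans (χ≤1 (2 ≤? deg Γ y ×-dec ∉? y f)) (≡⇒≤ (sym (χ-yes (far? (child-of y)) (far (st w)))))))) ⟩
      bnd Γ f + (∑ (λ v → χ (v ∈? f)) + ∑ (λ v → χ (far? v)))
        ≡⟨ sym (trans (S-+ (fin n) _ _) (cong (bnd Γ f +_) (S-+ (fin n) _ _))) ⟩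
      ∑ (λ v → χ (bd? Γ f v) + (χ (v ∈? f) + χ (far? v)))
        ≤⟨ S-mono (fin n) pt ⟩
      ∑ {n} (λ v → 1)
        ≡⟨ ∑-one n ⟩
      n ∎
    where
    open ≤-Reasoning
    far? : ∀ v → Dec (v ∉ f × ¬ Bd Γ f v)
    far? v = ∉? v f ×-dec ¬? (bd? Γ f v)
    st : ∀ {y} → χ (2 ≤? deg Γ y ×-dec ∉? y f) ≢ 0 → 2 ≤ deg Γ y × y ∉ f
    st {y} = χ≢0 (2 ≤? deg Γ y ×-dec ∉? y f)
    far : ∀ {y} → 2 ≤ deg Γ y × y ∉ f → child-of y ∉ f × ¬ Bd Γ f (child-of y)
    far {y} (le , y∉) = (λ m → y∉ (subst (_∈ f) (proj₂ (child-of-spec le)) (par-closed m))) , λ b → y∉ (subst (_∈ f) (proj₂ (child-of-spec le)) (bd-par b))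
    split : ∀ v → χ (2 ≤? deg Γ v) ≡ χ (v ∈? f) + χ (2 ≤? deg Γ v ×-dec ∉? v f)
    split v with v ∈? f
    ... | yes m = trans (χ-yes (2 ≤? deg Γ v) (fat m)) (cong suc (sym (χ-no (2 ≤? deg Γ v ×-dec no (λ h → h m)) (λ (_ , h) → h m))))
    ... | no h = χ-cong (2 ≤? deg Γ v) (2 ≤? deg Γ v ×-dec yes h) (_, h) proj₁
    pt : ∀ v → χ (bd? Γ f v) + (χ (v ∈? f) + χ (far? v)) ≤ 1
    pt v with bd? Γ f v | v ∈? f
    ... | yes b | yes m = ⊥-elim (proj₁ b m)
    ... | yes b | no h = ≤-refl
    ... | no b | yes m = ≤-refl
    ... | no b | no h = ≤-refl

leaves+inner : (G : Graph n) → leaves G + inner G ≡ n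
leaves+inner {n} G = trans (sym (S-+ (fin n) _ _)) (trans (∑-cong pt) (∑-one n))
  where
  pt : ∀ v → χ (deg G v ≤? 1) + χ (2 ≤? deg G v) ≡ 1
  pt v = trans (cong (χ (deg G v ≤? 1) +_) (χ-cong (2 ≤? deg G v) (¬? (deg G v ≤? 1)) <⇒≱ ≰⇒>)) (χ-compl (deg G v ≤? 1) (¬? (deg G v ≤? 1)))

bnd-leaves : (G : LGraph n) → (∀ r → Spanning (graph G) r) → {f : Tuple n k} → Grow (graph G) f → bnd (graph G) f ≤ leaves (graph G)
bnd-leaves {k = zero} G sp ()
bnd-leaves {k = suc k} G sp {f} gr = Core.bnd≤leaves G sp gr (∈-lookup zero f)

-- The boundary has at most as many vertices as there are leaves, so a connected k-tuple with its
-- boundary has at most k + n - `inner` < n - ℓ = N vertices.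
level0 : ∀ {N ℓ} (G H : LGraph n) → N + ℓ ≡ n → GAgree G H N → (∀ r → Spanning (graph G) r) → (∀ r → Spanning (graph H) r) →
  (∀ k → 2 * k ≤ n → k + ℓ < inner (graph G)) → ∀ {x y : Fin n} → x ≢ y → Isom G H
level0 {n} {N} {ℓ} G H e ag sp sp' ok x≢y = narrow-isom G H ag (λ k le → <⇒≤ (≤-trans (s≤s (m≤m+n k _)) (nar k le))) sp sp'
  (λ {k} f gr le → ≤-trans (s≤s (+-monoʳ-≤ k (bnd-leaves G sp gr))) (nar k le)) x≢y
  where
  nar : ∀ k → 2 * k ≤ n → k + leaves (graph G) < N
  nar k le = lia (k ∷ leaves (graph G) ∷ inner (graph G) ∷ N ∷ ℓ ∷ n ∷ [])
    (λ k l i N ℓ n → k :+ ℓ :< i ∷ l :+ i :≡ n ∷ N :+ ℓ :≡ n ∷ [] ⊢ k :+ l :< N) (ok k le , leaves+inner (graph G) , e , tt)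

-- The tree of inner vertices, labelled by degrees

tuples-within : (us : Tuple n m) → Unique us → ∀ k (W : Tuple n k → ℕ) → (∀ f → W f ≢ 0 → ∀ {x} → x ∈ f → x ∈ us) →
  ∑ᵛ k (λ xs → W (map (lookup us) xs)) ≡ ∑ᵛ k W
tuples-within us u zero    W h = refl
tuples-within {n} us u (suc k) W h = trans (∑ᵛ-cong k (λ xs → inner-sum (map (lookup us) xs)))
    (tuples-within us u k (λ ys → ∑ (λ v → W (v ∷ ys))) (λ f w m → let (v , p) = ∑-pos (λ v → W (v ∷ f)) w in h (v ∷ f) p (there m)))
  where
  inner-sum : ∀ ys → ∑ (λ i → W (lookup us i ∷ ys)) ≡ ∑ (λ v → W (v ∷ ys))
  inner-sum ys = trans (sym (∑-∈ us u (λ v → W (v ∷ ys)))) (∑-cong pt)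
    where
    pt : ∀ v → χ (v ∈? us) * W (v ∷ ys) ≡ W (v ∷ ys)
    pt v with W (v ∷ ys) ≟ 0
    ... | yes z = trans (cong (χ (v ∈? us) *_) z) (trans (*-zeroʳ (χ (v ∈? us))) (sym z))
    ... | no nz = trans (cong (_* W (v ∷ ys)) (χ-yes (v ∈? us) (h (v ∷ ys) nz (here refl)))) (+-identityʳ _)

same-trans : {A : LGraph n} {B : LGraph m} {C : LGraph n'} {xs : Tuple n k} {ys : Tuple m k} {zs : Tuple n' k} →
  Same A xs B ys → Same B ys C zs → Same A xs C zs
same-trans (a & l) (b & l') = (λ i j → trans (a i j) (b i j)) & (λ i → trans (l i) (l' i))

core : Graph n → Tuple n m → LGraph m
core T us = induce T us ⟨ (λ i → deg T (lookup us i)) ⟩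

core-same : (T : Graph n) (us : Tuple n m) (xs : Tuple m k) → Same (plain (induce T us)) xs (plain T) (map (lookup us) xs)
core-same T us xs = (λ i j → cong₂ (adj T) (sym (lookup-map i (lookup us) xs)) (sym (lookup-map j (lookup us) xs))) & (λ _ → refl)

Inner : Graph n → Fin n → Set
Inner T x = 2 ≤ deg T x

InnerList : Graph n → ℕ → Set
InnerList T m = Elements (Inner T) m

map-unique-core : {us : Tuple n m} → Unique us → {xs : Tuple m k} → Unique xs → Unique (map (lookup us) xs)
map-unique-core {us = us} u = map-unique (λ _ _ e → lookup-injective u _ _ e)

core-χg : (T : Graph n) {us : Tuple n m} → Unique us → (xs : Tuple m k) → χg (induce T us) xs ≡ χg T (map (lookup us) xs)
core-χg T {us} u xs = χ-cong (grow? (induce T us) xs) (grow? T (map (lookup us) xs))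
  (λ g → grow-same (core-same T us xs) (map-unique-core u (grow-unique g)) g)
  (λ g → grow-same (same-flip (core-same T us xs)) (unique-lookup (λ i j e → lookup-injective (grow-unique g) i j
    (trans (lookup-map i (lookup us) xs) (trans (cong (lookup us) e) (sym (lookup-map j (lookup us) xs)))))) g)

edges : Graph n → Tuple n k → Fin k → Fin k → Bool
edges G f i j = adj G (lookup f i) (lookup f j)

opaque
  all≥2? : (d : Vec ℕ k) → Dec (∀ i → 2 ≤ lookup d i)
  all≥2? d = Finₚ.all? (λ i → 2 ≤? lookup d i)

  type? : (A A' : Fin k → Fin k → Bool) (d d' : Vec ℕ k) → Dec ((∀ i j → A i j ≡ A' i j) × (∀ i → lookup d i ≡ lookup d' i))
  type? A A' d d' = Finₚ.all? (λ i → Finₚ.all? (λ j → A i j ≟ᵇ A' i j)) ×-dec Finₚ.all? (λ i → lookup d i ≟ lookup d' i)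

module CoreAgree {n N ℓ m : ℕ} (T H : Graph n) (e : N + ℓ ≡ n) (ag : GAgree (plain T) (plain H) N)
  (sp : ∀ r → Spanning T r) (sp' : ∀ r → Spanning H r) (eT : inner T ≡ m) (eH : inner H ≡ m)
  (uT : InnerList T m) (uH : InnerList H m) where

  open Elements uT using (us; unique; sound; full)
  open Elements uH using () renaming (us to us'; unique to unique'; sound to sound'; full to full')

  -- By `neighbourhood-small` the boundary has at most n - m vertices, and k + ℓ ≤ m turns this into
  -- k + (n - m) ≤ n - ℓ.
  close : (T : Graph n) → (∀ r → Spanning T r) → inner T ≡ m → ∀ {k} → k + ℓ ≤ m → (f : Tuple n k) → Grow T f →
          (∀ i → 2 ≤ deg T (lookup f i)) → k + bnd T f ≤ N
  close T sp eT {zero} le f () _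
  close T sp eT {suc k} le f gr fat = lia (suc k ∷ bnd T f ∷ inner T ∷ m ∷ ℓ ∷ N ∷ n ∷ [])
    (λ k b i m ℓ N n → k :+ ℓ :≤ m ∷ b :+ i :≤ n ∷ i :≡ m ∷ N :+ ℓ :≡ n ∷ [] ⊢ k :+ b :≤ N)
    (le , Core.neighbourhood-small (plain T) sp gr (∈-lookup zero f) (λ x∈ → let (i , q) = ∈⇒lookup x∈ in subst (λ x → 2 ≤ deg T x) q (fat i)) , eT , e , tt)

  -- The weight is a function of the adjacency matrix and the degree vector, so the same `Φ` serves
  -- both trees and has the form that `deg-transfer` expects.
  typeSum : (T : Graph n) (us : Tuple n m) → ∀ k → ((Fin k → Fin k → Bool) → Vec ℕ k → ℕ) → ℕ
  typeSum T us k Φ = ∑ᵛ k (λ xs → χg (induce T us) xs * Φ (edges (induce T us) xs) (map (lab (core T us)) xs))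

  module _ {k} (Φ : (Fin (suc k) → Fin (suc k) → Bool) → Vec ℕ (suc k) → ℕ) (Φ-ext : ∀ {A A' d} → (∀ i j → A i j ≡ A' i j) → Φ A d ≡ Φ A' d) where

    private
      Ψ : Graph n → Tuple n (suc k) → Vec ℕ (suc k) → ℕ
      Ψ G f d = χ (all≥2? d) * Φ (edges G f) d

      W : Graph n → Tuple n (suc k) → ℕ
      W G f = χg G f * Ψ G f (map (deg G) f)

      pull : (T : Graph n) (uT : InnerList T m) → typeSum T (Elements.us uT) (suc k) Φ ≡ ∑ᵛ (suc k) (W T)
      pull T uT = trans (∑ᵛ-cong (suc k) {λ xs → χg (induce T U.us) xs * Φ (edges (induce T U.us) xs) (map (lab (core T U.us)) xs)} {λ xs → W T (map (lookup U.us) xs)} pt)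
          (tuples-within U.us U.unique (suc k) (W T) (λ f w m → let (i , q) = ∈⇒lookup m in
            U.full (subst (λ x → 2 ≤ deg T x) q (subst (2 ≤_) (lookup-map i (deg T) f) (χ≢0 (all≥2? (map (deg T) f)) (*≢0ˡ _ (*≢0ʳ (χg T f) w)) i)))))
        where
        module U = Elements uT
        pt : ∀ xs → χg (induce T U.us) xs * Φ (edges (induce T U.us) xs) (map (lab (core T U.us)) xs) ≡ W T (map (lookup U.us) xs)
        pt xs = cong₂ _*_ (core-χg T U.unique xs) (trans (cong₂ Φ refl (map-∘ (deg T) (lookup U.us) xs))
          (trans (Φ-ext {d = map (deg T) (map (lookup U.us) xs)} (λ i j → cong₂ (adj T) (sym (lookup-map i (lookup U.us) xs)) (sym (lookup-map j (lookup U.us) xs))))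
            (sym (trans (cong (_* Φ (edges T (map (lookup U.us) xs)) (map (deg T) (map (lookup U.us) xs))) (χ-yes (all≥2? (map (deg T) (map (lookup U.us) xs)))
              (λ i → subst (2 ≤_) (trans (cong (deg T) (sym (lookup-map i (lookup U.us) xs))) (sym (lookup-map i (deg T) (map (lookup U.us) xs))))
                (U.sound (∈-lookup (lookup xs i) U.us))))) (+-identityʳ _)))))

    typeSum-agree : suc k + ℓ ≤ m → typeSum T us (suc k) Φ ≡ typeSum H us' (suc k) Φ
    typeSum-agree le = trans (pull T uT) (trans (deg-transfer (plain T) (plain H) ag k 2 (Ψ T) (Ψ H)
        (λ f f' _ _ s d → cong (χ (all≥2? d) *_) (Φ-ext (same-adj s)))
        (λ f d w → χ≢0 (all≥2? d) (*≢0ˡ _ w)) (λ f d w → χ≢0 (all≥2? d) (*≢0ˡ _ w))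
        (close T sp eT le) (close H sp' eH le)
        k≤N) (sym (pull H uH)))
      where
      k≤N : suc k ≤ N
      k≤N = lia (k ∷ ℓ ∷ m ∷ leaves T ∷ inner T ∷ n ∷ N ∷ []) (λ k ℓ m l i n N → con 1 :+ k :+ ℓ :≤ m ∷ l :+ i :≡ n ∷ i :≡ m ∷ N :+ ℓ :≡ n ∷ [] ⊢ con 1 :+ k :≤ N)
        (le , leaves+inner T , eT , e , tt)

  -- `typeSum-agree` for the indicator of one type.
  match-core : ∀ {k} → suc k + ℓ ≤ m → (xs : Tuple m (suc k)) → Grow (induce T us) xs →
    ∃ λ ys → Grow (induce H us') ys × Same (core T us) xs (core H us') ys
  match-core {k} le xs g =
    let (ys , p) = ∑ᵛ-exists (λ xs → χg (induce T us) xs * Φ (edges (induce T us) xs) (map (lab (core T us)) xs)) (λ ys → χg (induce H us') ys * Φ (edges (induce H us') ys) (map (lab (core H us')) ys)) (typeSum-agree Φ (λ {A} {A'} {d} h → χ-cong (type? A A₀ d d₀) (type? A' A₀ d d₀)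
                       (λ (p , q) → (λ i j → trans (sym (h i j)) (p i j)) , q) (λ (p , q) → (λ i j → trans (h i j) (p i j)) , q)) le)
                     xs (*-pos (χ-pos (grow? (induce T us) xs) g) (χ-pos (type? A₀ A₀ d₀ d₀) ((λ _ _ → refl) , λ _ → refl)))
        (q , l) = χ≢0 (type? (edges (induce H us') ys) A₀ (map (lab (core H us')) ys) d₀) (*≢0ʳ (χg (induce H us') ys) p)
    in ys , χ≢0 (grow? (induce H us') ys) (*≢0ˡ _ p) , (λ i j → sym (q i j)) & (λ i → trans (sym (lookup-map i (lab (core T us)) xs)) (trans (sym (l i)) (lookup-map i (lab (core H us')) ys)))
    where
    A₀ = edges (induce T us) xs
    d₀ = map (lab (core T us)) xs
    Φ : (Fin (suc k) → Fin (suc k) → Bool) → Vec ℕ (suc k) → ℕ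
    Φ A d = χ (type? A A₀ d d₀)

module CoreGAgree {n N ℓ m : ℕ} (T H : Graph n) (e : N + ℓ ≡ n) (ag : GAgree (plain T) (plain H) N)
  (sp : ∀ r → Spanning T r) (sp' : ∀ r → Spanning H r) (eT : inner T ≡ m) (eH : inner H ≡ m)
  (uT : InnerList T m) (uH : InnerList H m) where

  private
    module C = CoreAgree T H e ag sp sp' eT eH uT uH
    module C' = CoreAgree H T e (gagree-flip (plain T) (plain H) ag) sp' sp eH eT uH uT
    G' = core T (Elements.us uT)
    H' = core H (Elements.us uH)

  module _ {k} (le : suc k + ℓ ≤ m) (F : Tuple m (suc k) → ℕ) (F' : Tuple m (suc k) → ℕ)
    (r : ∀ xs ys → Grow (graph G') xs → Grow (graph H') ys → Same G' xs H' ys → F xs ≡ F' ys) where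

    private
      pat : (Fin (suc k) → Fin (suc k) → Bool) → Vec ℕ (suc k) → Pat (suc k)
      pat A d = record { A = A ; L = lookup d ; r = zero }

      found : (Fin (suc k) → Fin (suc k) → Bool) → Vec ℕ (suc k) → Tuple m (suc k) → ℕ
      found A d ys = χg (graph H') ys * χ (match? H' (pat A d) ys)

      -- A weight on types must be made from F and F', which are given on tuples only: evaluate F'
      -- at some tuple of this type found in H'. A type without a tuple gets 0.
      φ : (Fin (suc k) → Fin (suc k) → Bool) → Vec ℕ (suc k) → ℕ
      φ A d with ∑ᵛ (suc k) (found A d) ≟ 0
      ... | yes _ = 0
      ... | no h  = F' (proj₁ (∑ᵛ-pos (suc k) (found A d) h))

      -- F' is only known to agree with F across the two trees, so two tuples of H' are compared
      -- through one of G' of the same type.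
      F'-type : ∀ {ys zs} → Grow (graph H') ys → Grow (graph H') zs → Same H' ys H' zs → F' ys ≡ F' zs
      F'-type {ys} gy gz s = let (xs , gx , t) = C'.match-core le ys gy in
        trans (sym (r xs ys gx gy (same-flip t))) (r xs _ gx gz (same-trans (same-flip t) s))

      φ-found : ∀ A d ys → Grow (graph H') ys → Match H' (pat A d) ys → φ A d ≡ F' ys
      φ-found A d ys g mt with ∑ᵛ (suc k) (found A d) ≟ 0
      ... | yes z = ⊥-elim (*-pos (χ-pos (grow? (graph H') ys) g) (χ-pos (match? H' (pat A d) ys) mt)
                      (n≤0⇒n≡0 (≤-trans (S-≥ (vec m (suc k)) ys (found A d)) (≡⇒≤ z))))
      ... | no h = let (zs , w) = ∑ᵛ-pos (suc k) (found A d) h in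
            F'-type (χ≢0 (grow? (graph H') zs) (*≢0ˡ _ w)) g
              (match-same {G = H'} {H'} {pat A d} (χ≢0 (match? H' (pat A d) zs) (*≢0ʳ (χg (graph H') zs) w)) mt)

      φ-ext : ∀ {A A' d} → (∀ i j → A i j ≡ A' i j) → φ A d ≡ φ A' d
      φ-ext {A} {A'} {d} h = trans (φ-dep (∑ᵛ (suc k) (found A d) ≟ 0)) refl
        where
        same-sum : ∑ᵛ (suc k) (found A d) ≡ ∑ᵛ (suc k) (found A' d)
        same-sum = ∑ᵛ-cong (suc k) {found A d} {found A' d} (λ ys → cong (χg (graph H') ys *_) (χ-cong (match? H' (pat A d) ys) (match? H' (pat A' d) ys)
          (λ (p , q) → (λ i j → trans (p i j) (h i j)) , q) (λ (p , q) → (λ i j → trans (p i j) (sym (h i j))) , q)))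
        φ-zero : ∀ A → ∑ᵛ (suc k) (found A d) ≡ 0 → φ A d ≡ 0
        φ-zero A z with ∑ᵛ (suc k) (found A d) ≟ 0
        ... | yes _ = refl
        ... | no h = ⊥-elim (h z)
        φ-dep : Dec (∑ᵛ (suc k) (found A d) ≡ 0) → φ A d ≡ φ A' d
        φ-dep (yes z) = trans (φ-zero A z) (sym (φ-zero A' (trans (sym same-sum) z)))
        φ-dep (no nz) = let (zs , w) = ∑ᵛ-pos (suc k) (found A d) nz
                            g = χ≢0 (grow? (graph H') zs) (*≢0ˡ _ w)
                            (p , q) = χ≢0 (match? H' (pat A d) zs) (*≢0ʳ (χg (graph H') zs) w)
                        in trans (φ-found A d zs g (p , q)) (sym (φ-found A' d zs g ((λ i j → trans (p i j) (h i j)) , q)))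

    agree-suc : ∑ᵛ (suc k) (λ xs → χg (graph G') xs * F xs) ≡ ∑ᵛ (suc k) (λ ys → χg (graph H') ys * F' ys)
    agree-suc = trans (∑ᵛ-cong (suc k) {λ xs → χg (graph G') xs * F xs} {λ xs → χg (graph G') xs * φ (edges (graph G') xs) (map (lab G') xs)}
        (λ xs → χ-gate (grow? (graph G') xs) (λ g → let (ys , gy , s) = C.match-core le xs g in
          trans (r xs ys g gy s) (sym (φ-found _ _ ys gy ((λ i j → sym (same-adj s i j)) , λ i → trans (sym (same-lab s i)) (sym (lookup-map i (lab G') xs))))))))
      (trans (C.typeSum-agree φ φ-ext le)
      (∑ᵛ-cong (suc k) {λ ys → χg (graph H') ys * φ (edges (graph H') ys) (map (lab H') ys)} {λ ys → χg (graph H') ys * F' ys}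
        (λ ys → χ-gate (grow? (graph H') ys) (λ g → φ-found _ _ ys g ((λ i j → refl) , λ i → sym (lookup-map i (lab H') ys))))))

  core-agree : ∀ {M} → M + ℓ ≡ m → GAgree G' H' M
  core-agree e zero k≤ F F' r = trans (cong (_* F []) (χ-no (grow? (graph G') []) λ ())) (cong (_* F' []) (sym (χ-no (grow? (graph H') []) λ ())))
  core-agree e (suc k) k≤ F F' r = agree-suc (≤-trans (+-monoˡ-≤ ℓ k≤) (≡⇒≤ e)) F F' r

Acyclic′ : Graph n → Set
Acyclic′ {n} G = ¬ ∃ λ m → Σ (Tuple n (3 + m)) (Cycle G)

last-map : {A B : Set} (t : A → B) (xs : Vec A (suc k)) → last (map t xs) ≡ t (last xs)
last-map t (x ∷ [])     = refl
last-map t (x ∷ y ∷ xs) = last-map t (y ∷ xs)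

core-cycle : (T : Graph n) {us : Tuple n m} → Unique us → {xs : Tuple m (suc k)} → Cycle (induce T us) xs → Cycle T (map (lookup us) xs)
core-cycle T {us} u {x ∷ xs} (cycle c uq cl) = cycle (chain c) (map-unique-core u uq) (subst (λ z → Adj T z (lookup us x)) (sym (last-map (lookup us) (x ∷ xs))) cl)
  where
  chain : ∀ {k} {xs : Tuple _ k} → Chain (induce T us) xs → Chain T (map (lookup us) xs)
  chain (one x) = one (lookup us x)
  chain (a ∷ c) = a ∷ chain c

module _ (T : Graph n) {r} (R : Rooted T false) (dr : Rooted.dep R r ≡ 0) where
  open Root R
  open At (plain T) R r dr using (deeper)

  -- A parent has a child and, unless it is the root, a parent of its own.
  par-inner : Inner T r → ∀ {x} → x ≢ r → Inner T (par x)
  par-inner ir {x} x≢r with par x ≟ᶠ r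
  ... | yes e = subst (Inner T) (sym e) ir
  ... | no ne = deg-≥ T (par x) (x ∷ par (par x) ∷ []) (∉⇒All (λ { (here e) → skip e }) ∷ (∉⇒All (λ ()) ∷ []))
        λ { (here refl) → flip-adj T (adj← (up-par (deeper x≢r))) ; (there (here refl)) → adj← (up-par (deeper ne)) }
    where
    skip : x ≢ par (par x)
    skip e = m≢1+n+m (dep x) {1} (trans (up x (deeper x≢r)) (cong suc (trans (up (par x) (deeper ne)) (cong suc (cong dep (sym e))))))

core-spanning : (T : Graph n) → (∀ r → Spanning T r) → Acyclic′ T → (uT : InnerList T m) → ∀ r → Spanning (induce T (Elements.us uT)) r
core-spanning {n} {m} T sp acyclic uT r with component-of (induce T (Elements.us uT)) r
... | k , ys , g , c , q with tight? (induce T (Elements.us uT)) g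
...   | inj₂ (_ , _ , cy) = ⊥-elim (acyclic (_ , _ , core-cycle T (Elements.unique uT) cy))
...   | inj₁ t with root-at (sp (lookup (Elements.us uT) r))
...     | R , dr = record { verts = ys ; tight = t ; all-in = λ v → every _ v ≤-refl ; root≡ = q }
  where
  open Elements uT
  open Root R
  open At (plain T) R (lookup us r) dr using (deeper)
  every : ∀ d i → dep (lookup us i) ≤ d → i ∈ ys
  every d i le with lookup us i ≟ᶠ lookup us r
  ... | yes e = subst (_∈ ys) (trans q (sym (lookup-injective unique i r e))) (last-∈ ys)
  every zero i le | no ne = ⊥-elim (1+n≰n (≤-trans (deeper ne) le))
  every (suc d) i le | no ne with ∈⇒lookup (full (par-inner T R dr (sound (∈-lookup r us)) ne))
  ... | j , e = sealed-adj (induce T us) c (every d j (s≤s⁻¹ (≤-trans (≡⇒≤ (trans (cong (suc ∘ dep) e) (sym (up (lookup us i) (deeper ne))))) le)))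
                  (trans (cong (adj T (lookup us i)) e) (adj← (up-par (deeper ne))))

inner-nbrs : Graph n → Fin n → ℕ
inner-nbrs T v = ∑ (λ x → χ (2 ≤? deg T x ×-dec adj? T v x))

-- By `inner-core` these are the inner vertices of the tree of inner vertices. The same number later
-- bounds the configurations around a longest path.
inner² : Graph n → ℕ
inner² T = ∑ (λ v → χ (2 ≤? inner-nbrs T v))

inner-nbrs≤deg : (T : Graph n) → ∀ v → inner-nbrs T v ≤ deg T v
inner-nbrs≤deg {n} T v = S-mono (fin n) (λ x → χ-mono (2 ≤? deg T x ×-dec adj? T v x) (adj? T v x) proj₂)

inner²≤inner : (T : Graph n) → inner² T ≤ inner T
inner²≤inner {n} T = S-mono (fin n) (λ v → χ-mono (2 ≤? inner-nbrs T v) (2 ≤? deg T v) (λ p → ≤-trans p (inner-nbrs≤deg T v)))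

inner-core : (T : Graph n) (uT : InnerList T m) → inner (induce T (Elements.us uT)) ≡ inner² T
inner-core {n} {m} T uT = trans (∑-cong (λ i → cong (λ d → χ (2 ≤? d)) (core-deg i))) (trans (sym (∑-∈ us unique (λ v → χ (2 ≤? inner-nbrs T v)))) (∑-cong drop))
  where
  open Elements uT
  core-deg : ∀ i → deg (induce T us) i ≡ inner-nbrs T (lookup us i)
  core-deg i = trans (∑-cong (λ j → χ-cong (adj? (induce T us) i j) (adj? T (lookup us i) (lookup us j)) (λ a → a) (λ a → a)))
    (trans (vdeg-∈ T us unique (lookup us i)) (∑-cong (λ x → trans (cong (_* χ (adj? T (lookup us i) x)) (χ-cong (x ∈? us) (2 ≤? deg T x) sound full))
      (sym (χ-× (2 ≤? deg T x) (adj? T (lookup us i) x))))))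
  drop : ∀ v → χ (v ∈? us) * χ (2 ≤? inner-nbrs T v) ≡ χ (2 ≤? inner-nbrs T v)
  drop v with 2 ≤? inner-nbrs T v
  ... | no _ = *-zeroʳ (χ (v ∈? us))
  ... | yes p = trans (*-identityʳ _) (χ-yes (v ∈? us) (full (≤-trans p (inner-nbrs≤deg T v))))

lonely : (T : Graph n) → ∀ {x y z} → ¬ Inner T x → Adj T x y → Adj T x z → y ≡ z
lonely T {x} {y} {z} h a b with y ≟ᶠ z
... | yes e = e
... | no ne = ⊥-elim (h (deg-≥ T x (y ∷ z ∷ []) (∉⇒All (λ { (here e) → ne e }) ∷ (∉⇒All (λ ()) ∷ [])) λ { (here refl) → a ; (there (here refl)) → b }))

leaf-deg : (T : Graph n) → ∀ {x y} → ¬ Inner T x → Adj T x y → deg T x ≡ 1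
leaf-deg T h a = ≤-antisym (s≤s⁻¹ (≰⇒> h)) (deg-≥ T _ (_ ∷ []) (∉⇒All (λ ()) ∷ []) λ { (here refl) → a })

record Part {n : ℕ} (T H : Graph n) (k : ℕ) : Set where
  field
    f f'  : Tuple n k
    uf    : Unique f
    uf'   : Unique f'
    same  : Same (plain T) f (plain H) f'
    degs= : ∀ i → deg T (lookup f i) ≡ deg H (lookup f' i)
    inn   : ∀ {x} → Inner T x → x ∈ f
    inn'  : ∀ {x} → Inner H x → x ∈ f'

-- The leaves missing at a vertex are equal in number on both sides, so they can be matched one at a time.
attach : (T H : Graph n) {r : Fin n} → Inner T r → Spanning T r → Part T H k → Isom (plain T) (plain H)
attach {n} {k} T H {r} ir sp pt with root-at sp
... | R , dr = go n pt (m≤n+m n k)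
  where
  open Root R
  open At (plain T) R r dr using (deeper)
  go : ∀ d {k} → Part T H k → n ≤ k + d → Isom (plain T) (plain H)
  more : ∀ {k} (pt : Part T H k) {x} → x ∉ Part.f pt → Part T H (suc k)
  go d {k} pt le with all? T (Part.f pt)
  ... | inj₁ all = record { q = f ; q' = f' ; uq = uf ; uq' = uf' ; same = same ; all = all
        ; all' = λ x → subset-full (⊤? T) f' uf' (λ _ → tt) (≡⇒≤ (trans (∑-one n) (sym (complete-length T f uf all)))) x tt }
    where open Part pt
  go zero {k} pt le | inj₂ (x , x∉) = ⊥-elim (1+n≰n (≤-trans (unique-≤ (x ∷ Part.f pt) (∉⇒All x∉ ∷ Part.uf pt)) (≤-trans le (≡⇒≤ (+-identityʳ k)))))
  go (suc d) {k} pt le | inj₂ (x , x∉) = go d (more pt x∉) (≤-trans le (≡⇒≤ (+-suc k d)))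
  more {k} pt {x} x∉ = grown (∈⇒lookup (inn (par-inner T R dr ir x≢r)))
    where
    open Part pt
    x≢r : x ≢ r
    x≢r refl = x∉ (inn ir)
    grown : (∃ λ i → lookup f i ≡ par x) → Part T H (suc k)
    grown (i , e) with Finₚ.any? (λ z → ∉? z f' ×-dec adj? H (lookup f' i) z)
    -- If all neighbours in H of the partner are matched, its degree is the number of matched
    -- neighbours; the vertex of T has as many matched neighbours and x besides, against equal
    -- degrees.
    ... | no none = ⊥-elim (1+n≰n (≤-trans (≤-trans (≡⇒≤ (cong suc (sym v≡))) (≤-trans (≡⇒≤ (sym (vdeg-∷ T f xa))) (vdeg≤deg T (x ∷ f) (∉⇒All x∉ ∷ uf) (lookup f i))))
                    (≡⇒≤ (trans (degs= i) (sym (vdeg≡deg H f' uf' (lookup f' i) inside))))))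
      where
      v≡ : vdeg T f (lookup f i) ≡ vdeg H f' (lookup f' i)
      v≡ = vdeg-same same i
      xa : Adj T (lookup f i) x
      xa = flip-adj T (trans (cong (adj T x) e) (adj← (up-par (deeper x≢r))))
      inside : ∀ z → Adj H (lookup f' i) z → z ∈ f'
      inside z a with z ∈? f'
      ... | yes m = m
      ... | no h = ⊥-elim (none (z , h , a))
    ... | yes (x' , x'∉ , a') = record
        { f = x ∷ f ; f' = x' ∷ f' ; uf = ∉⇒All x∉ ∷ uf ; uf' = ∉⇒All x'∉ ∷ uf'
        ; same = edge & (λ _ → refl)
        ; degs= = λ { zero → trans (leaf-deg T (x∉ ∘ inn) a) (sym (leaf-deg H (x'∉ ∘ inn') (flip-adj H a'))) ; (suc j) → degs= j }
        ; inn = there ∘ inn ; inn' = there ∘ inn' }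
      where
      a : Adj T x (lookup f i)
      a = trans (cong (adj T x) e) (adj← (up-par (deeper x≢r)))
      one-edge : ∀ j → adj T x (lookup f j) ≡ adj H x' (lookup f' j)
      one-edge j = bool-iff
        (λ b → subst (λ j → Adj H x' (lookup f' j)) (lookup-injective uf i j (lonely T (x∉ ∘ inn) a b)) (flip-adj H a'))
        (λ b → subst (λ j → Adj T x (lookup f j)) (lookup-injective uf' i j (lonely H (x'∉ ∘ inn') (flip-adj H a') b)) a)
      edge : ∀ i j → adj T (lookup (x ∷ f) i) (lookup (x ∷ f) j) ≡ adj H (lookup (x' ∷ f') i) (lookup (x' ∷ f') j)
      edge zero zero = trans (irrefl T x) (sym (irrefl H x'))
      edge zero (suc j) = one-edge j
      edge (suc i) zero = trans (adj-sym T _ _) (trans (one-edge i) (adj-sym H _ _))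
      edge (suc i) (suc j) = same-adj same i j

core-part : (T H : Graph n) (uT : InnerList T m) (uH : InnerList H m) (is : Isom (core T (Elements.us uT)) (core H (Elements.us uH))) → Part T H (Isom.len is)
core-part T H uT uH is = record
  { f = map (lookup U.us) q ; f' = map (lookup U'.us) q' ; uf = map-unique-core U.unique uq ; uf' = map-unique-core U'.unique uq'
  ; same = same-trans (same-flip (core-same T U.us q)) (same-trans ((same-adj same) & (λ _ → refl)) (core-same H U'.us q'))
  ; degs= = λ i → trans (cong (deg T) (lookup-map i (lookup U.us) q)) (trans (same-lab same i) (cong (deg H) (sym (lookup-map i (lookup U'.us) q'))))
  ; inn = λ ix → let (i , e) = ∈⇒lookup (U.full ix) ; (j , e') = ∈⇒lookup (all i) in
          subst (_∈ map (lookup U.us) q) (trans (lookup-map j (lookup U.us) q) (trans (cong (lookup U.us) e') e)) (∈-lookup j (map (lookup U.us) q))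
  ; inn' = λ ix → let (i , e) = ∈⇒lookup (U'.full ix) ; (j , e') = ∈⇒lookup (all' i) in
          subst (_∈ map (lookup U'.us) q') (trans (lookup-map j (lookup U'.us) q') (trans (cong (lookup U'.us) e') e)) (∈-lookup j (map (lookup U'.us) q')) }
  where
  open Isom is
  module U = Elements uT
  module U' = Elements uH

-- Every vertex fits into a card together with its neighbours, so single vertices can be counted by
-- degree.
inner-agree : ∀ {N} (T H : Graph n) → GAgree (plain T) (plain H) N → 1 ≤ N → (∀ (f : Tuple n 1) → Grow T f → 1 + bnd T f < N) → inner T ≡ inner H
inner-agree {n} {N} T H ag 1≤N nw = trans (single T) (trans
  (deg-transfer (plain T) (plain H) ag 0 0 (λ _ d → χ (2 ≤? head d)) (λ _ d → χ (2 ≤? head d)) (λ _ _ _ _ _ _ → refl) (λ _ _ _ _ → z≤n) (λ _ _ _ _ → z≤n)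
    (λ f g _ → <⇒≤ (nw f g)) (λ f g _ → <⇒≤ (narrow-transfer-at (plain T) (plain H) ag 1 1≤N nw f g)) 1≤N) (sym (single H)))
  where
  single : ∀ T → inner T ≡ ∑ᵛ 1 (λ f → χg T f * χ (2 ≤? head (map (deg T) f)))
  single T = ∑-cong (λ x → sym (trans (cong (_* χ (2 ≤? deg T x)) (χ-yes (grow? T (x ∷ [])) (one x))) (+-identityʳ _)))

-- The computation for whole trees one level down: the tree has `inner T` vertices, of which
-- `inner² T` are inner, and tuples of up to `inner T ∸ ℓ` vertices are visible by `core-agree`.
level1 : ∀ {N ℓ} (T H : Graph n) → N + ℓ ≡ n → 1 ≤ ℓ → GAgree (plain T) (plain H) N → (∀ r → Spanning T r) → (∀ r → Spanning H r) →
  Acyclic′ T → Acyclic′ H → (∀ k → 2 * k ≤ inner T → k + ℓ < inner² T) → Isom (plain T) (plain H)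
level1 {n} {N} {ℓ} T H e 1≤ℓ ag sp sp' ac ac' ok = attach T H (Elements.sound uT (∈-lookup (proj₁ two) (Elements.us uT))) (sp _) (core-part T H uT uH
    (narrow-isom (core T (Elements.us uT)) (core H (Elements.us uH))
      (CoreGAgree.core-agree T H e ag sp sp' refl (sym eq) uT uH (m∸n+n≡m ℓ≤))
      (λ k le → lia (k ∷ ℓ ∷ inner² T ∷ inner T ∷ (inner T ∸ ℓ) ∷ []) (λ k ℓ j i M → k :+ ℓ :< j ∷ j :≤ i ∷ M :+ ℓ :≡ i ∷ [] ⊢ k :≤ M)
         (ok k le , inner²≤inner T , m∸n+n≡m ℓ≤ , tt))
      (core-spanning T sp ac uT) (core-spanning H sp' ac' uH)
      (λ {k} f g le → lia (k ∷ ℓ ∷ inner² T ∷ inner T ∷ (inner T ∸ ℓ) ∷ inner (induce T (Elements.us uT)) ∷ leaves (induce T (Elements.us uT)) ∷ bnd (induce T (Elements.us uT)) f ∷ [])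
         (λ k ℓ j i M c l b → k :+ ℓ :< j ∷ M :+ ℓ :≡ i ∷ c :≡ j ∷ l :+ c :≡ i ∷ b :≤ l ∷ [] ⊢ k :+ b :< M)
         (ok k le , m∸n+n≡m ℓ≤ , inner-core T uT , leaves+inner (induce T (Elements.us uT)) , bnd-leaves (core T (Elements.us uT)) (core-spanning T sp ac uT) g , tt))
      (proj₂ (proj₂ two))))
  where
  2≤inner : 2 ≤ inner T
  2≤inner = lia (ℓ ∷ inner² T ∷ inner T ∷ []) (λ ℓ j i → ℓ :< j ∷ j :≤ i ∷ con 1 :≤ ℓ ∷ [] ⊢ con 2 :≤ i) (ok 0 z≤n , inner²≤inner T , 1≤ℓ , tt)
  nw : ∀ (f : Tuple n 1) → Grow T f → 1 + bnd T f < N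
  nw f g = lia (ℓ ∷ inner² T ∷ inner T ∷ leaves T ∷ bnd T f ∷ N ∷ n ∷ [])
    (λ ℓ j i l b N n → con 1 :+ ℓ :< j ∷ j :≤ i ∷ l :+ i :≡ n ∷ b :≤ l ∷ N :+ ℓ :≡ n ∷ [] ⊢ con 1 :+ b :< N)
    (ok 1 2≤inner , inner²≤inner T , leaves+inner T , bnd-leaves (plain T) sp g , e , tt)
  eq : inner T ≡ inner H
  eq = inner-agree T H ag (lia (ℓ ∷ inner² T ∷ inner T ∷ leaves T ∷ N ∷ n ∷ [])
    (λ ℓ j i l N n → con 1 :+ ℓ :< j ∷ j :≤ i ∷ l :+ i :≡ n ∷ N :+ ℓ :≡ n ∷ [] ⊢ con 1 :≤ N) (ok 1 2≤inner , inner²≤inner T , leaves+inner T , e , tt)) nw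
  ℓ≤ : ℓ ≤ inner T
  ℓ≤ = ≤-trans (<⇒≤ (ok 0 z≤n)) (inner²≤inner T)
  uT : InnerList T (inner T)
  uT = elements (λ x → 2 ≤? deg T x)
  uH : InnerList H (inner T)
  uH = subst (InnerList H) (sym eq) (elements (λ x → 2 ≤? deg H x))
  two-of : ∀ {m} → 2 ≤ m → ∃ λ (x : Fin m) → ∃ λ y → x ≢ y
  two-of (s≤s (s≤s _)) = zero , suc zero , λ ()
  two = two-of 2≤inner

-- Centres and paths to the root

-- A walk without immediate reversals. In a tree this already makes it a path.
data Trail (G : Graph n) : ∀ {m} → Tuple n m → Set where
  edge : ∀ {x y} → Adj G x y → Trail G (x ∷ y ∷ [])
  turn : ∀ {m x y z} {r : Tuple n m} → Adj G x y → x ≢ z → Trail G (y ∷ z ∷ r) → Trail G (x ∷ y ∷ z ∷ r)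

trail-adj : {G : Graph n} {x y : Fin n} {r : Tuple n m} → Trail G (x ∷ y ∷ r) → Adj G x y
trail-adj (edge a)     = a
trail-adj (turn a _ _) = a

-- The two halves of a path around its centre, read from the centre outwards:
-- they share the central vertex, or they traverse the central edge in opposite directions.
Legs : Graph n → Bool → (A B : Tuple n (2 + k)) → Set
Legs G e A B = (Trail G A × Trail G B) × (if e then lookup A zero ≡ lookup B (suc zero) × lookup B zero ≡ lookup A (suc zero)
                                              else lookup A zero ≡ lookup B zero × lookup A (suc zero) ≢ lookup B (suc zero))

-- A path outwards from the centre. At a central edge it begins by crossing this edge in the
-- direction of one of the legs, so that its length determines the depth of its last vertex.
Stem : Graph n → Bool → (A B : Tuple n (2 + k)) → Tuple n (2 + m) → Set
Stem G e A B x = Trail G x × (if e then (lookup x zero ≡ lookup A zero × lookup x (suc zero) ≡ lookup A (suc zero)) ⊎ (lookup x zero ≡ lookup B zero × lookup x (suc zero) ≡ lookup B (suc zero))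
                                   else lookup x zero ≡ lookup A zero)

opaque
  trail? : (G : Graph n) (v : Tuple n m) → Dec (Trail G v)
  trail? G []          = no λ ()
  trail? G (x ∷ [])    = no λ ()
  trail? G (x ∷ y ∷ []) = map′ edge (λ { (edge a) → a }) (adj? G x y)
  trail? G (x ∷ y ∷ z ∷ r) = map′ (λ (a , ne , t) → turn a ne t) (λ { (turn a ne t) → a , ne , t }) (adj? G x y ×-dec (¬? (x ≟ᶠ z) ×-dec trail? G (y ∷ z ∷ r)))

  legs? : (G : Graph n) (e : Bool) (A B : Tuple n (2 + k)) → Dec (Legs G e A B)
  legs? G true  A B = (trail? G A ×-dec trail? G B) ×-dec ((lookup A zero ≟ᶠ lookup B (suc zero)) ×-dec (lookup B zero ≟ᶠ lookup A (suc zero)))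
  legs? G false A B = (trail? G A ×-dec trail? G B) ×-dec ((lookup A zero ≟ᶠ lookup B zero) ×-dec ¬? (lookup A (suc zero) ≟ᶠ lookup B (suc zero)))

  stem? : (G : Graph n) (e : Bool) (A B : Tuple n (2 + k)) (x : Tuple n (2 + m)) → Dec (Stem G e A B x)
  stem? G true  A B x = trail? G x ×-dec (((lookup x zero ≟ᶠ lookup A zero) ×-dec (lookup x (suc zero) ≟ᶠ lookup A (suc zero)))
                                         ⊎-dec ((lookup x zero ≟ᶠ lookup B zero) ×-dec (lookup x (suc zero) ≟ᶠ lookup B (suc zero))))
  stem? G false A B x = trail? G x ×-dec (lookup x zero ≟ᶠ lookup A zero)

-- The last vertex and the one before it, which by `rail-nock` is its parent.
tip nock : Tuple n (2 + m) → Fin n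
tip {m = m} x  = lookup x (suc (fromℕ m))
nock {m = m} x = lookup x (inject₁ (fromℕ m))

module InTree {n : ℕ} (G : Graph n) {e : Bool} (R : Rooted G e) where
  open Root R

  data Down : ∀ {m} → Tuple n (suc m) → Set where
    end : ∀ y → Down (y ∷ [])
    _∷_ : ∀ {m x y} {r : Tuple n m} → x ≡ par y × base e < dep y → Down (y ∷ r) → Down (x ∷ y ∷ r)

  -- After a step down, a step up would lead back to the vertex just left.
  trail-down : ∀ {m x y} {r : Tuple n m} → Trail G (x ∷ y ∷ r) → x ≡ par y → Down (y ∷ r)
  trail-down (edge {y = y} a) p = end y
  trail-down (turn {x = x} {y} {z} a ne t) p with adj→ (trail-adj t)
  ... | inj₂ q = ⊥-elim (ne (trans p (sym q)))
  ... | inj₁ refl = (refl , low (λ d → ne (trans p (top-par z d)))) ∷ trail-down t refl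

  down-dep : ∀ {m y} {r : Tuple n m} → Down (y ∷ r) → dep (lookup (y ∷ r) (fromℕ m)) ≡ dep y + m
  down-dep (end y) = sym (+-identityʳ _)
  down-dep {suc m} ((refl , lt) ∷ d) = trans (down-dep d) (trans (cong (_+ m) (up _ lt)) (sym (+-suc _ m)))

  down-below : ∀ {m y} {r : Tuple n m} → Down (y ∷ r) → y ≼ lookup (y ∷ r) (fromℕ m)
  down-below (end y) = ≼-refl
  down-below ((refl , lt) ∷ d) = ≼-trans (≼-step lt ≼-refl) (down-below d)

  down-above : ∀ {m} {v : Tuple n (suc m)} → Down v → ∀ {z} → z ∈ v → z ≼ lookup v (fromℕ m)
  down-above d (here refl) with d
  ... | end y = ≼-refl
  ... | (p , lt) ∷ d' = down-below ((p , lt) ∷ d')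
  down-above (_ ∷ d) (there m) = down-above d m

  down-par : ∀ {m} {x : Fin n} {v : Tuple n (suc m)} → Down v → x ≡ par (lookup v zero) → lookup (x ∷ v) (inject₁ (fromℕ m)) ≡ par (lookup v (fromℕ m))
  down-par (end y) p = p
  down-par (q ∷ d) p = down-par d (proj₁ q)

  down-unique : ∀ {m} {v v' : Tuple n (suc m)} → Down v → Down v' → lookup v (fromℕ m) ≡ lookup v' (fromℕ m) → v ≡ v'
  down-unique (end y) (end y') refl = refl
  down-unique ((p , _) ∷ d) ((p' , _) ∷ d') q with down-unique d d' q
  ... | refl = cong (_∷ _) (trans p (sym p'))

  descend : ∀ m {v} → dep v ≡ base e + m → ∃ λ (y : Fin n) → Σ (Tuple n m) λ r → Down (y ∷ r) × lookup (y ∷ r) (fromℕ m) ≡ v × dep y ≡ base e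
  descend m {v} d = subst (λ l → ∃ λ (y : Fin n) → Σ (Tuple n l) λ r → Down (y ∷ r) × lookup (y ∷ r) (fromℕ l) ≡ v × dep y ≡ base e)
      (+-identityʳ m) (go m 0 [] d (end v) refl)
    where
    go : ∀ i j {y} (r : Tuple n j) → dep y ≡ base e + i → Down (y ∷ r) → lookup (y ∷ r) (fromℕ j) ≡ v →
         ∃ λ (y : Fin n) → Σ (Tuple n (i + j)) λ r → Down (y ∷ r) × lookup (y ∷ r) (fromℕ (i + j)) ≡ v × dep y ≡ base e
    go zero    j r d dn q = _ , r , dn , q , trans d (+-identityʳ _)
    go (suc i) j {y} r d dn q with go i (suc j) {par y} (y ∷ r) (suc-injective (trans (sym (up y lt)) (trans d (+-suc (base e) i)))) ((refl , lt) ∷ dn) q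
      where lt = ≤-trans (s≤s (m≤m+n (base e) i)) (≡⇒≤ (sym (trans d (+-suc (base e) i))))
    ... | z , s , res = z , subst (λ l → Σ (Tuple n l) λ r → Down (z ∷ r) × lookup (z ∷ r) (fromℕ l) ≡ v × dep z ≡ base e) (+-suc i j) (s , res)

  -- What a stem is in terms of the rooting; in both kinds of rooting its second vertex has depth 1.
  record Rail {m : ℕ} (x : Tuple n (2 + m)) : Set where
    constructor rail
    field
      top : lookup x zero ≡ par (lookup x (suc zero))
      first : dep (lookup x (suc zero)) ≡ 1
      dn  : Down (tail x)

  first-≢ : ∀ {y} → dep y ≡ 1 → par y ≢ y
  first-≢ {y} d q = go e (kind y) (dep≥ y) (up y)
    where
    go : ∀ e → (dep y ≡ base e → if e then par y ≢ y else par y ≡ y) → base e ≤ dep y → (base e < dep y → dep y ≡ suc (dep (par y))) → ⊥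
    go true  k _ _ = k d q
    go false _ _ u = 1+n≢n (trans (sym (u (≡⇒≤ (sym d)))) (cong dep (sym q)))

  rail-dep : {x : Tuple n (2 + m)} → Rail x → dep (tip x) ≡ 1 + m
  rail-dep {x = _ ∷ _ ∷ _} (rail _ o d) = trans (down-dep d) (cong (_+ _) o)

  rail-nock : {x : Tuple n (2 + m)} → Rail x → nock x ≡ par (tip x)
  rail-nock {x = _ ∷ _ ∷ _} (rail t _ d) = down-par d t

  rail-unique : {x x' : Tuple n (2 + m)} → Rail x → Rail x' → tip x ≡ tip x' → x ≡ x'
  rail-unique {x = _ ∷ _ ∷ _} {_ ∷ _ ∷ _} (rail t _ d) (rail t' _ d') q with down-unique d d' q
  ... | refl = cong (_∷ _) (trans t (sym t'))

  rail-in : {x : Tuple n (2 + m)} → Rail x → ∀ {z} → z ∈ x → z ≼ tip x ⊎ dep z ≡ base e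
  rail-in {x = _ ∷ y ∷ _} (rail refl o d) (here refl) with base e <? dep y
  ... | yes lt = inj₁ (≼-trans (≼-step lt ≼-refl) (down-above d (here refl)))
  ... | no h = inj₂ (top-dep y (≤-antisym (≮⇒≥ h) (dep≥ y)))
  rail-in {x = _ ∷ y ∷ _} (rail _ o d) (there m) = inj₁ (down-above d m)

  rail-below : {x : Tuple n (2 + m)} → Rail x → lookup x (suc zero) ≼ tip x
  rail-below {x = _ ∷ y ∷ _} (rail _ o d) = down-above d (here refl)

  rail-of : ∀ {m v} → dep v ≡ 1 + m → Σ (Tuple n (2 + m)) λ x → Rail x × tip x ≡ v
  rail-of {m} {v} d = go e refl
    where
    go : ∀ e' → e ≡ e' → Σ (Tuple n (2 + m)) λ x → Rail x × tip x ≡ v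
    go true refl with descend m d
    ... | y , r , dn , q , dy = par y ∷ y ∷ r , rail refl dy dn , q
    go false refl with descend (suc m) d
    ... | y , z ∷ r , (p , lt) ∷ dn , q , dy = y ∷ z ∷ r , rail p (trans (up z lt) (cong suc (trans (cong dep (sym p)) dy))) dn , q

  rail-trail : {x : Tuple n (2 + m)} → Rail x → Trail G x
  rail-trail {x = _ ∷ _ ∷ _} (rail refl o d) = go d (first-≢ o)
    where
    go : ∀ {m y} {r : Tuple n m} → Down (y ∷ r) → par y ≢ y → Trail G (par y ∷ y ∷ r)
    go (end y) ne = edge (flip-adj G (adj← ne))
    go {y = y} ((refl , lt) ∷ d) ne = turn (flip-adj G (adj← ne)) skip (go d (up-par lt))
      where
      skip : par y ≢ _
      skip q = 1+n≰n (≤-trans (≡⇒≤ (trans (cong suc refl) (sym (up _ lt)))) (≤-trans (≡⇒≤ (cong dep (sym q))) par≤))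
        where
        par≤ : dep (par y) ≤ dep y
        par≤ with base e <? dep y
        ... | yes l = ≤-trans (n≤1+n _) (≡⇒≤ (sym (up y l)))
        ... | no h = ≡⇒≤ (trans (top-dep y t) (sym t))
          where t = ≤-antisym (≮⇒≥ h) (dep≥ y)

  trail-fork : ∀ {m c y} {r : Tuple n m} → Trail G (c ∷ y ∷ r) → y ≢ par c → c ≡ par y × base e < dep y
  trail-fork {c = c} {y} t ne with adj→ (trail-adj t)
  ... | inj₂ q = ⊥-elim (ne q)
  ... | inj₁ refl = refl , low (λ d → ne (sym (top-par y d)))

  module Height (h : ℕ) (hgt : ∀ v → dep v ≤ h) where

    fall-bound : ∀ {m c y} {r : Tuple n m} → Trail G (c ∷ y ∷ r) → c ≡ par y → dep y + m ≤ h
    fall-bound t p = ≤-trans (≡⇒≤ (sym (down-dep (trail-down t p)))) (hgt _)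

    -- From c a trail can at best climb to the top, cross the central edge if there is one, and
    -- descend to depth h.
    trail-bound : ∀ {m c y} {r : Tuple n m} → Trail G (c ∷ y ∷ r) → 2 + m + base e ≤ h + dep c + 1
    trail-bound {m} {c} {y} t with adj→ (trail-adj t)
    ... | inj₁ refl with base e <? dep y
    ...   | yes lt = lia (m ∷ base e ∷ h ∷ dep (par y) ∷ dep y ∷ []) (λ m b h c y → y :≡ con 1 :+ c ∷ y :+ m :≤ h ∷ b :≤ c ∷ [] ⊢ con 2 :+ m :+ b :≤ h :+ c :+ con 1)
            (up y lt , fall-bound t refl , dep≥ (par y) , tt)
    ...   | no h' = topcase e refl
      where
      dy : dep y ≡ base e
      dy = ≤-antisym (≮⇒≥ h') (dep≥ y)
      topcase : ∀ e' → e' ≡ e → 2 + m + base e ≤ h + dep (par y) + 1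
      topcase false refl = ⊥-elim (irrefl-adj G (trail-adj t) (kind y dy))
      topcase true refl = lia (m ∷ h ∷ dep (par y) ∷ dep y ∷ []) (λ m h c y → y :≡ con 1 ∷ c :≡ con 1 ∷ y :+ m :≤ h ∷ [] ⊢ con 2 :+ m :+ con 1 :≤ h :+ c :+ con 1)
        (dy , top-dep y dy , fall-bound t refl , tt)
    trail-bound {m} {c} {y} t | inj₂ refl with base e <? dep c
    ... | no h' = topcase e refl
      where
      dc : dep c ≡ base e
      dc = ≤-antisym (≮⇒≥ h') (dep≥ c)
      topcase : ∀ e' → e' ≡ e → 2 + m + base e ≤ h + dep c + 1
      topcase false refl = ⊥-elim (irrefl-adj G (trail-adj t) (sym (kind c dc)))
      topcase true refl = lia (m ∷ h ∷ dep (par c) ∷ dep c ∷ []) (λ m h c y → y :≡ con 1 ∷ c :≡ con 1 ∷ c :+ m :≤ h ∷ [] ⊢ con 2 :+ m :+ con 1 :≤ h :+ y :+ con 1)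
        (dc , top-dep c dc , fall-bound t (sym (top-par c dc)) , tt)
    trail-bound {c = c} (edge a) | inj₂ refl | yes lt = lia (base e ∷ h ∷ dep c ∷ dep (par c) ∷ []) (λ b h c p → c :≡ con 1 :+ p ∷ b :≤ p ∷ c :≤ h ∷ [] ⊢ con 2 :+ b :≤ h :+ c :+ con 1)
      (up c lt , dep≥ (par c) , hgt c , tt)
    trail-bound {suc m} {c = c} (turn a ne t) | inj₂ refl | yes lt = lia (m ∷ base e ∷ h ∷ dep c ∷ dep (par c) ∷ [])
      (λ m b h c p → c :≡ con 1 :+ p ∷ con 2 :+ m :+ b :≤ h :+ p :+ con 1 ∷ [] ⊢ con 2 :+ (con 1 :+ m) :+ b :≤ h :+ c :+ con 1) (up c lt , trail-bound t , tt)

    -- A path made of two legs is at most as long as the longest path of a tree of height h.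
    legs-bound : ∀ {k} (e' : Bool) {A B : Tuple n (2 + k)} → Legs G e' A B → 2 * (1 + k) + base e ≤ 2 * h + base e'
    legs-bound {k} false {c ∷ y ∷ r} {c ∷ z ∷ s} ((tA , tB) , refl , ne) with y ≟ᶠ par c
    ... | no h' = let (p , lt) = trail-fork tA h' in
      lia (k ∷ base e ∷ h ∷ dep c ∷ dep y ∷ []) (λ k b h c y → y :≡ con 1 :+ c ∷ y :+ k :≤ h ∷ con 2 :+ k :+ b :≤ h :+ c :+ con 1 ∷ [] ⊢ 2 :* (con 1 :+ k) :+ b :≤ 2 :* h :+ con 0)
        (trans (up y lt) (cong (suc ∘ dep) (sym p)) , fall-bound tA p , trail-bound tB , tt)
    ... | yes q = let (p , lt) = trail-fork tB (λ q' → ne (trans q (sym q'))) in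
      lia (k ∷ base e ∷ h ∷ dep c ∷ dep z ∷ []) (λ k b h c y → y :≡ con 1 :+ c ∷ y :+ k :≤ h ∷ con 2 :+ k :+ b :≤ h :+ c :+ con 1 ∷ [] ⊢ 2 :* (con 1 :+ k) :+ b :≤ 2 :* h :+ con 0)
        (trans (up z lt) (cong (suc ∘ dep) (sym p)) , fall-bound tB p , trail-bound tA , tt)
    legs-bound {k} true {c ∷ y ∷ r} {y ∷ c ∷ s} ((tA , tB) , refl , refl) with adj→ (trail-adj tA)
    ... | inj₁ p = lia (k ∷ base e ∷ h ∷ dep y ∷ []) (λ k b h y → y :+ k :≤ h ∷ con 2 :+ k :+ b :≤ h :+ y :+ con 1 ∷ [] ⊢ 2 :* (con 1 :+ k) :+ b :≤ 2 :* h :+ con 1)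
        (fall-bound tA p , trail-bound tB , tt)
    ... | inj₂ p = lia (k ∷ base e ∷ h ∷ dep c ∷ []) (λ k b h y → y :+ k :≤ h ∷ con 2 :+ k :+ b :≤ h :+ y :+ con 1 ∷ [] ⊢ 2 :* (con 1 :+ k) :+ b :≤ 2 :* h :+ con 1)
        (fall-bound tB p , trail-bound tA , tt)

record Halves {n : ℕ} {G : Graph n} {e : Bool} (R : Rooted G e) {k : ℕ} (A B : Tuple n (2 + k)) : Set where
  open InTree G R
  field
    railA : Rail A
    railB : Rail B
    apart : lookup A (suc zero) ≢ lookup B (suc zero)

-- One of the legs, or at a central edge its part beyond the first vertex, only descends. Its length
-- equals the height, so it has to start at the top.
legs-halves : ∀ {n k} (G : Graph n) e (R : Rooted G e) → (∀ v → Root.dep R v ≤ 1 + k) → {A B : Tuple n (2 + k)} → Legs G e A B → Halves R A B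
legs-halves {k = k} G false R hgt {c ∷ y ∷ r} {c ∷ z ∷ s} ((tA , tB) , refl , ne) = record { railA = down tA ; railB = down tB ; apart = ne }
  where
  open Root R
  open InTree G R
  open Height (1 + k) hgt
  root : dep c ≡ 0
  root with y ≟ᶠ par c
  ... | no h = let (p , lt) = trail-fork tA h in lia (k ∷ dep c ∷ dep y ∷ []) (λ k c y → y :≡ con 1 :+ c ∷ y :+ k :≤ con 1 :+ k ∷ [] ⊢ c :≡ con 0)
        (trans (up y lt) (cong (suc ∘ dep) (sym p)) , fall-bound tA p , tt)
  ... | yes q = let (p , lt) = trail-fork tB (λ q' → ne (trans q (sym q'))) in lia (k ∷ dep c ∷ dep z ∷ []) (λ k c y → y :≡ con 1 :+ c ∷ y :+ k :≤ con 1 :+ k ∷ [] ⊢ c :≡ con 0)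
        (trans (up z lt) (cong (suc ∘ dep) (sym p)) , fall-bound tB p , tt)
  down : ∀ {m y} {r : Tuple _ m} → Trail G (c ∷ y ∷ r) → Rail (c ∷ y ∷ r)
  down {y = y} t with trail-fork t (λ q → irrefl-adj G (trail-adj t) (trans (sym (kind c root)) (sym q)))
  ... | p , lt = rail p (trans (up y lt) (cong suc (trans (cong dep (sym p)) root))) (trail-down t p)
legs-halves {k = k} G true R hgt {c ∷ y ∷ r} {y ∷ c ∷ s} ((tA , tB) , refl , refl) = both (adj→ (trail-adj tA))
  where
  open Root R
  open InTree G R
  open Height (1 + k) hgt
  top-of : ∀ {y m} {r : Tuple _ m} → dep y + k ≤ 1 + k → dep y ≡ 1
  top-of {y} le = ≤-antisym (+-cancelʳ-≤ k _ _ le) (dep≥ y)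
  ne : y ≢ c
  ne q = irrefl-adj G (trail-adj tA) (sym q)
  both : c ≡ par y ⊎ y ≡ par c → Halves R (c ∷ y ∷ r) (y ∷ c ∷ s)
  both (inj₁ p) = let d = top-of {y} {r = r} (fall-bound tA p) ; p' = trans (sym (top-par y d)) (cong par (sym p)) in
    record { railA = rail p d (trail-down tA p) ; railB = rail p' (trans (cong dep p) (top-dep y d)) (trail-down tB p') ; apart = ne }
  both (inj₂ p) = let d = top-of {c} {r = r} (fall-bound tB p) ; p' = trans (sym (top-par c d)) (cong par (sym p)) in
    record { railA = rail p' (trans (cong dep p) (top-dep c d)) (trail-down tA p') ; railB = rail p d (trail-down tB p) ; apart = ne }

module _ {n : ℕ} (G : Graph n) where
  private
    root-unique : (R : Rooted G false) → ∀ {x y} → Root.dep R x ≡ 0 → Root.dep R y ≡ 0 → x ≡ y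
    root-unique R {x} {y} dx dy with Root.tops R x y dx dy
    ... | inj₁ q = q
    ... | inj₂ q = trans q (Root.kind R y dy)

    rail-root : (R : Rooted G false) → ∀ {m} {x : Tuple n (2 + m)} → InTree.Rail G R x → Root.dep R (lookup x zero) ≡ 0
    rail-root R {x = x ∷ y ∷ r} (InTree.rail t o _) = suc-injective (trans (cong suc (cong (Root.dep R) t)) (trans (sym (Root.up R y (≡⇒≤ (sym o)))) o))

  halves-legs : ∀ e (R : Rooted G e) {k} {A B : Tuple n (2 + k)} → Halves R A B → Legs G e A B
  halves-legs false R record { railA = a ; railB = b ; apart = ne } = (InTree.rail-trail G R a , InTree.rail-trail G R b) , root-unique R (rail-root R a) (rail-root R b) , ne
  halves-legs true R {A = _ ∷ y ∷ _} {_ ∷ z ∷ _} record { railA = a ; railB = b ; apart = ne } = (InTree.rail-trail G R a , InTree.rail-trail G R b) , A0 , B0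
    where
    open Root R
    yz : y ≡ par z
    yz with tops y z (InTree.Rail.first a) (InTree.Rail.first b)
    ... | inj₁ q = ⊥-elim (ne q)
    ... | inj₂ q = q
    A0 = trans (InTree.Rail.top a) (trans (cong par yz) (top-par z (InTree.Rail.first b)))
    B0 = trans (InTree.Rail.top b) (sym yz)

  stem-rail : ∀ e (R : Rooted G e) {k m} {A B : Tuple n (2 + k)} → Halves R A B → {x : Tuple n (2 + m)} → Stem G e A B x → InTree.Rail G R x
  stem-rail true R record { railA = a ; railB = b } {_ ∷ _ ∷ _} (t , inj₁ (p , q)) = InTree.rail (trans p (trans (InTree.Rail.top a) (cong (Root.par R) (sym q))))
    (trans (cong (Root.dep R) q) (InTree.Rail.first a)) (InTree.trail-down G R t (trans p (trans (InTree.Rail.top a) (cong (Root.par R) (sym q)))))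
  stem-rail true R record { railA = a ; railB = b } {_ ∷ _ ∷ _} (t , inj₂ (p , q)) = InTree.rail (trans p (trans (InTree.Rail.top b) (cong (Root.par R) (sym q))))
    (trans (cong (Root.dep R) q) (InTree.Rail.first b)) (InTree.trail-down G R t (trans p (trans (InTree.Rail.top b) (cong (Root.par R) (sym q)))))
  stem-rail false R record { railA = a } {c ∷ y ∷ r} (t , p) =
    let dc = trans (cong (Root.dep R) p) (rail-root R a)
        (q , lt) = InTree.trail-fork G R t (λ q → irrefl-adj G (trail-adj t) (trans (sym (Root.kind R c dc)) (sym q)))
    in InTree.rail q (trans (Root.up R y lt) (cong suc (trans (cong (Root.dep R) (sym q)) dc))) (InTree.trail-down G R t q)

  rail-stem : ∀ e (R : Rooted G e) {k m} {A B : Tuple n (2 + k)} → Halves R A B → {x : Tuple n (2 + m)} → InTree.Rail G R x → Stem G e A B x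
  rail-stem false R record { railA = a } rx = InTree.rail-trail G R rx , root-unique R (rail-root R rx) (rail-root R a)
  rail-stem true R {A = A} {B} hv {x} rx with Root.tops R (lookup x (suc zero)) (lookup A (suc zero)) (InTree.Rail.first rx) (InTree.Rail.first (Halves.railA hv))
  ... | inj₁ q = InTree.rail-trail G R rx , inj₁ (trans (InTree.Rail.top rx) (trans (cong (Root.par R) q) (sym (InTree.Rail.top (Halves.railA hv)))) , q)
  ... | inj₂ q = InTree.rail-trail G R rx , inj₂ (trans (InTree.Rail.top rx) (trans (cong (Root.par R) q') (sym (InTree.Rail.top (Halves.railB hv)))) , q')
    where
    q' : lookup x (suc zero) ≡ lookup B (suc zero)
    q' = trans q (trans (sym (InTree.Rail.top (Halves.railA hv))) (proj₁ (proj₂ (halves-legs true R hv))))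

  module _ (e : Bool) (R : Rooted G e) {k : ℕ} {A B : Tuple n (2 + k)} (hv : Halves R A B) where
    open Root R
    open InTree G R

    -- Tips match the stems of this length with the vertices of depth 1 + m, since a vertex has only
    -- one path from the centre.
    stem-sum : ∀ m (f : Fin n → ℕ) → ∑ᵛ (2 + m) (λ x → χ (stem? G e A B x) * f (tip x)) ≡ ∑ (λ v → χ (dep v ≟ 1 + m) * f v)
    stem-sum m f = ≤-antisym
      (S-inj-≤ (vec n (2 + m)) (fin n) w w' tip (λ x x' h h' q → rail-unique (st h) (st h') q)
        (λ x h → *-monoˡ-≤ (f (tip x)) (≤-trans (χ≤1 (stem? G e A B x)) (≡⇒≤ (sym (χ-yes (dep (tip x) ≟ 1 + m) (rail-dep (st h))))))))
      (S-inj-≤ (fin n) (vec n (2 + m)) w' w to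
        (λ v v' h h' q → trans (sym (proj₂ (to-spec h))) (trans (cong tip q) (proj₂ (to-spec h'))))
        (λ v h → ≤-trans (*-monoˡ-≤ (f v) (χ≤1 (dep v ≟ 1 + m))) (≡⇒≤ (sym (cong₂ _*_ (χ-yes (stem? G e A B (to v)) (rail-stem e R hv (proj₁ (to-spec h)))) (cong f (proj₂ (to-spec h))))))))
      where
      w : Tuple n (2 + m) → ℕ
      w x = χ (stem? G e A B x) * f (tip x)
      w' : Fin n → ℕ
      w' v = χ (dep v ≟ 1 + m) * f v
      st : ∀ {x} → w x ≢ 0 → Rail x
      st {x} h = stem-rail e R hv (χ≢0 (stem? G e A B x) (*≢0ˡ _ h))
      to : Fin n → Tuple n (2 + m)
      to v with dep v ≟ 1 + m
      ... | yes d = proj₁ (rail-of d)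
      -- A placeholder for a vertex of weight zero.
      ... | no _ = Data.Vec.replicate (2 + m) v
      to-spec : ∀ {v} → w' v ≢ 0 → Rail (to v) × tip (to v) ≡ v
      to-spec {v} h with dep v ≟ 1 + m
      ... | yes d = proj₂ (rail-of d)
      ... | no _ = ⊥-elim (h refl)

-- Existence of the centre

opaque
  argmax : (f : Fin n → ℕ) → Fin n → ∃ λ u → ∀ v → f v ≤ f u
  argmax {suc zero} f _ = zero , λ { zero → ≤-refl }
  argmax {suc (suc n)} f _ with argmax (f ∘ suc) zero
  ... | u , mx with ≤-total (f zero) (f (suc u))
  ...   | inj₁ le = suc u , λ { zero → le ; (suc v) → mx v }
  ...   | inj₂ le = zero , λ { zero → ≤-refl ; (suc v) → ≤-trans (mx v) le }

  argmin : (f : Fin n → ℕ) → Fin n → ∃ λ u → ∀ v → f u ≤ f v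
  argmin {suc zero} f _ = zero , λ { zero → ≤-refl }
  argmin {suc (suc n)} f _ with argmin (f ∘ suc) zero
  ... | u , mn with ≤-total (f zero) (f (suc u))
  ...   | inj₁ le = zero , λ { zero → ≤-refl ; (suc v) → ≤-trans le (mn v) }
  ...   | inj₂ le = suc u , λ { zero → le ; (suc v) → mn v }

record Centred (G : Graph n) : Set where
  field
    {e}   : Bool
    R     : Rooted G e
    {κ}   : ℕ
    hgt   : ∀ v → Root.dep R v ≤ 1 + κ
    A B   : Tuple n (2 + κ)
    halves : Halves R A B

-- Re-rooting from the vertex w to the edge between w and its child y: the subtree of y keeps its
-- depths and all other vertices sink by one.
module EdgeRoot (G : Graph n) (R : Rooted G false) {w y} (dw : Root.dep R w ≡ 0) (dy : Root.dep R y ≡ 1) where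
  open Root R
  open At (plain G) R w dw using (first-par; is-root; root-below)

  w≢y : w ≢ y
  w≢y e = 1+n≢0 (trans (sym dy) (trans (cong dep (sym e)) dw))

  par₂ : Fin n → Fin n
  par₂ v with v ≟ᶠ w
  ... | yes _ = y
  ... | no _  = par v

  par₂-w : par₂ w ≡ y
  par₂-w with w ≟ᶠ w
  ... | yes _ = refl
  ... | no h = ⊥-elim (h refl)

  par₂-≢ : ∀ {v} → v ≢ w → par₂ v ≡ par v
  par₂-≢ {v} ne with v ≟ᶠ w
  ... | yes q = ⊥-elim (ne q)
  ... | no _ = refl

  par₂-y : par₂ y ≡ w
  par₂-y = trans (par₂-≢ (w≢y ∘ sym)) (first-par dy)

  dep₂ : Fin n → ℕ
  dep₂ v with y ≼? v
  ... | yes _ = dep v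
  ... | no _  = suc (dep v)

  dep₂-in : ∀ {v} → y ≼ v → dep₂ v ≡ dep v
  dep₂-in {v} p with y ≼? v
  ... | yes _ = refl
  ... | no h = ⊥-elim (h p)

  dep₂-out : ∀ {v} → ¬ y ≼ v → dep₂ v ≡ suc (dep v)
  dep₂-out {v} p with y ≼? v
  ... | yes q = ⊥-elim (p q)
  ... | no h = refl

  w-out : ¬ y ≼ w
  w-out p = w≢y (sym (root-below p))

  dep₂-w : dep₂ w ≡ 1
  dep₂-w = trans (dep₂-out w-out) (cong suc dw)

  dep₂-y : dep₂ y ≡ 1
  dep₂-y = trans (dep₂-in ≼-refl) dy

  ends : ∀ {v} → dep₂ v ≡ 1 → v ≡ y ⊎ v ≡ w
  ends {v} d with y ≼? v
  ... | yes p = inj₁ (sym (≼-dep-eq p (≡⇒≤ (trans d (sym dy)))))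
  ... | no _ = inj₂ (is-root (suc-injective d))

  out-par : ∀ {v} → ¬ y ≼ v → v ≢ w → ¬ y ≼ par v
  out-par h ne p = h (≼-step (low (λ d → ne (is-root d))) p)

  dep₂-up : ∀ v → 1 < dep₂ v → dep₂ v ≡ suc (dep₂ (par₂ v))
  dep₂-up v lt with y ≼? v
  ... | yes p = trans (up v (≤-trans (s≤s z≤n) lt)) (cong suc (trans (sym (dep₂-in (proj₂ (≼-up p v≢y)))) (cong dep₂ (sym (par₂-≢ (λ e → w-out (subst (y ≼_) e p)))))))
    where
    v≢y : v ≢ y
    v≢y e = <-irrefl refl (≤-trans lt (≡⇒≤ (trans (cong dep e) dy)))
  ... | no h = cong suc (trans (up v (s≤s⁻¹ lt)) (trans (sym (dep₂-out (out-par h v≢w))) (cong dep₂ (sym (par₂-≢ v≢w)))))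
    where
    v≢w : v ≢ w
    v≢w e = <-irrefl refl (≤-trans lt (≡⇒≤ (cong suc (trans (cong dep e) dw))))

  R₂ : Rooted G true
  R₂ = record
    { par = par₂ ; dep = dep₂ ; dep≥ = ge ; up = dep₂-up ; top-dep = λ v d → td (ends {v} d) ; top-par = λ v d → tp (ends {v} d)
    ; tops = λ u v du dv → ts (ends {u} du) (ends {v} dv) ; kind = λ v d → kd (ends {v} d) ; adj→ = λ a → ad a (adj→ a) ; adj← = λ {u} → ab u }
    where
    ge : ∀ v → 1 ≤ dep₂ v
    ge v with y ≼? v
    ... | yes p = ≤-trans (≡⇒≤ (sym dy)) (≼-dep p)
    ... | no _ = s≤s z≤n
    td : ∀ {v} → v ≡ y ⊎ v ≡ w → dep₂ (par₂ v) ≡ 1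
    td (inj₁ refl) = trans (cong dep₂ par₂-y) dep₂-w
    td (inj₂ refl) = trans (cong dep₂ par₂-w) dep₂-y
    tp : ∀ {v} → v ≡ y ⊎ v ≡ w → par₂ (par₂ v) ≡ v
    tp (inj₁ refl) = trans (cong par₂ par₂-y) par₂-w
    tp (inj₂ refl) = trans (cong par₂ par₂-w) par₂-y
    ts : ∀ {u v} → u ≡ y ⊎ u ≡ w → v ≡ y ⊎ v ≡ w → u ≡ v ⊎ u ≡ par₂ v
    ts (inj₁ refl) (inj₁ refl) = inj₁ refl
    ts (inj₂ refl) (inj₂ refl) = inj₁ refl
    ts (inj₁ refl) (inj₂ refl) = inj₂ (sym par₂-w)
    ts (inj₂ refl) (inj₁ refl) = inj₂ (sym par₂-y)
    kd : ∀ {v} → v ≡ y ⊎ v ≡ w → par₂ v ≢ v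
    kd (inj₁ refl) q = w≢y (trans (sym par₂-y) q)
    kd (inj₂ refl) q = w≢y (trans (sym q) par₂-w)
    fix : ∀ {u v} → Adj G u v → u ≡ par v → u ≡ par₂ v
    fix {u} {v} a q with v ≟ᶠ w
    ... | yes refl = ⊥-elim (irrefl-adj G a (trans q (kind w dw)))
    ... | no _ = q
    ad : ∀ {u v} → Adj G u v → u ≡ par v ⊎ v ≡ par u → u ≡ par₂ v ⊎ v ≡ par₂ u
    ad a (inj₁ q) = inj₁ (fix a q)
    ad a (inj₂ q) = inj₂ (fix (flip-adj G a) q)
    ab : ∀ u → par₂ u ≢ u → Adj G u (par₂ u)
    ab u ne with u ≟ᶠ w
    ... | yes refl = flip-adj G (subst (Adj G y) (first-par dy) (adj← (λ q → w≢y (trans (sym (first-par dy)) q))))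
    ... | no _ = adj← ne

  side : ∀ {z v} → Root._≼_ R₂ z v → y ≼ v → y ≼ z
  side Root.≼-refl p = p
  side {v = v} (Root.≼-step lt q) p = side q (subst (y ≼_) (sym (par₂-≢ (λ e → w-out (subst (y ≼_) e p)))) (proj₂ (≼-up p
    (λ e → <-irrefl refl (≤-trans lt (≡⇒≤ (trans (cong dep₂ e) dep₂-y)))))))

  side-out : ∀ {z v} → Root._≼_ R₂ z v → ¬ y ≼ v → ¬ y ≼ z
  side-out Root.≼-refl p = p
  side-out {v = v} (Root.≼-step lt q) p = side-out q (subst (λ x → ¬ y ≼ x) (sym (par₂-≢ v≢w)) (out-par p v≢w))
    where
    v≢w : v ≢ w
    v≢w e = <-irrefl refl (≤-trans lt (≡⇒≤ (trans (cong dep₂ e) dep₂-w)))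

  -- Moving the root from w to y brings the subtree of y one step closer and everything else at most one step further away.
  module _ (R' : Rooted G false) (dy' : Root.dep R' y ≡ 0) where
    private
      module R' = Root R'
      near : ∀ {u v} → Adj G u v → R'.dep u ≤ suc (R'.dep v)
      near {u} {v} a with R'.adj→ a
      ... | inj₂ refl with 0 <? R'.dep u
      ...   | yes lt = ≡⇒≤ (R'.up u lt)
      ...   | no h = ≤-trans (≡⇒≤ (n≤0⇒n≡0 (≮⇒≥ h))) z≤n
      near {u} {v} a | inj₁ refl with 0 <? R'.dep v
      ...   | yes lt = ≤-trans (n≤1+n _) (≤-trans (≡⇒≤ (sym (R'.up v lt))) (n≤1+n _))
      ...   | no h = ⊥-elim (irrefl-adj G a (R'.kind v (n≤0⇒n≡0 (≮⇒≥ h))))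
      par-adj : ∀ {v} → v ≢ w → Adj G v (par v)
      par-adj ne = adj← (up-par (low (λ d → ne (is-root d))))

    closer : ∀ d {v} → dep v ≤ d → (y ≼ v → suc (R'.dep v) ≤ dep v) × (¬ y ≼ v → R'.dep v ≤ suc (dep v))
    closer d {v} le with v ≟ᶠ w
    ... | yes refl = (λ p → ⊥-elim (w-out p)) , λ _ → ≤-trans (near (flip-adj G (subst (Adj G y) (first-par dy) (par-adj (w≢y ∘ sym))))) (s≤s (≤-trans (≡⇒≤ dy') z≤n))
    closer zero {v} le | no ne = ⊥-elim (ne (is-root (n≤0⇒n≡0 le)))
    closer (suc d) {v} le | no ne with closer d {par v} (s≤s⁻¹ (≤-trans (≡⇒≤ (sym (up v (low (λ d → ne (is-root d)))))) le))
    ... | inn , out = inside , λ h → ≤-trans (near (par-adj ne)) (s≤s (≤-trans (out (out-par h ne)) (≡⇒≤ (sym (up v (low (λ d → ne (is-root d))))))))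
      where
      inside : y ≼ v → suc (R'.dep v) ≤ dep v
      inside p with v ≟ᶠ y
      ... | yes refl = ≡⇒≤ (trans (cong suc dy') (sym dy))
      ... | no h = ≤-trans (s≤s (≤-trans (near (par-adj ne)) (inn (proj₂ (≼-up p h))))) (≡⇒≤ (sym (up v (low (λ d → ne (is-root d))))))

-- Let w have least eccentricity, and let y be its neighbour towards a farthest vertex u. If a
-- vertex outside the subtree of y is equally far, w is the centre. Otherwise a vertex v farthest
-- from y lies outside this subtree, because the eccentricity of y is no smaller, and its distance
-- from w is one less than that of u; the edge from w to y is the centre.
centre : (G : Graph n) → (∀ r → Spanning G r) → ∀ {x y : Fin n} → x ≢ y → Centred G
centre {n} G sp {x} {x'} x≢x' = found (argmin ht x)
  where
  R : ∀ w → Rooted G false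
  R w = proj₁ (root-at (sp w))
  d₀ : ∀ w → Root.dep (R w) w ≡ 0
  d₀ w = proj₂ (root-at (sp w))
  deepest : ∀ w → ∃ λ u → ∀ v → Root.dep (R w) v ≤ Root.dep (R w) u
  deepest w = argmax (Root.dep (R w)) w
  ht : Fin n → ℕ
  ht w = Root.dep (R w) (proj₁ (deepest w))
  found : (∃ λ w → ∀ v → ht w ≤ ht v) → Centred G
  found (w , least) = by-ht (ht w) refl
    where
    open Root (R w)
    open At (plain G) (R w) w (d₀ w) using (above; deeper; is-root)
    u = proj₁ (deepest w)
    mx = proj₂ (deepest w)
    other : ∃ λ z → z ≢ w
    other with x ≟ᶠ w
    ... | yes refl = x' , (λ e → x≢x' (sym e))
    ... | no h = x , h
    by-ht : ∀ h → ht w ≡ h → Centred G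
    by-ht zero e = ⊥-elim (1+n≰n (≤-trans (deeper (proj₂ other)) (≤-trans (mx (proj₁ other)) (≡⇒≤ e))))
    by-ht (suc k) e with above u (λ q → 1+n≢0 (trans (sym e) (trans (cong dep q) (d₀ w))))
    ... | y , dy , y≼u with Finₚ.any? (λ v → (dep v ≟ suc k) ×-dec ¬? (y ≼? v))
    ...   | yes (u' , du' , h) with InTree.rail-of G (R w) {k} {u} e | InTree.rail-of G (R w) {k} {u'} du'
    ...     | A , ra , ta | B , rb , tb = record { R = R w ; hgt = λ v → ≤-trans (mx v) (≡⇒≤ e) ; A = A ; B = B ; halves = record
              { railA = ra ; railB = rb ; apart = λ q → h (subst₂ _≼_ (trans (sym q) (≼-linear (subst (_ ≼_) ta (InTree.rail-below G (R w) ra)) y≼u (trans (InTree.Rail.first ra) (sym dy)))) tb (InTree.rail-below G (R w) rb)) } }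
    by-ht (suc k) e | y , dy , y≼u | no none = edge-case
      where
      module E = EdgeRoot G (R w) (d₀ w) dy
      v = proj₁ (deepest y)
      cl = E.closer (R y) (d₀ y) (dep v) {v} ≤-refl
      far : suc k ≤ Root.dep (R y) v
      far = ≤-trans (≡⇒≤ (sym e)) (least y)
      v-out : ¬ y ≼ v
      v-out p = 1+n≰n (≤-trans (≤-trans (s≤s far) (proj₁ cl p)) (≤-trans (mx v) (≡⇒≤ e)))
      short : ∀ {z} → ¬ y ≼ z → suc (dep z) ≤ suc k
      short {z} h with dep z ≟ suc k
      ... | yes q = ⊥-elim (none (z , q , h))
      ... | no ne = ≤∧≢⇒< (≤-trans (mx z) (≡⇒≤ e)) ne
      dv : E.dep₂ v ≡ suc k
      dv = trans (E.dep₂-out v-out) (≤-antisym (short v-out) (≤-trans far (proj₂ cl v-out)))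
      edge-case : Centred G
      edge-case with InTree.rail-of G E.R₂ {k} {u} (trans (E.dep₂-in y≼u) e) | InTree.rail-of G E.R₂ {k} {v} dv
      ... | A , ra , ta | B , rb , tb = record { R = E.R₂ ; hgt = hg ; A = A ; B = B ; halves = record
              { railA = ra ; railB = rb ; apart = λ q → E.side-out (InTree.rail-below G E.R₂ rb) (subst (λ z → ¬ y ≼ z) (sym tb) v-out)
                  (subst (y ≼_) q (E.side (InTree.rail-below G E.R₂ ra) (subst (y ≼_) (sym ta) y≼u))) } }
        where
        hg : ∀ z → E.dep₂ z ≤ suc k
        hg z with y ≼? z
        ... | yes p = ≤-trans (mx z) (≡⇒≤ e)
        ... | no h = short h

-- Counting branches at a given depth

count-≤ : ∀ {c} (E : Tuple n c) → ∑ (λ x → χ (x ∈? E)) ≤ c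
count-≤ {n} [] = ≡⇒≤ (S-zero (fin n) (λ x → χ-no (x ∈? []) λ ()))
count-≤ {n} {suc c} (y ∷ E) = ≤-trans (S-mono (fin n) pt) (≤-trans (≡⇒≤ (trans (S-+ (fin n) _ _)
    (cong (_+ ∑ (λ x → χ (x ∈? E))) (trans (∑-cong (λ x → sym (*-identityʳ _))) (∑-δ y (λ _ → 1)))))) (s≤s (count-≤ E)))
  where
  pt : ∀ x → χ (x ∈? (y ∷ E)) ≤ χ (y ≟ᶠ x) + χ (x ∈? E)
  pt x with y ≟ᶠ x
  ... | yes _ = ≤-trans (χ≤1 (x ∈? (y ∷ E))) (s≤s z≤n)
  ... | no h = χ-mono (x ∈? (y ∷ E)) (x ∈? E) λ { (here e) → ⊥-elim (h (sym e)) ; (there m) → m }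

-- The way all configurations are bounded: a list of exceptions is added to the vertices with two
-- inner neighbours.
inner²-cover : ∀ {c} (G : Graph n) {Q : Fin n → Set} (Q? : ∀ z → Dec (Q z)) (E : Tuple n c) →
  (∀ {z} → Q z → 2 ≤ inner-nbrs G z ⊎ z ∈ E) → ∑ (λ z → χ (Q? z)) ≤ inner² G + c
inner²-cover {n} G Q? E h = ≤-trans (S-mono (fin n) pt) (≤-trans (≡⇒≤ (S-+ (fin n) _ _)) (+-monoʳ-≤ (inner² G) (count-≤ E)))
  where
  pt : ∀ z → χ (Q? z) ≤ χ (2 ≤? inner-nbrs G z) + χ (z ∈? E)
  pt z with Q? z
  ... | no _ = z≤n
  ... | yes q with h q
  ...   | inj₁ p = ≤-trans (≡⇒≤ (sym (χ-yes (2 ≤? inner-nbrs G z) p))) (m≤m+n _ _)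
  ...   | inj₂ m = ≤-trans (≡⇒≤ (sym (χ-yes (z ∈? E) m))) (m≤n+m _ _)

inner-nbrs-≥ : (G : Graph n) → ∀ {z a b} → a ≢ b → Adj G z a → Adj G z b → Inner G a → Inner G b → 2 ≤ inner-nbrs G z
inner-nbrs-≥ {n} G {z} {a} {b} ne za zb ia ib = ≤-trans (≡⇒≤ (sym (count-∈ (a ∷ b ∷ []) (∉⇒All (λ { (here e) → ne e }) ∷ (∉⇒All (λ ()) ∷ [])))))
  (S-mono (fin n) (λ x → χ-mono (x ∈? (a ∷ b ∷ [])) (2 ≤? deg G x ×-dec adj? G z x) λ { (here refl) → ia , za ; (there (here refl)) → ib , zb }))

deg-two : (G : Graph n) → ∀ {v a b} → a ≢ b → Adj G v a → Adj G v b → 2 ≤ deg G v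
deg-two G {v} {a} {b} ne va vb = deg-≥ G v (a ∷ b ∷ []) (∉⇒All (λ { (here e) → ne e }) ∷ (∉⇒All (λ ()) ∷ [])) λ { (here refl) → va ; (there (here refl)) → vb }

module Grand {n : ℕ} (G : Graph n) {e : Bool} (R : Rooted G e) {k} (hgt : ∀ v → Root.dep R v ≤ 1 + k) {A B : Tuple n (2 + k)} (hv : Halves R A B) where
  open Root R
  open InTree G R
  open Halves hv

  opaque
    child-towards : ∀ {v w} → v ≼ w → dep v < dep w → ∃ λ c → par c ≡ v × base e < dep c × c ≼ w
    child-towards {v} {w} p lt =
      let (c , q , d) = ancestor w (suc (dep v)) (≤-trans (dep≥ v) (n≤1+n _)) lt
          bc = ≤-trans (s≤s (dep≥ v)) (≡⇒≤ (sym d))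
      in c , ≼-linear (≼-trans (≼-step bc ≼-refl) q) p (suc-injective (trans (sym (up c bc)) d)) , bc , q

  par-dep : ∀ v → dep (par v) ≤ dep v
  par-dep v with base e <? dep v
  ... | yes l = ≤-trans (n≤1+n _) (≡⇒≤ (sym (up v l)))
  ... | no h = ≡⇒≤ (trans (top-dep v t) (sym t))
    where t = ≤-antisym (≮⇒≥ h) (dep≥ v)

  first-adj : {x : Tuple n (2 + m)} → Rail x → Adj G (lookup x zero) (lookup x (suc zero))
  first-adj {x = _ ∷ _ ∷ _} r = trail-adj (rail-trail r)

  loop-root : ∀ {v} → par v ≡ v → dep v ≡ base e × base e ≡ 0
  loop-root {v} q with base e <? dep v
  ... | yes l = ⊥-elim (up-par l q)
  ... | no h = d , go e (kind v) d
    where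
    d = ≤-antisym (≮⇒≥ h) (dep≥ v)
    go : ∀ e → (dep v ≡ base e → if e then par v ≢ v else par v ≡ v) → dep v ≡ base e → base e ≡ 0
    go false _ _ = refl
    go true k d = ⊥-elim (k d q)

  root-unique : base e ≡ 0 → ∀ {u v} → dep u ≡ 0 → dep v ≡ 0 → u ≡ v
  root-unique z {u} {v} du dv with tops u v (trans du (sym z)) (trans dv (sym z))
  ... | inj₁ q = q
  ... | inj₂ q = go e z (kind v) (λ k → trans q (k (trans dv (sym z))))
    where
    go : ∀ e → base e ≡ 0 → (dep v ≡ base e → if e then par v ≢ v else par v ≡ v) → ((dep v ≡ base e → par v ≡ v) → u ≡ v) → u ≡ v
    go false _ k f = f (λ _ → k (trans dv refl))

  zero-dep : base e ≡ 0 → ∀ {m} {x : Tuple n (2 + m)} → Rail x → dep (lookup x zero) ≡ 0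
  zero-dep z {x = _ ∷ y ∷ _} (rail t o _) = suc-injective (trans (cong (suc ∘ dep) t) (trans (sym (up y (≤-trans (s≤s (≡⇒≤ z)) (≡⇒≤ (sym o))))) o))

  inner-of : ∀ {c v} → par c ≡ v → base e < dep c → 2 ≤ deg G v
  inner-of {c} refl lt with par (par c) ≟ᶠ par c
  ... | no ne = deg-two G (λ q → 1+n≰n (≤-trans (≡⇒≤ (sym (up c lt))) (≤-trans (≡⇒≤ (cong dep q)) (par-dep (par c))))) (flip-adj G (adj← (up-par lt))) (adj← ne)
  ... | yes q = let (d , z) = loop-root q in
    deg-two G apart (subst (λ v → Adj G v _) (root-unique z (zero-dep z railA) (trans d z)) (first-adj railA)) (subst (λ v → Adj G v _) (root-unique z (zero-dep z railB) (trans d z)) (first-adj railB))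

  Grand : Fin n → Set
  Grand z = ∃ λ w → z ≼ w × 2 + dep z ≤ dep w

  branch-≢ : ∀ c → ∃ λ b → b ≢ c × dep b ≡ 1 × Adj G (par b) b × (∃ λ t → b ≼ t × dep t ≡ 1 + k)
  branch-≢ c with lookup A (suc zero) ≟ᶠ c
  ... | no ne = _ , ne , Rail.first railA , subst (λ p → Adj G p _) (Rail.top railA) (first-adj railA) , _ , rail-below railA , rail-dep railA
  ... | yes refl = _ , (λ q → apart (sym q)) , Rail.first railB , subst (λ p → Adj G p _) (Rail.top railB) (first-adj railB) , _ , rail-below railB , rail-dep railB

  bottoms : ∀ {b t z} → dep b ≡ 1 → dep t ≡ 1 + k → 2 + dep z ≤ 1 + k → dep b < dep t
  bottoms {b} {t} {z} db dt le = lia (dep b ∷ dep t ∷ k ∷ dep z ∷ []) (λ b t k z → b :≡ con 1 ∷ t :≡ con 1 :+ k ∷ con 2 :+ z :≤ con 1 :+ k ∷ [] ⊢ b :< t) (db , dt , le , tt)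

  branch-inner : ∀ {z} → 2 + dep z ≤ 1 + k → ∀ c → ∃ λ b → b ≢ c × dep b ≡ 1 × Adj G (par b) b × 2 ≤ deg G b
  branch-inner {z} le c =
    let (b , ne , db , ab , t , p , dt) = branch-≢ c
        (d , pd , ld , _) = child-towards p (bottoms {z = z} db dt le)
    in b , ne , db , ab , inner-of pd ld

  top-base : ∀ {z} → par z ≢ z → dep z ≡ base e → base e ≡ 1
  top-base {z} ne d = go e (kind z) d
    where
    go : ∀ e → (dep z ≡ base e → if e then par z ≢ z else par z ≡ z) → dep z ≡ base e → base e ≡ 1
    go true _ _ = refl
    go false k d = ⊥-elim (ne (k d))

  opposite-inner : ∀ {z} → par z ≢ z → dep z ≡ base e → 2 + dep z ≤ 1 + k → 2 ≤ deg G (par z)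
  opposite-inner {z} ne d le =
    let (b , b≢z , db , _ , ib) = branch-inner {z} le z
        b1 = top-base ne d
    in pick b≢z (trans db (sym b1)) ib (tops (par z) b (top-dep z d) (trans db (sym b1)))
    where
    pick : ∀ {b} → b ≢ z → dep b ≡ base e → 2 ≤ deg G b → par z ≡ b ⊎ par z ≡ par b → 2 ≤ deg G (par z)
    pick b≢z db ib (inj₁ eq) = subst (λ v → 2 ≤ deg G v) (sym eq) ib
    pick {b} b≢z db ib (inj₂ eq) = ⊥-elim (b≢z (trans (sym (top-par b db)) (trans (cong par (sym eq)) (top-par z d))))

  above-inner : ∀ {z} → par z ≢ z → 2 + dep z ≤ 1 + k → Dec (base e < dep z) → 2 ≤ deg G (par z)
  above-inner ne le (yes l) = inner-of refl l
  above-inner {z} ne le (no h) = opposite-inner ne (≤-antisym (≮⇒≥ h) (dep≥ z)) le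

  second-nbr : ∀ {z c} → par c ≡ z → base e < dep c → 2 + dep z ≤ 1 + k → Dec (par z ≡ z) → ∃ λ b → b ≢ c × Adj G z b × 2 ≤ deg G b
  second-nbr {z} {c} pc lc le (no ne) = par z , (λ eq → 1+n≰n (≤-trans (≡⇒≤ (sym (trans (up c lc) (cong (suc ∘ dep) pc)))) (≤-trans (≡⇒≤ (cong dep (sym eq))) (par-dep z))))
    , adj← ne , above-inner ne le (base e <? dep z)
  second-nbr {z} {c} pc lc le (yes q₀) =
    let (b , b≢c , db , ab , ib) = branch-inner {z} le c
        (dz , z0) = loop-root q₀
        pb = root-unique z0 (suc-injective (trans (sym (up b (≤-trans (s≤s (≡⇒≤ z0)) (≡⇒≤ (sym db))))) db)) (trans dz z0)
    in b , b≢c , subst (λ v → Adj G v b) pb ab , ib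

  -- The child towards w is inner because it has a child itself. The second inner neighbour is the
  -- parent or, if z is the root vertex, the first vertex of a leg in another branch; the legs are
  -- long enough for this vertex to be inner.
  grand-inner² : ∀ {z} → Grand z → 2 ≤ inner-nbrs G z
  grand-inner² {z} (w , p , le) =
    let (c , pc , lc , q) = child-towards p (≤-trans (n≤1+n _) le)
        (c' , pc' , lc' , _) = child-towards q (≤-trans (≡⇒≤ (cong suc (trans (up c lc) (cong (suc ∘ dep) pc)))) le)
        (b , b≢c , zb , ib) = second-nbr pc lc (≤-trans le (hgt w)) (par z ≟ᶠ z)
    in inner-nbrs-≥ G (λ eq → b≢c (sym eq)) (flip-adj G (subst (Adj G c) pc (adj← (up-par lc)))) zb (inner-of pc' lc') ib

  -- An ancestor of u other than u and its parent has u at least two levels below it.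
  near-tip : ∀ {z u} → z ≼ u → 2 ≤ inner-nbrs G z ⊎ z ∈ (u ∷ par u ∷ [])
  near-tip {z} {u} p with 2 + dep z ≤? dep u
  ... | yes le = inj₁ (grand-inner² (u , p , le))
  ... | no h with z ≟ᶠ u
  ...   | yes q = inj₂ (here q)
  ...   | no ne = let (lt , q) = ≼-up p (ne ∘ sym) in
          inj₂ (there (here (≼-dep-eq q (s≤s⁻¹ (≤-trans (≡⇒≤ (sym (up u lt))) (s≤s⁻¹ (≰⇒> h)))))))

  top-in : ∀ {z} → dep z ≡ base e → z ≼ tip A ⊎ z ≼ tip B
  top-in {z} d = go e refl
    where
    go : ∀ e' → e' ≡ e → z ≼ tip A ⊎ z ≼ tip B
    go false refl with ancestor (tip A) 0 z≤n z≤n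
    ... | y , p , dy = inj₁ (subst (_≼ tip A) (root-unique refl dy d) p)
    go true refl with tops z (lookup A (suc zero)) d (Rail.first railA)
    ... | inj₁ q = inj₁ (subst (_≼ tip A) (sym q) (rail-below railA))
    ... | inj₂ q with tops (lookup B (suc zero)) (lookup A (suc zero)) (Rail.first railB) (Rail.first railA)
    ...   | inj₁ q' = ⊥-elim (apart (sym q'))
    ...   | inj₂ q' = inj₂ (subst (_≼ tip B) (trans q' (sym q)) (rail-below railB))

  -- The part of the budget that is spent on the legs.
  exc : Tuple n 4
  exc = tip A ∷ par (tip A) ∷ tip B ∷ par (tip B) ∷ []

  legs-cover : ∀ {z} → z ≼ tip A ⊎ z ≼ tip B → 2 ≤ inner-nbrs G z ⊎ z ∈ exc
  legs-cover (inj₁ p) with near-tip p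
  ... | inj₁ q = inj₁ q
  ... | inj₂ (here q) = inj₂ (here q)
  ... | inj₂ (there (here q)) = inj₂ (there (here q))
  legs-cover (inj₂ p) with near-tip p
  ... | inj₁ q = inj₁ q
  ... | inj₂ (here q) = inj₂ (there (there (here q)))
  ... | inj₂ (there (here q)) = inj₂ (there (there (there (here q))))

  rail-cover : {x : Tuple n (2 + m)} → Rail x → ∀ {z} → z ∈ x → z ≼ tip x ⊎ (z ≼ tip A ⊎ z ≼ tip B)
  rail-cover r z∈ with rail-in r z∈
  ... | inj₁ p = inj₁ p
  ... | inj₂ d = inj₂ (top-in d)

-- Configurations of a longest path, paths from the root and branches

-- The vertex p stands for the parent of y, so that the condition mentions no rooting and can be
-- read off the pattern of the vertices involved.
OccAt : Graph n → Pat m → Fin n → Fin n → Tuple n m → Set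
OccAt G Q y p g = Unique g × Match (plain G) Q g × lookup g (Pat.r Q) ≡ y × p ∉ g

opaque
  occAt? : (G : Graph n) (Q : Pat m) (y p : Fin n) (g : Tuple n m) → Dec (OccAt G Q y p g)
  occAt? G Q y p g = unique? g ×-dec (match? (plain G) Q g ×-dec ((lookup g (Pat.r Q) ≟ᶠ y) ×-dec ∉? p g))

module Respect {n n' : ℕ} (G : Graph n) (H : Graph n') {R : Fin n → Fin n' → Set} (c : Corr G H R) where

  Along : Tuple n k → Tuple n' k → Set
  Along v v' = ∀ i → R (lookup v i) (lookup v' i)

  keep-adj : ∀ {x x' y y'} → R x x' → R y y' → Adj G x y → Adj H x' y'
  keep-adj p q a = trans (sym (proj₁ (c p q))) a

  keep-≡ : ∀ {x x' y y'} → R x x' → R y y' → x ≡ y → x' ≡ y'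
  keep-≡ p q = proj₁ (proj₂ (c p q))

  keep-≢ : ∀ {x x' y y'} → R x x' → R y y' → x ≢ y → x' ≢ y'
  keep-≢ p q ne e = ne (proj₂ (proj₂ (c p q)) e)

  keep-trail : {v : Tuple n k} {v' : Tuple n' k} → Along v v' → Trail G v → Trail H v'
  keep-trail {v' = _ ∷ _ ∷ []} ρ (edge a) = edge (keep-adj (ρ zero) (ρ (suc zero)) a)
  keep-trail {v' = _ ∷ _ ∷ _ ∷ _} ρ (turn a ne t) = turn (keep-adj (ρ zero) (ρ (suc zero)) a) (keep-≢ (ρ zero) (ρ (suc (suc zero))) ne) (keep-trail (ρ ∘ suc) t)

  keep-legs : ∀ e {A B : Tuple n (2 + k)} {A' B' : Tuple n' (2 + k)} → Along A A' → Along B B' → Legs G e A B → Legs H e A' B'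
  keep-legs true  α β ((s , t) , p , q) = (keep-trail α s , keep-trail β t) , keep-≡ (α zero) (β (suc zero)) p , keep-≡ (β zero) (α (suc zero)) q
  keep-legs false α β ((s , t) , p , q) = (keep-trail α s , keep-trail β t) , keep-≡ (α zero) (β zero) p , keep-≢ (α (suc zero)) (β (suc zero)) q

  keep-stem : ∀ e {A B : Tuple n (2 + k)} {A' B' : Tuple n' (2 + k)} {x : Tuple n (2 + m)} {x' : Tuple n' (2 + m)} →
              Along A A' → Along B B' → Along x x' → Stem G e A B x → Stem H e A' B' x'
  keep-stem true  α β ξ (t , inj₁ (p , q)) = keep-trail ξ t , inj₁ (keep-≡ (ξ zero) (α zero) p , keep-≡ (ξ (suc zero)) (α (suc zero)) q)
  keep-stem true  α β ξ (t , inj₂ (p , q)) = keep-trail ξ t , inj₂ (keep-≡ (ξ zero) (β zero) p , keep-≡ (ξ (suc zero)) (β (suc zero)) q)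
  keep-stem false α β ξ (t , p)            = keep-trail ξ t , keep-≡ (ξ zero) (α zero) p

  keep-occ : {Q : Pat m} {g : Tuple n m} {g' : Tuple n' m} → Along g g' → ∀ {y y' p p'} → R y y' → R p p' → OccAt G Q y p g → OccAt H Q y' p' g'
  keep-occ {Q = Q} {g} {g'} γ ry rp (u , (a , l) , q , p∉) =
      unique-lookup (λ i j e → lookup-injective u i j (proj₂ (proj₂ (c (γ i) (γ j))) e))
    , ((λ i j → trans (sym (proj₁ (c (γ i) (γ j)))) (a i j)) , l)
    , keep-≡ (γ (Pat.r Q)) ry q
    , λ m → let (i , e) = ∈⇒lookup m in p∉ (subst (_∈ g) (proj₂ (proj₂ (c (γ i) rp)) e) (∈-lookup i g))

corr-flip : {G : Graph n} {H : Graph m} {R : Fin n → Fin m → Set} → Corr G H R → Corr H G (λ y x → R x y)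
corr-flip c p q = let (a , f , g) = c p q in sym a , g , f

zip-along : (v : Tuple n k) (v' : Tuple m k) → ∀ i → Zip v v' (lookup v i) (lookup v' i)
zip-along v v' i = i , refl , refl

opaque
  in? : ∀ ks (x : Fin n) (t : Tup n ks) → Dec (_∈ᵗ_ {ks = ks} x t)
  in? []       x t       = no λ ()
  in? (k ∷ ks) x (v , t) with x ∈? v | in? ks x t
  ... | yes p | _     = yes (inj₁ p)
  ... | no _  | yes q = yes (inj₂ q)
  ... | no p  | no q  = no λ { (inj₁ r) → p r ; (inj₂ r) → q r }

spread : ∀ ks → Tup n ks → ℕ
spread ks t = ∑ (λ x → χ (in? ks x t))

transfer-small : ∀ {N} (G : Graph n) (H : Graph m) → Agree (plain G) (plain H) N → ∀ ks (F : Tup n ks → ℕ) (F' : Tup m ks → ℕ) →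
  (∀ t s → Corr G H (Zipᵗ ks t s) → F t ≡ F' s) → (∀ t → F t ≢ 0 → spread ks t ≤ N) → (∀ t → F' t ≢ 0 → spread ks t ≤ N) → ∑ᵗ ks F ≡ ∑ᵗ ks F'
transfer-small {n} {m} {N} G H ag ks F F' r z z' = transfer G H ag ks F F' r (zero-big F z) (zero-big F' z')
  where
  zero-big : ∀ {n} (F : Tup n ks → ℕ) → (∀ t → F t ≢ 0 → spread ks t ≤ N) → ∀ t (g : Tuple n (suc N)) → Unique g → (∀ {v} → v ∈ g → v ∈ᵗ t) → F t ≡ 0
  zero-big {n} F z t g u sub with F t ≟ 0
  ... | yes e = e
  ... | no ne = ⊥-elim (1+n≰n (≤-trans (≤-trans (≡⇒≤ (sym (count-∈ g u))) (S-mono (fin n) (λ x → χ-mono (x ∈? g) (in? ks x t) sub))) (z t ne)))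

∑ᵗ-pos : ∀ ks (F : Tup n ks → ℕ) → ∑ᵗ ks F ≢ 0 → ∃ λ t → F t ≢ 0
∑ᵗ-pos []       F h = tt , h
∑ᵗ-pos (k ∷ ks) F h = let (t , p) = ∑ᵗ-pos ks _ h ; (v , q) = ∑ᵛ-pos k _ p in (v , t) , q

∑ᵗ-zero : ∀ ks (F : Tup n ks → ℕ) → ∑ᵗ ks F ≡ 0 → ∀ t → F t ≡ 0
∑ᵗ-zero []       F z tt      = z
∑ᵗ-zero {n} (k ∷ ks) F z (v , t) = n≤0⇒n≡0 (≤-trans (S-≥ (vec n k) v (λ v → F (v , t))) (≡⇒≤ (∑ᵗ-zero ks (λ t → ∑ᵛ k (λ v → F (v , t))) z t)))

∑ᵗ-* : ∀ ks c (F : Tup n ks → ℕ) → ∑ᵗ ks (λ t → c * F t) ≡ c * ∑ᵗ ks F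
∑ᵗ-* []       c F = refl
∑ᵗ-* {n} (k ∷ ks) c F = trans (∑ᵗ-cong ks (λ t → S-* (vec n k) c (λ v → F (v , t)))) (∑ᵗ-* ks c (λ t → ∑ᵛ k (λ v → F (v , t))))
  where
  ∑ᵗ-cong : ∀ ks {F F' : Tup n ks → ℕ} → (∀ t → F t ≡ F' t) → ∑ᵗ ks F ≡ ∑ᵗ ks F'
  ∑ᵗ-cong []       h = h tt
  ∑ᵗ-cong (k ∷ ks) h = ∑ᵗ-cong ks (λ t → S-cong (vec n k) (λ v → h (v , t)))

-- The last `suc h` entries form a path that starts at the marked vertex; the first `off` entries
-- are the loose ones.
record Shape {off h : ℕ} (Q : Pat (off + suc h)) : Set where
  field
    links : ∀ (i : Fin h) → Pat.A Q (off ↑ʳ inject₁ i) (off ↑ʳ suc i) ≡ true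
    rooted : Pat.r Q ≡ off ↑ʳ zero

Grows : Graph n → Pat m → Set
Grows {n} {m} G Q = ∀ {g : Tuple n m} → Unique g → Match (plain G) Q g → Grow G g

legsKs oneKs : ∀ (k m d : ℕ) → List ℕ
legsKs k _ _ = (2 + k) ∷ (2 + k) ∷ []
oneKs  k m d = m ∷ (2 + d) ∷ legsKs k m d

pairKs : ∀ (k m m' d : ℕ) → List ℕ
pairKs k m m' d = m' ∷ (2 + d) ∷ oneKs k m d

module _ (G : Graph n) (e : Bool) where

  legsW : ∀ k → Tup n (legsKs k 0 0) → ℕ
  legsW k (B , A , _) = χ (legs? G e A B)

  oneW : ∀ k d (Q : Pat m) → Tup n (oneKs k m d) → ℕ
  oneW k d Q (g , x , B , A , _) = χ (legs? G e A B) * (χ (stem? G e A B x) * χ (occAt? G Q (tip x) (nock x) g))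

  -- Two occurrences at different vertices of the same depth, sharing one pair of legs.
  pairW : ∀ k d {m'} (Q : Pat m) (Z : Pat m') → Tup n (pairKs k m m' d) → ℕ
  pairW k d Q Z (g' , x' , g , x , B , A , _) = χ (legs? G e A B) * (χ (stem? G e A B x) * (χ (occAt? G Q (tip x) (nock x) g) *
    (χ (stem? G e A B x') * (χ (¬? (tip x ≟ᶠ tip x')) * χ (occAt? G Z (tip x') (nock x') g')))))

module RespectW {n m : ℕ} (G : Graph n) (H : Graph m) (e : Bool) {R : Fin n → Fin m → Set} (c : Corr G H R) where
  private
    module X = Respect G H c
    module Y = Respect H G (corr-flip {G = G} {H} c)

  On : Tuple n k → Tuple m k → Set
  On v v' = ∀ i → R (lookup v i) (lookup v' i)

  legs≡ : ∀ {k} (A B : Tuple n (2 + k)) (A' B' : Tuple m (2 + k)) → On A A' → On B B' → χ (legs? G e A B) ≡ χ (legs? H e A' B')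
  legs≡ A B A' B' α β = χ-cong (legs? G e A B) (legs? H e A' B') (X.keep-legs e {A} {B} {A'} {B'} α β) (Y.keep-legs e {A'} {B'} {A} {B} α β)

  stem≡ : ∀ {k d} (A B : Tuple n (2 + k)) (A' B' : Tuple m (2 + k)) (x : Tuple n (2 + d)) (x' : Tuple m (2 + d)) →
          On A A' → On B B' → On x x' → χ (stem? G e A B x) ≡ χ (stem? H e A' B' x')
  stem≡ A B A' B' x x' α β ξ = χ-cong (stem? G e A B x) (stem? H e A' B' x') (X.keep-stem e {A} {B} {A'} {B'} {x} {x'} α β ξ) (Y.keep-stem e {A'} {B'} {A} {B} {x'} {x} α β ξ)

  occ≡ : ∀ {k d} (Q : Pat k) (x : Tuple n (2 + d)) (x' : Tuple m (2 + d)) (g : Tuple n k) (g' : Tuple m k) →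
         On x x' → On g g' → χ (occAt? G Q (tip x) (nock x) g) ≡ χ (occAt? H Q (tip x') (nock x') g')
  occ≡ Q x x' g g' ξ γ = χ-cong (occAt? G Q (tip x) (nock x) g) (occAt? H Q (tip x') (nock x') g')
    (X.keep-occ {Q = Q} {g} {g'} γ (ξ _) (ξ _)) (Y.keep-occ {Q = Q} {g'} {g} γ (ξ _) (ξ _))

  tips≡ : ∀ {d} (x w : Tuple n (2 + d)) (x' w' : Tuple m (2 + d)) → On x x' → On w w' → χ (¬? (tip x ≟ᶠ tip w)) ≡ χ (¬? (tip x' ≟ᶠ tip w'))
  tips≡ x w x' w' ξ ω = χ-cong (¬? (tip x ≟ᶠ tip w)) (¬? (tip x' ≟ᶠ tip w')) (X.keep-≢ (ξ _) (ω _)) (Y.keep-≢ (ξ _) (ω _))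

module _ (G : Graph n) (H : Graph m) (e : Bool) where

  legsW-corr : ∀ k t s → Corr G H (Zipᵗ (legsKs k 0 0) t s) → legsW G e k t ≡ legsW H e k s
  legsW-corr k (B , A , _) (B' , A' , _) c = RespectW.legs≡ G H e c A B A' B' (λ i → inj₂ (inj₁ (zip-along A A' i))) (λ i → inj₁ (zip-along B B' i))

  oneW-corr : ∀ k d {l} (Q : Pat l) t s → Corr G H (Zipᵗ (oneKs k l d) t s) → oneW G e k d Q t ≡ oneW H e k d Q s
  oneW-corr k d Q (g , x , B , A , _) (g' , x' , B' , A' , _) c = cong₂ _*_ (legs≡ A B A' B' α β) (cong₂ _*_ (stem≡ A B A' B' x x' α β ξ) (occ≡ Q x x' g g' ξ (λ i → inj₁ (zip-along g g' i))))
    where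
    open RespectW G H e c
    α : On A A'
    α i = inj₂ (inj₂ (inj₂ (inj₁ (zip-along A A' i))))
    β : On B B'
    β i = inj₂ (inj₂ (inj₁ (zip-along B B' i)))
    ξ : On x x'
    ξ i = inj₂ (inj₁ (zip-along x x' i))

  pairW-corr : ∀ k d {l l'} (Q : Pat l) (Z : Pat l') t s → Corr G H (Zipᵗ (pairKs k l l' d) t s) → pairW G e k d Q Z t ≡ pairW H e k d Q Z s
  pairW-corr k d Q Z (f , w , g , x , B , A , _) (f' , w' , g' , x' , B' , A' , _) c = cong₂ _*_ (legs≡ A B A' B' α β) (cong₂ _*_ (stem≡ A B A' B' x x' α β ξ)
    (cong₂ _*_ (occ≡ Q x x' g g' ξ (λ i → inj₂ (inj₂ (inj₁ (zip-along g g' i))))) (cong₂ _*_ (stem≡ A B A' B' w w' α β ω)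
      (cong₂ _*_ (tips≡ x w x' w' ξ ω) (occ≡ Z w w' f f' ω (λ i → inj₁ (zip-along f f' i)))))))
    where
    open RespectW G H e c
    α : On A A'
    α i = inj₂ (inj₂ (inj₂ (inj₂ (inj₂ (inj₁ (zip-along A A' i))))))
    β : On B B'
    β i = inj₂ (inj₂ (inj₂ (inj₂ (inj₁ (zip-along B B' i)))))
    ξ : On x x'
    ξ i = inj₂ (inj₂ (inj₂ (inj₁ (zip-along x x' i))))
    ω : On w w'
    ω i = inj₂ (inj₁ (zip-along w w' i))

record Split {n : ℕ} {G : Graph n} {e : Bool} (R : Rooted G e) (off h : ℕ) (y : Fin n) (g : Tuple n (off + suc h)) : Set where
  open Root R
  field
    loose  : Tuple n off
    spine  : Tuple n (suc h)
    glued  : g ≡ loose ++ spine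
    down   : InTree.Down G R spine
    start  : lookup spine zero ≡ y
    spine-below : ∀ {z} → z ∈ spine → z ≼ lookup spine (fromℕ h)
  bottom : Fin n
  bottom = lookup spine (fromℕ h)
  root-bottom : y ≼ bottom
  root-bottom = subst (_≼ bottom) start (spine-below (∈-lookup zero spine))
  covers : ∀ {z} → z ∈ g → z ∈ loose ⊎ z ≼ bottom
  covers {z} m with ∈-++⁻ loose (subst (z ∈_) glued m)
  ... | inj₁ p = inj₁ p
  ... | inj₂ p = inj₂ (spine-below p)

module _ {n : ℕ} (G : Graph n) {e : Bool} (R : Rooted G e) where
  open Root R
  open InTree G R

  path-trail : ∀ {h x} (v : Tuple n (suc h)) → Adj G x (lookup v zero) → (∀ (i : Fin h) → Adj G (lookup v (inject₁ i)) (lookup v (suc i))) →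
    x ∉ v → Unique v → Trail G (x ∷ v)
  path-trail (y ∷ [])     a l x∉ u       = edge a
  path-trail (y ∷ z ∷ r) a l x∉ (p ∷ u) = turn a (λ e → x∉ (there (here e))) (path-trail (z ∷ r) (l zero) (l ∘ suc) (All⇒∉ p) u)

  -- Preceded by `par y`, the path of the pattern becomes a trail that begins with a step down, so
  -- it descends throughout.
  occ-split : ∀ {off h} (Q : Pat (off + suc h)) → Shape {off} {h} Q → ∀ {y g} → par y ≢ y → Sub.Occ (plain G) R Q y g → Split R off h y g
  occ-split {off} {h} Q sh {y} {g} ne (u , (a , _) , q , p∉) with splitAt off g
  ... | zs , v , refl = record { loose = zs ; spine = v ; glued = refl ; down = dn ; start = hd ; spine-below = down-above dn }
    where
    at-v : ∀ j → lookup (zs ++ v) (off ↑ʳ j) ≡ lookup v j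
    at-v = lookup-++ʳ zs v
    hd : lookup v zero ≡ y
    hd = trans (sym (at-v zero)) (trans (cong (lookup (zs ++ v)) (sym (Shape.rooted sh))) q)
    lk : ∀ (i : Fin h) → Adj G (lookup v (inject₁ i)) (lookup v (suc i))
    lk i = subst₂ (Adj G) (at-v (inject₁ i)) (at-v (suc i)) (trans (a (off ↑ʳ inject₁ i) (off ↑ʳ suc i)) (Shape.links sh i))
    uv : ∀ {m} (zs : Tuple n m) {v : Tuple n (suc h)} → Unique (zs ++ v) → Unique v
    uv []       u       = u
    uv (z ∷ zs) (_ ∷ u) = uv zs u
    dn : Down v
    dn = go v hd (path-trail v (flip-adj G (subst (λ z → Adj G z (par y)) (sym hd) (adj← ne))) lk (λ m → p∉ (∈-++⁺ʳ zs m)) (uv zs u))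
      where
      go : ∀ {h} (v : Tuple n (suc h)) → lookup v zero ≡ y → Trail G (par y ∷ v) → Down v
      go (y ∷ r) refl t = trail-down t refl

  Lev : ∀ {m} → Pat m → ℕ → ℕ
  Lev Q d = ∑ (λ v → χ (dep v ≟ 1 + d) * Sub.occs (plain G) R Q v)

  rest : ∀ {m} → Pat m → ℕ → Fin n → ℕ
  rest Z d v = ∑ (λ z → χ (dep z ≟ 1 + d) * (χ (¬? (v ≟ᶠ z)) * Sub.occs (plain G) R Z z))

  PairLev : ∀ {m m'} → Pat m → Pat m' → ℕ → ℕ
  PairLev Q Z d = ∑ (λ v → χ (dep v ≟ 1 + d) * (Sub.occs (plain G) R Q v * rest Z d v))

  legsCount : ℕ → ℕ
  legsCount k = ∑ᵗ (legsKs k 0 0) (legsW G e k)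

  module Sums {k : ℕ} (hgt : ∀ v → dep v ≤ 1 + k) where

    occ-sum : ∀ {d m} (Q : Pat m) {x : Tuple n (2 + d)} → Rail x → ∑ᵛ m (λ g → χ (occAt? G Q (tip x) (nock x) g)) ≡ Sub.occs (plain G) R Q (tip x)
    occ-sum {m = m} Q {x} r = S-cong (vec n m) (λ g → χ-cong (occAt? G Q (tip x) (nock x) g) (Sub.occ? (plain G) R Q (tip x) g)
      (λ (u , mt , q , p) → u , mt , q , subst (_∉ g) (rail-nock r) p) (λ (u , mt , q , p) → u , mt , q , subst (_∉ g) (sym (rail-nock r)) p))

    module _ {A B : Tuple n (2 + k)} (hv : Halves R A B) where

      stems : ∀ d (f : Tuple n (2 + d) → ℕ) (g : Fin n → ℕ) → (∀ {x} → Rail x → f x ≡ g (tip x)) →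
              ∑ᵛ (2 + d) (λ x → χ (stem? G e A B x) * f x) ≡ ∑ (λ v → χ (dep v ≟ 1 + d) * g v)
      stems d f g eq = trans (∑ᵛ-cong (2 + d) {λ x → χ (stem? G e A B x) * f x} {λ x → χ (stem? G e A B x) * g (tip x)}
        (λ x → χ-gate (stem? G e A B x) (λ s → eq (stem-rail G e R hv s)))) (stem-sum G e R hv d g)

      one-inner : ∀ d {m} (Q : Pat m) → ∑ᵛ (2 + d) (λ x → ∑ᵛ m (λ g → χ (stem? G e A B x) * χ (occAt? G Q (tip x) (nock x) g))) ≡ Lev Q d
      one-inner d {m} Q = trans (∑ᵛ-cong (2 + d) {λ x → ∑ᵛ m (λ g → χ (stem? G e A B x) * χ (occAt? G Q (tip x) (nock x) g))}
          {λ x → χ (stem? G e A B x) * ∑ᵛ m (λ g → χ (occAt? G Q (tip x) (nock x) g))} (λ x → S-* (vec n m) (χ (stem? G e A B x)) (λ g → χ (occAt? G Q (tip x) (nock x) g))))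
        (stems d (λ x → ∑ᵛ m (λ g → χ (occAt? G Q (tip x) (nock x) g))) (Sub.occs (plain G) R Q) (occ-sum Q))

      rest-inner : ∀ d {m} (Z : Pat m) v → ∑ᵛ (2 + d) (λ x' → ∑ᵛ m (λ g' → χ (stem? G e A B x') * (χ (¬? (v ≟ᶠ tip x')) * χ (occAt? G Z (tip x') (nock x') g')))) ≡ rest Z d v
      rest-inner d {m} Z v = trans (∑ᵛ-cong (2 + d) {λ x → ∑ᵛ m (λ g → χ (stem? G e A B x) * (χ (¬? (v ≟ᶠ tip x)) * χ (occAt? G Z (tip x) (nock x) g)))}
          {λ x → χ (stem? G e A B x) * (χ (¬? (v ≟ᶠ tip x)) * ∑ᵛ m (λ g → χ (occAt? G Z (tip x) (nock x) g)))}
          (λ x → trans (S-* (vec n m) (χ (stem? G e A B x)) (λ g → χ (¬? (v ≟ᶠ tip x)) * χ (occAt? G Z (tip x) (nock x) g)))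
            (cong (χ (stem? G e A B x) *_) (S-* (vec n m) (χ (¬? (v ≟ᶠ tip x))) (λ g → χ (occAt? G Z (tip x) (nock x) g))))))
        (stems d (λ x → χ (¬? (v ≟ᶠ tip x)) * ∑ᵛ m (λ g → χ (occAt? G Z (tip x) (nock x) g))) (λ z → χ (¬? (v ≟ᶠ z)) * Sub.occs (plain G) R Z z)
          (λ {x} r → cong (χ (¬? (v ≟ᶠ tip x)) *_) (occ-sum Z r)))

      pair-inner : ∀ d {m m'} (Q : Pat m) (Z : Pat m') →
        ∑ᵛ (2 + d) (λ x → ∑ᵛ m (λ g → ∑ᵛ (2 + d) (λ x' → ∑ᵛ m' (λ g' → χ (stem? G e A B x) * (χ (occAt? G Q (tip x) (nock x) g) *
          (χ (stem? G e A B x') * (χ (¬? (tip x ≟ᶠ tip x')) * χ (occAt? G Z (tip x') (nock x') g')))))))) ≡ PairLev Q Z d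
      pair-inner d {m} {m'} Q Z = trans (∑ᵛ-cong (2 + d) {F₀} {λ x → χ (stem? G e A B x) * (∑ᵛ m (λ g → χ (occAt? G Q (tip x) (nock x) g)) * rest Z d (tip x))} step)
          (stems d (λ x → ∑ᵛ m (λ g → χ (occAt? G Q (tip x) (nock x) g)) * rest Z d (tip x)) (λ v → Sub.occs (plain G) R Q v * rest Z d v)
            (λ {x} r → cong (_* rest Z d (tip x)) (occ-sum Q r)))
        where
        inn : Tuple n (2 + d) → Tuple n (2 + d) → Tuple n m' → ℕ
        inn x x' g' = χ (stem? G e A B x') * (χ (¬? (tip x ≟ᶠ tip x')) * χ (occAt? G Z (tip x') (nock x') g'))
        F₀ : Tuple n (2 + d) → ℕ
        F₀ x = ∑ᵛ m (λ g → ∑ᵛ (2 + d) (λ x' → ∑ᵛ m' (λ g' → χ (stem? G e A B x) * (χ (occAt? G Q (tip x) (nock x) g) * inn x x' g'))))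
        pull : ∀ x g → ∑ᵛ (2 + d) (λ x' → ∑ᵛ m' (λ g' → χ (stem? G e A B x) * (χ (occAt? G Q (tip x) (nock x) g) * inn x x' g')))
                       ≡ χ (stem? G e A B x) * (χ (occAt? G Q (tip x) (nock x) g) * rest Z d (tip x))
        pull x g = trans (∑ᵗ-* (m' ∷ (2 + d) ∷ []) (χ (stem? G e A B x)) (λ (g' , x' , _) → χ (occAt? G Q (tip x) (nock x) g) * inn x x' g'))
          (cong (χ (stem? G e A B x) *_) (trans (∑ᵗ-* (m' ∷ (2 + d) ∷ []) (χ (occAt? G Q (tip x) (nock x) g)) (λ (g' , x' , _) → inn x x' g'))
            (cong (χ (occAt? G Q (tip x) (nock x) g) *_) (rest-inner d Z (tip x)))))
        step : ∀ x → F₀ x ≡ χ (stem? G e A B x) * (∑ᵛ m (λ g → χ (occAt? G Q (tip x) (nock x) g)) * rest Z d (tip x))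
        step x = trans (∑ᵛ-cong m {λ g → ∑ᵛ (2 + d) (λ x' → ∑ᵛ m' (λ g' → χ (stem? G e A B x) * (χ (occAt? G Q (tip x) (nock x) g) * inn x x' g')))}
            {λ g → χ (stem? G e A B x) * (χ (occAt? G Q (tip x) (nock x) g) * rest Z d (tip x))} (pull x))
          (trans (S-* (vec n m) (χ (stem? G e A B x)) (λ g → χ (occAt? G Q (tip x) (nock x) g) * rest Z d (tip x)))
            (cong (χ (stem? G e A B x) *_) (S-*ʳ (vec n m) (λ g → χ (occAt? G Q (tip x) (nock x) g)) (rest Z d (tip x)))))

module Total {n : ℕ} (G : Graph n) {e : Bool} (R : Rooted G e) {k} (hgt : ∀ v → Root.dep R v ≤ 1 + k) where
  open Sums G R {k} hgt

  private
    factor : (F : Tuple n (2 + k) → Tuple n (2 + k) → ℕ) → ∀ L → (∀ A B → F A B ≡ χ (legs? G e A B) * L) →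
             ∑ᵛ (2 + k) (λ A → ∑ᵛ (2 + k) (λ B → F A B)) ≡ legsCount G R k * L
    factor F L h = trans (∑ᵛ-cong (2 + k) {λ A → ∑ᵛ (2 + k) (F A)} {λ A → ∑ᵛ (2 + k) (λ B → χ (legs? G e A B)) * L}
        (λ A → trans (∑ᵛ-cong (2 + k) {F A} {λ B → χ (legs? G e A B) * L} (h A)) (S-*ʳ (vec n (2 + k)) (λ B → χ (legs? G e A B)) L)))
      (S-*ʳ (vec n (2 + k)) (λ A → ∑ᵛ (2 + k) (λ B → χ (legs? G e A B))) L)

  -- All legs of this length determine the same root, so the inner sum is the same for every choice
  -- of legs. The number of legs splits off as a factor and can be cancelled later.
  one-total : ∀ d {m} (Q : Pat m) → ∑ᵗ (oneKs k m d) (oneW G e k d Q) ≡ legsCount G R k * Lev G R Q d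
  one-total d {m} Q = factor (λ A B → ∑ᵛ (2 + d) (λ x → ∑ᵛ m (λ g → χ (legs? G e A B) * inn A B x g))) (Lev G R Q d) step
    where
    inn : (A B : Tuple n (2 + k)) → Tuple n (2 + d) → Tuple n m → ℕ
    inn A B x g = χ (stem? G e A B x) * χ (occAt? G Q (tip x) (nock x) g)
    step : ∀ A B → ∑ᵛ (2 + d) (λ x → ∑ᵛ m (λ g → χ (legs? G e A B) * inn A B x g)) ≡ χ (legs? G e A B) * Lev G R Q d
    step A B = trans (∑ᵗ-* (m ∷ (2 + d) ∷ []) (χ (legs? G e A B)) (λ (g , x , _) → inn A B x g))
      (χ-gate (legs? G e A B) (λ l → one-inner (legs-halves G e R hgt l) d Q))

  pair-total : ∀ d {m m'} (Q : Pat m) (Z : Pat m') → ∑ᵗ (pairKs k m m' d) (pairW G e k d Q Z) ≡ legsCount G R k * PairLev G R Q Z d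
  pair-total d {m} {m'} Q Z = factor (λ A B → ∑ᵛ (2 + d) (λ x → ∑ᵛ m (λ g → ∑ᵛ (2 + d) (λ x' → ∑ᵛ m' (λ g' → χ (legs? G e A B) * inn A B x g x' g'))))) (PairLev G R Q Z d) step
    where
    inn : (A B : Tuple n (2 + k)) → Tuple n (2 + d) → Tuple n m → Tuple n (2 + d) → Tuple n m' → ℕ
    inn A B x g x' g' = χ (stem? G e A B x) * (χ (occAt? G Q (tip x) (nock x) g) * (χ (stem? G e A B x') * (χ (¬? (tip x ≟ᶠ tip x')) * χ (occAt? G Z (tip x') (nock x') g'))))
    step : ∀ A B → ∑ᵛ (2 + d) (λ x → ∑ᵛ m (λ g → ∑ᵛ (2 + d) (λ x' → ∑ᵛ m' (λ g' → χ (legs? G e A B) * inn A B x g x' g')))) ≡ χ (legs? G e A B) * PairLev G R Q Z d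
    step A B = trans (∑ᵗ-* (m' ∷ (2 + d) ∷ m ∷ (2 + d) ∷ []) (χ (legs? G e A B)) (λ (g' , x' , g , x , _) → inn A B x g x' g'))
      (χ-gate (legs? G e A B) (λ l → pair-inner (legs-halves G e R hgt l) d Q Z))

  open Root R
  open InTree G R

  pos-≢ : ∀ {y d} → dep y ≡ 1 + d → par y ≢ y
  pos-≢ {y} {zero}  e = first-≢ e
  pos-≢ {y} {suc d} dy = up-par (≤-trans (s≤s base≤1) (≤-trans (s≤s (s≤s z≤n)) (≡⇒≤ (sym dy))))
    where
    base≤1 : base e ≤ 1
    base≤1 = go e
      where
      go : ∀ e → base e ≤ 1
      go false = z≤n
      go true  = ≤-refl

  module Bounds where

    record OneCase {d off h} (Q : Pat (off + suc h)) (A B : Tuple n (2 + k)) (x : Tuple n (2 + d)) (g : Tuple n (off + suc h)) : Set where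
      field
        hv    : Halves R A B
        rx    : Rail x
        split : Split R off h (tip x) g

    opaque
      one-case : ∀ {d off h} (Q : Pat (off + suc h)) → Shape {off} {h} Q → ∀ {A B} {x : Tuple n (2 + d)} {g} →
                 χ (legs? G e A B) ≢ 0 → χ (stem? G e A B x) ≢ 0 → χ (occAt? G Q (tip x) (nock x) g) ≢ 0 → OneCase {d} {off} {h} Q A B x g
      one-case {d} {off} {h} Q sh {A} {B} {x} {g} l s o =
        let hv = legs-halves G e R hgt (χ≢0 (legs? G e A B) l)
            rx = stem-rail G e R hv (χ≢0 (stem? G e A B x) s)
            (u , mt , q , p) = χ≢0 (occAt? G Q (tip x) (nock x) g) o
        in record { hv = hv ; rx = rx ; split = occ-split G R {off} {h} Q sh (pos-≢ (rail-dep rx)) (u , mt , q , subst (_∉ g) (rail-nock rx) p) }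

    private
      one-cover : ∀ {d off h} {Q : Pat (off + suc h)} {A B x g} (oc : OneCase {d} {off} {h} Q A B x g) → ∀ {z} → z ∈ g ⊎ (z ∈ x ⊎ (z ∈ B ⊎ (z ∈ A ⊎ ⊥))) →
        2 ≤ inner-nbrs G z ⊎ z ∈ (Grand.exc G R hgt (OneCase.hv oc) ++ ((Split.bottom (OneCase.split oc) ∷ par (Split.bottom (OneCase.split oc)) ∷ []) ++ Split.loose (OneCase.split oc)))
      one-cover {off = off} {A = A} {B} {x} oc z∈ = place z∈
        where
        open OneCase oc
        open Grand G R hgt hv
        open Split split
        u = bottom
        two = u ∷ par u ∷ []
        at-u : ∀ {z} → z ≼ u → 2 ≤ inner-nbrs G z ⊎ z ∈ (exc ++ (two ++ loose))
        at-u p with near-tip p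
        ... | inj₁ q = inj₁ q
        ... | inj₂ m = inj₂ (∈-++⁺ʳ exc (∈-++⁺ˡ m))
        at-legs : ∀ {z} → z ≼ tip A ⊎ z ≼ tip B → 2 ≤ inner-nbrs G z ⊎ z ∈ (exc ++ (two ++ loose))
        at-legs p with legs-cover p
        ... | inj₁ q = inj₁ q
        ... | inj₂ m = inj₂ (∈-++⁺ˡ m)
        place : ∀ {z} → z ∈ _ ⊎ (z ∈ x ⊎ (z ∈ B ⊎ (z ∈ A ⊎ ⊥))) → 2 ≤ inner-nbrs G z ⊎ z ∈ (exc ++ (two ++ loose))
        place (inj₁ m) with covers m
        ... | inj₁ p = inj₂ (∈-++⁺ʳ exc (∈-++⁺ʳ two p))
        ... | inj₂ p = at-u p
        place (inj₂ (inj₁ m)) with rail-cover rx m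
        ... | inj₁ p = at-u (≼-trans p root-bottom)
        ... | inj₂ p = at-legs p
        place (inj₂ (inj₂ (inj₁ m))) with rail-cover (Halves.railB hv) m
        ... | inj₁ p = at-legs (inj₂ p)
        ... | inj₂ p = at-legs p
        place (inj₂ (inj₂ (inj₂ (inj₁ m)))) with rail-cover (Halves.railA hv) m
        ... | inj₁ p = at-legs (inj₁ p)
        ... | inj₂ p = at-legs p

    legs-spread : ∀ t → legsW G e k t ≢ 0 → spread (legsKs k 0 0) t ≤ inner² G + 4
    legs-spread (B , A , _) w = inner²-cover G (λ z → in? (legsKs k 0 0) z (B , A , tt)) exc place
      where
      hv = legs-halves G e R hgt (χ≢0 (legs? G e A B) w)
      open Grand G R hgt hv
      place : ∀ {z} → z ∈ B ⊎ (z ∈ A ⊎ ⊥) → 2 ≤ inner-nbrs G z ⊎ z ∈ exc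
      place (inj₁ m) with rail-cover (Halves.railB hv) m
      ... | inj₁ p = legs-cover (inj₂ p)
      ... | inj₂ p = legs-cover p
      place (inj₂ (inj₁ m)) with rail-cover (Halves.railA hv) m
      ... | inj₁ p = legs-cover (inj₁ p)
      ... | inj₂ p = legs-cover p

    -- The exceptions are four from the legs, the lower end of the path in the branch with its
    -- parent, and the loose vertices. The stem lies above that end or on the legs and adds none.
    one-spread : ∀ {d off h} (Q : Pat (off + suc h)) → Shape {off} {h} Q → ∀ t → oneW G e k d Q t ≢ 0 → spread (oneKs k (off + suc h) d) t ≤ inner² G + (6 + off)
    one-spread {d} {off} {h} Q sh (g , x , B , A , _) w =
      inner²-cover G (λ z → in? (oneKs k (off + suc h) d) z (g , x , B , A , tt)) _
        (one-cover {Q = Q} (one-case {d} {off} {h} Q sh (*≢0ˡ _ w) (*≢0ˡ _ (*≢0ʳ (χ (legs? G e A B)) w)) (*≢0ʳ (χ (stem? G e A B x)) (*≢0ʳ (χ (legs? G e A B)) w))))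

    -- The legs are shared, so the second branch costs only 2 + off' further exceptions.
    pair-spread : ∀ {d off h off' h'} (Q : Pat (off + suc h)) → Shape {off} {h} Q → (Z : Pat (off' + suc h')) → Shape {off'} {h'} Z →
      ∀ t → pairW G e k d Q Z t ≢ 0 → spread (pairKs k (off + suc h) (off' + suc h') d) t ≤ inner² G + (4 + (2 + off) + (2 + off'))
    pair-spread {d} {off} {h} {off'} {h'} Q sh Z sh' (g' , x' , g , x , B , A , _) w =
      inner²-cover G (λ z → in? (pairKs k (off + suc h) (off' + suc h') d) z (g' , x' , g , x , B , A , tt)) (E₁ ++ E₂) place
      where
      w₁ = *≢0ʳ (χ (legs? G e A B)) w
      w₂ = *≢0ʳ (χ (stem? G e A B x)) w₁
      w₃ = *≢0ʳ (χ (occAt? G Q (tip x) (nock x) g)) w₂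
      w₄ = *≢0ʳ (χ (stem? G e A B x')) w₃
      oc = one-case {d} {off} {h} Q sh {A} {B} {x} {g} (*≢0ˡ _ w) (*≢0ˡ _ w₁) (*≢0ˡ _ w₂)
      oc' = one-case {d} {off'} {h'} Z sh' {A} {B} {x'} {g'} (*≢0ˡ _ w) (*≢0ˡ _ w₃) (*≢0ʳ (χ (¬? (tip x ≟ᶠ tip x'))) w₄)
      M₁ = (Split.bottom (OneCase.split oc) ∷ par (Split.bottom (OneCase.split oc)) ∷ []) ++ Split.loose (OneCase.split oc)
      E₁ = Grand.exc G R hgt (OneCase.hv oc) ++ M₁
      exc' = Grand.exc G R hgt (OneCase.hv oc')
      E₂ = (Split.bottom (OneCase.split oc') ∷ par (Split.bottom (OneCase.split oc')) ∷ []) ++ Split.loose (OneCase.split oc')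
      left : ∀ {z} → 2 ≤ inner-nbrs G z ⊎ z ∈ E₁ → 2 ≤ inner-nbrs G z ⊎ z ∈ (E₁ ++ E₂)
      left (inj₁ q) = inj₁ q
      left (inj₂ m) = inj₂ (∈-++⁺ˡ m)
      right : ∀ {z} → 2 ≤ inner-nbrs G z ⊎ z ∈ (exc' ++ E₂) → 2 ≤ inner-nbrs G z ⊎ z ∈ (E₁ ++ E₂)
      right (inj₁ q) = inj₁ q
      right (inj₂ m) with ∈-++⁻ exc' m
      ... | inj₁ p = inj₂ (∈-++⁺ˡ {ys = E₂} (∈-++⁺ˡ {ys = M₁} p))
      ... | inj₂ p = inj₂ (∈-++⁺ʳ E₁ p)
      place : ∀ {z} → z ∈ g' ⊎ (z ∈ x' ⊎ (z ∈ g ⊎ (z ∈ x ⊎ (z ∈ B ⊎ (z ∈ A ⊎ ⊥))))) → 2 ≤ inner-nbrs G z ⊎ z ∈ (E₁ ++ E₂)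
      place (inj₁ m) = right (one-cover {Q = Z} oc' (inj₁ m))
      place (inj₂ (inj₁ m)) = right (one-cover {Q = Z} oc' (inj₂ (inj₁ m)))
      place (inj₂ (inj₂ m)) = left (one-cover {Q = Q} oc m)

record Frame {n : ℕ} (G : Graph n) (e : Bool) (k : ℕ) : Set where
  field
    R   : Rooted G e
    hgt : ∀ v → Root.dep R v ≤ 1 + k
    A B : Tuple n (2 + k)
    hv  : Halves R A B

module Comparison {n N ℓ : ℕ} (T H : Graph n) (ag : Agree (plain T) (plain H) N) {e : Bool} {k : ℕ} (fT : Frame T e k) (fH : Frame H e k)
  (cT : inner² T + 8 + 2 * ℓ ≤ N) (cH : inner² H + 8 + 2 * ℓ ≤ N) where

  private
    module F = Frame fT
    module F' = Frame fH
    module X = Total T F.R {k} F.hgt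
    module Y = Total H F'.R {k} F'.hgt

    legs≤ : ∀ {G : Graph n} → inner² G + 8 + 2 * ℓ ≤ N → inner² G + 4 ≤ N
    legs≤ {G} c = lia (inner² G ∷ ℓ ∷ N ∷ []) (λ i ℓ N → i :+ con 8 :+ 2 :* ℓ :≤ N ∷ [] ⊢ i :+ con 4 :≤ N) (c , tt)

    legs-agree : legsCount T F.R k ≡ legsCount H F'.R k
    legs-agree = transfer-small T H ag (legsKs k 0 0) (legsW T e k) (legsW H e k) (legsW-corr T H e k)
      (λ t w → ≤-trans (X.Bounds.legs-spread t w) (legs≤ {T} cT)) (λ t w → ≤-trans (Y.Bounds.legs-spread t w) (legs≤ {H} cH))

    legs≢0 : legsCount T F.R k ≢ 0
    legs≢0 z = χ-pos (legs? T e F.A F.B) (halves-legs T e F.R F.hv) (∑ᵗ-zero (legsKs k 0 0) (legsW T e k) z (F.B , F.A , tt))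

    cancel : ∀ {a b} → legsCount T F.R k * a ≡ legsCount H F'.R k * b → a ≡ b
    cancel {a} {b} q = *-cancelˡ-≡ a b (legsCount T F.R k) {{≢-nonZero legs≢0}} (trans q (cong (_* b) (sym legs-agree)))

  lev-agree : ∀ d {m} (Q : Pat m) → (∀ t → oneW T e k d Q t ≢ 0 → spread (oneKs k m d) t ≤ N) → (∀ t → oneW H e k d Q t ≢ 0 → spread (oneKs k m d) t ≤ N) →
              Lev T F.R Q d ≡ Lev H F'.R Q d
  lev-agree d {m} Q s s' = cancel (trans (sym (X.one-total d Q)) (trans (transfer-small T H ag (oneKs k m d) (oneW T e k d Q) (oneW H e k d Q) (oneW-corr T H e k d Q) s s') (Y.one-total d Q)))

  -- The bound on `off` is what six exceptions leave of the budget 8 + 2ℓ.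
  lev-shaped : ∀ d {off h} (Q : Pat (off + suc h)) → Shape {off} {h} Q → off ≤ 2 * ℓ + 2 → Lev T F.R Q d ≡ Lev H F'.R Q d
  lev-shaped d {off} {h} Q sh le = lev-agree d Q (λ t w → ≤-trans (X.Bounds.one-spread {d} {off} {h} Q sh t w) (fits T cT)) (λ t w → ≤-trans (Y.Bounds.one-spread {d} {off} {h} Q sh t w) (fits H cH))
    where
    fits : ∀ G → inner² G + 8 + 2 * ℓ ≤ N → inner² G + (6 + off) ≤ N
    fits G c = lia (inner² G ∷ ℓ ∷ N ∷ off ∷ []) (λ i ℓ N o → i :+ con 8 :+ 2 :* ℓ :≤ N ∷ o :≤ 2 :* ℓ :+ con 2 ∷ [] ⊢ i :+ (con 6 :+ o) :≤ N) (c , le , tt)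

  -- The whole budget is used here: 4 + (2 + ℓ) + (2 + ℓ) = 8 + 2ℓ.
  pair-agree : ∀ d {off h off' h'} (Q : Pat (off + suc h)) → Shape {off} {h} Q → (Z : Pat (off' + suc h')) → Shape {off'} {h'} Z → off ≤ ℓ → off' ≤ ℓ →
               PairLev T F.R Q Z d ≡ PairLev H F'.R Q Z d
  pair-agree d {off} {h} {off'} {h'} Q sh Z sh' le le' = cancel (trans (sym (X.pair-total d Q Z))
      (trans (transfer-small T H ag (pairKs k (off + suc h) (off' + suc h') d) (pairW T e k d Q Z) (pairW H e k d Q Z) (pairW-corr T H e k d Q Z)
        (λ t w → ≤-trans (X.Bounds.pair-spread {d} {off} {h} {off'} {h'} Q sh Z sh' t w) (fits T cT))
        (λ t w → ≤-trans (Y.Bounds.pair-spread {d} {off} {h} {off'} {h'} Q sh Z sh' t w) (fits H cH))) (Y.pair-total d Q Z)))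
    where
    fits : ∀ G → inner² G + 8 + 2 * ℓ ≤ N → inner² G + (4 + (2 + off) + (2 + off')) ≤ N
    fits G c = lia (inner² G ∷ ℓ ∷ N ∷ off ∷ off' ∷ []) (λ i ℓ N o o' → i :+ con 8 :+ 2 :* ℓ :≤ N ∷ o :≤ ℓ ∷ o' :≤ ℓ ∷ [] ⊢ i :+ (con 4 :+ (con 2 :+ o) :+ (con 2 :+ o')) :≤ N) (c , le , le' , tt)

-- Loose vertices

module _ {n : ℕ} (G : Graph n) {e : Bool} (R : Rooted G e) where
  open Root R
  open InTree G R

  dep-near : ∀ {u v} → Adj G u v → dep u ≤ suc (dep v)
  dep-near {u} {v} a with adj→ a
  ... | inj₁ refl with base e <? dep v
  ...   | yes lt = ≤-trans (n≤1+n _) (≤-trans (≡⇒≤ (sym (up v lt))) (n≤1+n _))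
  ...   | no h = ≤-trans (≡⇒≤ (trans (top-dep v t) (sym t))) (n≤1+n _)
    where t = ≤-antisym (≮⇒≥ h) (dep≥ v)
  dep-near {u} {v} a | inj₂ refl with base e <? dep u
  ...   | yes lt = ≡⇒≤ (up u lt)
  ...   | no h = ≤-trans (≡⇒≤ (trans t (sym (top-dep u t)))) (n≤1+n _)
    where t = ≤-antisym (≮⇒≥ h) (dep≥ u)

  segment : ∀ {y u} → y ≼ u → ∃ λ h → Σ (Tuple n h) λ r → Down (y ∷ r) × lookup (y ∷ r) (fromℕ h) ≡ u
  segment p = go p [] (end _) refl
    where
    go : ∀ {y z u j} → y ≼ z → (r : Tuple n j) → Down (z ∷ r) → lookup (z ∷ r) (fromℕ j) ≡ u → ∃ λ h → Σ (Tuple n h) λ r → Down (y ∷ r) × lookup (y ∷ r) (fromℕ h) ≡ u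
    go ≼-refl r d q = _ , r , d , q
    go (≼-step {z} lt p) r d q = go p (z ∷ r) ((refl , lt) ∷ d) q

  down-from : ∀ {m y} {r : Tuple n m} → Down (y ∷ r) → ∀ {z} → z ∈ (y ∷ r) → y ≼ z
  down-from d (here refl) = ≼-refl
  down-from ((refl , lt) ∷ d) (there m) = ≼-trans (≼-step lt ≼-refl) (down-from d m)

  down-grow : ∀ {m} {v : Tuple n (suc m)} → Down v → Grow G v
  down-grow (end y) = one y
  down-grow ((refl , lt) ∷ d) = add (λ m → par-not-below (up-par lt) (down-from d m)) zero (flip-adj G (adj← (up-par lt))) (down-grow d)

  down-links : ∀ {m} {v : Tuple n (suc m)} → Down v → ∀ (i : Fin m) → Adj G (lookup v (inject₁ i)) (lookup v (suc i))
  down-links ((refl , lt) ∷ d) zero = flip-adj G (adj← (up-par lt))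
  down-links ((refl , lt) ∷ d) (suc i) = down-links d i

  down-between : ∀ {m y} {r : Tuple n m} → Down (y ∷ r) → ∀ {z} → y ≼ z → z ≼ lookup (y ∷ r) (fromℕ m) → z ∈ (y ∷ r)
  down-between (end y) p q = here (≼-dep-eq q (≼-dep p))
  down-between {y = x} (_∷_ {y = y} (refl , lt) d) {z} p q with dep x ≟ dep z
  ... | yes eq = here (sym (≼-dep-eq p (≡⇒≤ (sym eq))))
  ... | no ne = there (down-between d below q)
    where
    le : dep y ≤ dep z
    le = ≤-trans (≡⇒≤ (up y lt)) (≤∧≢⇒< (≼-dep p) ne)
    below : y ≼ z
    below with ancestor z (dep y) (≤-trans (n≤1+n _) lt) le
    ... | w , s , dw = subst (_≼ z) (≼-linear (≼-trans s q) (down-below d) dw) s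

  -- A descending path has at most one vertex at each depth.
  down-short : ∀ h {m y} {r : Tuple n m} → Down (y ∷ r) → ∑ (λ z → χ (z ∈? (y ∷ r) ×-dec (dep z ≤? dep y + h))) ≤ suc h
  down-short h {m} {y} {r} dn = ≤-trans (S-mono (fin n) (pt h dn)) (≤-trans (≡⇒≤ (trans (S-+ (fin n) _ _)
      (cong (_+ ∑ (λ z → χ (deeper? h dn z))) (trans (∑-cong (λ x → sym (*-identityʳ _))) (∑-δ y (λ _ → 1)))))) (s≤s (later h dn)))
    where
    Deeper : ∀ h {m y} {r : Tuple n m} → Down (y ∷ r) → Fin n → Set
    Deeper h {y = y} {r} _ z = z ∈ r × dep z ≤ dep y + h
    deeper? : ∀ h {m y} {r : Tuple n m} (d : Down (y ∷ r)) z → Dec (Deeper h d z)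
    deeper? h {y = y} {r} _ z = z ∈? r ×-dec (dep z ≤? dep y + h)
    pt : ∀ h {m y} {r : Tuple n m} (d : Down (y ∷ r)) z → χ (z ∈? (y ∷ r) ×-dec (dep z ≤? dep y + h)) ≤ χ (y ≟ᶠ z) + χ (deeper? h d z)
    pt h {y = y} {r} d z with y ≟ᶠ z
    ... | yes _ = ≤-trans (χ≤1 (z ∈? (y ∷ r) ×-dec (dep z ≤? dep y + h))) (s≤s z≤n)
    ... | no ne = χ-mono (z ∈? (y ∷ r) ×-dec (dep z ≤? dep y + h)) (deeper? h d z) λ { (here q , _) → ⊥-elim (ne (sym q)) ; (there q , l) → q , l }
    later : ∀ h {m y} {r : Tuple n m} (d : Down (y ∷ r)) → ∑ (λ z → χ (deeper? h d z)) ≤ h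
    later h (end y) = ≤-trans (≡⇒≤ (S-zero (fin n) (λ z → χ-no (deeper? h (end y) z) λ { (() , _) }))) z≤n
    later zero d@(_∷_ {y = y'} (refl , lt) d') = ≡⇒≤ (S-zero (fin n) (λ z → χ-no (deeper? zero d z)
      (λ (m , l) → 1+n≰n (≤-trans (≤-trans (≡⇒≤ (sym (up y' lt))) (≼-dep (down-from d' m))) (≤-trans l (≡⇒≤ (+-identityʳ _)))))))
    later (suc h) d@(_∷_ {y = y'} {r = r'} (refl , lt) d') = ≤-trans (S-mono (fin n) (λ z → χ-mono (deeper? (suc h) d z) (z ∈? (y' ∷ r') ×-dec (dep z ≤? dep y' + h))
        (λ (m , l) → m , ≤-trans l (≡⇒≤ (trans (+-suc _ h) (cong (_+ h) (sym (up y' lt))))))))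
      (≤-trans (S-mono (fin n) (pt h d')) (≤-trans (≡⇒≤ (trans (S-+ (fin n) _ _)
      (cong (_+ ∑ (λ z → χ (deeper? h d' z))) (trans (∑-cong (λ x → sym (*-identityʳ _))) (∑-δ y' (λ _ → 1)))))) (s≤s (later h d'))))

  -- A longest descending path from y, with the rest of the branch in front of it as loose vertices,
  -- in an order that keeps the suffixes from y on connected.
  record Spine (y : Fin n) : Set where
    field
      {off h} : ℕ
      zs   : Tuple n off
      r    : Tuple n h
      dn   : Down (y ∷ r)
      en   : Sub.Enum (plain G) R y (zs ++ (y ∷ r))
      deep : ∀ {z} → y ≼ z → dep z ≤ dep y + h

  opaque
    spine : ∀ y → Spine y
    spine y =
      let (u , mx) = argmax (λ v → χ (y ≼? v) * suc (dep v)) y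
          y≼u = χ≢0 (y ≼? u) (λ z → 1+n≰n (≤-trans (s≤s z≤n) (≤-trans (≡⇒≤ (sym (trans (cong (_* suc (dep y)) (χ-yes (y ≼? y) ≼-refl)) (+-identityʳ _))))
                  (≤-trans (mx y) (≡⇒≤ (cong (_* suc (dep u)) z))))))
          (h , r , dn , q) = segment y≼u
          (m , zs , en) = Sub.enum-from (plain G) R y (y ∷ r) (down-grow dn) (here refl) (down-from dn)
      in record { zs = zs ; r = r ; dn = dn ; en = en ; deep = λ {z} p → s≤s⁻¹ (≤-trans (≤-trans (≡⇒≤ (sym (trans (cong (_* suc (dep z)) (χ-yes (y ≼? z) p)) (+-identityʳ _))))
            (mx z)) (≤-trans (*-monoˡ-≤ (suc (dep u)) (χ≤1 (y ≼? u))) (≡⇒≤ (trans (+-identityʳ _) (cong suc (trans (cong dep (sym q)) (down-dep dn))))))) }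

  enumV : ∀ y → ∃ λ k → Σ (Tuple n k) (Sub.Enum (plain G) R y)
  enumV y = let open Spine (spine y) in off + suc h , zs ++ (y ∷ r) , en

  offs hs : Fin n → ℕ
  offs y = Spine.off (spine y)
  hs y = Spine.h (spine y)

  fullPat : ∀ y → Pat (offs y + suc (hs y))
  fullPat y = Sub.enum-pat (plain G) R (Spine.en (spine y))

  full-shape : ∀ y → Shape {offs y} {hs y} (fullPat y)
  full-shape y = record
    { links = λ i → trans (cong₂ (adj G) (lookup-++ʳ zs (y ∷ r) (inject₁ i)) (lookup-++ʳ zs (y ∷ r) (suc i))) (down-links dn i)
    ; rooted = lookup-injective (Sub.Enum.uniq en) _ _ (trans (proj₂ (Sub.enum-root (plain G) R en)) (sym (lookup-++ʳ zs (y ∷ r) zero))) }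
    where open Spine (spine y)

  sized : ∀ y → offs y + suc (hs y) ≡ size y
  sized y = Sub.Enum.len≡ (Spine.en (spine y))

  -- The spine with exactly ℓ loose vertices: few enough for counting in pairs, and by `occ-fat`
  -- enough to certify ℓ loose vertices wherever this pattern occurs.
  record Partial (ℓ : ℕ) (y : Fin n) : Set where
    field
      zs    : Tuple n ℓ
    g : Tuple n (ℓ + suc (hs y))
    g = zs ++ (y ∷ Spine.r (spine y))
    field
      grown : Grow G g
      below : ∀ {z} → z ∈ g → y ≼ z

  opaque
    partial : ∀ {ℓ y} → ℓ ≤ offs y → Partial ℓ y
    partial {ℓ} {y} le = cut (offs y ∸ ℓ) (m∸n+n≡m le) zs (Sub.Enum.grown en) (Sub.Enum.below en)
      where
      open Spine (spine y)
      assoc : ∀ {a} (as : Tuple n a) {b} (bs : Tuple n b) {c} (cs : Tuple n (suc c)) → Grow G ((as ++ bs) ++ cs) → Grow G (bs ++ cs)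
      assoc []       bs cs g = g
      assoc {suc a} (x ∷ as) {b} bs {c} cs g = assoc as bs cs (grow-tail g (≤-trans (s≤s z≤n) (m≤n+m (suc c) (a + b))))
      cut : ∀ a {o} → a + ℓ ≡ o → (zs : Tuple n o) → Grow G (zs ++ (y ∷ r)) → (∀ {z} → z ∈ (zs ++ (y ∷ r)) → y ≼ z) → Partial ℓ y
      cut a refl zs gr b with splitAt a zs
      ... | as , bs , refl = record { zs = bs ; grown = assoc as bs (y ∷ r) gr ; below = λ m → b (reassoc as bs m) }
        where
        reassoc : ∀ {a} (as : Tuple n a) {b} (bs : Tuple n b) {z} → z ∈ (bs ++ (y ∷ r)) → z ∈ ((as ++ bs) ++ (y ∷ r))
        reassoc []       bs m = m
        reassoc (x ∷ as) bs m = there (reassoc as bs m)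

  partPat : ∀ {ℓ y} → Partial ℓ y → Pat (ℓ + suc (hs y))
  partPat {ℓ} {y} p = patOf (plain G) (Partial.g p) (ℓ ↑ʳ zero)

  part-shape : ∀ {ℓ y} (p : Partial ℓ y) → Shape {ℓ} {hs y} (partPat p)
  part-shape {ℓ} {y} p = record
    { links = λ i → trans (cong₂ (adj G) (lookup-++ʳ (Partial.zs p) (y ∷ r) (inject₁ i)) (lookup-++ʳ (Partial.zs p) (y ∷ r) (suc i))) (down-links dn i)
    ; rooted = refl }
    where open Spine (spine y)

  part-occ : ∀ {ℓ y} (p : Partial ℓ y) → par y ≢ y → Sub.Occ (plain G) R (partPat p) y (Partial.g p)
  part-occ {ℓ} {y} p ne = grow-unique (Partial.grown p) , ((λ i j → refl) , λ i → refl) , lookup-++ʳ (Partial.zs p) (y ∷ Spine.r (spine y)) zero , λ m → par-not-below ne (Partial.below p m)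

occs-pos : {G : Graph n} {e : Bool} (R : Rooted G e) (Q : Pat m) {y : Fin n} {g : Tuple n m} → Sub.Occ (plain G) R Q y g → Sub.occs (plain G) R Q y ≢ 0
occs-pos {n} {m} {G} R Q {y} {g} o z = χ-pos (Sub.occ? (plain G) R Q y g) o (n≤0⇒n≡0 (≤-trans (S-≥ (vec n m) g (λ g → χ (Sub.occ? (plain G) R Q y g))) (≡⇒≤ z)))

module _ {n n' : ℕ} (G : Graph n) (H : Graph n') {e e' : Bool} (R : Rooted G e) (R' : Rooted H e') where
  private
    module X = Root R
    module Y = Root R'

  -- A vertex at relative depth d is reached from the marked one by d edges inside the tuple, and in
  -- the other tree each edge increases the depth by at most one.
  rank : {g : Tuple n m} {g' : Tuple n' m} → Grow G g → Same (plain G) g (plain H) g' → ∀ {r} → (∀ {z} → z ∈ g → lookup g r X.≼ z) →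
         ∀ d j → X.dep (lookup g j) ≤ X.dep (lookup g r) + d → Y.dep (lookup g' j) ≤ Y.dep (lookup g' r) + d
  rank {g = g} {g'} gr sm {r} below d j le with lookup g j ≟ᶠ lookup g r
  ... | yes q = ≤-trans (≡⇒≤ (cong (Y.dep ∘ lookup g') (lookup-injective (grow-unique gr) j r q))) (m≤m+n _ d)
  rank {g = g} gr sm {r} below zero j le | no ne = ⊥-elim (ne (sym (X.≼-dep-eq (below (∈-lookup j g)) (≤-trans le (≡⇒≤ (+-identityʳ _))))))
  rank {g = g} {g'} gr sm {r} below (suc d) j le | no ne with X.≼-up (below (∈-lookup j g)) ne
  ... | lt , p with X.par (lookup g j) ∈? g
  ...   | no p∉ = ⊥-elim (ne (X.≼-dep-eq (Sub.grow-below (plain G) R gr (∈-lookup j g) p∉ (∈-lookup r g)) (X.≼-dep (below (∈-lookup j g)))))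
  ...   | yes p∈ with ∈⇒lookup p∈
  ...     | i , q = ≤-trans (dep-near H R' (trans (sym (same-adj sm j i)) (trans (cong (adj G (lookup g j)) q) (X.adj← (X.up-par lt)))))
             (≤-trans (s≤s (rank gr sm {r} below d i (s≤s⁻¹ (≤-trans (≡⇒≤ (trans (cong (suc ∘ X.dep) q) (sym (X.up _ lt)))) (≤-trans le (≡⇒≤ (+-suc _ d)))))))
               (≡⇒≤ (sym (+-suc _ d))))

  -- The occurrence has ℓ + 1 + `hs` y vertices, none more than `hs` y levels below y' by `rank`. At
  -- most 1 + `hs` y of them lie on the spine of y', so at least ℓ are loose there.
  occ-fat : ∀ {ℓ y} (p : Partial G R ℓ y) {y' g'} → Sub.Occ (plain H) R' (partPat G R p) y' g' → ℓ ≤ offs H R' y'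
  occ-fat {ℓ} {y} p {y'} {g'} (u , mt , q , p∉) = +-cancelʳ-≤ (suc (hs G R y)) ℓ _ (≤-trans (≡⇒≤ (sym (count-∈ g' u)))
      (≤-trans (S-mono (fin n') pt) (≤-trans (≡⇒≤ (S-+ (fin n') _ _)) (+-mono-≤ (count-≤ (Spine.zs (spine H R' y'))) (down-short H R' (hs G R y) (Spine.dn (spine H R' y')))))))
    where
    sm : Same (plain G) (Partial.g p) (plain H) g'
    sm = match-same {G = plain G} {plain H} {partPat G R p} ((λ _ _ → refl) , λ _ → refl) mt
    gr' : Grow H g'
    gr' = grow-same sm u (Partial.grown p)
    rt : lookup (Partial.g p) (ℓ ↑ʳ zero) ≡ y
    rt = lookup-++ʳ (Partial.zs p) (y ∷ Spine.r (spine G R y)) zero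
    bel : ∀ {z} → z ∈ g' → y' Y.≼ z
    bel = Sub.grow-below (plain H) R' gr' (subst (_∈ g') q (∈-lookup (ℓ ↑ʳ zero) g')) p∉
    low-dep : ∀ {z} → z ∈ g' → Y.dep z ≤ Y.dep y' + hs G R y
    low-dep m with ∈⇒lookup m
    ... | j , refl = ≤-trans (rank (Partial.grown p) sm {ℓ ↑ʳ zero} (λ m → subst (X._≼ _) (sym rt) (Partial.below p m)) (hs G R y) j
          (≤-trans (Spine.deep (spine G R y) (Partial.below p (∈-lookup j (Partial.g p)))) (≡⇒≤ (cong (λ v → X.dep v + hs G R y) (sym rt)))))
        (≡⇒≤ (cong (λ v → Y.dep v + hs G R y) q))
    pt : ∀ z → χ (z ∈? g') ≤ χ (z ∈? Spine.zs (spine H R' y')) + χ (z ∈? (y' ∷ Spine.r (spine H R' y')) ×-dec (Y.dep z ≤? Y.dep y' + hs G R y))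
    pt z with z ∈? g'
    ... | no _ = z≤n
    ... | yes m with ∈-++⁻ (Spine.zs (spine H R' y')) (Sub.Enum.all-of (Spine.en (spine H R' y')) (bel m))
    ...   | inj₁ a = ≤-trans (≡⇒≤ (sym (χ-yes (z ∈? Spine.zs (spine H R' y')) a))) (m≤m+n _ _)
    ...   | inj₂ b = ≤-trans (≡⇒≤ (sym (χ-yes (z ∈? (y' ∷ Spine.r (spine H R' y')) ×-dec (Y.dep z ≤? Y.dep y' + hs G R y)) (b , low-dep m)))) (m≤n+m _ _)

module Alone {n : ℕ} (G : Graph n) {e : Bool} (R : Rooted G e) {k} (hgt : ∀ v → Root.dep R v ≤ 1 + k) where
  open Root R
  open InTree G R
  open Total G R {k} hgt

  -- Outside the subtree of tip x such a configuration meets the subtree of z only in a descending path.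
  leftover : ∀ {d m} {A B : Tuple n (2 + k)} (hv : Halves R A B) {x : Tuple n (2 + d)} → Rail x → {g : Tuple n m} → (∀ {v} → v ∈ g → tip x ≼ v) →
    ∀ z → dep z ≡ 1 + d → z ≢ tip x → spread (oneKs k m d) (g , x , B , A , tt) + offs G R z ≤ n
  leftover {d} {m} {A} {B} hv {x} rx {g} below z dz ne = +-cancelʳ-≤ (suc (hs G R z)) _ _ (≤-trans (≡⇒≤ (trans (+-assoc (spread _ t) _ _) (cong (spread (oneKs k m d) t +_) (sized G R z))))
      (≤-trans (≡⇒≤ (sym (S-+ (fin n) _ _))) (≤-trans (S-mono (fin n) pt) (≤-trans (≡⇒≤ (S-+ (fin n) _ _)) (+-mono-≤ (≡⇒≤ (∑-one n)) (shared (z ≼? tip A) (z ≼? tip B)))))))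
    where
    open Grand G R hgt hv using (rail-cover)
    t : Tup n (oneKs k m d)
    t = g , x , B , A , tt
    On : Fin n → Set
    On v = z ≼ v × (v ≼ tip A ⊎ v ≼ tip B)
    on? : ∀ v → Dec (On v)
    on? v = z ≼? v ×-dec (v ≼? tip A ⊎-dec v ≼? tip B)
    not-x : ∀ {v} → z ≼ v → v ≼ tip x → ⊥
    not-x p q = ne (≼-dep-eq (≼-trans p q) (≡⇒≤ (trans (rail-dep rx) (sym dz))))
    place : ∀ {v} → z ≼ v → v ∈ g ⊎ (v ∈ x ⊎ (v ∈ B ⊎ (v ∈ A ⊎ ⊥))) → On v
    place p (inj₁ m') = ⊥-elim (ne (≼-linear p (below m') (trans dz (sym (rail-dep rx)))))
    place p (inj₂ (inj₁ m')) with rail-cover rx m'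
    ... | inj₁ q = ⊥-elim (not-x p q)
    ... | inj₂ q = p , q
    place p (inj₂ (inj₂ (inj₁ m'))) with rail-cover (Halves.railB hv) m'
    ... | inj₁ q = p , inj₂ q
    ... | inj₂ q = p , q
    place p (inj₂ (inj₂ (inj₂ (inj₁ m')))) with rail-cover (Halves.railA hv) m'
    ... | inj₁ q = p , inj₁ q
    ... | inj₂ q = p , q
    pt : ∀ v → χ (in? (oneKs k m d) v t) + χ (z ≼? v) ≤ 1 + χ (on? v)
    pt v with z ≼? v
    ... | no _ = ≤-trans (≡⇒≤ (+-identityʳ _)) (≤-trans (χ≤1 (in? (oneKs k m d) v t)) (s≤s z≤n))
    ... | yes p with in? (oneKs k m d) v t
    ...   | no _ = s≤s z≤n
    ...   | yes i = s≤s (≡⇒≤ (sym (χ-yes (yes p ×-dec (v ≼? tip A ⊎-dec v ≼? tip B)) (place p i))))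
    not-both : z ≼ tip A → z ≼ tip B → ⊥
    not-both p q with ancestor z 1 base≤ (≤-trans (s≤s z≤n) (≡⇒≤ (sym dz)))
      where
      base≤ : base e ≤ 1
      base≤ = ≤-trans (dep≥ (lookup A (suc zero))) (≡⇒≤ (Rail.first (Halves.railA hv)))
    ... | w , r , dw = Halves.apart hv (trans (≼-linear (rail-below (Halves.railA hv)) (≼-trans r p) (trans (Rail.first (Halves.railA hv)) (sym dw)))
                         (≼-linear (≼-trans r q) (rail-below (Halves.railB hv)) (trans dw (sym (Rail.first (Halves.railB hv))))))
    leg : ∀ {u} → z ≼ u → (∀ {v} → On v → v ≼ u) → ∑ (λ v → χ (on? v)) ≤ suc (hs G R z)
    leg p h with segment G R p
    ... | j , r , dn , q = ≤-trans (S-mono (fin n) (λ v → χ-mono (on? v) (v ∈? (z ∷ r)) (λ o → down-between G R dn (proj₁ o) (subst (v ≼_) (sym q) (h o)))))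
          (≤-trans (count-≤ (z ∷ r)) (s≤s (+-cancelˡ-≤ (dep z) _ _ (≤-trans (≡⇒≤ (trans (sym (down-dep dn)) (cong dep q))) (Spine.deep (spine G R z) p)))))
    shared : Dec (z ≼ tip A) → Dec (z ≼ tip B) → ∑ (λ v → χ (on? v)) ≤ suc (hs G R z)
    shared (yes p) _ = leg p λ { (_ , inj₁ q) → q ; (r , inj₂ q) → ⊥-elim (not-both p (≼-trans r q)) }
    shared (no h) (yes p) = leg p λ { (r , inj₁ q) → ⊥-elim (h (≼-trans r q)) ; (_ , inj₂ q) → q }
    shared (no h) (no h') = ≤-trans (≡⇒≤ (S-zero (fin n) (λ v → χ-no (on? v) λ { (r , inj₁ q) → h (≼-trans r q) ; (r , inj₂ q) → h' (≼-trans r q) }))) z≤n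

agree-flip : ∀ {N} (G : LGraph n) (H : LGraph n') → Agree G H N → Agree H G N
agree-flip G H ag k k≤ F F' r = sym (ag k k≤ F' F (λ xs ys u v s → sym (r ys xs v u (same-flip s))))

module Levels {n : ℕ} (G : Graph n) {e : Bool} (R : Rooted G e) where
  open Root R
  private
    oc : ∀ {m} → Pat m → Fin n → ℕ
    oc = Sub.occs (plain G) R

  lev-pos : ∀ {d m} (Q : Pat m) {v} → dep v ≡ 1 + d → oc Q v ≢ 0 → Lev G R Q d ≢ 0
  lev-pos {d} Q {v} dv o z = *-pos (χ-pos (dep v ≟ 1 + d) dv) o (n≤0⇒n≡0 (≤-trans (S-≥ (fin n) v (λ v → χ (dep v ≟ 1 + d) * oc Q v)) (≡⇒≤ z)))

  lev-wit : ∀ {d m} (Q : Pat m) → Lev G R Q d ≢ 0 → ∃ λ v → dep v ≡ 1 + d × oc Q v ≢ 0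
  lev-wit {d} Q h = let (v , p) = ∑-pos _ h in v , χ≢0 (dep v ≟ 1 + d) (*≢0ˡ _ p) , *≢0ʳ (χ (dep v ≟ 1 + d)) p

  pair-pos : ∀ {d m m'} (Q : Pat m) (Z : Pat m') {v z} → dep v ≡ 1 + d → dep z ≡ 1 + d → v ≢ z → oc Q v ≢ 0 → oc Z z ≢ 0 → PairLev G R Q Z d ≢ 0
  pair-pos {d} Q Z {v} {z} dv dz ne o o' zz = *-pos (χ-pos (dep v ≟ 1 + d) dv) (*-pos o
      (λ r → *-pos (χ-pos (dep z ≟ 1 + d) dz) (*-pos (χ-pos (¬? (v ≟ᶠ z)) ne) o')
        (n≤0⇒n≡0 (≤-trans (S-≥ (fin n) z (λ z → χ (dep z ≟ 1 + d) * (χ (¬? (v ≟ᶠ z)) * oc Z z))) (≡⇒≤ r)))))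
    (n≤0⇒n≡0 (≤-trans (S-≥ (fin n) v (λ v → χ (dep v ≟ 1 + d) * (oc Q v * rest G R Z d v))) (≡⇒≤ zz)))

  pair-wit : ∀ {d m m'} (Q : Pat m) (Z : Pat m') → PairLev G R Q Z d ≢ 0 → ∃ λ v → ∃ λ z → dep v ≡ 1 + d × dep z ≡ 1 + d × v ≢ z × oc Q v ≢ 0 × oc Z z ≢ 0
  pair-wit {d} Q Z h =
    let (v , p) = ∑-pos _ h
        q = *≢0ʳ (χ (dep v ≟ 1 + d)) p
        (z , r) = ∑-pos _ (*≢0ʳ (oc Q v) q)
        s = *≢0ʳ (χ (dep z ≟ 1 + d)) r
    in v , z , χ≢0 (dep v ≟ 1 + d) (*≢0ˡ _ p) , χ≢0 (dep z ≟ 1 + d) (*≢0ˡ _ r) , χ≢0 (¬? (v ≟ᶠ z)) (*≢0ˡ _ s) , *≢0ˡ _ q , *≢0ʳ (χ (¬? (v ≟ᶠ z))) s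

  level-single : ∀ {d X} (f : Fin n → ℕ) → dep X ≡ 1 + d → (∀ v → dep v ≡ 1 + d → f v ≢ 0 → v ≡ X) → ∑ (λ v → χ (dep v ≟ 1 + d) * f v) ≡ f X
  level-single {d} {X} f dX only = trans (S-single (fin n) X _ others) (trans (cong (_* f X) (χ-yes (dep X ≟ 1 + d) dX)) (+-identityʳ _))
    where
    others : ∀ v → v ≢ X → χ (dep v ≟ 1 + d) * f v ≡ 0
    others v ne with dep v ≟ 1 + d | f v ≟ 0
    ... | no _   | _     = refl
    ... | yes _  | yes z = trans (+-identityʳ _) z
    ... | yes dv | no nz = ⊥-elim (ne (only v dv nz))

  pair-single : ∀ {d m m'} (Q : Pat m) (Z : Pat m') {X} → dep X ≡ 1 + d → (∀ v → dep v ≡ 1 + d → oc Q v ≢ 0 → v ≡ X) → PairLev G R Q Z d ≡ oc Q X * rest G R Z d X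
  pair-single {d} Q Z dX only = level-single (λ v → oc Q v * rest G R Z d v) dX (λ v dv p → only v dv (*≢0ˡ _ p))

module Lone {n N ℓ : ℕ} (G : Graph n) (eN : N + ℓ ≡ n) {e : Bool} {k : ℕ} (f : Frame G e k) (c : inner² G + 8 + 2 * ℓ ≤ N) where
  open Frame f
  open Root R
  open InTree G R

  Sole : ℕ → Set
  Sole d = ∀ z z' → dep z ≡ 1 + d → dep z' ≡ 1 + d → ℓ ≤ offs G R z → ℓ ≤ offs G R z' → z ≡ z'

  heavy : ∀ d {m} → Pat m → ℕ
  heavy d {m} Q = ∑ᵗ (oneKs k m d) (λ t → oneW G e k d Q t * χ (suc N ≤? spread (oneKs k m d) t))

  heavy-light : ∀ d {m} (Q : Pat m) → heavy d Q ≡ 0 → ∀ t → oneW G e k d Q t ≢ 0 → spread (oneKs k m d) t ≤ N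
  heavy-light d {m} Q z t w with suc N ≤? spread (oneKs k m d) t
  ... | no h = ≮⇒≥ h
  ... | yes p = ⊥-elim (*-pos w (χ-pos (suc N ≤? spread (oneKs k m d) t) p) (∑ᵗ-zero (oneKs k m d) (λ t → oneW G e k d Q t * χ (suc N ≤? spread (oneKs k m d) t)) z t))

  -- More than N vertices leave fewer than ℓ uncovered, whereas by `leftover` all loose vertices of
  -- any other vertex z of this level, or as many others, stay uncovered. The budget gives ℓ ≤ off:
  -- with fewer loose vertices the configuration would fit.
  heavy-sole : ∀ d {off h} (Q : Pat (off + suc h)) → Shape {off} {h} Q → Grows G Q → heavy d Q ≢ 0 → Sole d × ℓ ≤ off
  heavy-sole d {off} {h} Q sh grows hv≢ = from (∑ᵗ-pos (oneKs k (off + suc h) d) _ hv≢)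
    where
    ks = oneKs k (off + suc h) d
    from : (∃ λ t → oneW G e k d Q t * χ (suc N ≤? spread ks t) ≢ 0) → Sole d × ℓ ≤ off
    from ((g , x , B' , A' , _) , p) = (λ z z' dz dz' fz fz' → trans (is-tip z dz fz) (sym (is-tip z' dz' fz'))) ,
        lia (inner² G ∷ ℓ ∷ N ∷ off ∷ spread ks t ∷ []) (λ i ℓ N o s → i :+ con 8 :+ 2 :* ℓ :≤ N ∷ N :< s ∷ s :≤ i :+ (con 6 :+ o) ∷ [] ⊢ ℓ :≤ o)
          (c , big , Total.Bounds.one-spread G R hgt {d} {off} {h} Q sh t w , tt)
      where
      t = (g , x , B' , A' , tt)
      w : oneW G e k d Q t ≢ 0
      w = *≢0ˡ _ p
      big : N < spread ks t
      big = χ≢0 (suc N ≤? spread ks t) (*≢0ʳ (oneW G e k d Q t) p)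
      hv' : Halves R A' B'
      hv' = legs-halves G e R hgt (χ≢0 (legs? G e A' B') (*≢0ˡ _ w))
      w₁ = *≢0ʳ (χ (legs? G e A' B')) w
      rx : Rail x
      rx = stem-rail G e R hv' (χ≢0 (stem? G e A' B' x) (*≢0ˡ _ w₁))
      oa = χ≢0 (occAt? G Q (tip x) (nock x) g) (*≢0ʳ (χ (stem? G e A' B' x)) w₁)
      below : ∀ {v} → v ∈ g → tip x ≼ v
      below = Sub.grow-below (plain G) R (grows (proj₁ oa) (proj₁ (proj₂ oa))) (subst (_∈ g) (proj₁ (proj₂ (proj₂ oa))) (∈-lookup (Pat.r Q) g))
        (subst (_∉ g) (rail-nock rx) (proj₂ (proj₂ (proj₂ oa))))
      is-tip : ∀ z → dep z ≡ 1 + d → ℓ ≤ offs G R z → z ≡ tip x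
      is-tip z dz fz with z ≟ᶠ tip x
      ... | yes q = q
      ... | no ne = ⊥-elim (lia⊥ (spread ks t ∷ offs G R z ∷ n ∷ N ∷ ℓ ∷ []) (λ s o n N ℓ → s :+ o :≤ n ∷ N :< s ∷ ℓ :≤ o ∷ N :+ ℓ :≡ n ∷ [])
            (Alone.leftover G R hgt hv' rx below z dz ne , big , fz , eN , tt))

module SoleTransfer {n N ℓ : ℕ} (T H : Graph n) (eN : N + ℓ ≡ n) (ag : Agree (plain T) (plain H) N) {e : Bool} {k : ℕ} (fT : Frame T e k) (fH : Frame H e k)
  (cT : inner² T + 8 + 2 * ℓ ≤ N) (cH : inner² H + 8 + 2 * ℓ ≤ N) where
  private
    R = Frame.R fT
    R' = Frame.R fH
    module X = Root R
    module Y = Root R'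
    module C = Comparison {n} {N} {ℓ} T H ag fT fH cT cH

  pos-par : ∀ {y d} → X.dep y ≡ 1 + d → X.par y ≢ y
  pos-par = Total.pos-≢ T R (Frame.hgt fT)

  fat-image : ∀ {d y} (p : Partial T R ℓ y) → X.dep y ≡ 1 + d → ∃ λ y' → Y.dep y' ≡ 1 + d × Sub.occs (plain H) R' (partPat T R p) y' ≢ 0
  fat-image {d} p dy = Levels.lev-wit H R' (partPat T R p) (λ z → Levels.lev-pos T R (partPat T R p) dy (occs-pos R (partPat T R p) (part-occ T R p (pos-par dy)))
    (trans (C.lev-shaped d (partPat T R p) (part-shape T R p) (≤-trans (m≤n*m ℓ 2) (m≤m+n (2 * ℓ) 2))) z))

  occs-fat : ∀ {y} (p : Partial T R ℓ y) {y'} → Sub.occs (plain H) R' (partPat T R p) y' ≢ 0 → ℓ ≤ offs H R' y'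
  occs-fat {y} p {y'} o = let (g , w) = ∑ᵛ-pos (ℓ + suc (hs T R y)) _ o in occ-fat T H R R' p (χ≢0 (Sub.occ? (plain H) R' (partPat T R p) y' g) w)

  occs-fat-self : ∀ {y} (p : Partial T R ℓ y) {y'} → Sub.occs (plain T) R (partPat T R p) y' ≢ 0 → ℓ ≤ offs T R y'
  occs-fat-self {y} p {y'} o = let (g , w) = ∑ᵛ-pos (ℓ + suc (hs T R y)) _ o in occ-fat T T R R p (χ≢0 (Sub.occ? (plain T) R (partPat T R p) y' g) w)

  -- Two such vertices of T would give a pair of partial branches; by `pair-agree` the pair also
  -- occurs in H, and by `occ-fat` at two vertices with ℓ loose ones each.
  sole-transfer : ∀ d → Lone.Sole H eN fH cH d → Lone.Sole T eN fT cT d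
  sole-transfer d sole z z' dz dz' fz fz' with z ≟ᶠ z'
  ... | yes q = q
  ... | no ne = ⊥-elim (pair (λ r → Levels.pair-pos T R Q Q' dz dz' ne (occs-pos R Q (part-occ T R p (pos-par dz))) (occs-pos R Q' (part-occ T R p' (pos-par dz')))
                  (trans (C.pair-agree d Q (part-shape T R p) Q' (part-shape T R p') ≤-refl ≤-refl) r)))
    where
    p = partial T R {ℓ} fz
    p' = partial T R {ℓ} fz'
    Q = partPat T R p
    Q' = partPat T R p'
    pair : PairLev H R' Q Q' d ≢ 0 → ⊥
    pair h = let (v , w , dv , dw , v≢w , o , o') = Levels.pair-wit H R' Q Q' h in v≢w (sole v w dv dw (occs-fat p o) (occs-fat p' o'))

module ParZip {n n' : ℕ} (G : LGraph n) (H : LGraph n') {e : Bool} (R : Rooted (graph G) e) (R' : Rooted (graph H) e) (st : Pair.State G H R R')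
  (closed : ∀ {z} → z ∈ Pair.State.q st → base e < Root.dep R z → Root.par R z ∈ Pair.State.q st) where
  private
    module X = Root R
    module Y = Root R'
  open Pair.State st

  zip-fun : ∀ {x x' y'} → Zip q q' x x' → Zip q q' x y' → x' ≡ y'
  zip-fun (i , p , r) (j , p' , r') = trans (sym r) (trans (cong (lookup q') (lookup-injective uq i j (trans p (sym p')))) r')

  zip-dep : ∀ {x x'} → Zip q q' x x' → X.dep x ≡ Y.dep x'
  zip-dep (i , refl , refl) = deps i

  -- The partner of the parent is adjacent and one level higher, which only the parent is.
  par-zip : ∀ {x x'} → Zip q q' x x' → base e < X.dep x → Zip q q' (X.par x) (Y.par x')
  par-zip (i , refl , refl) lt with ∈⇒lookup (closed (∈-lookup i q) lt)
  ... | l , ql = l , ql , pick (Y.adj→ (trans (sym (same-adj same i l)) (trans (cong (adj (graph G) (lookup q i)) ql) (X.adj← (X.up-par lt)))))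
    where
    d : Y.dep (lookup q' i) ≡ suc (Y.dep (lookup q' l))
    d = trans (sym (deps i)) (trans (X.up _ lt) (cong suc (trans (cong X.dep (sym ql)) (deps l))))
    pick : lookup q' i ≡ Y.par (lookup q' l) ⊎ lookup q' l ≡ Y.par (lookup q' i) → lookup q' l ≡ Y.par (lookup q' i)
    pick (inj₂ r) = r
    pick (inj₁ r) with base e <? Y.dep (lookup q' l)
    ... | yes lt' = ⊥-elim (m≢1+n+m (Y.dep (lookup q' l)) {1} (trans (Y.up _ lt') (cong suc (trans (cong Y.dep (sym r)) d))))
    ... | no h = ⊥-elim (1+n≢n (trans (sym d) (trans (cong Y.dep r) (trans (Y.top-dep _ t) (sym t)))))
      where t = ≤-antisym (≮⇒≥ h) (Y.dep≥ (lookup q' l))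

  carry : ∀ {y y' x x'} → Zip q q' y y' → Zip q q' x x' → y X.≼ x → y' Y.≼ x'
  carry zy zx X.≼-refl = subst (Y._≼_ _) (zip-fun zy zx) Y.≼-refl
  carry zy zx (X.≼-step lt p) = Y.≼-step (subst (base e <_) (zip-dep zx) lt) (carry zy (par-zip zx lt) p)

-- Descending from the centre

data Small (ℓ : ℕ) : ∀ {m} → Pat m → Set where
  small : ∀ {off h} (Q : Pat (off + suc h)) → Shape {off} {h} Q → off ≤ ℓ → Small ℓ Q

-- One side of a partial matching: β marks the vertices of level d + 1 whose subtrees are still unmatched.
module Half {n : ℕ} (G : Graph n) {e : Bool} (R : Rooted G e) (d : ℕ) (β : Fin n → Bool) {k : ℕ} (q : Tuple n k) (uq : Unique q)
  (dβ : ∀ {y} → β y ≡ true → Root.dep R y ≡ 1 + d)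
  (cover : ∀ z → z ∈ q ⊎ ∃ λ y → β y ≡ true × Root._≼_ R y z)
  (apart : ∀ {y z} → β y ≡ true → z ∈ q → ¬ Root._≼_ R y z) where
  private
    module X = Root R

  at-level : ∀ {z} → X.dep z ≡ 1 + d → z ∈ q ⊎ β z ≡ true
  at-level {z} dz with cover z
  ... | inj₁ m = inj₁ m
  ... | inj₂ (y , b , p) with X.≼-dep-eq p (≡⇒≤ (trans dz (sym (dβ b))))
  ...   | refl = inj₂ b

  inside : ∀ {y z} → y ∈ q → X.dep y ≡ 1 + d → y X.≼ z → z ∈ q
  inside {y} {z} y∈ dy p with cover z
  ... | inj₁ m = m
  ... | inj₂ (w , b , r) = ⊥-elim (apart b y∈ (subst (w X.≼_) (X.≼-linear r p (trans (dβ b) (sym dy))) X.≼-refl))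

  level : ∀ (f : Fin n → ℕ) → ∑ (λ v → χ (X.dep v ≟ 1 + d) * f v) ≡ ∑ (λ i → χ (X.dep (lookup q i) ≟ 1 + d) * f (lookup q i)) + ∑ (λ v → on β v * f v)
  level f = trans (∑-cong pt) (trans (S-+ (fin n) _ _) (cong (_+ ∑ (λ v → on β v * f v)) (∑-∈ q uq (λ v → χ (X.dep v ≟ 1 + d) * f v))))
    where
    pt : ∀ v → χ (X.dep v ≟ 1 + d) * f v ≡ χ (v ∈? q) * (χ (X.dep v ≟ 1 + d) * f v) + on β v * f v
    pt v with v ∈? q
    ... | yes m = sym (trans (cong₂ _+_ (+-identityʳ (χ (X.dep v ≟ 1 + d) * f v)) (cong (_* f v) (χ-no (β v ≟ᵇ true) (λ b → apart b m X.≼-refl)))) (+-identityʳ _))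
    ... | no h = cong (_* f v) (χ-cong (X.dep v ≟ 1 + d) (β v ≟ᵇ true) (λ dv → pick dv (at-level dv)) dβ)
      where
      pick : X.dep v ≡ 1 + d → v ∈ q ⊎ β v ≡ true → β v ≡ true
      pick _ (inj₁ m) = ⊥-elim (h m)
      pick _ (inj₂ b) = b

module Tree {n N ℓ : ℕ} (T H : Graph n) (eN : N + ℓ ≡ n) (ag : Agree (plain T) (plain H) N) {e : Bool} {k : ℕ} (fT : Frame T e k) (fH : Frame H e k)
  (cT : inner² T + 8 + 2 * ℓ ≤ N) (cH : inner² H + 8 + 2 * ℓ ≤ N) where

  private
    R = Frame.R fT
    R' = Frame.R fH
    module X = Root R
    module Y = Root R'
    module LX = Lone T eN fT cT
    module LY = Lone H eN fH cH
    module ST = SoleTransfer T H eN ag fT fH cT cH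
    module ST' = SoleTransfer H T eN (agree-flip (plain T) (plain H) ag) fH fT cH cT
    module C = Comparison {n} {N} {ℓ} T H ag fT fH cT cH
    oc : ∀ {m} → Pat m → Fin n → ℕ
    oc = Sub.occs (plain T) R
    oc' : ∀ {m} → Pat m → Fin n → ℕ
    oc' = Sub.occs (plain H) R'
  open Pair (plain T) (plain H) R R'

  posX : ∀ {y d} → X.dep y ≡ 1 + d → X.par y ≢ y
  posX = Total.pos-≢ T R (Frame.hgt fT)
  posY : ∀ {y d} → Y.dep y ≡ 1 + d → Y.par y ≢ y
  posY = Total.pos-≢ H R' (Frame.hgt fH)

  -- The matched vertices are closed under parents, so matching respects ancestors, and the
  -- unmatched rest consists of entire branches whose tops are marked on one common level.
  record Inv (d : ℕ) : Set where
    field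
      st      : State
      β β'    : Fin n → Bool
      dβ      : ∀ {y} → β y ≡ true → X.dep y ≡ 1 + d
      dβ'     : ∀ {y} → β' y ≡ true → Y.dep y ≡ 1 + d
      closed  : ∀ {z} → z ∈ State.q st → base e < X.dep z → X.par z ∈ State.q st
      closed' : ∀ {z} → z ∈ State.q' st → base e < Y.dep z → Y.par z ∈ State.q' st
      cover   : ∀ z → z ∈ State.q st ⊎ ∃ λ y → β y ≡ true × y X.≼ z
      cover'  : ∀ z → z ∈ State.q' st ⊎ ∃ λ y → β' y ≡ true × y Y.≼ z
      apart   : ∀ {y x} → β y ≡ true → x ∈ State.q st → ¬ y X.≼ x
      apart'  : ∀ {y x} → β' y ≡ true → x ∈ State.q' st → ¬ y Y.≼ x
      al      : ∀ {y y'} → β y ≡ true → β' y' ≡ true → Aligned st y y'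

  -- The vertices of a level that are matched already contribute equally on both sides.
  module Split-level {d} (inv : Inv d) where
    open Inv inv
    open State st

    flipped : Pair.State (plain H) (plain T) R' R
    flipped = record { q = q' ; q' = q ; uq = uq' ; uq' = uq ; same = same-flip same ; deps = λ i → sym (deps i) }

    module Z = ParZip (plain T) (plain H) R R' st closed
    module Z' = ParZip (plain H) (plain T) R' R flipped closed'

    open Half T R d β q uq dβ cover apart public
    open Half H R' d β' q' uq' dβ' cover' apart' public using () renaming (at-level to at-level'; inside to inside'; level to level')

    twin : ∀ i → X.dep (lookup q i) ≡ 1 + d → Twin (lookup q i) (lookup q' i)
    twin i dy = record { a = q ; b = q' ; ua = uq ; ub = uq' ; same = same ; inA = inside (∈-lookup i q) dy ; inB = inside' (∈-lookup i q') (trans (sym (deps i)) dy)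
      ; below→ = λ j → Z.carry (i , refl , refl) (j , refl , refl) ; below← = λ j → Z'.carry (i , refl , refl) (j , refl , refl) ; i = i ; a-i = refl ; b-i = refl }

    twin-occs : ∀ {m} (Q : Pat m) → Good Q → ∀ i → X.dep (lookup q i) ≡ 1 + d → oc Q (lookup q i) ≡ oc' Q (lookup q' i)
    twin-occs Q gd i dy = occs-≡ (plain T) (plain H) R R' (twin i dy) (posX dy) (posY (trans (sym (deps i)) dy)) Q gd

    unmatched : ∀ (f f' : Fin n → ℕ) → (∀ i → X.dep (lookup q i) ≡ 1 + d → f (lookup q i) ≡ f' (lookup q' i)) →
      ∑ (λ v → χ (X.dep v ≟ 1 + d) * f v) ≡ ∑ (λ v → χ (Y.dep v ≟ 1 + d) * f' v) → ∑ (λ v → on β v * f v) ≡ ∑ (λ v → on β' v * f' v)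
    unmatched f f' h eq = +-cancelˡ-≡ (∑ (λ i → χ (X.dep (lookup q i) ≟ 1 + d) * f (lookup q i))) _ _ (trans (sym (level f)) (trans eq (trans (level' f')
      (cong (_+ ∑ (λ v → on β' v * f' v)) (∑-cong (λ i → trans (cong (λ z → χ (z ≟ 1 + d) * f' (lookup q' i)) (sym (deps i)))
        (χ-gate (X.dep (lookup q i) ≟ 1 + d) (λ dy → sym (h i dy)))))))))

  Light : ℕ → ∀ {m} → Pat m → Set
  Light d {m} Q = (∀ t → oneW T e k d Q t ≢ 0 → spread (oneKs k m d) t ≤ N) × (∀ t → oneW H e k d Q t ≢ 0 → spread (oneKs k m d) t ≤ N)

  all-light : ∀ {d} (inv : Inv d) → (∀ {y} → Inv.β inv y ≡ true → Light d (fullPat T R y)) → (∀ {y} → Inv.β' inv y ≡ true → Light d (fullPat H R' y)) → Isom (plain T) (plain H)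
  all-light {d} inv li li' = record
      { q = State.q new ; q' = State.q' new ; uq = State.uq new ; uq' = State.uq' new ; same = State.same new ; all = λ x → all (cover x) ; all' = λ x → all' (cover' x) }
    where
    open Inv inv
    open Split-level inv using (unmatched; twin-occs)
    module OG = OccGreedy (plain T) (plain H) R R' (enumV T R) (enumV H R') (1 + d) (Light d)
    ready : OG.Ready st β β'
    ready = record { ne = posX ∘ dβ ; ne' = posY ∘ dβ' ; depD = dβ ; depD' = dβ' ; apart = apart ; apart' = apart' ; al = al ; fam = li ; fam' = li'
      ; sums = λ P gd (a , b) → unmatched (oc P) (oc' P) (twin-occs P gd) (C.lev-agree d P a b) }
    ex = OG.greedy ready
    open Greedy.Extension ex
    oldq : ∀ {x} → x ∈ State.q st → x ∈ State.q new
    oldq m = let (i , e) = ∈⇒lookup m ; (j , p , _) = old (i , refl , refl) in subst (_∈ State.q new) (trans p e) (∈-lookup j (State.q new))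
    oldq' : ∀ {x} → x ∈ State.q' st → x ∈ State.q' new
    oldq' m = let (i , e) = ∈⇒lookup m ; (j , _ , p) = old (i , refl , refl) in subst (_∈ State.q' new) (trans p e) (∈-lookup j (State.q' new))
    all : ∀ {x} → x ∈ State.q st ⊎ (∃ λ y → β y ≡ true × y X.≼ x) → x ∈ State.q new
    all (inj₁ m) = oldq m
    all (inj₂ (y , b , p)) = in-q b p
    all' : ∀ {x} → x ∈ State.q' st ⊎ (∃ λ y → β' y ≡ true × y Y.≼ x) → x ∈ State.q' new
    all' (inj₁ m) = oldq' m
    all' (inj₂ (y , b , p)) = in-q' b p

  -- Of the two branches entered next only this much is known: a part of the one at x also occurs at
  -- x', and no other vertex of the level has ℓ loose vertices.
  record Hot {d} (inv : Inv d) : Set where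
    open Inv inv
    field
      sole  : LX.Sole d
      sole' : LY.Sole d
      x x'  : Fin n
      bx    : β x ≡ true
      bx'   : β' x' ≡ true
      fatx  : ℓ ≤ offs T R x
      occx' : oc' (partPat T R (partial T R {ℓ} fatx)) x' ≢ 0

  part-good : ∀ {y} (p : Partial T R ℓ y) → Good (partPat T R p)
  part-good p = (λ u mt → grow-same (match-same {G = plain T} {plain T} {partPat T R p} ((λ _ _ → refl) , λ _ → refl) mt) u (Partial.grown p))
              , (λ u mt → grow-same (match-same {G = plain T} {plain H} {partPat T R p} ((λ _ _ → refl) , λ _ → refl) mt) u (Partial.grown p))

  part-good' : ∀ {y} (p : Partial H R' ℓ y) → Good (partPat H R' p)
  part-good' p = (λ u mt → grow-same (match-same {G = plain H} {plain T} {partPat H R' p} ((λ _ _ → refl) , λ _ → refl) mt) u (Partial.grown p))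
               , (λ u mt → grow-same (match-same {G = plain H} {plain H} {partPat H R' p} ((λ _ _ → refl) , λ _ → refl) mt) u (Partial.grown p))

  module _ {d} (inv : Inv d) (sole : LX.Sole d) (sole' : LY.Sole d) where
    open Inv inv
    open State st

    -- The part pattern of x occurs at this level of H. If it occurred at a matched vertex, it would
    -- occur at the matched partner in T, which would then have ℓ loose vertices and be x, although
    -- x is unmatched.
    hot : ∀ {x} → β x ≡ true → ℓ ≤ offs T R x → Hot inv
    hot {x} bx fatx = at-image (ST.fat-image p (dβ bx))
      where
      p : Partial T R ℓ x
      p = partial T R {ℓ} fatx
      matched : ∀ i → Y.dep (lookup q' i) ≡ 1 + d → oc' (partPat T R p) (lookup q' i) ≢ 0 → ⊥
      matched i dx' o = apart bx (∈-lookup i q) (subst (X._≼ lookup q i) (sole (lookup q i) x di (dβ bx)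
          (ST.occs-fat-self p (λ z → o (trans (sym (Split-level.twin-occs inv (partPat T R p) (part-good p) i di)) z))) fatx) X.≼-refl)
        where
        di : X.dep (lookup q i) ≡ 1 + d
        di = trans (deps i) dx'
      at-image : (∃ λ x' → Y.dep x' ≡ 1 + d × oc' (partPat T R p) x' ≢ 0) → Hot inv
      at-image (x' , dx' , o) = pick (Split-level.at-level' inv dx')
        where
        pick : x' ∈ q' ⊎ β' x' ≡ true → Hot inv
        pick (inj₂ bx') = record { sole = sole ; sole' = sole' ; x = x ; x' = x' ; bx = bx ; bx' = bx' ; fatx = fatx ; occx' = o }
        pick (inj₁ m) = let (i , e) = ∈⇒lookup m in ⊥-elim (matched i (trans (cong Y.dep e) dx') (λ z → o (trans (cong (oc' (partPat T R p)) (sym e)) z)))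

    -- The part pattern of x' leads back to an unmatched vertex of T with ℓ loose vertices, so that
    -- `Hot` can always be recorded from the side of T.
    hot' : ∀ {x'} → β' x' ≡ true → ℓ ≤ offs H R' x' → Hot inv
    hot' {x'} bx' fatx' = at-image (ST'.fat-image p (dβ' bx'))
      where
      p : Partial H R' ℓ x'
      p = partial H R' {ℓ} fatx'
      matched : ∀ i → X.dep (lookup q i) ≡ 1 + d → oc (partPat H R' p) (lookup q i) ≢ 0 → ⊥
      matched i dx o = apart' bx' (∈-lookup i q') (subst (Y._≼ lookup q' i) (sole' (lookup q' i) x' (trans (sym (deps i)) dx) (dβ' bx')
          (ST'.occs-fat-self p (λ z → o (trans (Split-level.twin-occs inv (partPat H R' p) (part-good' p) i dx) z))) fatx') Y.≼-refl)
      at-image : (∃ λ x → X.dep x ≡ 1 + d × oc (partPat H R' p) x ≢ 0) → Hot inv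
      at-image (x , dx , o) = pick (Split-level.at-level inv dx)
        where
        pick : x ∈ q ⊎ β x ≡ true → Hot inv
        pick (inj₂ bx) = hot bx (ST'.occs-fat p o)
        pick (inj₁ m) = let (i , e) = ∈⇒lookup m in ⊥-elim (matched i (trans (cong X.dep e) dx) (λ z → o (trans (cong (oc (partPat H R' p)) (sym e)) z)))

  full-grows : ∀ y {G : Graph n} → Grows G (fullPat T R y)
  full-grows y {G} u mt = grow-same (match-same {G = plain T} {plain G} {fullPat T R y} ((λ _ _ → refl) , λ _ → refl) mt) u (Sub.Enum.grown (Spine.en (spine T R y)))

  full-grows' : ∀ y {G : Graph n} → Grows G (fullPat H R' y)
  full-grows' y {G} u mt = grow-same (match-same {G = plain H} {plain G} {fullPat H R' y} ((λ _ _ → refl) , λ _ → refl) mt) u (Sub.Enum.grown (Spine.en (spine H R' y)))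

  heavy-hot : ∀ {d} (inv : Inv d) {y} → Inv.β inv y ≡ true → LX.heavy d (fullPat T R y) ≢ 0 ⊎ LY.heavy d (fullPat T R y) ≢ 0 → Hot inv
  heavy-hot {d} inv {y} b (inj₁ h) = let (s , f) = LX.heavy-sole d (fullPat T R y) (full-shape T R y) (full-grows y) h in hot inv s (ST'.sole-transfer d s) b f
  heavy-hot {d} inv {y} b (inj₂ h) = let (s , f) = LY.heavy-sole d (fullPat T R y) (full-shape T R y) (full-grows y) h in hot inv (ST.sole-transfer d s) s b f

  heavy-hot' : ∀ {d} (inv : Inv d) {y} → Inv.β' inv y ≡ true → LX.heavy d (fullPat H R' y) ≢ 0 ⊎ LY.heavy d (fullPat H R' y) ≢ 0 → Hot inv
  heavy-hot' {d} inv {y} b (inj₁ h) = let (s , f) = LX.heavy-sole d (fullPat H R' y) (full-shape H R' y) (full-grows' y) h in hot' inv s (ST'.sole-transfer d s) b f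
  heavy-hot' {d} inv {y} b (inj₂ h) = let (s , f) = LY.heavy-sole d (fullPat H R' y) (full-shape H R' y) (full-grows' y) h in hot' inv (ST.sole-transfer d s) s b f

  opaque
    hot-or-light : ∀ {d} (inv : Inv d) → Hot inv ⊎ ((∀ {y} → Inv.β inv y ≡ true → Light d (fullPat T R y)) × (∀ {y} → Inv.β' inv y ≡ true → Light d (fullPat H R' y)))
    hot-or-light {d} inv = go (Finₚ.any? (λ y → (Inv.β inv y ≟ᵇ true) ×-dec either? (fullPat T R y))) (Finₚ.any? (λ y → (Inv.β' inv y ≟ᵇ true) ×-dec either? (fullPat H R' y)))
      where
      either? : ∀ {m} (Q : Pat m) → Dec (LX.heavy d Q ≢ 0 ⊎ LY.heavy d Q ≢ 0)
      either? Q = ¬? (LX.heavy d Q ≟ 0) ⊎-dec ¬? (LY.heavy d Q ≟ 0)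
      light : ∀ {m} (Q : Pat m) → ¬ (LX.heavy d Q ≢ 0 ⊎ LY.heavy d Q ≢ 0) → Light d Q
      light Q h = LX.heavy-light d Q (zero-of (LX.heavy d Q ≟ 0) (h ∘ inj₁)) , LY.heavy-light d Q (zero-of (LY.heavy d Q ≟ 0) (h ∘ inj₂))
        where
        zero-of : ∀ {a} → Dec (a ≡ 0) → ¬ (a ≢ 0) → a ≡ 0
        zero-of (yes z) _ = z
        zero-of (no nz) h = ⊥-elim (h nz)
      go : Dec (∃ λ y → Inv.β inv y ≡ true × (LX.heavy d (fullPat T R y) ≢ 0 ⊎ LY.heavy d (fullPat T R y) ≢ 0)) →
           Dec (∃ λ y → Inv.β' inv y ≡ true × (LX.heavy d (fullPat H R' y) ≢ 0 ⊎ LY.heavy d (fullPat H R' y) ≢ 0)) →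
           Hot inv ⊎ ((∀ {y} → Inv.β inv y ≡ true → Light d (fullPat T R y)) × (∀ {y} → Inv.β' inv y ≡ true → Light d (fullPat H R' y)))
      go (yes (y , b , h)) _ = inj₁ (heavy-hot inv b h)
      go (no _) (yes (y , b , h)) = inj₁ (heavy-hot' inv b h)
      go (no h) (no h') = inj₂ ((λ {y} b → light (fullPat T R y) (λ w → h (y , b , w))) , (λ {y} b → light (fullPat H R' y) (λ w → h' (y , b , w))))

  module Siblings {d} (inv : Inv d) (ho : Hot inv) where
    open Inv inv
    open Hot ho
    open Split-level inv using (unmatched; twin-occs)
    private
      module OG = OccGreedy (plain T) (plain H) R R' (enumV T R) (enumV H R') (1 + d) (Small ℓ)
      p = partial T R {ℓ} fatx
      Q = partPat T R p

    β- = without β x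
    β'- = without β' x'

    fatx' : ℓ ≤ offs H R' x'
    fatx' = ST.occs-fat p occx'

    only : ∀ v → X.dep v ≡ 1 + d → oc Q v ≢ 0 → v ≡ x
    only v dv o = sole v x dv (dβ bx) (ST.occs-fat-self p o) fatx

    only' : ∀ v → Y.dep v ≡ 1 + d → oc' Q v ≢ 0 → v ≡ x'
    only' v dv o = sole' v x' dv (dβ' bx') (ST.occs-fat p o) fatx'

    same-count : oc Q x ≡ oc' Q x'
    same-count = trans (sym (Levels.level-single T R (oc Q) (dβ bx) only)) (trans (C.lev-shaped d Q (part-shape T R p) (≤-trans (m≤n*m ℓ 2) (m≤m+n (2 * ℓ) 2))) (Levels.level-single H R' (oc' Q) (dβ' bx') only'))

    -- On this level the part pattern of x occurs only at x, respectively x'. The pair count is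
    -- therefore its number of occurrences there times the count of Z at the other vertices, and the
    -- first factor is the same nonzero number in both trees.
    rests : ∀ {off h} (Z : Pat (off + suc h)) → Shape {off} {h} Z → off ≤ ℓ → rest T R Z d x ≡ rest H R' Z d x'
    rests {off} {h} Z sh le = *-cancelˡ-≡ _ _ (oc' Q x') {{≢-nonZero occx'}} (trans (cong (_* rest T R Z d x) (sym same-count))
      (trans (sym (Levels.pair-single T R Q Z (dβ bx) only)) (trans (C.pair-agree d {ℓ} {hs T R x} {off} {h} Q (part-shape T R p) Z sh ≤-refl le) (Levels.pair-single H R' Q Z (dβ' bx') only'))))

    drop : ∀ (β : Fin n → Bool) x (f : Fin n → ℕ) → ∑ (λ v → on β v * (χ (¬? (x ≟ᶠ v)) * f v)) ≡ ∑ (λ v → on (without β x) v * f v)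
    drop β x f = ∑-cong pt
      where
      pt : ∀ v → on β v * (χ (¬? (x ≟ᶠ v)) * f v) ≡ on (without β x) v * f v
      pt v with v ≟ᶠ x
      ... | yes refl = trans (cong (on β v *_) (cong (_* f v) (χ-no (¬? (v ≟ᶠ v)) (λ h → h refl)))) (*-zeroʳ (on β v))
      ... | no ne = cong (on β v *_) (trans (cong (_* f v) (χ-yes (¬? (x ≟ᶠ v)) (ne ∘ sym))) (+-identityʳ _))

    sums : ∀ {m} (P : Pat m) → Good P → Small ℓ P → ∑ (λ v → on β- v * oc P v) ≡ ∑ (λ v → on β'- v * oc' P v)
    sums P gd (small Z sh le) = trans (sym (drop β x (oc Z))) (trans (unmatched (λ v → χ (¬? (x ≟ᶠ v)) * oc Z v) (λ v → χ (¬? (x' ≟ᶠ v)) * oc' Z v)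
        (λ i di → cong₂ _*_ (trans (χ-yes (¬? (x ≟ᶠ lookup q i)) (λ e → apart bx (∈-lookup i q) (subst (x X.≼_) e X.≼-refl)))
            (sym (χ-yes (¬? (x' ≟ᶠ lookup q' i)) (λ e → apart' bx' (∈-lookup i q') (subst (x' Y.≼_) e Y.≼-refl))))) (twin-occs Z gd i di))
        (rests Z sh le)) (drop β' x' (oc' Z)))
      where open State st

    ready : OG.Ready st β- β'-
    ready = record { ne = posX ∘ dβ ∘ proj₁ ∘ without-on β x ; ne' = posY ∘ dβ' ∘ proj₁ ∘ without-on β' x'
      ; depD = dβ ∘ proj₁ ∘ without-on β x ; depD' = dβ' ∘ proj₁ ∘ without-on β' x'
      ; apart = apart ∘ proj₁ ∘ without-on β x ; apart' = apart' ∘ proj₁ ∘ without-on β' x'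
      ; al = λ b b' → al (proj₁ (without-on β x b)) (proj₁ (without-on β' x' b'))
      ; fam = λ {y} b → small (fullPat T R y) (full-shape T R y) (thin y (without-on β x b))
      ; fam' = λ {y} b → small (fullPat H R' y) (full-shape H R' y) (thin' y (without-on β' x' b))
      ; sums = sums }
      where
      -- By soleness the siblings have fewer than ℓ loose vertices, so their full patterns are
      -- covered by `rests`.
      thin : ∀ y → β y ≡ true × y ≢ x → offs T R y ≤ ℓ
      thin y (b , ne) with ℓ ≤? offs T R y
      ... | yes f = ⊥-elim (ne (sole y x (dβ b) (dβ bx) f fatx))
      ... | no h = <⇒≤ (≰⇒> h)
      thin' : ∀ y → β' y ≡ true × y ≢ x' → offs H R' y ≤ ℓ
      thin' y (b , ne) with ℓ ≤? offs H R' y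
      ... | yes f = ⊥-elim (ne (sole' y x' (dβ' b) (dβ' bx') f fatx'))
      ... | no h = <⇒≤ (≰⇒> h)

    opaque
      extension : Greedy.Extension (plain T) (plain H) R R' st β- β'-
      extension = OG.greedy ready

module Descent {n : ℕ} (G : Graph n) {e : Bool} (R : Rooted G e) (d : ℕ) (β : Fin n → Bool) {k k' : ℕ} (q : Tuple n k) (q⁺ : Tuple n k') (x : Fin n)
  (bx : β x ≡ true) (dβ : ∀ {y} → β y ≡ true → Root.dep R y ≡ 1 + d)
  (closed : ∀ {z} → z ∈ q → base e < Root.dep R z → Root.par R z ∈ q)
  (cover : ∀ z → z ∈ q ⊎ ∃ λ y → β y ≡ true × Root._≼_ R y z)
  (apart : ∀ {y z} → β y ≡ true → z ∈ q → ¬ Root._≼_ R y z)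
  (old : ∀ {z} → z ∈ q → z ∈ q⁺)
  (in-q : ∀ {y z} → without β x y ≡ true → Root._≼_ R y z → z ∈ q⁺)
  (q-in : ∀ {z} → z ∈ q⁺ → z ∈ q ⊎ ∃ λ y → without β x y ≡ true × Root._≼_ R y z) where
  open Root R

  β⁺ : Fin n → Bool
  β⁺ y = Dec.does ((dep y ≟ 2 + d) ×-dec (x ≼? y))

  β⁺→ : ∀ {y} → β⁺ y ≡ true → dep y ≡ 2 + d × x ≼ y
  β⁺→ {y} = does→ ((dep y ≟ 2 + d) ×-dec (x ≼? y))

  not-above : ∀ {z} → z ∈ q⁺ → ¬ x ≼ z
  not-above m p with q-in m
  ... | inj₁ m' = apart bx m' p
  ... | inj₂ (y , b , r) = let (by , ne) = without-on β x b in ne (≼-linear r p (trans (dβ by) (sym (dβ bx))))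

  x∉ : x ∉ q⁺
  x∉ m = not-above m ≼-refl

  par-x : base e < dep x → par x ∈ q
  par-x lt with cover (par x)
  ... | inj₁ m = m
  ... | inj₂ (y , b , p) = ⊥-elim (1+n≰n (≤-trans (≡⇒≤ (trans (sym (up x lt)) (trans (dβ bx) (sym (dβ b))))) (≼-dep p)))

  closed⁺ : ∀ {z} → z ∈ (x ∷ q⁺) → base e < dep z → par z ∈ (x ∷ q⁺)
  closed⁺ (here refl) lt = there (old (par-x lt))
  closed⁺ {z} (there m) lt with q-in m
  ... | inj₁ m' = there (old (closed m' lt))
  ... | inj₂ (y , b , p) with z ≟ᶠ y
  ...   | no ne = there (in-q b (proj₂ (≼-up p ne)))
  ...   | yes refl with cover (par z)
  ...     | inj₁ m' = there (old m')
  ...     | inj₂ (w , bw , r) = ⊥-elim (1+n≰n (≤-trans (≡⇒≤ (trans (sym (up z lt)) (trans (dβ (proj₁ (without-on β x b))) (sym (dβ bw))))) (≼-dep r)))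

  cover⁺ : ∀ z → z ∈ (x ∷ q⁺) ⊎ ∃ λ y → β⁺ y ≡ true × y ≼ z
  cover⁺ z with cover z
  ... | inj₁ m = inj₁ (there (old m))
  ... | inj₂ (y , b , p) with y ≟ᶠ x
  ...   | no ne = inj₁ (there (in-q (on-without β b ne) p))
  ...   | yes refl with z ≟ᶠ x
  ...     | yes refl = inj₁ (here refl)
  ...     | no ne with ≼-up p ne
  ...       | lt , r with ancestor z (2 + d) (≤-trans (dep≥ x) (≤-trans (≡⇒≤ (dβ bx)) (n≤1+n _))) (≤-trans (s≤s (≤-trans (≡⇒≤ (sym (dβ bx))) (≼-dep r))) (≡⇒≤ (sym (up z lt))))
  ...         | w , s , dw = inj₂ (w , does← ((dep w ≟ 2 + d) ×-dec (x ≼? w)) (dw , below) , s)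
    where
    below : x ≼ w
    below with ancestor w (dep x) (dep≥ x) (≤-trans (≡⇒≤ (dβ bx)) (≤-trans (n≤1+n _) (≡⇒≤ (sym dw))))
    ... | v , t , dv = subst (_≼ w) (≼-linear (≼-trans t s) p dv) t

  apart⁺ : ∀ {y z} → β⁺ y ≡ true → z ∈ (x ∷ q⁺) → ¬ y ≼ z
  apart⁺ b (here refl) p = 1+n≰n (≤-trans (≡⇒≤ (trans (cong suc (dβ bx)) (sym (proj₁ (β⁺→ b))))) (≼-dep p))
  apart⁺ b (there m) p = not-above m (≼-trans (proj₂ (β⁺→ b)) p)

  par-child : ∀ {y} → β⁺ y ≡ true → par y ≡ x
  par-child {y} b = let (dy , p) = β⁺→ b
                        (lt , r) = ≼-up p (λ e → 1+n≢n (trans (sym dy) (trans (cong dep e) (dβ bx))))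
                    in sym (≼-dep-eq r (≡⇒≤ (suc-injective (trans (sym (up y lt)) (trans dy (cong suc (sym (dβ bx))))))))

  nbr : ∀ {z} → z ∈ q⁺ → Adj G x z → z ≡ par x
  nbr m a with ≼-adj ≼-refl a
  ... | inj₁ p = ⊥-elim (not-above m p)
  ... | inj₂ (_ , p) = p

module Induct {n N ℓ : ℕ} (T H : Graph n) (eN : N + ℓ ≡ n) (ag : Agree (plain T) (plain H) N) {e : Bool} {k : ℕ} (fT : Frame T e k) (fH : Frame H e k)
  (cT : inner² T + 8 + 2 * ℓ ≤ N) (cH : inner² H + 8 + 2 * ℓ ≤ N) where
  open Tree T H eN ag fT fH cT cH
  private
    R = Frame.R fT
    R' = Frame.R fH
    module X = Root R
    module Y = Root R'
  open Pair (plain T) (plain H) R R'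

  module Next {d} (inv : Inv d) (ho : Hot inv) where
    open Inv inv
    open Hot ho using (x; x'; bx; bx')
    open Greedy.Extension (Siblings.extension inv ho)
    module N = State new

    old₁ : ∀ {z} → z ∈ State.q st → z ∈ N.q
    old₁ m = let (i , e) = ∈⇒lookup m ; (j , p , _) = old (i , refl , refl) in subst (_∈ N.q) (trans p e) (∈-lookup j N.q)
    old₂ : ∀ {z} → z ∈ State.q' st → z ∈ N.q'
    old₂ m = let (i , e) = ∈⇒lookup m ; (j , _ , p) = old (i , refl , refl) in subst (_∈ N.q') (trans p e) (∈-lookup j N.q')

    module A = Descent T R d β (State.q st) N.q x bx dβ closed cover apart old₁ in-q q-in
    module B = Descent H R' d β' (State.q' st) N.q' x' bx' dβ' closed' cover' apart' old₂ in-q' q-in'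

    dx : X.dep x ≡ Y.dep x'
    dx = trans (dβ bx) (sym (dβ' bx'))

    -- Below the top the parent of x was matched at an earlier stage, and its alignment is on
    -- record. At the top x is one end of a central edge, and the partner of the other end is a top
    -- vertex different from x'.
    matched→ : ∀ {z z'} → Zip N.q N.q' z z' → z ≡ X.par x → z' ≡ Y.par x'
    matched→ (i , refl , refl) e₀ with base e <? X.dep x
    ... | yes lt = let (j , p) = ∈⇒lookup (A.par-x lt)
                       (l , r , s) = old (j , refl , refl)
                   in trans (cong (lookup N.q') (lookup-injective N.uq i l (trans e₀ (trans (sym p) (sym r))))) (trans s (proj₁ (al bx bx' (j , refl , refl)) p))
    ... | no h with Y.tops (lookup N.q' i) x' (trans (sym (N.deps i)) (trans (cong X.dep e₀) (X.top-dep x t))) (trans (sym dx) t)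
      where t = ≤-antisym (≮⇒≥ h) (X.dep≥ x)
    ...   | inj₁ q = ⊥-elim (B.x∉ (subst (_∈ N.q') q (∈-lookup i N.q')))
    ...   | inj₂ q = q

    matched← : ∀ {z z'} → Zip N.q N.q' z z' → z' ≡ Y.par x' → z ≡ X.par x
    matched← (i , refl , refl) e₀ with base e <? Y.dep x'
    ... | yes lt = let (j , p) = ∈⇒lookup (B.par-x lt)
                       (l , r , s) = old (j , refl , refl)
                   in trans (cong (lookup N.q) (lookup-injective N.uq' i l (trans e₀ (trans (sym p) (sym s))))) (trans r (proj₂ (al bx bx' (j , refl , refl)) p))
    ... | no h with X.tops (lookup N.q i) x (trans (N.deps i) (trans (cong Y.dep e₀) (Y.top-dep x' t))) (trans dx t)
      where t = ≤-antisym (≮⇒≥ h) (Y.dep≥ x')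
    ...   | inj₁ q = ⊥-elim (A.x∉ (subst (_∈ N.q) q (∈-lookup i N.q)))
    ...   | inj₂ q = q

    one-edge : ∀ j → adj T x (lookup N.q j) ≡ adj H x' (lookup N.q' j)
    one-edge j = bool-iff
      (λ a → subst (Adj H x') (sym (matched→ (j , refl , refl) (A.nbr (∈-lookup j N.q) a))) (Y.adj← (posY (dβ' bx'))))
      (λ a → subst (Adj T x) (sym (matched← (j , refl , refl) (B.nbr (∈-lookup j N.q') a))) (X.adj← (posX (dβ bx))))

    st⁺ : State
    st⁺ = record { q = x ∷ N.q ; q' = x' ∷ N.q' ; uq = ∉⇒All A.x∉ ∷ N.uq ; uq' = ∉⇒All B.x∉ ∷ N.uq' ; same = pairs & (λ _ → refl)
      ; deps = λ { zero → dx ; (suc i) → N.deps i } }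
      where
      pairs : ∀ i j → adj T (lookup (x ∷ N.q) i) (lookup (x ∷ N.q) j) ≡ adj H (lookup (x' ∷ N.q') i) (lookup (x' ∷ N.q') j)
      pairs zero zero = trans (irrefl T x) (sym (irrefl H x'))
      pairs zero (suc j) = one-edge j
      pairs (suc i) zero = trans (adj-sym T _ _) (trans (one-edge i) (adj-sym H _ _))
      pairs (suc i) (suc j) = same-adj N.same i j

    aligned : ∀ {y y'} → A.β⁺ y ≡ true → B.β⁺ y' ≡ true → Aligned st⁺ y y'
    aligned b b' (zero , refl , refl) = (λ _ → sym (B.par-child b')) , (λ _ → sym (A.par-child b))
    aligned b b' (suc i , refl , refl) = (λ p → ⊥-elim (A.x∉ (subst (_∈ N.q) (trans p (A.par-child b)) (∈-lookup i N.q))))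
                                       , (λ p → ⊥-elim (B.x∉ (subst (_∈ N.q') (trans p (B.par-child b')) (∈-lookup i N.q'))))

    next : Inv (suc d)
    next = record { st = st⁺ ; β = A.β⁺ ; β' = B.β⁺ ; dβ = proj₁ ∘ A.β⁺→ ; dβ' = proj₁ ∘ B.β⁺→ ; closed = A.closed⁺ ; closed' = B.closed⁺
      ; cover = A.cover⁺ ; cover' = B.cover⁺ ; apart = A.apart⁺ ; apart' = B.apart⁺ ; al = aligned }

  opaque
    next : ∀ {d} (inv : Inv d) → Hot inv → Inv (suc d)
    next = Next.next

  loop : ∀ f {d} → 1 + k ≤ f + d → Inv d → Isom (plain T) (plain H)
  loop f {d} le inv = go f le (hot-or-light inv)
    where
    go : ∀ f → 1 + k ≤ f + d → Hot inv ⊎ _ → Isom (plain T) (plain H)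
    go _ _ (inj₂ (a , b)) = all-light inv a b
    -- The top of the next branch would have depth 1 + d, beyond the height 1 + k.
    go zero le (inj₁ ho) = ⊥-elim (1+n≰n (≤-trans (≡⇒≤ (sym (Inv.dβ inv (Hot.bx ho)))) (≤-trans (Frame.hgt fT (Hot.x ho)) le)))
    go (suc f) le (inj₁ ho) = loop f (≤-trans le (≡⇒≤ (sym (+-suc f d)))) (next inv ho)

module Starts {n N ℓ : ℕ} (T H : Graph n) (eN : N + ℓ ≡ n) (ag : Agree (plain T) (plain H) N) {k : ℕ} (cT : inner² T + 8 + 2 * ℓ ≤ N) (cH : inner² H + 8 + 2 * ℓ ≤ N) where

  at-vertex : (fT : Frame T false k) (fH : Frame H false k) → Tree.Inv T H eN ag fT fH cT cH 0
  at-vertex fT fH = record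
    { st = record { q = c ∷ [] ; q' = c' ∷ [] ; uq = ∉⇒All (λ ()) ∷ [] ; uq' = ∉⇒All (λ ()) ∷ [] ; same = (λ { zero zero → trans (irrefl T c) (sym (irrefl H c')) }) & (λ _ → refl)
                  ; deps = λ { zero → trans dc (sym dc') } }
    ; β = λ y → Dec.does (X.dep y ≟ 1) ; β' = λ y → Dec.does (Y.dep y ≟ 1)
    ; dβ = λ {y} → does→ (X.dep y ≟ 1) ; dβ' = λ {y} → does→ (Y.dep y ≟ 1)
    ; closed = λ { (here refl) lt → ⊥-elim (<-irrefl (sym dc) lt) } ; closed' = λ { (here refl) lt → ⊥-elim (<-irrefl (sym dc') lt) }
    ; cover = cov T fT ; cover' = cov H fH
    ; apart = λ { {y} b (here refl) p → 1+n≰n (≤-trans (≡⇒≤ (sym (does→ (X.dep y ≟ 1) b))) (≤-trans (X.≼-dep p) (≡⇒≤ dc))) }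
    ; apart' = λ { {y} b (here refl) p → 1+n≰n (≤-trans (≡⇒≤ (sym (does→ (Y.dep y ≟ 1) b))) (≤-trans (Y.≼-dep p) (≡⇒≤ dc'))) }
    ; al = λ { {y} {y'} b b' (zero , refl , refl) → (λ _ → sym (root-par H fH (does→ (Y.dep y' ≟ 1) b'))) , (λ _ → sym (root-par T fT (does→ (X.dep y ≟ 1) b))) } }
    where
    module X = Root (Frame.R fT)
    module Y = Root (Frame.R fH)
    c = lookup (Frame.A fT) zero
    c' = lookup (Frame.A fH) zero
    root-dep : ∀ G (F : Frame G false k) → Root.dep (Frame.R F) (lookup (Frame.A F) zero) ≡ 0
    root-dep G F = Grand.zero-dep G (Frame.R F) (Frame.hgt F) (Frame.hv F) refl (Halves.railA (Frame.hv F))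
    dc = root-dep T fT
    dc' = root-dep H fH
    root-par : ∀ G (F : Frame G false k) {y} → Root.dep (Frame.R F) y ≡ 1 → Root.par (Frame.R F) y ≡ lookup (Frame.A F) zero
    root-par G F {y} d = Grand.root-unique G (Frame.R F) (Frame.hgt F) (Frame.hv F) refl
      (suc-injective (trans (sym (Root.up (Frame.R F) y (≡⇒≤ (sym d)))) d)) (root-dep G F)
    cov : ∀ G (F : Frame G false k) z → z ∈ (lookup (Frame.A F) zero ∷ []) ⊎ ∃ λ y → Dec.does (Root.dep (Frame.R F) y ≟ 1) ≡ true × Root._≼_ (Frame.R F) y z
    cov G F z with Root.dep (Frame.R F) z ≟ 0
    ... | yes d = inj₁ (here (Grand.root-unique G (Frame.R F) (Frame.hgt F) (Frame.hv F) refl d (root-dep G F)))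
    ... | no h = let (y , p , d) = Root.ancestor (Frame.R F) z 1 z≤n (n≢0⇒n>0 h) in inj₂ (y , does← (Root.dep (Frame.R F) y ≟ 1) d , p)

  -- A central vertex is matched from the outset; a central edge starts with nothing matched, its
  -- two ends being the tops of the first level.
  at-edge : (fT : Frame T true k) (fH : Frame H true k) → Tree.Inv T H eN ag fT fH cT cH 0
  at-edge fT fH = record
    { st = record { q = [] ; q' = [] ; uq = [] ; uq' = [] ; same = (λ ()) & (λ ()) ; deps = λ () }
    ; β = λ y → Dec.does (X.dep y ≟ 1) ; β' = λ y → Dec.does (Y.dep y ≟ 1)
    ; dβ = λ {y} → does→ (X.dep y ≟ 1) ; dβ' = λ {y} → does→ (Y.dep y ≟ 1)
    ; closed = λ () ; closed' = λ ()
    ; cover = cov T fT ; cover' = cov H fH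
    ; apart = λ _ () ; apart' = λ _ () ; al = λ { _ _ (() , _) } }
    where
    module X = Root (Frame.R fT)
    module Y = Root (Frame.R fH)
    cov : ∀ G (F : Frame G true k) z → z ∈ [] ⊎ ∃ λ y → Dec.does (Root.dep (Frame.R F) y ≟ 1) ≡ true × Root._≼_ (Frame.R F) y z
    cov G F z = let (y , p , d) = Root.ancestor (Frame.R F) z 1 ≤-refl (Root.dep≥ (Frame.R F) z) in inj₂ (y , does← (Root.dep (Frame.R F) y ≟ 1) d , p)

-- Comparing the centres and combining the methods

framed : ∀ {n N ℓ} (T H : Graph n) → N + ℓ ≡ n → Agree (plain T) (plain H) N → inner² T + 8 + 2 * ℓ ≤ N → inner² H + 8 + 2 * ℓ ≤ N →
  ∀ e k → Frame T e k → Frame H e k → Isom (plain T) (plain H)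
framed T H eN ag cT cH false k fT fH = Induct.loop T H eN ag fT fH cT cH (1 + k) (≡⇒≤ (sym (+-identityʳ _))) (Starts.at-vertex T H eN ag cT cH fT fH)
framed T H eN ag cT cH true  k fT fH = Induct.loop T H eN ag fT fH cT cH (1 + k) (≡⇒≤ (sym (+-identityʳ _))) (Starts.at-edge T H eN ag cT cH fT fH)

-- The two legs have 2 + 2k distinct vertices apart from their common centre, so k is small.
legs-short : (G : Graph n) (C : Centred G) → (2 + Centred.κ C) + (2 + Centred.κ C) ≤ inner² G + 6
legs-short {n} G C = lia (κ ∷ inner² G ∷ spread (legsKs κ 0 0) t ∷ []) (λ k i s → (con 1 :+ k) :+ (con 1 :+ k) :≤ s ∷ s :≤ i :+ con 4 ∷ [] ⊢ (con 2 :+ k) :+ (con 2 :+ k) :≤ i :+ con 6)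
    (≤-trans (≡⇒≤ (sym (count-∈ (tail A ++ tail B) u))) (S-mono (fin n) (λ z → χ-mono (z ∈? (tail A ++ tail B)) (in? (legsKs κ 0 0) z t) sub))
    , Total.Bounds.legs-spread G R hgt t (χ-pos (legs? G e A B) (halves-legs G e R halves)) , tt)
  where
  open Centred C
  open Root R
  open InTree G R
  t : Tup n (legsKs κ 0 0)
  t = B , A , tt
  tail-in : ∀ {m} (x : Tuple n (suc m)) {z} → z ∈ tail x → z ∈ x
  tail-in (_ ∷ _) m = there m
  sub : ∀ {z} → z ∈ (tail A ++ tail B) → z ∈ B ⊎ (z ∈ A ⊎ ⊥)
  sub m with ∈-++⁻ (tail A) m
  ... | inj₁ p = inj₂ (inj₁ (tail-in A p))
  ... | inj₂ p = inj₁ (tail-in B p)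
  from : ∀ {m} {x : Tuple n (2 + m)} → Rail x → ∀ {z} → z ∈ tail x → lookup x (suc zero) ≼ z
  from {x = _ ∷ _ ∷ _} (rail _ _ d) m = down-from G R d m
  ut : ∀ {m} {x : Tuple n (suc m)} → Down x → Unique x
  ut d = grow-unique (down-grow G R d)
  u : Unique (tail A ++ tail B)
  u = unique-++ G (tail A) (ut (Rail.dn (Halves.railB halves))) (ut (Rail.dn (Halves.railA halves)))
        (λ p q → Halves.apart halves (≼-linear (from (Halves.railA halves) p) (from (Halves.railB halves) q) (trans (Rail.first (Halves.railA halves)) (sym (Rail.first (Halves.railB halves))))))

legs-spread-≤ : ∀ k (t : Tup n (legsKs k 0 0)) → spread (legsKs k 0 0) t ≤ (2 + k) + (2 + k)
legs-spread-≤ {n} k (B , A , tt) = ≤-trans (S-mono (fin n) (λ z → χ-mono (in? (legsKs k 0 0) z (B , A , tt)) (z ∈? (B ++ A)) λ { (inj₁ p) → ∈-++⁺ˡ p ; (inj₂ (inj₁ p)) → ∈-++⁺ʳ B p }))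
  (count-≤ (B ++ A))

-- The longest paths of T are visible in the deck.
legs-found : ∀ {N ℓ} (T H : Graph n) → Agree (plain T) (plain H) N → inner² T + 8 + 2 * ℓ ≤ N → (C : Centred T) (C' : Centred H) →
             2 * (1 + Centred.κ C) + base (Centred.e C') ≤ 2 * (1 + Centred.κ C') + base (Centred.e C)
legs-found {n} {N} {ℓ} T H ag c C C' =
  let (t , w) = ∑ᵗ-pos ks (legsW H e κ) (λ z → χ-pos (legs? T e A B) (halves-legs T e R halves) (∑ᵗ-zero ks (legsW T e κ) (trans (transfer-small T H ag ks (legsW T e κ) (legsW H e κ) (legsW-corr T H e κ) (λ t _ → fits t) (λ t _ → fits t)) z) (B , A , tt)))
  in InTree.Height.legs-bound H C'.R (1 + C'.κ) C'.hgt e (χ≢0 (legs? H e (proj₁ (proj₂ t)) (proj₁ t)) w)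
  where
  open Centred C
  module C' = Centred C'
  ks = legsKs κ 0 0
  fits : ∀ {n} (t : Tup n (legsKs κ 0 0)) → spread (legsKs κ 0 0) t ≤ N
  fits t = ≤-trans (legs-spread-≤ κ t) (≤-trans (legs-short T C) (lia (inner² T ∷ ℓ ∷ N ∷ []) (λ i ℓ N → i :+ con 8 :+ 2 :* ℓ :≤ N ∷ [] ⊢ i :+ con 6 :≤ N) (c , tt)))

-- A longest path has 2(1 + k) - `base e` edges. The two inequalities say that these lengths agree,
-- and parity separates k from e.
same-frame : ∀ e k e' k' → 2 * (1 + k) + base e' ≤ 2 * (1 + k') + base e → 2 * (1 + k') + base e ≤ 2 * (1 + k) + base e' → e ≡ e' × k ≡ k'
same-frame false k false k' p q = refl , ≤-antisym (s≤s⁻¹ (*-cancelˡ-≤ 2 (+-cancelʳ-≤ 0 _ _ p))) (s≤s⁻¹ (*-cancelˡ-≤ 2 (+-cancelʳ-≤ 0 _ _ q)))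
same-frame true k true k' p q = refl , ≤-antisym (s≤s⁻¹ (*-cancelˡ-≤ 2 (+-cancelʳ-≤ 1 _ _ p))) (s≤s⁻¹ (*-cancelˡ-≤ 2 (+-cancelʳ-≤ 1 _ _ q)))
same-frame false k true k' p q with k' ≤? k
... | yes le = lia⊥ (k ∷ k' ∷ []) (λ k l → l :≤ k ∷ 2 :* (con 1 :+ k) :+ con 1 :≤ 2 :* (con 1 :+ l) :+ con 0 ∷ []) (le , p , tt)
... | no h = lia⊥ (k ∷ k' ∷ []) (λ k l → k :< l ∷ 2 :* (con 1 :+ l) :+ con 0 :≤ 2 :* (con 1 :+ k) :+ con 1 ∷ []) (≰⇒> h , q , tt)
same-frame true k false k' p q with k ≤? k'
... | yes le = lia⊥ (k' ∷ k ∷ []) (λ k l → l :≤ k ∷ 2 :* (con 1 :+ k) :+ con 1 :≤ 2 :* (con 1 :+ l) :+ con 0 ∷ []) (le , q , tt)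
... | no h = lia⊥ (k' ∷ k ∷ []) (λ k l → k :< l ∷ 2 :* (con 1 :+ l) :+ con 0 :≤ 2 :* (con 1 :+ k) :+ con 1 ∷ []) (≰⇒> h , p , tt)

few-deep : ∀ {N ℓ} (T H : Graph n) → N + ℓ ≡ n → Agree (plain T) (plain H) N → inner² T + 8 + 2 * ℓ ≤ N → inner² H + 8 + 2 * ℓ ≤ N → Centred T → Centred H → Isom (plain T) (plain H)
few-deep {n} {N} {ℓ} T H eN ag cT cH C C' = go C C' (same-frame _ _ _ _ (legs-found {ℓ = ℓ} T H ag cT C C') (legs-found {ℓ = ℓ} H T (agree-flip (plain T) (plain H) ag) cH C' C))
  where
  go : (C : Centred T) (C' : Centred H) → Centred.e C ≡ Centred.e C' × Centred.κ C ≡ Centred.κ C' → Isom (plain T) (plain H)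
  go record { e = e ; κ = k ; R = R ; hgt = hgt ; A = A ; B = B ; halves = hv } record { R = R' ; hgt = hgt' ; A = A' ; B = B' ; halves = hv' } (refl , refl) =
    framed {ℓ = ℓ} T H eN ag cT cH e k (record { R = R ; hgt = hgt ; A = A ; B = B ; hv = hv }) (record { R = R' ; hgt = hgt' ; A = A' ; B = B' ; hv = hv' })

half-bound : ∀ k n → 2 * k ≤ n → k ≤ ⌊ n /2⌋
half-bound k n le = ≤-trans (≡⇒≤ (n≡⌊n+n/2⌋ k)) (⌊n/2⌋-mono (≤-trans (≡⇒≤ (cong (k +_) (sym (+-identityʳ k)))) le))

half-double : ∀ n → 2 * ⌊ n /2⌋ ≤ n
half-double n = ≤-trans (+-monoʳ-≤ ⌊ n /2⌋ (≤-trans (≡⇒≤ (+-identityʳ _)) (⌊n/2⌋≤⌈n/2⌉ n))) (≡⇒≤ (⌊n/2⌋+⌈n/2⌉≡n n))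

isom-flip : {G : LGraph n} {H : LGraph n'} → Isom G H → Isom H G
isom-flip i = record { q = q' ; q' = q ; uq = uq' ; uq' = uq ; same = same-flip same ; all = all' ; all' = all }
  where open Isom i

isom-≅ : {T H : Graph n} → Isom (plain T) (plain H) → T ≅ H
isom-≅ {T = T} {H} i = mk↔ₛ′ to from to-from from-to , λ u v →
    trans (cong₂ (adj T) (sym (proj₂ (ix u))) (sym (proj₂ (ix v)))) (same-adj same (proj₁ (ix u)) (proj₁ (ix v)))
  where
  open Isom i
  ix : ∀ x → ∃ λ j → lookup q j ≡ x
  ix x = ∈⇒lookup (all x)
  ix' : ∀ x → ∃ λ j → lookup q' j ≡ x
  ix' x = ∈⇒lookup (all' x)
  to = λ x → lookup q' (proj₁ (ix x))
  from = λ x → lookup q (proj₁ (ix' x))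
  to-from : ∀ x → to (from x) ≡ x
  to-from x = trans (cong (lookup q') (lookup-injective uq _ _ (proj₂ (ix (from x))))) (proj₂ (ix' x))
  from-to : ∀ x → from (to x) ≡ x
  from-to x = trans (cong (lookup q) (lookup-injective uq' _ _ (proj₂ (ix' (to x))))) (proj₂ (ix x))

levels : ∀ {N ℓ} (T H : Graph n) → 1 ≤ ℓ → 6 * ℓ + 11 ≤ n → N + ℓ ≡ n → Agree (plain T) (plain H) N →
  (∀ r → Spanning T r) → (∀ r → Spanning H r) → Acyclic′ T → Acyclic′ H → ∀ {x y : Fin n} → x ≢ y →
  Isom (plain T) (plain H) ⊎ inner² T + 8 + 2 * ℓ ≤ N
levels {n} {N} {ℓ} T H 1≤ℓ big eN ag sp sp' ac ac' x≢y with ⌊ n /2⌋ + ℓ <? inner T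
... | yes p = inj₁ (level0 (plain T) (plain H) eN (agree-grow (plain T) (plain H) ag) sp sp' (λ k le → ≤-trans (s≤s (+-monoˡ-≤ ℓ (half-bound k n le))) p) x≢y)
... | no h with ⌊ inner T /2⌋ + ℓ <? inner² T
...   | yes p = inj₁ (level1 T H eN 1≤ℓ (agree-grow (plain T) (plain H) ag) sp sp' ac ac' (λ k le → ≤-trans (s≤s (+-monoˡ-≤ ℓ (half-bound k (inner T) le))) p))
-- Multiplied by four: 4 `inner²` + 32 + 8ℓ ≤ n + 14ℓ + 32 ≤ 4n - 4ℓ.
...   | no h' = inj₂ (*-cancelˡ-≤ 4 (lia (n ∷ ℓ ∷ N ∷ inner² T ∷ [])
          (λ n ℓ N j → 6 :* ℓ :+ con 11 :≤ n ∷ N :+ ℓ :≡ n ∷ 4 :* j :≤ n :+ 6 :* ℓ ∷ [] ⊢ 4 :* (j :+ con 8 :+ 2 :* ℓ) :≤ 4 :* N)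
          (big , eN , four , tt)))
  where
  four : 4 * inner² T ≤ n + 6 * ℓ
  four = lia (n ∷ ℓ ∷ inner T ∷ inner² T ∷ []) (λ n ℓ i j → 2 :* i :≤ n :+ 2 :* ℓ ∷ 2 :* j :≤ i :+ 2 :* ℓ ∷ [] ⊢ 4 :* j :≤ n :+ 6 :* ℓ)
    ( lia (n ∷ ℓ ∷ inner T ∷ ⌊ n /2⌋ ∷ []) (λ n ℓ i a → i :≤ a :+ ℓ ∷ 2 :* a :≤ n ∷ [] ⊢ 2 :* i :≤ n :+ 2 :* ℓ) (≮⇒≥ h , half-double n , tt)
    , lia (inner T ∷ ℓ ∷ inner² T ∷ ⌊ inner T /2⌋ ∷ []) (λ i ℓ j b → j :≤ b :+ ℓ ∷ 2 :* b :≤ i ∷ [] ⊢ 2 :* j :≤ i :+ 2 :* ℓ) (≮⇒≥ h' , half-double (inner T) , tt) , tt)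

theorem1p3 : ∀ (ℓ n : ℕ) → 1 ≤ ℓ → 6 * ℓ + 11 ≤ n →
  ∀ (T : Graph n) → IsTree T → Reconstructible ℓ T
theorem1p3 ℓ n 1≤ℓ big T tree H deck = isom-≅ (decide (levels {ℓ = ℓ} T H 1≤ℓ big eN ag sp sp' ac ac' distinct) (levels {ℓ = ℓ} H T 1≤ℓ big eN ag' sp' sp ac' ac distinct))
  where
  ag = agree-below (plain T) (plain H) (m∸n≤m n ℓ) (deck-agree {ℓ = ℓ} T H deck)
  ag' = agree-flip (plain T) (plain H) ag
  module Q = Recognise ℓ big T H tree ag
  eN = Q.N+ℓ
  sp = tree-spanning T tree
  sp' = Q.H-spanning
  ac : Acyclic′ T
  ac (_ , _ , cy) = proj₂ tree (cycle→HasCycle cy)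
  ac' = Q.H-acyclic
  2≤n : 2 ≤ n
  2≤n = lia (ℓ ∷ n ∷ []) (λ ℓ n → 6 :* ℓ :+ con 11 :≤ n ∷ [] ⊢ con 2 :≤ n) (big , tt)
  distinct : Data.Fin.fromℕ< {0} (≤-trans (s≤s z≤n) 2≤n) ≢ Data.Fin.fromℕ< {1} 2≤n
  distinct e with trans (sym (Finₚ.toℕ-fromℕ< (≤-trans (s≤s z≤n) 2≤n))) (trans (cong Data.Fin.toℕ e) (Finₚ.toℕ-fromℕ< 2≤n))
  ... | ()
  -- The limb counts are tried from both sides because the last method needs the budget in both
  -- trees.
  decide : Isom (plain T) (plain H) ⊎ inner² T + 8 + 2 * ℓ ≤ n ∸ ℓ → Isom (plain H) (plain T) ⊎ inner² H + 8 + 2 * ℓ ≤ n ∸ ℓ → Isom (plain T) (plain H)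
  decide (inj₁ i) _ = i
  decide (inj₂ _) (inj₁ i) = isom-flip i
  decide (inj₂ c) (inj₂ c') = few-deep {ℓ = ℓ} T H eN ag c c' (centre T sp distinct) (centre H sp' distinct)
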